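{- Let $P,Q\subset\mathbb R^3$ be lattice polytopes with $|P|=6$ and $|Q|=3$. Then $L(P+Q)\geq 3$.
   Context: $|P|$ is the number of lattice points of $P$. The Minkowski length $L(P)$ is the largest $L$ such that $P$ contains a Minkowski sum of $L$ lattice polytopes each of positive dimension. -}

module Defs where

open import Data.Nat using (ℕ; _≤_)
open import Data.Integer using (ℤ)
import Data.Integer as ℤ
open import Data.Rational using (ℚ; 0ℚ; 1ℚ; _+_; _*_; _/_)
import Data.Rational as ℚ
open import Data.Product using (_×_; _,_; Σ; ∃; ∃-syntax)
open import Data.List using (List; []; _∷_; length; map; concatMap; zipWith; foldr)
open import Data.List.Relation.Unary.All using (All)
open import Data.List.Relation.Unary.Unique.Propositional using (Unique)
open import Data.List.Membership.Propositional using (_∈_)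
open import Relation.Binary.PropositionalEquality using (_≡_)
open import Relation.Nullary using (¬_)

-- Lattice points of ℤ³ and points of ℚ³ (ℚ³ ⊂ ℝ³ suffices: all
-- points relevant to conv of lattice points with lattice targets are rational).
Pt : Set
Pt = ℤ × ℤ × ℤ

Qt : Set
Qt = ℚ × ℚ × ℚ

ι : ℤ → ℚ
ι z = z / 1

_⊕_ : Pt → Pt → Pt
(a , b , c) ⊕ (d , e , f) = (a ℤ.+ d , b ℤ.+ e , c ℤ.+ f)

origin : Pt
origin = (ℤ.+ 0 , ℤ.+ 0 , ℤ.+ 0)

scale : ℚ → Pt → Qt
scale w (a , b , c) = (w * ι a , w * ι b , w * ι c)

_⊞_ : Qt → Qt → Qt
(a , b , c) ⊞ (d , e , f) = (a + d , b + e , c + f)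

embed : Pt → Qt
embed (a , b , c) = (ι a , ι b , ι c)

sumℚ : List ℚ → ℚ
sumℚ = foldr _+_ 0ℚ

combo : List ℚ → List Pt → Qt
combo ws S = foldr _⊞_ (0ℚ , 0ℚ , 0ℚ) (zipWith scale ws S)

-- A lattice polytope is conv(S) for a finite list S of lattice points.
-- x ∈ conv(S): x is a convex combination (nonnegative rational weights
-- summing to 1) of the points of S.
InConv : List Pt → Pt → Set
InConv S x = Σ (List ℚ) λ ws →
  (length ws ≡ length S) × All (0ℚ ℚ.≤_) ws × (sumℚ ws ≡ 1ℚ) × (combo ws S ≡ embed x)

NumLatticePts : List Pt → ℕ → Set
NumLatticePts S n = Σ (List Pt) λ l →
  (length l ≡ n) × Unique l × (∀ x → (x ∈ l → InConv S x) × (InConv S x → x ∈ l))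

-- Minkowski sum of generating sets: conv(S) + conv(T) = conv(S ⊕ T).
MinkPair : List Pt → List Pt → List Pt
MinkPair S T = concatMap (λ s → map (s ⊕_) T) S

MinkSum : List (List Pt) → List Pt
MinkSum = foldr MinkPair (origin ∷ [])

-- conv(T) has positive dimension iff it contains two distinct points,
-- i.e. T contains two distinct points.
PosDim : List Pt → Set
PosDim T = ∃[ x ] ∃[ y ] (x ∈ T × y ∈ T × ¬ (x ≡ y))

-- conv(T) ⊆ conv(S)
Contained : List Pt → List Pt → Set
Contained T S = ∀ x → x ∈ T → InConv S x

MinkLengthAtLeast : List Pt → ℕ → Set
MinkLengthAtLeast S k = Σ (List (List Pt)) λ Ts →
  (k ≤ length Ts) × All PosDim Ts × Contained (MinkSum Ts) S

{-# OPTIONS --safe #-}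

-- Suppose L(P + Q) < 3.  Then the lattice points of P + Q are distinct modulo 3, those of P
-- and of Q are distinct modulo 2, and P contains no parallelogram.  If Q contains no segment
-- of lattice length 2, it is a unimodular triangle, and coordinates are chosen in which its
-- vertices are e₀, e₁, e₂; the level of a point is the sum of its coordinates.  The six
-- points of P lie in six classes modulo 2.  Three points A₀, A₁, A₂ in the classes of
-- s + e₀, s + e₁, s + e₂ give twelve points Aᵢ + eⱼ and (Aᵢ + Aⱼ + eᵢ + eⱼ) / 2 of P + Q,
-- and a computation modulo 3 shows that either two of the A differ by an edge of Q, or
-- their sum is 0 or (1,1,1) modulo 3.  If the levels of P of each parity contribute three classes,
-- the two resulting triples are incompatible.  If one parity contributes four classes, P contains a
-- translate of Q; then convexity restricts the levels of the remaining points of P to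
-- finitely many configurations.

module Submission where

-- The argument is constructive: nothing is assumed about L(P + Q); instead the lemmas offer the
-- wanted decomposition, called `G`, as an alternative to their own conclusion. Every decomposition
-- has one pattern, eight points of P + Q spanned by three nonzero vectors. These may be parallel,
-- so two distinct points of P + Q congruent modulo 3 suffice, and so does a segment of lattice
-- length 2 with a parallel copy. The obstacle is that six lattice points do not bound the
-- coordinates of P. Residues do not see size, so congruences come first. Modulo 2 they yield
-- midpoints, lattice points of P + Q that need not be sums of lattice points; modulo 3 the number 2
-- is invertible, so the residues of the midpoints follow from those of P and a finite table
-- decides. Residues alone do not settle the case of a translate of Q in P, where these points
-- coincide. There, however, the hull of the translate and one distant point contains predictable
-- lattice points, and linear inequalities take over. There are eight classes modulo 2, four for
-- each parity of the level; hence six points split as 3 + 3 or 4 + 2.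

open import Data.Empty using (⊥; ⊥-elim)
open import Data.Fin using (Fin; zero; suc; toℕ)
import Data.Integer as ℤ
open import Data.Integer using (ℤ; +_; -[1+_]; 0ℤ; 1ℤ)
import Data.Integer.Properties as ℤ
open import Data.Integer.Tactic.RingSolver using (solve-∀)
import Data.Nat as ℕ
open import Data.Nat using (ℕ; zero; suc)
import Data.Nat.Properties as ℕ
open import Data.Product using (Σ; ∃; _×_; _,_; proj₁; proj₂)
open import Data.Sum using (_⊎_; inj₁; inj₂; [_,_]′)
open import Defs renaming (_⊕_ to infixl 6 _⊕_)
open import Relation.Binary.PropositionalEquality
open import Relation.Nullary using (Dec; yes; no; ¬_)
open import Data.List using (List; []; _∷_)
open import Data.List.Membership.Propositional using (_∈_)
open import Data.List.Relation.Unary.Any using (here; there)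
open import Data.List.Relation.Unary.AllPairs using ([]; _∷_)
open import Data.List.Relation.Unary.All using ([]; _∷_)

-- Linear integer arithmetic by elimination of variables

module LinearArithmetic where

  open import Data.Bool using (Bool; true; false; _∨_; _∧_; not; T)
  open import Data.Bool.ListAction using (any)
  open import Data.Bool.Properties using (T-∨; T-∧)
  open import Data.Integer using (_+_; _*_; -_; _-_; _≤_; +≤+; _≤ᵇ_)
  open import Data.List using (List; []; _∷_; _++_; map; concatMap)
  import Data.List.Relation.Unary.All as All
  open import Data.List.Relation.Unary.All using (All; []; _∷_)
  open import Data.List.Relation.Unary.All.Properties using (++⁺; map⁺; concat⁺; All¬⇒¬Any)
  open import Data.List.Relation.Unary.Any.Properties using (any⁻)
  open import Data.Vec using (Vec; []; _∷_; lookup; tabulate)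
  open import Data.Vec.N-ary using (N-ary; _$ⁿ_; ∀ⁿ; curryⁿ)
  open import Function using (_∘_; Equivalence)

  infixl 6 _:+_ _:-_
  infixl 7 _:*_
  infix 4 _:≤_ _:=_
  infixr 3 _⇒_

  data Expr (n : ℕ) : Set where
    var : Fin n → Expr n
    con : ℤ → Expr n
    _:+_ _:-_ : Expr n → Expr n → Expr n
    _:*_ : ℤ → Expr n → Expr n

  data Atom (n : ℕ) : Set where
    _:=_ _:≤_ : Expr n → Expr n → Atom n

  data Claim (n : ℕ) : Set where
    _:=_ _:≤_ : Expr n → Expr n → Claim n
    absurd : Claim n
    _⇒_ : Atom n → Claim n → Claim n

  eval : ∀ {n} → Expr n → Vec ℤ n → ℤ
  eval (var i) ρ = lookup ρ i
  eval (con k) ρ = k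
  eval (a :+ b) ρ = eval a ρ + eval b ρ
  eval (a :- b) ρ = eval a ρ - eval b ρ
  eval (k :* a) ρ = k * eval a ρ

  ⟦_⟧ₐ : ∀ {n} → Atom n → Vec ℤ n → Set
  ⟦ a := b ⟧ₐ ρ = eval a ρ ≡ eval b ρ
  ⟦ a :≤ b ⟧ₐ ρ = eval a ρ ≤ eval b ρ

  ⟦_⟧ : ∀ {n} → Claim n → Vec ℤ n → Set
  ⟦ a := b ⟧ ρ = eval a ρ ≡ eval b ρ
  ⟦ a :≤ b ⟧ ρ = eval a ρ ≤ eval b ρ
  ⟦ absurd ⟧ ρ = ⊥
  ⟦ c ⇒ d ⟧ ρ = ⟦ c ⟧ₐ ρ → ⟦ d ⟧ ρ

  Form : ℕ → Set
  Form n = Vec ℤ n × ℤ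

  dot : ∀ {n} → Vec ℤ n → Vec ℤ n → ℤ
  dot [] [] = 0ℤ
  dot (c ∷ cs) (x ∷ ρ) = c * x + dot cs ρ

  value : ∀ {n} → Form n → Vec ℤ n → ℤ
  value (cs , k) ρ = dot cs ρ + k

  zeros : ∀ {n} → Vec ℤ n
  zeros {zero} = []
  zeros {suc n} = 0ℤ ∷ zeros

  unit : ∀ {n} → Fin n → Vec ℤ n
  unit zero = 1ℤ ∷ zeros
  unit (suc i) = 0ℤ ∷ unit i

  blend : ∀ {n} → ℤ → Vec ℤ n → ℤ → Vec ℤ n → Vec ℤ n
  blend a [] b [] = []
  blend a (x ∷ xs) b (y ∷ ys) = a * x + b * y ∷ blend a xs b ys

  comb : ∀ {n} → ℤ → Form n → ℤ → Form n → Form n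
  comb a (xs , k) b (ys , l) = blend a xs b ys , a * k + b * l

  dot-zeros : ∀ {n} (ρ : Vec ℤ n) → dot zeros ρ ≡ 0ℤ
  dot-zeros [] = refl
  dot-zeros (x ∷ ρ) rewrite dot-zeros ρ = refl

  dot-unit : ∀ {n} (i : Fin n) ρ → dot (unit i) ρ ≡ lookup ρ i
  dot-unit zero (x ∷ ρ) rewrite dot-zeros ρ = lemma x
    where
    lemma : ∀ x → 1ℤ * x + 0ℤ ≡ x
    lemma = solve-∀
  dot-unit (suc i) (x ∷ ρ) rewrite dot-unit i ρ = lemma x (lookup ρ i)
    where
    lemma : ∀ x y → 0ℤ * x + y ≡ y
    lemma = solve-∀

  dot-blend : ∀ {n} a (xs : Vec ℤ n) b ys ρ → dot (blend a xs b ys) ρ ≡ a * dot xs ρ + b * dot ys ρ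
  dot-blend a [] b [] [] = sym (lemma a b)
    where
    lemma : ∀ a b → a * 0ℤ + b * 0ℤ ≡ 0ℤ
    lemma = solve-∀
  dot-blend a (x ∷ xs) b (y ∷ ys) (r ∷ ρ) rewrite dot-blend a xs b ys ρ =
    lemma a b x y r (dot xs ρ) (dot ys ρ)
    where
    lemma : ∀ a b x y r u v → (a * x + b * y) * r + (a * u + b * v) ≡ a * (x * r + u) + b * (y * r + v)
    lemma = solve-∀

  value-comb : ∀ {n} a (p : Form n) b q ρ → value (comb a p b q) ρ ≡ a * value p ρ + b * value q ρ
  value-comb a (xs , k) b (ys , l) ρ rewrite dot-blend a xs b ys ρ = lemma a b (dot xs ρ) (dot ys ρ) k l
    where
    lemma : ∀ a b u v k l → a * u + b * v + (a * k + b * l) ≡ a * (u + k) + b * (v + l)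
    lemma = solve-∀

  form : ∀ {n} → Expr n → Form n
  form (var i) = unit i , 0ℤ
  form (con k) = zeros , k
  form (a :+ b) = comb 1ℤ (form a) 1ℤ (form b)
  form (a :- b) = comb 1ℤ (form a) (- 1ℤ) (form b)
  form (k :* a) = comb k (form a) 0ℤ (zeros , 0ℤ)

  value-form : ∀ {n} (e : Expr n) ρ → value (form e) ρ ≡ eval e ρ
  value-form (var i) ρ rewrite dot-unit i ρ = ℤ.+-identityʳ _
  value-form (con k) ρ rewrite dot-zeros ρ = ℤ.+-identityˡ _
  value-form (a :+ b) ρ
    rewrite value-comb 1ℤ (form a) 1ℤ (form b) ρ | value-form a ρ | value-form b ρ = lemma (eval a ρ) (eval b ρ)
    where
    lemma : ∀ x y → 1ℤ * x + 1ℤ * y ≡ x + y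
    lemma = solve-∀
  value-form (a :- b) ρ
    rewrite value-comb 1ℤ (form a) (- 1ℤ) (form b) ρ | value-form a ρ | value-form b ρ = lemma (eval a ρ) (eval b ρ)
    where
    lemma : ∀ x y → 1ℤ * x + (- 1ℤ) * y ≡ x - y
    lemma = solve-∀
  value-form (k :* a) ρ
    rewrite value-comb k (form a) 0ℤ (zeros , 0ℤ) ρ | value-form a ρ = ℤ.+-identityʳ _

  Zero Nonneg : ∀ {n} → Vec ℤ n → Form n → Set
  Zero ρ p = value p ρ ≡ 0ℤ
  Nonneg ρ p = 0ℤ ≤ value p ρ

  -- Forms in which the eliminated variable survives are dropped: weakening the system is sound, and
  -- the combinations formed beforehand keep what they imply.
  tails : ∀ {n} → List (Form (suc n)) → List (Form n)
  tails [] = []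
  tails (((+ 0) ∷ cs , k) ∷ ps) = (cs , k) ∷ tails ps
  tails (_ ∷ ps) = tails ps

  tails⁺ : ∀ {n} (P : ℤ → Set) {x : ℤ} {ρ : Vec ℤ n} (ps : List (Form (suc n))) →
    All (λ p → P (value p (x ∷ ρ))) ps → All (λ p → P (value p ρ)) (tails ps)
  tails⁺ P [] [] = []
  tails⁺ P {x} {ρ} (((+ 0) ∷ cs , k) ∷ ps) (h ∷ hs) =
    subst P (cong (_+ k) (lemma x (dot cs ρ))) h ∷ tails⁺ P ps hs
    where
    lemma : ∀ x y → 0ℤ * x + y ≡ y
    lemma = solve-∀
  tails⁺ P ((+ (suc _) ∷ _ , _) ∷ ps) (_ ∷ hs) = tails⁺ P ps hs
  tails⁺ P ((-[1+ _ ] ∷ _ , _) ∷ ps) (_ ∷ hs) = tails⁺ P ps hs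

  head : ∀ {n} → Form (suc n) → ℤ
  head (c ∷ _ , _) = c

  -- Cancels the first variable of q against p; the multiplier of q is positive,
  -- so that the sign of q is kept.
  cancel : ∀ {n} → Form (suc n) → Form (suc n) → Form (suc n)
  cancel p q with head p
  ... | + c = comb (- head q) p (+ c) q
  ... | -[1+ c ] = comb (head q) p (+ suc c) q

  cancel-zero : ∀ {n} {ρ : Vec ℤ (suc n)} p q → Zero ρ p → Zero ρ q → Zero ρ (cancel p q)
  cancel-zero {ρ = ρ} p q hp hq with head p
  ... | + c rewrite value-comb (- head q) p (+ c) q ρ | hp | hq = lemma (- head q) (+ c)
    where
    lemma : ∀ a b → a * 0ℤ + b * 0ℤ ≡ 0ℤ
    lemma = solve-∀
  ... | -[1+ c ] rewrite value-comb (head q) p (+ suc c) q ρ | hp | hq = lemma (head q) (+ suc c)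
    where
    lemma : ∀ a b → a * 0ℤ + b * 0ℤ ≡ 0ℤ
    lemma = solve-∀

  nonneg-* : ∀ c {x} → 0ℤ ≤ x → 0ℤ ≤ + c * x
  nonneg-* c {+ n} _ = subst (0ℤ ≤_) (ℤ.pos-* c n) (+≤+ ℕ.z≤n)

  cancel-nonneg : ∀ {n} {ρ : Vec ℤ (suc n)} p q → Zero ρ p → Nonneg ρ q → Nonneg ρ (cancel p q)
  cancel-nonneg {ρ = ρ} p q hp hq with head p
  ... | + c rewrite value-comb (- head q) p (+ c) q ρ | hp | ℤ.*-zeroʳ (- head q) | ℤ.+-identityˡ (+ c * value q ρ) =
    nonneg-* c hq
  ... | -[1+ c ] rewrite value-comb (head q) p (+ suc c) q ρ | hp | ℤ.*-zeroʳ (head q) | ℤ.+-identityˡ (+ suc c * value q ρ) =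
    nonneg-* (suc c) hq

  isZero : ℤ → Bool
  isZero (+ 0) = true
  isZero _ = false

  -- The default is the zero form, itself a true equation. A vanishing leading coefficient of the
  -- result thus signals that no equation contains the variable, and soundness needs no case
  -- distinction.
  pivot : ∀ {n} → List (Form (suc n)) → Form (suc n)
  pivot [] = zeros , 0ℤ
  pivot (p ∷ ps) with isZero (head p)
  ... | false = p
  ... | true = pivot ps

  pivot-zero : ∀ {n} {ρ : Vec ℤ (suc n)} ps → All (Zero ρ) ps → Zero ρ (pivot ps)
  pivot-zero {ρ = ρ} [] [] = trans (ℤ.+-identityʳ _) (dot-zeros ρ)
  pivot-zero (p ∷ ps) (h ∷ hs) with isZero (head p)
  ... | false = h
  ... | true = pivot-zero ps hs

  -- Fourier–Motzkin: a positive combination of two inequalities whose leading coefficients have opposite signs.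
  pair : ∀ {n} → Form (suc n) → Form (suc n) → List (Form (suc n))
  pair p q with head p | head q
  ... | + (suc a) | -[1+ b ] = comb (+ suc b) p (+ suc a) q ∷ []
  ... | _ | _ = []

  pair⁺ : ∀ {n} {ρ : Vec ℤ (suc n)} p q → Nonneg ρ p → Nonneg ρ q → All (Nonneg ρ) (pair p q)
  pair⁺ {ρ = ρ} p q hp hq with head p | head q
  ... | + (suc a) | -[1+ b ] =
    subst (0ℤ ≤_) (sym (value-comb (+ suc b) p (+ suc a) q ρ)) (ℤ.+-mono-≤ (nonneg-* (suc b) hp) (nonneg-* (suc a) hq)) ∷ []
  ... | + 0 | _ = []
  ... | -[1+ _ ] | _ = []
  ... | + (suc _) | + _ = []

  pairs : ∀ {n} → List (Form (suc n)) → List (Form (suc n))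
  pairs ps = concatMap (λ p → concatMap (pair p) ps) ps

  pairs⁺ : ∀ {n} {ρ : Vec ℤ (suc n)} ps → All (Nonneg ρ) ps → All (Nonneg ρ) (pairs ps)
  pairs⁺ ps hs = concat⁺ (map⁺ (All.map (λ {p} hp → concat⁺ (map⁺ (All.map (λ {q} → pair⁺ p q hp) hs))) hs))

  -- A refutation over the rationals. Each step removes one variable, by substitution if some
  -- equation contains it and by Fourier-Motzkin elimination otherwise; constants remain at the end.
  contradictory : ∀ n → List (Form n) → List (Form n) → Bool
  contradictory zero es ps = any (not ∘ isZero ∘ proj₂) es ∨ any (not ∘ (0ℤ ≤ᵇ_) ∘ proj₂) ps
  contradictory (suc n) es ps with isZero (head (pivot es))
  ... | true = contradictory n (tails es) (tails (ps ++ pairs ps))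
  ... | false = contradictory n (tails (map (cancel (pivot es)) es)) (tails (map (cancel (pivot es)) ps))

  isZero-0 : ∀ {k} → k ≡ 0ℤ → T (not (isZero k)) → ⊥
  isZero-0 refl ()

  contradictory⁺ : ∀ n es ps → T (contradictory n es ps) → ∀ ρ → All (Zero ρ) es → All (Nonneg ρ) ps → ⊥
  contradictory⁺ zero es ps t [] hes hps
    with Equivalence.to (T-∨ {any (not ∘ isZero ∘ proj₂) es}) t
  ... | inj₁ u = All¬⇒¬Any (All.map (λ { {[] , k} h → isZero-0 (trans (sym (ℤ.+-identityˡ k)) h) }) hes)
                   (any⁻ (not ∘ isZero ∘ proj₂) es u)
  ... | inj₂ u = All¬⇒¬Any (All.map (λ { {[] , k} h → negative k (subst (0ℤ ≤_) (ℤ.+-identityˡ k) h) }) hps)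
                   (any⁻ (not ∘ (0ℤ ≤ᵇ_) ∘ proj₂) ps u)
    where
    negative : ∀ k → 0ℤ ≤ k → T (not (0ℤ ≤ᵇ k)) → ⊥
    negative (+ _) _ ()
  contradictory⁺ (suc n) es ps t (x ∷ ρ) hes hps with isZero (head (pivot es))
  ... | true = contradictory⁺ n (tails es) (tails (ps ++ pairs ps)) t ρ
                 (tails⁺ (_≡ 0ℤ) es hes) (tails⁺ (0ℤ ≤_) (ps ++ pairs ps) (++⁺ hps (pairs⁺ ps hps)))
  ... | false = contradictory⁺ n _ _ t ρ
                 (tails⁺ (_≡ 0ℤ) (map (cancel (pivot es)) es) (map⁺ (All.map (λ {q} → cancel-zero (pivot es) q (pivot-zero es hes)) hes)))
                 (tails⁺ (0ℤ ≤_) (map (cancel (pivot es)) ps) (map⁺ (All.map (λ {q} → cancel-nonneg (pivot es) q (pivot-zero es hes)) hps)))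

  _∸f_ : ∀ {n} → Expr n → Expr n → Form n
  a ∸f b = form (a :- b)

  value-∸ : ∀ {n} (a b : Expr n) ρ → value (a ∸f b) ρ ≡ eval a ρ - eval b ρ
  value-∸ a b ρ = value-form (a :- b) ρ

  -- Integrality enters here: the negation of a ≤ b is a - b - 1 ≥ 0, which is stronger than its
  -- rational counterpart.
  valid : ∀ {n} → List (Form n) → List (Form n) → Claim n → Bool
  valid {n} es ps (a := b) =
    contradictory n es (((a :- b) ∸f con 1ℤ) ∷ ps) ∧ contradictory n es (((b :- a) ∸f con 1ℤ) ∷ ps)
  valid {n} es ps (a :≤ b) = contradictory n es (((a :- b) ∸f con 1ℤ) ∷ ps)
  valid {n} es ps absurd = contradictory n es ps
  valid es ps ((a := b) ⇒ d) = valid ((a ∸f b) ∷ es) ps d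
  valid es ps ((a :≤ b) ⇒ d) = valid es ((b ∸f a) ∷ ps) d

  below : ∀ {x y} → ¬ (0ℤ ≤ (x - y) - 1ℤ) → x ≤ y
  below {x} {y} h = ℤ.≮⇒≥ λ y<x → h (subst (0ℤ ≤_) (lemma x y) (ℤ.i≤j⇒0≤j-i (ℤ.i<j⇒suc[i]≤j y<x)))
    where
    lemma : ∀ x y → x - (1ℤ + y) ≡ (x - y) - 1ℤ
    lemma = solve-∀

  valid⁺ : ∀ {n} es ps (c : Claim n) → T (valid es ps c) → ∀ ρ → All (Zero ρ) es → All (Nonneg ρ) ps → ⟦ c ⟧ ρ
  valid⁺ {n} es ps (a := b) t ρ hes hps = ℤ.≤-antisym
    (below λ h → contradictory⁺ n es _ (proj₁ ts) ρ hes (subst (0ℤ ≤_) (sym (value-∸ (a :- b) (con 1ℤ) ρ)) h ∷ hps))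
    (below λ h → contradictory⁺ n es _ (proj₂ ts) ρ hes (subst (0ℤ ≤_) (sym (value-∸ (b :- a) (con 1ℤ) ρ)) h ∷ hps))
    where ts = Equivalence.to (T-∧ {contradictory n es (((a :- b) ∸f con 1ℤ) ∷ ps)}) t
  valid⁺ {n} es ps (a :≤ b) t ρ hes hps =
    below λ h → contradictory⁺ n es _ t ρ hes (subst (0ℤ ≤_) (sym (value-∸ (a :- b) (con 1ℤ) ρ)) h ∷ hps)
  valid⁺ {n} es ps absurd t ρ hes hps = contradictory⁺ n es ps t ρ hes hps
  valid⁺ es ps ((a := b) ⇒ d) t ρ hes hps h =
    valid⁺ _ ps d t ρ (trans (value-∸ a b ρ) (ℤ.i≡j⇒i-j≡0 h) ∷ hes) hps
  valid⁺ es ps ((a :≤ b) ⇒ d) t ρ hes hps h =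
    valid⁺ es _ d t ρ hes (subst (0ℤ ≤_) (sym (value-∸ b a ρ)) (ℤ.i≤j⇒0≤j-i h) ∷ hps)

  vars : ∀ n → Vec (Expr n) n
  vars n = tabulate var

  universal : ∀ {A : Set} n {F : Vec A n → Set} → (∀ ρ → F ρ) → ∀ⁿ n (curryⁿ {n = n} F)
  universal zero f = f []
  universal (suc n) f = λ x → universal n (λ ρ → f (x ∷ ρ))

  -- The hidden argument evaluates to the unit type exactly when the elimination succeeds, so a true
  -- claim is its own certificate.
  lia : ∀ n (c : N-ary n (Expr n) (Claim n)) → {T (valid [] [] (c $ⁿ vars n))} →
    ∀ⁿ n (curryⁿ {n = n} λ ρ → ⟦ c $ⁿ vars n ⟧ ρ)
  lia n c {t} = universal n λ ρ → valid⁺ [] [] (c $ⁿ vars n) t ρ [] []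

-- Convex combinations and dilates of polytopes

module Cones where

  open import Data.List using (List; []; _∷_; _++_; map; length)
  open import Data.List.Relation.Unary.All using (All; []; _∷_)
  open import Data.Nat using (z≤n)
  import Data.Rational as ℚ
  open import Data.Rational using (ℚ; 0ℚ; 1ℚ)
  import Data.Rational.Properties as ℚ
  import Data.Rational.Solver as ℚ
  import Data.Rational.Unnormalised as ℚᵘ
  open import Data.Rational.Unnormalised using (mkℚᵘ; *≡*)
  import Data.Rational.Unnormalised.Properties as ℚᵘ

  infixr 7 _•_
  infixr 7 _⊡_

  _•_ : ℤ → Pt → Pt
  k • (a , b , c) = k ℤ.* a , k ℤ.* b , k ℤ.* c

  _⊡_ : ℚ → Qt → Qt
  k ⊡ (a , b , c) = k ℚ.* a , k ℚ.* b , k ℚ.* c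

  triple : ∀ {A : Set} {a b c d e f : A} → a ≡ d → b ≡ e → c ≡ f → (a , b , c) ≡ (d , e , f)
  triple refl refl refl = refl

  ι-rep : ∀ a → ℚ.toℚᵘ (ι a) ℚᵘ.≃ mkℚᵘ a 0
  ι-rep a = ℚ.toℚᵘ-fromℚᵘ (mkℚᵘ a 0)

  ι-+ : ∀ a b → ι (a ℤ.+ b) ≡ ι a ℚ.+ ι b
  ι-+ a b = ℚ.toℚᵘ-injective (ℚᵘ.≃-trans (ι-rep (a ℤ.+ b)) (ℚᵘ.≃-trans (*≡* (lemma a b))
    (ℚᵘ.≃-sym (ℚᵘ.≃-trans (ℚ.toℚᵘ-homo-+ (ι a) (ι b)) (ℚᵘ.+-cong (ι-rep a) (ι-rep b))))))
    where
    lemma : ∀ a b → (a ℤ.+ b) ℤ.* 1ℤ ≡ (a ℤ.* 1ℤ ℤ.+ b ℤ.* 1ℤ) ℤ.* 1ℤ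
    lemma = solve-∀

  ι-* : ∀ a b → ι (a ℤ.* b) ≡ ι a ℚ.* ι b
  ι-* a b = ℚ.toℚᵘ-injective (ℚᵘ.≃-trans (ι-rep (a ℤ.* b))
    (ℚᵘ.≃-sym (ℚᵘ.≃-trans (ℚ.toℚᵘ-homo-* (ι a) (ι b)) (ℚᵘ.*-cong (ι-rep a) (ι-rep b)))))

  ι-nonneg : ∀ a → 0ℤ ℤ.≤ a → 0ℚ ℚ.≤ ι a
  ι-nonneg (+ n) _ = ℚ.toℚᵘ-cancel-≤ (ℚᵘ.≤-respʳ-≃ (ℚᵘ.≃-sym (ι-rep (+ n)))
    (ℚᵘ.*≤* (subst₂ ℤ._≤_ (sym (ℤ.*-zeroˡ 1ℤ)) (sym (ℤ.*-identityʳ (+ n))) (ℤ.+≤+ z≤n))))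

  embed-⊕ : ∀ v w → embed (v ⊕ w) ≡ embed v ⊞ embed w
  embed-⊕ (a , b , c) (d , e , f) = triple (ι-+ a d) (ι-+ b e) (ι-+ c f)

  embed-• : ∀ k v → embed (k • v) ≡ ι k ⊡ embed v
  embed-• k (a , b , c) = triple (ι-* k a) (ι-* k b) (ι-* k c)

  +-swap : ∀ a b c d → (a ℚ.+ b) ℚ.+ (c ℚ.+ d) ≡ (a ℚ.+ c) ℚ.+ (b ℚ.+ d)
  +-swap = solve 4 (λ a b c d → (a :+ b) :+ (c :+ d) := (a :+ c) :+ (b :+ d)) refl
    where open ℚ.+-*-Solver

  ⊞-swap : ∀ a b c d → (a ⊞ b) ⊞ (c ⊞ d) ≡ (a ⊞ c) ⊞ (b ⊞ d)
  ⊞-swap (a , b , c) (d , e , f) (g , h , i) (j , k , l) = triple (+-swap a d g j) (+-swap b e h k) (+-swap c f i l)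

  ⊡-⊞ : ∀ k v w → k ⊡ (v ⊞ w) ≡ (k ⊡ v) ⊞ (k ⊡ w)
  ⊡-⊞ k (a , b , c) (d , e , f) = triple (ℚ.*-distribˡ-+ k a d) (ℚ.*-distribˡ-+ k b e) (ℚ.*-distribˡ-+ k c f)

  ⊡-+ : ∀ k l v → (k ℚ.+ l) ⊡ v ≡ (k ⊡ v) ⊞ (l ⊡ v)
  ⊡-+ k l (a , b , c) = triple (ℚ.*-distribʳ-+ a k l) (ℚ.*-distribʳ-+ b k l) (ℚ.*-distribʳ-+ c k l)

  ⊡-⊡ : ∀ k l v → (k ℚ.* l) ⊡ v ≡ k ⊡ (l ⊡ v)
  ⊡-⊡ k l (a , b , c) = triple (ℚ.*-assoc k l a) (ℚ.*-assoc k l b) (ℚ.*-assoc k l c)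

  0q : Qt
  0q = 0ℚ , 0ℚ , 0ℚ

  ⊡-0 : ∀ k → k ⊡ 0q ≡ 0q
  ⊡-0 k = triple (ℚ.*-zeroʳ k) (ℚ.*-zeroʳ k) (ℚ.*-zeroʳ k)

  0-⊡ : ∀ v → 0ℚ ⊡ v ≡ 0q
  0-⊡ (a , b , c) = triple (ℚ.*-zeroˡ a) (ℚ.*-zeroˡ b) (ℚ.*-zeroˡ c)

  1-⊡ : ∀ v → 1ℚ ⊡ v ≡ v
  1-⊡ (a , b , c) = triple (ℚ.*-identityˡ a) (ℚ.*-identityˡ b) (ℚ.*-identityˡ c)

  ⊞-0 : ∀ v → v ⊞ 0q ≡ v
  ⊞-0 (a , b , c) = triple (ℚ.+-identityʳ a) (ℚ.+-identityʳ b) (ℚ.+-identityʳ c)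

  0-⊞ : ∀ v → 0q ⊞ v ≡ v
  0-⊞ (a , b , c) = triple (ℚ.+-identityˡ a) (ℚ.+-identityˡ b) (ℚ.+-identityˡ c)

  ⊞-assoc : ∀ u v w → (u ⊞ v) ⊞ w ≡ u ⊞ (v ⊞ w)
  ⊞-assoc (a , b , c) (d , e , f) (g , h , i) = triple (ℚ.+-assoc a d g) (ℚ.+-assoc b e h) (ℚ.+-assoc c f i)

  nonneg-* : ∀ {p q} → 0ℚ ℚ.≤ p → 0ℚ ℚ.≤ q → 0ℚ ℚ.≤ p ℚ.* q
  nonneg-* {p} {q} 0≤p 0≤q = subst (ℚ._≤ p ℚ.* q) (ℚ.*-zeroˡ q)
    (ℚ.*-monoʳ-≤-nonNeg q {{ℚ.nonNegative 0≤q}} 0≤p)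

  -- Combos S n v: v is a combination of the points of S with nonnegative weights of total n.
  data Combos : List Pt → ℚ → Qt → Set where
    [] : Combos [] 0ℚ 0q
    _∷_ : ∀ {s S w n v} → 0ℚ ℚ.≤ w → Combos S n v → Combos (s ∷ S) (w ℚ.+ n) (scale w s ⊞ v)

  cast : ∀ {S n m v w} → n ≡ m → v ≡ w → Combos S n v → Combos S m w
  cast refl refl c = c

  toCombos : ∀ S ws → length ws ≡ length S → All (0ℚ ℚ.≤_) ws → Combos S (sumℚ ws) (combo ws S)
  toCombos [] [] _ _ = []
  toCombos (s ∷ S) (w ∷ ws) e (h ∷ hs) = h ∷ toCombos S ws (cong Data.Nat.pred e) hs

  fromCombos : ∀ {S n v} → Combos S n v →
    Σ (List ℚ) λ ws → length ws ≡ length S × All (0ℚ ℚ.≤_) ws × sumℚ ws ≡ n × combo ws S ≡ v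
  fromCombos [] = [] , refl , [] , refl , refl
  fromCombos (_∷_ {s} {w = w} h c) with fromCombos c
  ... | ws , e , hs , en , ev = w ∷ ws , cong suc e , h ∷ hs , cong (w ℚ.+_) en , cong (scale w s ⊞_) ev

  addC : ∀ {S n m v w} → Combos S n v → Combos S m w → Combos S (n ℚ.+ m) (v ⊞ w)
  addC [] [] = []
  addC (_∷_ {s} {S} {a} {n} {v} h c) (_∷_ {w = b} {m} {w} k d) =
    cast (+-swap a b n m) (trans (cong (_⊞ (v ⊞ w)) (⊡-+ a b (embed s))) (⊞-swap (scale a s) (scale b s) v w))
      (ℚ.+-mono-≤ h k ∷ addC c d)

  mulC : ∀ {S n v} k → 0ℚ ℚ.≤ k → Combos S n v → Combos S (k ℚ.* n) (k ⊡ v)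
  mulC k h [] = cast (sym (ℚ.*-zeroʳ k)) (sym (⊡-0 k)) []
  mulC k h (_∷_ {s} {S} {a} {n} {v} g c) =
    cast (sym (ℚ.*-distribˡ-+ k a n)) (trans (cong (_⊞ (k ⊡ v)) (⊡-⊡ k a (embed s))) (sym (⊡-⊞ k (scale a s) v)))
      (nonneg-* h g ∷ mulC k h c)

  appendC : ∀ {S T n m v w} → Combos S n v → Combos T m w → Combos (S ++ T) (n ℚ.+ m) (v ⊞ w)
  appendC {m = m} {w = w} [] d = cast (sym (ℚ.+-identityˡ m)) (sym (0-⊞ w)) d
  appendC {m = m} {w = w} (_∷_ {s} {S} {a} {n} {v} h c) d =
    cast (sym (ℚ.+-assoc a n m)) (sym (⊞-assoc (scale a s) v w)) (h ∷ appendC c d)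

  shiftC : ∀ s {T m w} → Combos T m w → Combos (map (s ⊕_) T) m ((m ⊡ embed s) ⊞ w)
  shiftC s [] = cast refl (sym (trans (⊞-0 _) (0-⊡ (embed s)))) []
  shiftC s (_∷_ {t} {T} {a} {n} {v} h c) =
    cast refl (trans (cong (_⊞ ((n ⊡ embed s) ⊞ v)) (trans (cong (a ⊡_) (embed-⊕ s t)) (⊡-⊞ a (embed s) (embed t))))
      (trans (⊞-swap (a ⊡ embed s) (a ⊡ embed t) (n ⊡ embed s) v)
        (cong (_⊞ ((a ⊡ embed t) ⊞ v)) (sym (⊡-+ a n (embed s))))))
      (h ∷ shiftC s c)

  -- Each weight of the first combination is distributed over a whole copy of the second. As the
  -- second has total 1, the total n is kept and w is counted n times.
  minkC : ∀ {S T n v w} → Combos S n v → Combos T 1ℚ w → Combos (MinkPair S T) n (v ⊞ (n ⊡ w))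
  minkC {w = w} [] d = cast refl (sym (trans (0-⊞ _) (0-⊡ w))) []
  minkC {T = T} {w = w} (_∷_ {s} {S} {a} {n} {v} h c) d =
    cast (cong (ℚ._+ n) (ℚ.*-identityʳ a))
      (trans (cong (_⊞ (v ⊞ (n ⊡ w))) (trans (⊡-⊞ a (1ℚ ⊡ embed s) w) (cong (λ z → (a ⊡ z) ⊞ (a ⊡ w)) (1-⊡ (embed s)))))
        (trans (⊞-swap (scale a s) (a ⊡ w) v (n ⊡ w)) (cong ((scale a s ⊞ v) ⊞_) (sym (⊡-+ a n w)))))
      (appendC (mulC a h (shiftC s d)) (minkC c d))

  -- Total weight n means that v lies in the n-fold dilate of the polytope. Dilates turn rational
  -- points with a common denominator into lattice points.
  Cone : List Pt → ℤ → Pt → Set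
  Cone S n v = Combos S (ι n) (embed v)

  cone⇒conv : ∀ {S x} → Cone S 1ℤ x → InConv S x
  cone⇒conv = fromCombos

  conv⇒cone : ∀ {S x} → InConv S x → Cone S 1ℤ x
  conv⇒cone {S} (ws , e , hs , en , ev) = cast en ev (toCombos S ws e hs)

  cone-+ : ∀ {S} n m v w → Cone S n v → Cone S m w → Cone S (n ℤ.+ m) (v ⊕ w)
  cone-+ n m v w c d = cast (sym (ι-+ n m)) (sym (embed-⊕ v w)) (addC c d)

  cone-* : ∀ {S} k n v → 0ℤ ℤ.≤ k → Cone S n v → Cone S (k ℤ.* n) (k • v)
  cone-* k n v h c = cast (sym (ι-* k n)) (sym (embed-• k v)) (mulC (ι k) (ι-nonneg k h) c)

  inverse : ∀ n → Σ ℚ λ r → 0ℚ ℚ.≤ r × r ℚ.* ι (+ suc n) ≡ 1ℚ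
  inverse n = r , ℚ.toℚᵘ-cancel-≤ (ℚᵘ.≤-respʳ-≃ (ℚᵘ.≃-sym rep)
      (ℚᵘ.*≤* (subst₂ ℤ._≤_ (sym (ℤ.*-zeroˡ (+ suc n))) refl (ℤ.+≤+ z≤n))))
    , ℚ.toℚᵘ-injective (ℚᵘ.≃-trans (ℚ.toℚᵘ-homo-* r (ι (+ suc n))) (ℚᵘ.≃-trans (ℚᵘ.*-cong rep (ι-rep (+ suc n))) (*≡* (lemma (+ suc n)))))
    where
    r : ℚ
    r = ℚ.fromℚᵘ (mkℚᵘ 1ℤ n)
    rep : ℚ.toℚᵘ r ℚᵘ.≃ mkℚᵘ 1ℤ n
    rep = ℚ.toℚᵘ-fromℚᵘ (mkℚᵘ 1ℤ n)
    lemma : ∀ m → 1ℤ ℤ.* m ℤ.* 1ℤ ≡ 1ℤ ℤ.* (m ℤ.* 1ℤ)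
    lemma = solve-∀

  cone-÷ : ∀ {S} n v → Cone S (+ suc n) (+ suc n • v) → Cone S 1ℤ v
  cone-÷ n v c with inverse n
  ... | r , 0≤r , e = cast e (trans (cong (r ⊡_) (embed-• (+ suc n) v))
      (trans (sym (⊡-⊡ r _ (embed v))) (trans (cong (_⊡ embed v) e) (1-⊡ (embed v))))) (mulC r 0≤r c)

  -- The points v / N and w / N need not be integral, only their sum x is. This is the source of
  -- lattice points of P + Q that are not sums of lattice points of P and Q.
  cone-mink : ∀ {S T} n v w x → Cone S (+ suc n) v → Cone T (+ suc n) w → v ⊕ w ≡ + suc n • x → Cone (MinkPair S T) 1ℤ x
  cone-mink {S} {T} n v w x c d eq with inverse n
  ... | r , 0≤r , e = cast refl
    (trans (cong ((r ⊡ embed v) ⊞_) (1-⊡ (r ⊡ embed w)))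
      (trans (sym (⊡-⊞ r (embed v) (embed w))) (trans (cong (r ⊡_) (trans (sym (embed-⊕ v w)) (trans (cong embed eq) (embed-• (+ suc n) x))))
        (trans (sym (⊡-⊡ r _ (embed x))) (trans (cong (_⊡ embed x) e) (1-⊡ (embed x)))))))
    (minkC (cast e refl (mulC r 0≤r c)) (cast e refl (mulC r 0≤r d)))

-- An interface for P and P + Q, and the patterns that produce three segments

module Bodies where

  open import Data.Bool using (T)
  open import Data.Integer using (_+_; _*_; -_; _-_; _≤_; +≤+)
  open import Data.List using ([])
  open import Data.List.Relation.Unary.All using ([])
  open import Data.Product.Properties using (≡-dec)
  open import Data.Vec using (Vec; []; lookup; map)
  open import Data.Vec.N-ary using (N-ary; _$ⁿ_; ∀ⁿ; curryⁿ)
  open import Data.Vec.Properties using (lookup-map)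
  open LinearArithmetic
  open Cones using (_•_; triple)

  infixl 6 _⊖_

  _⊖_ : Pt → Pt → Pt
  (a , b , c) ⊖ (d , e , f) = a - d , b - e , c - f

  _≟_ : (x y : Pt) → Dec (x ≡ y)
  _≟_ = ≡-dec ℤ._≟_ (≡-dec ℤ._≟_ ℤ._≟_)

  evalₚ : ∀ {n} → Expr n → Vec Pt n → Pt
  evalₚ (var i) ρ = lookup ρ i
  -- A constant is read as a point with equal coordinates, so that `con 0ℤ` denotes the origin and
  -- `con 1ℤ` the point `𝟏`.
  evalₚ (con k) ρ = k , k , k
  evalₚ (a :+ b) ρ = evalₚ a ρ ⊕ evalₚ b ρ
  evalₚ (a :- b) ρ = evalₚ a ρ ⊖ evalₚ b ρ
  evalₚ (k :* a) ρ = k • evalₚ a ρ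

  data Axis : Set where
    x₀ x₁ x₂ : Axis

  _at_ : Pt → Axis → ℤ
  (a , b , c) at x₀ = a
  (a , b , c) at x₁ = b
  (a , b , c) at x₂ = c

  evalₚ-at : ∀ {n} (e : Expr n) ρ i → evalₚ e ρ at i ≡ eval e (map (_at i) ρ)
  evalₚ-at (var j) ρ i = sym (lookup-map j (_at i) ρ)
  evalₚ-at (con k) ρ x₀ = refl
  evalₚ-at (con k) ρ x₁ = refl
  evalₚ-at (con k) ρ x₂ = refl
  evalₚ-at (a :+ b) ρ x₀ = cong₂ _+_ (evalₚ-at a ρ x₀) (evalₚ-at b ρ x₀)
  evalₚ-at (a :+ b) ρ x₁ = cong₂ _+_ (evalₚ-at a ρ x₁) (evalₚ-at b ρ x₁)
  evalₚ-at (a :+ b) ρ x₂ = cong₂ _+_ (evalₚ-at a ρ x₂) (evalₚ-at b ρ x₂)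
  evalₚ-at (a :- b) ρ x₀ = cong₂ _-_ (evalₚ-at a ρ x₀) (evalₚ-at b ρ x₀)
  evalₚ-at (a :- b) ρ x₁ = cong₂ _-_ (evalₚ-at a ρ x₁) (evalₚ-at b ρ x₁)
  evalₚ-at (a :- b) ρ x₂ = cong₂ _-_ (evalₚ-at a ρ x₂) (evalₚ-at b ρ x₂)
  evalₚ-at (k :* a) ρ x₀ = cong (k *_) (evalₚ-at a ρ x₀)
  evalₚ-at (k :* a) ρ x₁ = cong (k *_) (evalₚ-at a ρ x₁)
  evalₚ-at (k :* a) ρ x₂ = cong (k *_) (evalₚ-at a ρ x₂)

  ⟦_⟧ₚₐ : ∀ {n} → Atom n → Vec Pt n → Set
  ⟦ a := b ⟧ₚₐ ρ = evalₚ a ρ ≡ evalₚ b ρ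
  ⟦ a :≤ b ⟧ₚₐ ρ = ∀ i → evalₚ a ρ at i ≤ evalₚ b ρ at i

  ⟦_⟧ₚ : ∀ {n} → Claim n → Vec Pt n → Set
  ⟦ a := b ⟧ₚ ρ = evalₚ a ρ ≡ evalₚ b ρ
  ⟦ a :≤ b ⟧ₚ ρ = ∀ i → evalₚ a ρ at i ≤ evalₚ b ρ at i
  ⟦ absurd ⟧ₚ ρ = ⊥
  ⟦ c ⇒ d ⟧ₚ ρ = ⟦ c ⟧ₚₐ ρ → ⟦ d ⟧ₚ ρ

  coordinatewise : ∀ {n} (c : Claim n) ρ → (∀ i → ⟦ c ⟧ (map (_at i) ρ)) → ⟦ c ⟧ₚ ρ
  coordinatewise (a := b) ρ f = triple (each x₀) (each x₁) (each x₂)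
    where
    each : ∀ i → evalₚ a ρ at i ≡ evalₚ b ρ at i
    each i = trans (evalₚ-at a ρ i) (trans (f i) (sym (evalₚ-at b ρ i)))
  coordinatewise (a :≤ b) ρ f i = subst₂ _≤_ (sym (evalₚ-at a ρ i)) (sym (evalₚ-at b ρ i)) (f i)
  coordinatewise absurd ρ f = f x₀
  coordinatewise ((a := b) ⇒ d) ρ f h = coordinatewise d ρ λ i →
    f i (trans (sym (evalₚ-at a ρ i)) (trans (cong (_at i) h) (evalₚ-at b ρ i)))
  coordinatewise ((a :≤ b) ⇒ d) ρ f h = coordinatewise d ρ λ i →
    f i (subst₂ _≤_ (evalₚ-at a ρ i) (evalₚ-at b ρ i) (h i))

  vlia : ∀ n (c : N-ary n (Expr n) (Claim n)) → {T (valid [] [] (c $ⁿ vars n))} →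
    ∀ⁿ n (curryⁿ {n = n} λ ρ → ⟦ c $ⁿ vars n ⟧ₚ ρ)
  vlia n c {t} = universal n λ ρ → coordinatewise (c $ⁿ vars n) ρ λ i → valid⁺ [] [] (c $ⁿ vars n) t _ [] []

  e₀ e₁ e₂ 𝟏 : Pt
  e₀ = + 1 , + 0 , + 0
  e₁ = + 0 , + 1 , + 0
  e₂ = + 0 , + 0 , + 1
  𝟏 = + 1 , + 1 , + 1

  e : Fin 3 → Pt
  e zero = e₀
  e (suc zero) = e₁
  e (suc (suc zero)) = e₂

  sum₃ : Pt → ℤ
  sum₃ (a , b , c) = a + b + c

  -- P and X stand for the lattice points of a polytope and of its Minkowski sum with the
  -- triangle e₀e₁e₂; hull n v says that v lies in the n-fold dilate of the polytope.
  record Body (G : Set) : Set₁ where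
    field
      P X : Pt → Set
      hull : ℤ → Pt → Set
      point : ∀ {p} → P p → hull 1ℤ p
      hull-+ : ∀ {n m v w} → hull n v → hull m w → hull (n + m) (v ⊕ w)
      hull-* : ∀ {n v} k → 0ℤ ≤ k → hull n v → hull (k * n) (k • v)
      hull-÷ : ∀ n {v} → hull (+ suc n) (+ suc n • v) → P v
      -- A nonnegative vector of coordinate sum N is a point of the N-fold dilate of the triangle
      -- e₀e₁e₂: its coordinates are its barycentric weights.
      mink : ∀ n {v x} w → hull (+ suc n) v → (∀ i → 0ℤ ≤ w at i) → sum₃ w ≡ + suc n → v ⊕ w ≡ + suc n • x → X x
      middle : ∀ {x y} m → X x → X y → x ⊕ y ≡ + 2 • m → X m
      third : ∀ {x y} m → X x → X y → x ⊕ x ⊕ y ≡ + 3 • m → X m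
      -- `G` stands for the existence of three summands. The vectors d, a and b may be parallel or
      -- equal.
      box : ∀ x d a b → d ≢ origin → a ≢ origin → b ≢ origin →
        X x → X (x ⊕ d) → X (x ⊕ a) → X (x ⊕ b) → X (x ⊕ d ⊕ a) → X (x ⊕ d ⊕ b) → X (x ⊕ a ⊕ b) → X (x ⊕ d ⊕ a ⊕ b) → G

  e-nonneg : ∀ i j → 0ℤ ≤ e i at j
  e-nonneg zero x₀ = +≤+ ℕ.z≤n
  e-nonneg zero x₁ = +≤+ ℕ.z≤n
  e-nonneg zero x₂ = +≤+ ℕ.z≤n
  e-nonneg (suc zero) x₀ = +≤+ ℕ.z≤n
  e-nonneg (suc zero) x₁ = +≤+ ℕ.z≤n
  e-nonneg (suc zero) x₂ = +≤+ ℕ.z≤n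
  e-nonneg (suc (suc zero)) x₀ = +≤+ ℕ.z≤n
  e-nonneg (suc (suc zero)) x₁ = +≤+ ℕ.z≤n
  e-nonneg (suc (suc zero)) x₂ = +≤+ ℕ.z≤n

  sum₃-e : ∀ i → sum₃ (e i) ≡ 1ℤ
  sum₃-e zero = refl
  sum₃-e (suc zero) = refl
  sum₃-e (suc (suc zero)) = refl

  infix 4 _≡₃_
  _≡₃_ : Pt → Pt → Set
  x ≡₃ y = ∃ λ d → x ≡ y ⊕ + 3 • d

  infix 4 _≡₂_
  _≡₂_ : Pt → Pt → Set
  x ≡₂ y = ∃ λ d → x ≡ y ⊕ + 2 • d

  e-difference : ∀ {i j} → i ≢ j → e i ⊖ e j ≢ origin
  e-difference {zero} {zero} h = ⊥-elim (h refl)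
  e-difference {zero} {suc zero} h ()
  e-difference {zero} {suc (suc zero)} h ()
  e-difference {suc zero} {zero} h ()
  e-difference {suc zero} {suc zero} h = ⊥-elim (h refl)
  e-difference {suc zero} {suc (suc zero)} h ()
  e-difference {suc (suc zero)} {zero} h ()
  e-difference {suc (suc zero)} {suc zero} h ()
  e-difference {suc (suc zero)} {suc (suc zero)} h = ⊥-elim (h refl)

  module Rules {G : Set} (K : Body G) where
    open Body K

    translate : ∀ {p} → P p → ∀ i → X (p ⊕ e i)
    translate {p} h i = mink 0 (e i) (point h) (e-nonneg i) (sum₃-e i) (vlia 2 (λ p q → p :+ q := + 1 :* (p :+ q)) p (e i))

    X≡ : ∀ {x y} → x ≡ y → X x → X y
    X≡ refl h = h

    -- Three points x, m, y in arithmetic progression, moved by d.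
    doubled : ∀ x y d m → x ≢ y → d ≢ origin → x ⊕ y ≡ + 2 • m →
      X x → X y → X (x ⊕ d) → X (y ⊕ d) → G
    doubled x y d m x≢y d≢0 h X₁ X₂ X₃ X₄ =
      box x d (m ⊖ x) (m ⊖ x) d≢0 a≢0 a≢0 X₁ X₃ Xa Xa Xb Xb
        (X≡ (vlia 3 (λ x y m → x :+ y := + 2 :* m ⇒ y := x :+ (m :- x) :+ (m :- x)) x y m h) X₂)
        (X≡ (vlia 4 (λ x y m d → x :+ y := + 2 :* m ⇒ y :+ d := x :+ d :+ (m :- x) :+ (m :- x)) x y m d h) X₄)
      where
      a≢0 : m ⊖ x ≢ origin
      a≢0 k = x≢y (vlia 3 (λ x y m → x :+ y := + 2 :* m ⇒ m :- x := con 0ℤ ⇒ x := y) x y m h k)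
      Xa : X (x ⊕ (m ⊖ x))
      Xa = X≡ (vlia 2 (λ x m → m := x :+ (m :- x)) x m) (middle m X₁ X₂ h)
      Xb : X (x ⊕ d ⊕ (m ⊖ x))
      Xb = X≡ (vlia 3 (λ x m d → m :+ d := x :+ d :+ (m :- x)) x m d) (middle (m ⊕ d) X₃ X₄
        (vlia 4 (λ x y m d → x :+ y := + 2 :* m ⇒ (x :+ d) :+ (y :+ d) := + 2 :* (m :+ d)) x y m d h))

    -- A segment of lattice length divisible by 3 contains three equal lattice steps and so is a sum
    -- of three segments.
    tripled : ∀ x y → X x → X y → x ≡₃ y → x ≡ y ⊎ G
    tripled x y X₁ X₂ (d , h) with d ≟ origin
    ... | yes refl = inj₁ (trans h (vlia 1 (λ y → y :+ + 3 :* con 0ℤ := y) y))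
    ... | no d≢0 = inj₂ (box y d d d d≢0 d≢0 d≢0 X₂ Y₁ Y₁ Y₁ Y₂ Y₂ Y₂
        (X≡ (vlia 3 (λ x y d → x := y :+ + 3 :* d ⇒ x := y :+ d :+ d :+ d) x y d h) X₁))
      where
      Y₁ : X (y ⊕ d)
      Y₁ = third (y ⊕ d) X₂ X₁ (vlia 3 (λ x y d → x := y :+ + 3 :* d ⇒ y :+ y :+ x := + 3 :* (y :+ d)) x y d h)
      Y₂ : X (y ⊕ d ⊕ d)
      Y₂ = third (y ⊕ d ⊕ d) X₁ X₂ (vlia 3 (λ x y d → x := y :+ + 3 :* d ⇒ x :+ x :+ y := + 3 :* (y :+ d :+ d)) x y d h)

    -- The parallelogram supplies two segments and an edge of Q the third.
    parallelogram : ∀ p q r s → P p → P q → P r → P s → p ⊖ q ≡ r ⊖ s → p ≢ q → p ≢ r → G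
    parallelogram p q r s Pp Pq Pr Ps h p≢q p≢r =
      box (q ⊕ e₀) (e₁ ⊖ e₀) (p ⊖ q) (s ⊖ q) (λ ()) (λ k → p≢q (vlia 2 (λ p q → p :- q := con 0ℤ ⇒ p := q) p q k))
        (λ k → p≢r (vlia 4 (λ p q r s → p :- q := r :- s ⇒ s :- q := con 0ℤ ⇒ p := r) p q r s h k))
        (translate Pq zero)
        (X≡ (vlia 3 (λ q a b → q :+ b := q :+ a :+ (b :- a)) q e₀ e₁) (translate Pq (suc zero)))
        (X≡ (vlia 3 (λ p q a → p :+ a := q :+ a :+ (p :- q)) p q e₀) (translate Pp zero))
        (X≡ (vlia 3 (λ s q a → s :+ a := q :+ a :+ (s :- q)) s q e₀) (translate Ps zero))
        (X≡ (vlia 4 (λ p q a b → p :+ b := q :+ a :+ (b :- a) :+ (p :- q)) p q e₀ e₁) (translate Pp (suc zero)))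
        (X≡ (vlia 4 (λ s q a b → s :+ b := q :+ a :+ (b :- a) :+ (s :- q)) s q e₀ e₁) (translate Ps (suc zero)))
        (X≡ (vlia 5 (λ p q r s a → p :- q := r :- s ⇒ r :+ a := q :+ a :+ (p :- q) :+ (s :- q)) p q r s e₀ h) (translate Pr zero))
        (X≡ (vlia 6 (λ p q r s a b → p :- q := r :- s ⇒ r :+ b := q :+ a :+ (b :- a) :+ (p :- q) :+ (s :- q)) p q r s e₀ e₁ h)
          (translate Pr (suc zero)))

    -- Two distinct congruent points span a segment of even lattice length, hence two summands; an
    -- edge of Q is the third.
    congruent : ∀ p q → P p → P q → p ≡₂ q → p ≡ q ⊎ G
    congruent p q Pp Pq (d , h) with p ≟ q
    ... | yes p≡q = inj₁ p≡q
    ... | no p≢q = inj₂ (doubled (p ⊕ e₀) (q ⊕ e₀) (e₁ ⊖ e₀) (q ⊕ d ⊕ e₀)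
        (λ k → p≢q (vlia 3 (λ p q a → p :+ a := q :+ a ⇒ p := q) p q e₀ k)) (λ ())
        (vlia 4 (λ p q d a → p := q :+ + 2 :* d ⇒ (p :+ a) :+ (q :+ a) := + 2 :* (q :+ d :+ a)) p q d e₀ h)
        (translate Pp zero) (translate Pq zero) (move p Pp) (move q Pq))
      where
      move : ∀ p → P p → X (p ⊕ e₀ ⊕ (e₁ ⊖ e₀))
      move p Pp = X≡ (vlia 3 (λ p a b → p :+ b := p :+ a :+ (b :- a)) p e₀ e₁) (translate Pp (suc zero))

-- Decidable congruences and residues of points

module Congruences where

  open import Data.Fin using (fromℕ<)
  open import Data.Fin.Properties using (toℕ-fromℕ<)
  open import Data.Integer using (_+_; _*_; -_; _-_; _/ℕ_)
  open import Data.Integer.DivMod using (a≡a%ℕn+[a/ℕn]*n; n%ℕd<d)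
  open import Data.Integer.Divisibility.Signed using (_∣_; _∣?_; divides)
  open import Relation.Nullary.Decidable using (map′; _×-dec_)
  open Cones using (_•_; triple)
  open Bodies

  infix 4 _≡_mod_
  _≡_mod_ : ℤ → ℤ → ℕ → Set
  x ≡ y mod m = ∃ λ d → x ≡ y + + m * d

  ∣⇒mod : ∀ {m x y} → + m ∣ x - y → x ≡ y mod m
  ∣⇒mod {m} {x} {y} (divides q h) = q ,
    trans (sym (trans (ℤ.+-assoc x (- y) y) (trans (cong (_+_ x) (ℤ.+-inverseˡ y)) (ℤ.+-identityʳ x))))
      (trans (cong (_+ y) h) (trans (ℤ.+-comm (q * + m) y) (cong (_+_ y) (ℤ.*-comm q (+ m)))))

  mod⇒∣ : ∀ {m x y} → x ≡ y mod m → + m ∣ x - y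
  mod⇒∣ {m} {y = y} (q , refl) = divides q (trans (cong (_- y) (ℤ.+-comm y (+ m * q)))
    (trans (ℤ.+-assoc (+ m * q) y (- y)) (trans (cong (_+_ (+ m * q)) (ℤ.+-inverseʳ y)) (trans (ℤ.+-identityʳ _) (ℤ.*-comm (+ m) q)))))

  mod? : ∀ m x y → Dec (x ≡ y mod m)
  mod? m x y = map′ ∣⇒mod mod⇒∣ (+ m ∣? x - y)

  abstract
    residue : ∀ m x → ∃ λ (r : Fin (suc m)) → x ≡ + toℕ r mod (suc m)
    residue m x = fromℕ< (n%ℕd<d x (suc m)) , x /ℕ suc m ,
      trans (a≡a%ℕn+[a/ℕn]*n x (suc m)) (cong₂ _+_ (cong +_ (sym (toℕ-fromℕ< (n%ℕd<d x (suc m))))) (ℤ.*-comm (x /ℕ suc m) (+ suc m)))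

  pt : ∀ {m} → Fin m → Fin m → Fin m → Pt
  pt a b c = + toℕ a , + toℕ b , + toℕ c

  abstract
    residueₚ : ∀ m x → ∃ λ (a : Fin (suc m)) → ∃ λ b → ∃ λ c → ∃ λ d → x ≡ pt a b c ⊕ + suc m • d
    residueₚ m (x , y , z) with residue m x | residue m y | residue m z
    ... | a , d , h | b , e , k | c , f , l = a , b , c , (d , e , f) , triple h k l

  modₚ? : ∀ m x y → Dec (∃ λ d → x ≡ y ⊕ + m • d)
  modₚ? m (x , y , z) (x′ , y′ , z′) = map′
    (λ { ((d , h) , (e , k) , (f , l)) → (d , e , f) , triple h k l })
    (λ { ((d , e , f) , h) → (d , cong (λ p → p at x₀) h) , (e , cong (λ p → p at x₁) h) , (f , cong (λ p → p at x₂) h) })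
    (mod? m x x′ ×-dec mod? m y y′ ×-dec mod? m z z′)

  infix 4 _≡₃?_ _≡₂?_

  _≡₃?_ : ∀ x y → Dec (x ≡₃ y)
  _≡₃?_ = modₚ? 3

  _≡₂?_ : ∀ x y → Dec (x ≡₂ y)
  _≡₂?_ = modₚ? 2

-- Twelve points of P + Q from three classes modulo 2

module Midpoints where

  open import Data.Fin.Properties using () renaming (_≟_ to _≟ᶠ_)
  open import Data.Integer using (_+_)
  open LinearArithmetic
  open Cones using (_•_; triple)
  open Bodies

  next : Fin 3 → Fin 3
  next zero = suc zero
  next (suc zero) = suc (suc zero)
  next (suc (suc zero)) = zero

  data View (k : Fin 3) : Fin 3 → Set where
    self : View k k
    forward : View k (next k)
    backward : View k (next (next k))

  view : ∀ k l → View k l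
  view zero zero = self
  view zero (suc zero) = forward
  view zero (suc (suc zero)) = backward
  view (suc zero) zero = backward
  view (suc zero) (suc zero) = self
  view (suc zero) (suc (suc zero)) = forward
  view (suc (suc zero)) zero = forward
  view (suc (suc zero)) (suc zero) = backward
  view (suc (suc zero)) (suc (suc zero)) = self

  next≢ : ∀ k → next k ≢ k
  next≢ zero ()
  next≢ (suc zero) ()
  next≢ (suc (suc zero)) ()

  next²≢ : ∀ k → next (next k) ≢ k
  next²≢ zero ()
  next²≢ (suc zero) ()
  next²≢ (suc (suc zero)) ()

  next³ : ∀ k → next (next (next k)) ≡ k
  next³ zero = refl
  next³ (suc zero) = refl
  next³ (suc (suc zero)) = refl

  Step : Pt → Pt → Set
  Step p q = ∃ λ i → ∃ λ j → i ≢ j × p ⊖ q ≡ e i ⊖ e j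

  data Index : Set where
    S : Fin 3 → Fin 3 → Index
    M : Fin 3 → Index

  -- The residue modulo 3 of the point with the given index: 2 is its own inverse modulo 3, so
  -- halving becomes doubling.
  rep : (Fin 3 → Pt) → Index → Pt
  rep a (S i j) = a i ⊕ e j
  rep a (M k) = + 2 • (a (next k) ⊕ a (next (next k)) ⊕ e (next k) ⊕ e (next (next k)))

  module _ {G : Set} (K : Body G) where
    open Body K
    open Rules K

    module Points (s : Pt) (A : Fin 3 → Pt) (PA : ∀ i → P (A i)) (cls : ∀ i → A i ≡₂ s ⊕ e i)
                  (A-distinct : ∀ {i j} → i ≢ j → A i ≢ A j) where

      -- The relation A i ⊖ A j = e k ⊖ e l says that the sums A i ⊕ e l and A j ⊕ e k coincide;
      -- this is the degenerate outcome in which fewer than twelve points are available.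
      SS : Set
      SS = ∃ λ i → ∃ λ j → i ≢ j × Step (A i) (A j)

      -- All A i ⊕ e i are congruent to s modulo 2, so the midpoint of any two of them is a lattice
      -- point. It is indexed by the third index k.
      mid : Fin 3 → Pt
      mid k = s ⊕ e (next k) ⊕ e (next (next k)) ⊕ proj₁ (cls (next k)) ⊕ proj₁ (cls (next (next k)))

      mid-double : ∀ k → A (next k) ⊕ A (next (next k)) ⊕ e (next k) ⊕ e (next (next k)) ≡ + 2 • mid k
      mid-double k = vlia 7 (λ s a b e f c d → a := s :+ e :+ + 2 :* c ⇒ b := s :+ f :+ + 2 :* d ⇒
          a :+ b :+ e :+ f := + 2 :* (s :+ e :+ f :+ c :+ d))
        s (A i) (A j) (e i) (e j) (proj₁ (cls i)) (proj₁ (cls j)) (proj₂ (cls i)) (proj₂ (cls j))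
        where
        i = next k
        j = next (next k)

      V : Index → Pt
      V (S i j) = A i ⊕ e j
      V (M k) = mid k

      XV : ∀ x → X (V x)
      XV (S i j) = translate (PA i) j
      XV (M k) = middle (mid k) (translate (PA i) i) (translate (PA j) j)
          (trans (vlia 4 (λ a b e f → a :+ e :+ (b :+ f) := a :+ b :+ e :+ f) (A i) (A j) (e i) (e j)) (mid-double k))
        where
        i = next k
        j = next (next k)

      module Corner {i j k : Fin 3} (i≢j : i ≢ j) (i≢k : i ≢ k) (j≢k : j ≢ k) {mᵢⱼ mᵢₖ mⱼₖ : Pt}
               (hᵢⱼ : A i ⊕ A j ⊕ e i ⊕ e j ≡ + 2 • mᵢⱼ) (hᵢₖ : A i ⊕ A k ⊕ e i ⊕ e k ≡ + 2 • mᵢₖ)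
               (hⱼₖ : A j ⊕ A k ⊕ e j ⊕ e k ≡ + 2 • mⱼₖ) (Xᵢₖ : X mᵢₖ) (Xⱼₖ : X mⱼₖ) where

        -- The points A k ⊕ e i and A i ⊕ e k have midpoint mᵢₖ. Translation by e k ⊖ e i takes them
        -- to A k ⊕ e k and, by hypothesis, to A j ⊕ e j.
        α : mᵢⱼ ≡ A i ⊕ e k → SS ⊎ G
        α h with (A k ⊕ e i) ≟ (A i ⊕ e k)
        ... | yes q = inj₁ (k , i , ≢-sym i≢k , k , i , ≢-sym i≢k ,
                vlia 4 (λ a c e f → c :+ e := a :+ f ⇒ c :- a := f :- e) (A i) (A k) (e i) (e k) q)
        ... | no q = inj₂ (doubled (A k ⊕ e i) (A i ⊕ e k) (e k ⊖ e i) mᵢₖ q (e-difference (≢-sym i≢k))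
                (trans (vlia 4 (λ a c e f → c :+ e :+ (a :+ f) := a :+ c :+ e :+ f) (A i) (A k) (e i) (e k)) hᵢₖ)
                (translate (PA k) i) (translate (PA i) k)
                (X≡ (vlia 3 (λ c e f → c :+ f := c :+ e :+ (f :- e)) (A k) (e i) (e k)) (translate (PA k) k))
                (X≡ (vlia 6 (λ a b e g f m → a :+ b :+ e :+ g := + 2 :* m ⇒ m := a :+ f ⇒ b :+ g := a :+ f :+ (f :- e))
                     (A i) (A j) (e i) (e j) (e k) mᵢⱼ hᵢⱼ h) (translate (PA j) j)))

        -- Write B l for A l ⊕ e l. Then B i, mᵢₖ, B k, mⱼₖ, B j are equally spaced on a line, so B
        -- i and mⱼₖ are three steps apart; they are equal only if B i = B k.
        β : mᵢⱼ ≡ A k ⊕ e k → SS ⊎ G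
        β h = [ (λ q → inj₁ (i , k , i≢k , k , i , ≢-sym i≢k ,
                  vlia 8 (λ a b c e g f m o → a :+ b :+ e :+ g := + 2 :* m ⇒ b :+ c :+ g :+ f := + 2 :* o ⇒
                      m := c :+ f ⇒ a :+ e := o ⇒ a :- c := f :- e)
                    (A i) (A j) (A k) (e i) (e j) (e k) mᵢⱼ mⱼₖ hᵢⱼ hⱼₖ h q)) , inj₂ ]′
                (tripled (A i ⊕ e i) mⱼₖ (translate (PA i) i) Xⱼₖ (A i ⊕ e i ⊖ mᵢₖ ,
                  vlia 9 (λ a b c e g f m n o → a :+ b :+ e :+ g := + 2 :* m ⇒ a :+ c :+ e :+ f := + 2 :* n ⇒
                      b :+ c :+ g :+ f := + 2 :* o ⇒ m := c :+ f ⇒ a :+ e := o :+ + 3 :* (a :+ e :- n))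
                    (A i) (A j) (A k) (e i) (e j) (e k) mᵢⱼ mᵢₖ mⱼₖ hᵢⱼ hᵢₖ hⱼₖ h))

        -- The points A k ⊕ e k and A j ⊕ e j have midpoint mⱼₖ. Translation by A i ⊖ A k takes them
        -- to A i ⊕ e k and, by hypothesis, to A k ⊕ e i.
        γ : mᵢⱼ ≡ A k ⊕ e i → SS ⊎ G
        γ h with (A k ⊕ e k) ≟ (A j ⊕ e j)
        ... | yes q = inj₁ (k , j , ≢-sym j≢k , j , k , j≢k ,
                vlia 4 (λ b c g f → c :+ f := b :+ g ⇒ c :- b := g :- f) (A j) (A k) (e j) (e k) q)
        ... | no q = inj₂ (doubled (A k ⊕ e k) (A j ⊕ e j) (A i ⊖ A k) mⱼₖ q
                (λ z → A-distinct i≢k (vlia 2 (λ a c → a :- c := con 0ℤ ⇒ a := c) (A i) (A k) z))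
                (trans (vlia 4 (λ b c g f → c :+ f :+ (b :+ g) := b :+ c :+ g :+ f) (A j) (A k) (e j) (e k)) hⱼₖ)
                (translate (PA k) k) (translate (PA j) j)
                (X≡ (vlia 3 (λ a c f → a :+ f := c :+ f :+ (a :- c)) (A i) (A k) (e k)) (translate (PA i) k))
                (X≡ (vlia 6 (λ a b c e g m → a :+ b :+ e :+ g := + 2 :* m ⇒ m := c :+ e ⇒ c :+ e := b :+ g :+ (a :- c))
                     (A i) (A j) (A k) (e i) (e j) mᵢⱼ hᵢⱼ h) (translate (PA k) i)))

        near : mᵢⱼ ≡ A i ⊕ e i → SS ⊎ G
        near h = inj₁ (j , i , ≢-sym i≢j , i , j , i≢j ,
          vlia 5 (λ a b e g m → a :+ b :+ e :+ g := + 2 :* m ⇒ m := a :+ e ⇒ b :- a := e :- g) (A i) (A j) (e i) (e j) mᵢⱼ hᵢⱼ h)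

        far : mᵢⱼ ≡ A i ⊕ e j → SS ⊎ G
        far h = inj₁ (j , i , ≢-sym i≢j , j , i , ≢-sym i≢j ,
          vlia 5 (λ a b e g m → a :+ b :+ e :+ g := + 2 :* m ⇒ m := a :+ g ⇒ b :- a := g :- e) (A i) (A j) (e i) (e j) mᵢⱼ hᵢⱼ h)

      swapped : ∀ i j m → A i ⊕ A j ⊕ e i ⊕ e j ≡ + 2 • m → A j ⊕ A i ⊕ e j ⊕ e i ≡ + 2 • m
      swapped i j m h = trans (vlia 4 (λ a b e f → b :+ a :+ f :+ e := a :+ b :+ e :+ f) (A i) (A j) (e i) (e j)) h

      module At (k : Fin 3) where
        i j : Fin 3
        i = next k
        j = next (next k)
        h₁ : A j ⊕ A k ⊕ e j ⊕ e k ≡ + 2 • mid i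
        h₁ = subst (λ l → A j ⊕ A l ⊕ e j ⊕ e l ≡ + 2 • mid i) (next³ k) (mid-double i)
        h₂ : A k ⊕ A i ⊕ e k ⊕ e i ≡ + 2 • mid j
        h₂ = subst (λ l → A l ⊕ A (next l) ⊕ e l ⊕ e (next l) ≡ + 2 • mid j) (next³ k) (mid-double j)
        h₀ = mid-double k
        module ij = Corner {i} {j} {k} (≢-sym (next≢ i)) (next≢ k) (next²≢ k) h₀ (swapped k i (mid j) h₂) h₁ (XV (M j)) (XV (M i))
        module ji = Corner {j} {i} {k} (next≢ i) (next²≢ k) (next≢ k) (swapped i j (mid k) h₀) h₁ (swapped k i (mid j) h₂) (XV (M i)) (XV (M j))

        S-M : ∀ l a → V (M k) ≡ V (S l a) → SS ⊎ G
        S-M l a h with view k l | view k a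
        ... | self | self = ij.β h
        ... | self | forward = ij.γ h
        ... | self | backward = ji.γ h
        ... | forward | self = ij.α h
        ... | forward | forward = ij.near h
        ... | forward | backward = ij.far h
        ... | backward | self = ji.α h
        ... | backward | forward = ji.far h
        ... | backward | backward = ji.near h

        M-M : V (M k) ≡ V (M i) → SS ⊎ G
        M-M h = inj₁ (i , k , next≢ k , k , i , ≢-sym (next≢ k) ,
          vlia 8 (λ a b c e f g m n → a :+ b :+ e :+ f := + 2 :* m ⇒ b :+ c :+ f :+ g := + 2 :* n ⇒ m := n ⇒ a :- c := g :- e)
            (A i) (A j) (A k) (e i) (e j) (e k) (mid k) (mid i) h₀ h₁ h)

      -- A congruence modulo 3 between two of the twelve points yields three segments or an
      -- equality. This lemma disposes of the equality.
      coincide : ∀ x y → x ≢ y → V x ≡ V y → SS ⊎ G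
      coincide (S i a) (S j b) x≢y h with i ≟ᶠ j
      ... | yes refl = ⊥-elim (same a b (λ { refl → x≢y refl }) (vlia 3 (λ p q r → p :+ q := p :+ r ⇒ q :- r := con 0ℤ) (A i) (e a) (e b) h))
        where
        same : ∀ a b → a ≢ b → e a ⊖ e b ≢ origin
        same a b = e-difference
      ... | no i≢j with a ≟ᶠ b
      ...   | yes refl = ⊥-elim (A-distinct i≢j (vlia 3 (λ p q r → p :+ r := q :+ r ⇒ p := q) (A i) (A j) (e a) h))
      ...   | no a≢b = inj₁ (i , j , i≢j , b , a , ≢-sym a≢b ,
                vlia 4 (λ p q r s → p :+ r := q :+ s ⇒ p :- q := s :- r) (A i) (A j) (e a) (e b) h)
      coincide (S l a) (M k) x≢y h = At.S-M k l a (sym h)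
      coincide (M k) (S l a) x≢y h = At.S-M k l a h
      coincide (M k) (M l) x≢y h with view k l
      ... | self = ⊥-elim (x≢y refl)
      ... | forward = At.M-M k h
      ... | backward = At.M-M (next (next k)) (trans (sym h) (cong mid (sym (next³ k))))

-- The table of residues modulo 3

module MidpointTable where

  open import Data.Bool using (Bool; true; false; _∧_; T)
  open import Data.Bool.Properties using (T-∧)
  open import Data.Fin.Properties using (all?) renaming (_≟_ to _≟ᶠ_)
  open import Data.Integer using (∣_∣; -_; _-_)
  open import Data.Integer.Divisibility.Signed using (∣ᵤ⇒∣)
  open import Data.List using (List; []; _∷_; _++_; map; concatMap)
  open import Data.Maybe using (Maybe; just; nothing)
  open import Data.Nat using (_%_; _≡ᵇ_)
  open import Data.Nat.Divisibility using (m%n≡0⇒n∣m)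
  open import Data.Nat.Properties using (≡ᵇ⇒≡)
  open import Data.Unit using (tt)
  open import Function using (Equivalence)
  open import Relation.Nullary.Decidable using (_×-dec_; _⊎-dec_; ¬?)
  open LinearArithmetic
  open Cones using (_•_; triple)
  open Bodies
  open Congruences
  open Midpoints

  divisible₃ : ℤ → Bool
  divisible₃ x = ∣ x ∣ % 3 ≡ᵇ 0

  congruent₃ : Pt → Pt → Bool
  congruent₃ (a , b , c) (d , f , g) = divisible₃ (a - d) ∧ divisible₃ (b - f) ∧ divisible₃ (c - g)

  divisible₃⁺ : ∀ x y → T (divisible₃ (x - y)) → x ≡ y mod 3
  divisible₃⁺ x y t with mod? 3 x y
  ... | yes h = h
  ... | no n = ⊥-elim (n (∣⇒mod (∣ᵤ⇒∣ (m%n≡0⇒n∣m ∣ x - y ∣ 3 (≡ᵇ⇒≡ _ 0 t)))))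

  congruent₃⁺ : ∀ x y → T (congruent₃ x y) → x ≡₃ y
  congruent₃⁺ (a , b , c) (d , f , g) t
    with Equivalence.to (T-∧ {divisible₃ (a - d)}) t
  ... | t₁ , t′ with Equivalence.to (T-∧ {divisible₃ (b - f)}) t′
  ... | t₂ , t₃ with divisible₃⁺ a d t₁ | divisible₃⁺ b f t₂ | divisible₃⁺ c g t₃
  ... | k , h₁ | l , h₂ | m , h₃ = (k , l , m) , triple h₁ h₂ h₃

  Collision : (Fin 3 → Pt) → Set
  Collision a = ∃ λ x → ∃ λ y → x ≢ y × rep a x ≡₃ rep a y

  -- One order of each pair is enough. Pairs S i a, S i b are left out because distinct unit vectors
  -- are incongruent modulo 3.
  data Clash : Index → Index → Set where
    S-S : ∀ i a b → Clash (S i a) (S (next i) b)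
    M-S : ∀ k i a → Clash (M k) (S i a)
    M-M : ∀ k → Clash (M k) (M (next k))

  clash-≢ : ∀ {x y} → Clash x y → x ≢ y
  clash-≢ (S-S zero a b) ()
  clash-≢ (S-S (suc zero) a b) ()
  clash-≢ (S-S (suc (suc zero)) a b) ()
  clash-≢ (M-S k i a) ()
  clash-≢ (M-M zero) ()
  clash-≢ (M-M (suc zero)) ()
  clash-≢ (M-M (suc (suc zero))) ()

  clashes : List (∃ λ x → ∃ λ y → Clash x y)
  clashes = concatMap (λ i → concatMap (λ a → map (λ b → _ , _ , S-S i a b) three) three) three
    ++ concatMap (λ k → concatMap (λ i → map (λ a → _ , _ , M-S k i a) three) three) three
    ++ map (λ k → _ , _ , M-M k) three
    where three = zero ∷ suc zero ∷ suc (suc zero) ∷ []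

  collision : ∀ a → Maybe (Collision a)
  collision a = search clashes
    where
    search : List (∃ λ x → ∃ λ y → Clash x y) → Maybe (Collision a)
    search [] = nothing
    search ((x , y , c) ∷ cs) with congruent₃ (rep a x) (rep a y) | congruent₃⁺ (rep a x) (rep a y)
    ... | true | f = just (x , y , clash-≢ c , f tt)
    ... | false | _ = search cs

  Spread : (Fin 3 → Pt) → Set
  Spread a = ∀ i j → ¬ (i ≢ j × sum₃ (a i) ≡ sum₃ (a j) mod 3)

  spread? : ∀ a → Dec (Spread a)
  spread? a = all? λ i → all? λ j → ¬? (¬? (i ≟ᶠ j) ×-dec mod? 3 (sum₃ (a i)) (sum₃ (a j)))

  total : (Fin 3 → Pt) → Pt
  total a = a zero ⊕ a (suc zero) ⊕ a (suc (suc zero))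

  Outcome : (Fin 3 → Pt) → Set
  Outcome a = Collision a ⊎ (Spread a × (total a ≡₃ 𝟏 ⊎ total a ≡₃ origin))

  -- A common translation by o moves all twelve residues by o, the midpoints because 4 o is
  -- congruent to o, and changes the total by 3 o. So the first point may be the origin, and 27
  -- times 27 cases remain.
  based : Pt → Pt → Fin 3 → Pt
  based x y zero = origin
  based x y (suc zero) = x
  based x y (suc (suc zero)) = y

  outcome? : ∀ a → Maybe (Outcome a)
  outcome? a with collision a
  ... | just c = just (inj₁ c)
  ... | nothing with spread? a ×-dec ((total a ≡₃? 𝟏) ⊎-dec (total a ≡₃? origin))
  ...   | yes h = just (inj₂ h)
  ...   | no h = nothing

  found : ∀ {A : Set} → Maybe A → Bool
  found (just _) = true
  found nothing = false

  everywhere : (Fin 3 → Bool) → Bool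
  everywhere f = f zero ∧ f (suc zero) ∧ f (suc (suc zero))

  everywhere⁺ : ∀ f → T (everywhere f) → ∀ i → T (f i)
  everywhere⁺ f t zero = proj₁ (Equivalence.to (T-∧ {f zero}) t)
  everywhere⁺ f t (suc zero) = proj₁ (Equivalence.to (T-∧ {f (suc zero)}) (proj₂ (Equivalence.to (T-∧ {f zero}) t)))
  everywhere⁺ f t (suc (suc zero)) = proj₂ (Equivalence.to (T-∧ {f (suc zero)}) (proj₂ (Equivalence.to (T-∧ {f zero}) t)))

  everywhere³ : (Fin 3 → Fin 3 → Fin 3 → Bool) → Bool
  everywhere³ f = everywhere λ a → everywhere λ b → everywhere λ c → f a b c

  everywhere³⁺ : ∀ f → T (everywhere³ f) → ∀ a b c → T (f a b c)
  everywhere³⁺ f t a b c = everywhere⁺ (f a b) (everywhere⁺ (λ b → everywhere (f a b)) (everywhere⁺ (λ a → everywhere λ b → everywhere (f a b)) t a) b) c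

  extract : ∀ {A : Set} (m : Maybe A) → T (found m) → A
  extract (just x) _ = x

  outcomeᵇ : Fin 3 → Fin 3 → Fin 3 → Fin 3 → Fin 3 → Fin 3 → Bool
  outcomeᵇ a b c d f g = found (outcome? (based (pt a b c) (pt d f g)))

  abstract
    outcome : ∀ a b c d f g → Outcome (based (pt {3} a b c) (pt {3} d f g))
    outcome a b c d f g = extract (outcome? (based (pt a b c) (pt d f g)))
      (everywhere³⁺ (outcomeᵇ a b c) (everywhere³⁺ (λ a b c → everywhere³ (outcomeᵇ a b c)) tt a b c) d f g)

-- From the table to the geometry of three points

module Trios where

  open import Data.Fin.Properties using (all?) renaming (_≟_ to _≟ᶠ_)
  open import Data.Integer using (_+_; _*_; -_; _-_)
  open import Relation.Nullary.Decidable using (_×-dec_; from-yes; ¬?)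
  open LinearArithmetic
  open Cones using (_•_; triple)
  open Bodies
  open Congruences
  open Midpoints
  open MidpointTable

  ≡₃-trans : ∀ {x y z} → x ≡₃ y → y ≡₃ z → x ≡₃ z
  ≡₃-trans {x} {y} {z} (d , h) (f , k) = d ⊕ f , vlia 5 (λ x y z d f → x := y :+ + 3 :* d ⇒ y := z :+ + 3 :* f ⇒ x := z :+ + 3 :* (d :+ f)) x y z d f h k

  ≡₃-sym : ∀ {x y} → x ≡₃ y → y ≡₃ x
  ≡₃-sym {x} {y} (d , h) = origin ⊖ d , vlia 3 (λ x y d → x := y :+ + 3 :* d ⇒ y := x :+ + 3 :* (con 0ℤ :- d)) x y d h

  ≡₃-refl : ∀ {x} → x ≡₃ x
  ≡₃-refl {x} = origin , vlia 1 (λ x → x := x :+ + 3 :* con 0ℤ) x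

  ≡₃-⊕ : ∀ {x y u v} → x ≡₃ y → u ≡₃ v → x ⊕ u ≡₃ y ⊕ v
  ≡₃-⊕ {x} {y} {u} {v} (d , h) (f , k) = d ⊕ f , vlia 6 (λ x y u v d f → x := y :+ + 3 :* d ⇒ u := v :+ + 3 :* f ⇒ x :+ u := y :+ v :+ + 3 :* (d :+ f)) x y u v d f h k

  module _ {G : Set} (K : Body G) where
    open Body K
    open Rules K

    module Analysis (s : Pt) (A : Fin 3 → Pt) (PA : ∀ i → P (A i)) (cls : ∀ i → A i ≡₂ s ⊕ e i)
                    (A-distinct : ∀ {i j} → i ≢ j → A i ≢ A j) where
      open Points K s A PA cls A-distinct public

      private
        o = A zero
        r₁ = residueₚ 2 (A (suc zero) ⊖ o)
        r₂ = residueₚ 2 (A (suc (suc zero)) ⊖ o)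
        v₁ = pt (proj₁ r₁) (proj₁ (proj₂ r₁)) (proj₁ (proj₂ (proj₂ r₁)))
        v₂ = pt (proj₁ r₂) (proj₁ (proj₂ r₂)) (proj₁ (proj₂ (proj₂ r₂)))
        a = based v₁ v₂

      close : ∀ i → A i ≡₃ o ⊕ a i
      close zero = origin , vlia 1 (λ o → o := o :+ con 0ℤ :+ + 3 :* con 0ℤ) o
      close (suc zero) = d , vlia 4 (λ x o v d → x :- o := v :+ + 3 :* d ⇒ x := o :+ v :+ + 3 :* d) (A (suc zero)) o v₁ d (proj₂ (proj₂ (proj₂ (proj₂ r₁))))
        where d = proj₁ (proj₂ (proj₂ (proj₂ r₁)))
      close (suc (suc zero)) = d , vlia 4 (λ x o v d → x :- o := v :+ + 3 :* d ⇒ x := o :+ v :+ + 3 :* d) (A (suc (suc zero))) o v₂ d (proj₂ (proj₂ (proj₂ (proj₂ r₂))))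
        where d = proj₁ (proj₂ (proj₂ (proj₂ r₂)))

      V-rep : ∀ x → V x ≡₃ o ⊕ rep a x
      V-rep (S i j) = proj₁ (close i) , vlia 5 (λ x o v d f → x := o :+ v :+ + 3 :* d ⇒ x :+ f := o :+ (v :+ f) :+ + 3 :* d)
        (A i) o (a i) (proj₁ (close i)) (e j) (proj₂ (close i))
      -- The witness comes from 4 m = 2 (x + y + f + g): replacing 4 m by m costs 3 m.
      V-rep (M k) = o ⊕ + 2 • (proj₁ (close i) ⊕ proj₁ (close j)) ⊖ mid k ,
        vlia 10 (λ x y o v w c d f g m → x := o :+ v :+ + 3 :* c ⇒ y := o :+ w :+ + 3 :* d ⇒ x :+ y :+ f :+ g := + 2 :* m ⇒
            m := o :+ + 2 :* (v :+ w :+ f :+ g) :+ + 3 :* (o :+ + 2 :* (c :+ d) :- m))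
          (A i) (A j) o (a i) (a j) (proj₁ (close i)) (proj₁ (close j)) (e i) (e j) (mid k)
          (proj₂ (close i)) (proj₂ (close j)) (mid-double k)
        where
        i = next k
        j = next (next k)

      Generic : Set
      Generic = Spread A × (total A ≡₃ 𝟏 ⊎ total A ≡₃ origin)

      private
        sum-close : ∀ i → sum₃ (A i) ≡ sum₃ o + sum₃ (a i) + + 3 * sum₃ (proj₁ (close i))
        sum-close i = shape (A i) o (a i) (proj₁ (close i)) (proj₂ (close i))
          where
          shape : ∀ x o v d → x ≡ o ⊕ v ⊕ + 3 • d → sum₃ x ≡ sum₃ o + sum₃ v + + 3 * sum₃ d
          shape _ (o₀ , o₁ , o₂) (v₀ , v₁ , v₂) (d₀ , d₁ , d₂) refl =
            lia 9 (λ o₀ o₁ o₂ v₀ v₁ v₂ d₀ d₁ d₂ → (o₀ :+ v₀ :+ + 3 :* d₀) :+ (o₁ :+ v₁ :+ + 3 :* d₁) :+ (o₂ :+ v₂ :+ + 3 :* d₂)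
                := (o₀ :+ o₁ :+ o₂) :+ (v₀ :+ v₁ :+ v₂) :+ + 3 :* (d₀ :+ d₁ :+ d₂)) o₀ o₁ o₂ v₀ v₁ v₂ d₀ d₁ d₂

        spread : Spread a → Spread A
        spread f i j (i≢j , d , h) = f i j (i≢j , d + y - x ,
          lia 8 (λ p q o s t x y d → p := o :+ s :+ + 3 :* x ⇒ q := o :+ t :+ + 3 :* y ⇒ p := q :+ + 3 :* d ⇒ s := t :+ + 3 :* (d :+ y :- x))
            (sum₃ (A i)) (sum₃ (A j)) (sum₃ o) (sum₃ (a i)) (sum₃ (a j)) x y d (sum-close i) (sum-close j) h)
          where
          x = sum₃ (proj₁ (close i))
          y = sum₃ (proj₁ (close j))

        total≡ : total A ≡₃ total a
        total≡ = o ⊕ proj₁ (close zero) ⊕ proj₁ (close (suc zero)) ⊕ proj₁ (close (suc (suc zero))) ,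
          vlia 10 (λ x y z o u v w c d f → x := o :+ u :+ + 3 :* c ⇒ y := o :+ v :+ + 3 :* d ⇒ z := o :+ w :+ + 3 :* f ⇒
              x :+ y :+ z := u :+ v :+ w :+ + 3 :* (o :+ c :+ d :+ f))
            (A zero) (A (suc zero)) (A (suc (suc zero))) o (a zero) (a (suc zero)) (a (suc (suc zero)))
            (proj₁ (close zero)) (proj₁ (close (suc zero))) (proj₁ (close (suc (suc zero))))
            (proj₂ (close zero)) (proj₂ (close (suc zero))) (proj₂ (close (suc (suc zero))))

        conclude : Outcome a → SS ⊎ G ⊎ Generic
        conclude (inj₁ (x , y , x≢y , h)) =
          [ (λ q → [ inj₁ , (λ g → inj₂ (inj₁ g)) ]′ (coincide x y x≢y q)) , (λ g → inj₂ (inj₁ g)) ]′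
            (tripled (V x) (V y) (XV x) (XV y) (≡₃-trans {V x} {o ⊕ rep a x} {V y} (V-rep x)
              (≡₃-trans {o ⊕ rep a x} {o ⊕ rep a y} {V y} (≡₃-⊕ {o} {o} {rep a x} {rep a y} (≡₃-refl {o}) h)
                (≡₃-sym {V y} {o ⊕ rep a y} (V-rep y)))))
        conclude (inj₂ (f , inj₁ h)) = inj₂ (inj₂ (spread f , inj₁ (≡₃-trans {total A} {total a} {𝟏} total≡ h)))
        conclude (inj₂ (f , inj₂ h)) = inj₂ (inj₂ (spread f , inj₂ (≡₃-trans {total A} {total a} {origin} total≡ h)))

      classify : SS ⊎ G ⊎ Generic
      classify = conclude (outcome (proj₁ r₁) (proj₁ (proj₂ r₁)) (proj₁ (proj₂ (proj₂ r₁)))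
                                   (proj₁ r₂) (proj₁ (proj₂ r₂)) (proj₁ (proj₂ (proj₂ r₂))))

    data Edges (p q r s : Pt) : Set where
      same : p ≡ r → q ≡ s → Edges p q r s
      opposite : p ≡ s → q ≡ r → Edges p q r s
      corner : ∀ c → (∀ i → P (c ⊕ e i)) → (p ≡ r ⊎ p ≡ s ⊎ q ≡ r ⊎ q ≡ s) → (∃ λ i → q ≡ c ⊕ e i) → Edges p q r s

    module _ where
      private
        -- If the edges at q and s have different base points, e i ⊖ e k, e j ⊖ e k and s ⊖ q span a
        -- box from q ⊕ e k; its two far corners are p ⊕ e j and r ⊕ e i. If q = s, the three
        -- endpoints form a translate of the triangle.
        fork : ∀ i j k → i ≢ j → i ≢ k → j ≢ k → ∀ {p q r s} → P p → P q → P r → P s →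
          p ⊖ q ≡ e i ⊖ e k → r ⊖ s ≡ e j ⊖ e k → (∃ λ c → (∀ l → P (c ⊕ e l)) × q ≡ s × q ≡ c ⊕ e k) ⊎ G
        fork i j k i≢j i≢k j≢k {p} {q} {r} {s} Pp Pq Pr Ps h₁ h₂ = go (q ≟ s)
          where
          P≡ : ∀ {x y} → x ≡ y → P x → P y
          P≡ refl z = z
          go : Dec (q ≡ s) → _
          go (yes q≡s) = inj₁ (q ⊖ e k , member , q≡s , vlia 2 (λ q e → q := q :- e :+ e) q (e k))
            where
            at-i : P (q ⊖ e k ⊕ e i)
            at-i = P≡ (vlia 4 (λ p q e f → p :- q := f :- e ⇒ p := q :- e :+ f) p q (e k) (e i) h₁) Pp
            at-j : P (q ⊖ e k ⊕ e j)
            at-j = P≡ (vlia 5 (λ r q s e f → r :- s := f :- e ⇒ q := s ⇒ r := q :- e :+ f) r q s (e k) (e j) h₂ q≡s) Pr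
            at-k : P (q ⊖ e k ⊕ e k)
            at-k = P≡ (vlia 2 (λ q e → q := q :- e :+ e) q (e k)) Pq
            member : ∀ l → P (q ⊖ e k ⊕ e l)
            member l with l ≟ᶠ i | l ≟ᶠ j | l ≟ᶠ k
            ... | yes refl | _ | _ = at-i
            ... | no _ | yes refl | _ = at-j
            ... | no _ | no _ | yes refl = at-k
            ... | no l≢i | no l≢j | no l≢k = ⊥-elim (four l i j k (l≢i , l≢j , l≢k , i≢j , i≢k , j≢k))
              where
              four : ∀ (l i j k : Fin 3) → ¬ (l ≢ i × l ≢ j × l ≢ k × i ≢ j × i ≢ k × j ≢ k)
              four = from-yes (all? {3} λ l → all? λ i → all? λ j → all? λ k →
                ¬? (¬? (l ≟ᶠ i) ×-dec ¬? (l ≟ᶠ j) ×-dec ¬? (l ≟ᶠ k) ×-dec ¬? (i ≟ᶠ j) ×-dec ¬? (i ≟ᶠ k) ×-dec ¬? (j ≟ᶠ k)))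
          go (no q≢s) = inj₂ (box (q ⊕ e k) (e i ⊖ e k) (e j ⊖ e k) (s ⊖ q) (e-difference i≢k) (e-difference j≢k)
            (λ z → q≢s (vlia 2 (λ q s → s :- q := con 0ℤ ⇒ q := s) q s z))
            (translate Pq k)
            (X≡ (vlia 3 (λ q k i → q :+ i := q :+ k :+ (i :- k)) q (e k) (e i)) (translate Pq i))
            (X≡ (vlia 3 (λ q k j → q :+ j := q :+ k :+ (j :- k)) q (e k) (e j)) (translate Pq j))
            (X≡ (vlia 3 (λ q k s → s :+ k := q :+ k :+ (s :- q)) q (e k) s) (translate Ps k))
            (X≡ (vlia 5 (λ p q i j k → p :- q := i :- k ⇒ p :+ j := q :+ k :+ (i :- k) :+ (j :- k)) p q (e i) (e j) (e k) h₁) (translate Pp j))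
            (X≡ (vlia 4 (λ q s i k → s :+ i := q :+ k :+ (i :- k) :+ (s :- q)) q s (e i) (e k)) (translate Ps i))
            (X≡ (vlia 4 (λ q s j k → s :+ j := q :+ k :+ (j :- k) :+ (s :- q)) q s (e j) (e k)) (translate Ps j))
            (X≡ (vlia 6 (λ q r s i j k → r :- s := j :- k ⇒ r :+ i := q :+ k :+ (i :- k) :+ (j :- k) :+ (s :- q)) q r s (e i) (e j) (e k) h₂) (translate Pr i)))

        flip : ∀ p q i j → p ⊖ q ≡ e i ⊖ e j → q ⊖ p ≡ e j ⊖ e i
        flip p q i j h = vlia 4 (λ p q i j → p :- q := i :- j ⇒ q :- p := j :- i) p q (e i) (e j) h

        parallel : ∀ i j {p q r s} → i ≢ j → P p → P q → P r → P s → p ⊖ q ≡ e i ⊖ e j → r ⊖ s ≡ e i ⊖ e j → (p ≡ r × q ≡ s) ⊎ G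
        parallel i j {p} {q} {r} {s} i≢j Pp Pq Pr Ps h₁ h₂ = go (p ≟ r)
          where
          go : Dec (p ≡ r) → _
          go (yes p≡r) = inj₁ (p≡r , vlia 6 (λ p q r s i j → p :- q := i :- j ⇒ r :- s := i :- j ⇒ p := r ⇒ q := s) p q r s (e i) (e j) h₁ h₂ p≡r)
          go (no p≢r) = inj₂ (parallelogram p q r s Pp Pq Pr Ps (trans h₁ (sym h₂))
            (λ z → e-difference i≢j (vlia 4 (λ p q i j → p :- q := i :- j ⇒ p := q ⇒ i :- j := con 0ℤ) p q (e i) (e j) h₁ z)) p≢r)

      -- Two parallel edges that differ form a parallelogram. Two edges in different directions,
      -- suitably oriented, point away from a common vertex direction, which is the situation of
      -- `fork`.
      edges : ∀ {p q r s} → P p → P q → P r → P s → Step p q → Step r s → Edges p q r s ⊎ G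
      edges {p} {q} {r} {s} Pp Pq Pr Ps (i , j , i≢j , h) (k , l , k≢l , g) = go (i ≟ᶠ k) (j ≟ᶠ l) (i ≟ᶠ l) (j ≟ᶠ k)
        where
        go : Dec (i ≡ k) → Dec (j ≡ l) → Dec (i ≡ l) → Dec (j ≡ k) → Edges p q r s ⊎ G
        go (yes refl) (yes refl) _ _ = [ (λ (a , b) → inj₁ (same a b)) , inj₂ ]′ (parallel i j i≢j Pp Pq Pr Ps h g)
        go _ _ (yes refl) (yes refl) = [ (λ (a , b) → inj₁ (opposite a b)) , inj₂ ]′ (parallel i j i≢j Pp Pq Ps Pr h (flip r s k l g))
        go (yes refl) (no j≢l) _ _ = [ (λ (c , m , a , b) → inj₁ (corner c m (inj₁ a) (j , at-q c m a b))) , inj₂ ]′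
            (fork j l i j≢l (≢-sym i≢j) (≢-sym k≢l) Pq Pp Ps Pr (flip p q i j h) (flip r s k l g))
          where
          at-q : ∀ c → (∀ l → P (c ⊕ e l)) → p ≡ r → p ≡ c ⊕ e i → q ≡ c ⊕ e j
          at-q c _ _ b = vlia 5 (λ p q c i j → p :- q := i :- j ⇒ p := c :+ i ⇒ q := c :+ j) p q c (e i) (e j) h b
        go (no i≢k) (yes refl) _ _ = [ (λ (c , m , a , b) → inj₁ (corner c m (inj₂ (inj₂ (inj₂ a))) (j , b))) , inj₂ ]′
            (fork i k j i≢k i≢j k≢l Pp Pq Pr Ps h g)
        go _ _ (yes refl) (no j≢k) = [ (λ (c , m , a , b) → inj₁ (corner c m (inj₂ (inj₁ a)) (j , at-q c b))) , inj₂ ]′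
            (fork j k i j≢k (≢-sym i≢j) k≢l Pq Pp Pr Ps (flip p q i j h) g)
          where
          at-q : ∀ c → p ≡ c ⊕ e i → q ≡ c ⊕ e j
          at-q c b = vlia 5 (λ p q c i j → p :- q := i :- j ⇒ p := c :+ i ⇒ q := c :+ j) p q c (e i) (e j) h b
        go _ _ (no i≢l) (yes refl) = [ (λ (c , m , a , b) → inj₁ (corner c m (inj₂ (inj₂ (inj₁ a))) (j , b))) , inj₂ ]′
            (fork i l j i≢l i≢j (≢-sym k≢l) Pp Pq Ps Pr h (flip r s k l g))
        go (no i≢k) (no j≢l) (no i≢l) (no j≢k) = ⊥-elim (four i j k l (i≢j , k≢l , i≢k , j≢l , i≢l , j≢k))
          where
          four : ∀ (i j k l : Fin 3) → ¬ (i ≢ j × k ≢ l × i ≢ k × j ≢ l × i ≢ l × j ≢ k)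
          four = from-yes (all? {3} λ i → all? λ j → all? λ k → all? λ l →
            ¬? (¬? (i ≟ᶠ j) ×-dec ¬? (k ≟ᶠ l) ×-dec ¬? (i ≟ᶠ k) ×-dec ¬? (j ≟ᶠ l) ×-dec ¬? (i ≟ᶠ l) ×-dec ¬? (j ≟ᶠ k)))

-- Translates of the triangle modulo 3

module Packing where

  open import Data.Fin.Properties using (all?; any?) renaming (_≟_ to _≟ᶠ_)
  open import Data.Integer using (_+_; _*_; -_; _-_)
  open import Relation.Nullary.Decidable using (_×-dec_; _⊎-dec_; from-yes; from-no; ¬?)
  open LinearArithmetic
  open Cones using (_•_; triple)
  open Bodies
  open Congruences
  open Midpoints
  open MidpointTable
  open Trios

  sum₃-⊕ : ∀ x y → sum₃ (x ⊕ y) ≡ sum₃ x + sum₃ y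
  sum₃-⊕ (a , b , c) (d , f , g) = lia 6 (λ a b c d f g → (a :+ d) :+ (b :+ f) :+ (c :+ g) := (a :+ b :+ c) :+ (d :+ f :+ g)) a b c d f g

  sum₃-• : ∀ k x → sum₃ (k • x) ≡ k * sum₃ x
  sum₃-• k (a , b , c) = sym (trans (ℤ.*-distribˡ-+ k (a + b) c) (cong (_+ k * c) (ℤ.*-distribˡ-+ k a b)))

  level : ∀ {x y} m → (∃ λ d → x ≡ y ⊕ + m • d) → sum₃ x ≡ sum₃ y mod m
  level {x} {y} m (d , h) = sum₃ d , trans (cong sum₃ h) (trans (sum₃-⊕ y (+ m • d)) (cong (_+_ (sum₃ y)) (sum₃-• (+ m) d)))

  odd : ∀ x d → x ≢ x + 1ℤ + + 2 * d
  odd x d h = from-no (mod? 2 1ℤ 0ℤ) (- d ,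
    lia 3 (λ x d n → x := x :+ con 1ℤ :+ + 2 :* d ⇒ n := con 0ℤ :- d ⇒ con 1ℤ := con 0ℤ :+ + 2 :* n) x d (- d) h (sym (ℤ.+-identityˡ (- d))))

  e-odd : ∀ i j → ¬ (i ≢ j × e i ⊖ e j ≡₂ origin)
  e-odd = from-yes (all? {3} λ i → all? λ j → ¬? (¬? (i ≟ᶠ j) ×-dec (e i ⊖ e j ≡₂? origin)))

  distinct-classes : ∀ {s} {A : Fin 3 → Pt} → (∀ i → A i ≡₂ s ⊕ e i) → ∀ {i j} → i ≢ j → A i ≢ A j
  distinct-classes {s} {A} cls {i} {j} i≢j h = e-odd i j (i≢j , proj₁ (cls j) ⊖ proj₁ (cls i) ,
    vlia 7 (λ a b s e f c d → a := s :+ e :+ + 2 :* c ⇒ b := s :+ f :+ + 2 :* d ⇒ a := b ⇒ e :- f := con 0ℤ :+ + 2 :* (d :- c))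
      (A i) (A j) s (e i) (e j) (proj₁ (cls i)) (proj₁ (cls j)) (proj₂ (cls i)) (proj₂ (cls j)) h)

  covered : ∀ r₀ r₁ r₂ t → r₀ ≡ r₁ ⊎ r₀ ≡ r₂ ⊎ r₁ ≡ r₂ ⊎ t ≡ r₀ ⊎ t ≡ r₁ ⊎ t ≡ r₂
  covered = from-yes (all? {3} λ r₀ → all? {3} λ r₁ → all? {3} λ r₂ → all? {3} λ t →
    (r₀ ≟ᶠ r₁) ⊎-dec (r₀ ≟ᶠ r₂) ⊎-dec (r₁ ≟ᶠ r₂) ⊎-dec (t ≟ᶠ r₀) ⊎-dec (t ≟ᶠ r₁) ⊎-dec (t ≟ᶠ r₂))

  mod-via : ∀ {x y} {r r′ : Fin 3} → x ≡ + toℕ r mod 3 → y ≡ + toℕ r′ mod 3 → r ≡ r′ → x ≡ y mod 3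
  mod-via {x} {y} {r} (d , h) (f , k) refl = d - f ,
    lia 5 (λ x y r d f → x := r :+ + 3 :* d ⇒ y := r :+ + 3 :* f ⇒ x := y :+ + 3 :* (d :- f)) x y (+ toℕ r) d f h k

  cover′ : ∀ {a} → Spread a → ∀ n → ∃ λ k → n ≡ sum₃ (a k) mod 3
  cover′ {a} f n = go (covered (proj₁ (r zero)) (proj₁ (r (suc zero))) (proj₁ (r (suc (suc zero)))) (proj₁ t))
    where
    r = λ k → residue 2 (sum₃ (a k))
    t = residue 2 n
    go : _ → ∃ λ k → n ≡ sum₃ (a k) mod 3
    go (inj₁ h) = ⊥-elim (f zero (suc zero) ((λ ()) , mod-via (proj₂ (r zero)) (proj₂ (r (suc zero))) h))
    go (inj₂ (inj₁ h)) = ⊥-elim (f zero (suc (suc zero)) ((λ ()) , mod-via (proj₂ (r zero)) (proj₂ (r (suc (suc zero)))) h))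
    go (inj₂ (inj₂ (inj₁ h))) = ⊥-elim (f (suc zero) (suc (suc zero)) ((λ ()) , mod-via (proj₂ (r (suc zero))) (proj₂ (r (suc (suc zero)))) h))
    go (inj₂ (inj₂ (inj₂ (inj₁ h)))) = zero , mod-via (proj₂ t) (proj₂ (r zero)) h
    go (inj₂ (inj₂ (inj₂ (inj₂ (inj₁ h))))) = suc zero , mod-via (proj₂ t) (proj₂ (r (suc zero))) h
    go (inj₂ (inj₂ (inj₂ (inj₂ (inj₂ h))))) = suc (suc zero) , mod-via (proj₂ t) (proj₂ (r (suc (suc zero)))) h

  abstract
    cover : ∀ {a} → Spread a → ∀ n → ∃ λ k → n ≡ sum₃ (a k) mod 3
    cover {a} f n = cover′ {a} f n

  Touching : Pt → Set
  Touching c = ∃ λ x → ∃ λ y → c ⊕ e x ≡₃ e y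

  touching? : ∀ c → Dec (Touching c)
  touching? c = any? λ x → any? λ y → c ⊕ e x ≡₃? e y

  -- Nine residues have level 0 modulo 3: the seven differences of two vertices of the triangle,
  -- counting 0 once, and plus or minus (1,1,1).
  packing-table : ∀ a b c → (sum₃ (pt {3} a b c) ≡ 0ℤ mod 3 → ⊥) ⊎ Touching (pt {3} a b c) ⊎ pt {3} a b c ≡₃ 𝟏 ⊎ pt {3} a b c ≡₃ origin ⊖ 𝟏
  packing-table = from-yes (all? λ a → all? λ b → all? λ c →
    ¬? (mod? 3 (sum₃ (pt {3} a b c)) 0ℤ) ⊎-dec touching? (pt a b c) ⊎-dec (pt a b c ≡₃? 𝟏) ⊎-dec (pt a b c ≡₃? origin ⊖ 𝟏))

  -- If neither residue touched, both would be plus or minus (1,1,1), and the edge would be 0 or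
  -- plus or minus (1,1,1) modulo 3.
  edge-table : ∀ a b c i j → (sum₃ (pt {3} a b c) ≡ 0ℤ mod 3 → ⊥) ⊎ i ≡ j ⊎ Touching (pt {3} a b c) ⊎ Touching (pt {3} a b c ⊖ (e i ⊖ e j))
  edge-table = from-yes (all? λ a → all? λ b → all? λ c → all? λ i → all? λ j →
    ¬? (mod? 3 (sum₃ (pt {3} a b c)) 0ℤ) ⊎-dec (i ≟ᶠ j) ⊎-dec touching? (pt a b c) ⊎-dec touching? (pt a b c ⊖ (e i ⊖ e j)))

  sum₃-⊖ : ∀ x y → sum₃ (x ⊖ y) ≡ sum₃ x - sum₃ y
  sum₃-⊖ (a , b , c) (d , f , g) = lia 6 (λ a b c d f g → (a :- d) :+ (b :- f) :+ (c :- g) := (a :+ b :+ c) :- (d :+ f :+ g)) a b c d f g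

  Touch : Pt → Pt → Set
  Touch x y = ∃ λ i → ∃ λ j → x ⊕ e i ≡₃ y ⊕ e j

  module Difference (x y : Pt) where
    private
      r = residueₚ 2 (x ⊖ y)
      q = proj₁ (proj₂ (proj₂ (proj₂ r)))
      h = proj₂ (proj₂ (proj₂ (proj₂ r)))
    a b c : Fin 3
    a = proj₁ r
    b = proj₁ (proj₂ r)
    c = proj₁ (proj₂ (proj₂ r))
    v : Pt
    v = pt a b c

    flat : sum₃ x ≡ sum₃ y mod 3 → sum₃ v ≡ 0ℤ mod 3
    flat (d , k) = d - sum₃ q , lia 5 (λ x y v q d → x :- y := v :+ + 3 :* q ⇒ x := y :+ + 3 :* d ⇒ v := con 0ℤ :+ + 3 :* (d :- q))
      (sum₃ x) (sum₃ y) (sum₃ v) (sum₃ q) d (trans (sym (sum₃-⊖ x y)) (proj₂ (level {x ⊖ y} {v} 3 (q , h)))) k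

    touch : ∀ w z → z ≡ x ⊖ w → Touching (v ⊖ w) → Touch z y
    touch w z z≡ (i , j , d , k) = i , j , q ⊕ d ,
      vlia 9 (λ x y v q w z f g d → x :- y := v :+ + 3 :* q ⇒ z := x :- w ⇒ v :- w :+ f := g :+ + 3 :* d ⇒ z :+ f := y :+ g :+ + 3 :* (q :+ d))
        x y v q w z (e i) (e j) d h z≡ k

    touch₀ : Touching v → Touch x y
    touch₀ (i , j , d , k) = i , j , q ⊕ d ,
      vlia 7 (λ x y v q f g d → x :- y := v :+ + 3 :* q ⇒ v :+ f := g :+ + 3 :* d ⇒ x :+ f := y :+ g :+ + 3 :* (q :+ d))
        x y v q (e i) (e j) d h k

    up : v ≡₃ 𝟏 → x ≡₃ y ⊕ 𝟏
    up (d , k) = q ⊕ d , vlia 6 (λ x y v q o d → x :- y := v :+ + 3 :* q ⇒ v := o :+ + 3 :* d ⇒ x := y :+ o :+ + 3 :* (q :+ d)) x y v q 𝟏 d h k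

    down : v ≡₃ origin ⊖ 𝟏 → y ≡₃ x ⊕ 𝟏
    down (d , k) = origin ⊖ (q ⊕ d) , vlia 6 (λ x y v q o d → x :- y := v :+ + 3 :* q ⇒ v := (con 0ℤ :- o) :+ + 3 :* d ⇒ y := x :+ o :+ + 3 :* (con 0ℤ :- (q :+ d))) x y v q 𝟏 d h k

  packing′ : ∀ x y → sum₃ x ≡ sum₃ y mod 3 → Touch x y ⊎ x ≡₃ y ⊕ 𝟏 ⊎ y ≡₃ x ⊕ 𝟏
  packing′ x y h = go (packing-table a b c)
    where
    open Difference x y
    go : _ → Touch x y ⊎ x ≡₃ y ⊕ 𝟏 ⊎ y ≡₃ x ⊕ 𝟏
    go (inj₁ k) = ⊥-elim (k (flat h))
    go (inj₂ (inj₁ k)) = inj₁ (touch₀ k)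
    go (inj₂ (inj₂ (inj₁ k))) = inj₂ (inj₁ (up k))
    go (inj₂ (inj₂ (inj₂ k))) = inj₂ (inj₂ (down k))

  abstract
    packing : ∀ x y → sum₃ x ≡ sum₃ y mod 3 → Touch x y ⊎ x ≡₃ y ⊕ 𝟏 ⊎ y ≡₃ x ⊕ 𝟏
    packing x y h = packing′ x y h

  edge-packing′ : ∀ x x′ y → sum₃ x ≡ sum₃ y mod 3 → Step x x′ → Touch x y ⊎ Touch x′ y
  edge-packing′ x x′ y h (i , j , i≢j , k) = go (edge-table a b c i j)
    where
    open Difference x y
    go : _ → Touch x y ⊎ Touch x′ y
    go (inj₁ l) = ⊥-elim (l (flat h))
    go (inj₂ (inj₁ l)) = ⊥-elim (i≢j l)
    go (inj₂ (inj₂ (inj₁ l))) = inj₁ (touch₀ l)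
    go (inj₂ (inj₂ (inj₂ l))) = inj₂ (touch (e i ⊖ e j) x′ (vlia 4 (λ x x′ i j → x :- x′ := i :- j ⇒ x′ := x :- (i :- j)) x x′ (e i) (e j) k) l)

  abstract
    edge-packing : ∀ x x′ y → sum₃ x ≡ sum₃ y mod 3 → Step x x′ → Touch x y ⊎ Touch x′ y
    edge-packing x x′ y h k = edge-packing′ x x′ y h k

  surjective-table : ∀ a b c → a ≡ b ⊎ a ≡ c ⊎ b ≡ c ⊎ (∀ (j : Fin 3) → a ≡ j ⊎ b ≡ j ⊎ c ≡ j)
  surjective-table = from-yes (all? {3} λ a → all? λ b → all? λ c →
    (a ≟ᶠ b) ⊎-dec (a ≟ᶠ c) ⊎-dec (b ≟ᶠ c) ⊎-dec all? λ j → (a ≟ᶠ j) ⊎-dec (b ≟ᶠ j) ⊎-dec (c ≟ᶠ j))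

  abstract
    injective⇒surjective : ∀ a b c → a ≡ b ⊎ a ≡ c ⊎ b ≡ c ⊎ (∀ (j : Fin 3) → a ≡ j ⊎ b ≡ j ⊎ c ≡ j)
    injective⇒surjective = surjective-table

  total-permuted : ∀ (B : Fin 3 → Pt) a b c → a ≢ b → a ≢ c → b ≢ c → B a ⊕ B b ⊕ B c ≡ total B
  total-permuted B zero zero c h _ _ = ⊥-elim (h refl)
  total-permuted B zero (suc zero) zero _ h _ = ⊥-elim (h refl)
  total-permuted B zero (suc zero) (suc zero) _ _ h = ⊥-elim (h refl)
  total-permuted B zero (suc zero) (suc (suc zero)) _ _ _ = refl
  total-permuted B zero (suc (suc zero)) zero _ h _ = ⊥-elim (h refl)
  total-permuted B zero (suc (suc zero)) (suc zero) _ _ _ = vlia 3 (λ x y z → x :+ z :+ y := x :+ y :+ z) (B zero) (B (suc zero)) (B (suc (suc zero)))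
  total-permuted B zero (suc (suc zero)) (suc (suc zero)) _ _ h = ⊥-elim (h refl)
  total-permuted B (suc zero) zero zero _ _ h = ⊥-elim (h refl)
  total-permuted B (suc zero) zero (suc zero) _ h _ = ⊥-elim (h refl)
  total-permuted B (suc zero) zero (suc (suc zero)) _ _ _ = vlia 3 (λ x y z → y :+ x :+ z := x :+ y :+ z) (B zero) (B (suc zero)) (B (suc (suc zero)))
  total-permuted B (suc zero) (suc zero) c h _ _ = ⊥-elim (h refl)
  total-permuted B (suc zero) (suc (suc zero)) zero _ _ _ = vlia 3 (λ x y z → y :+ z :+ x := x :+ y :+ z) (B zero) (B (suc zero)) (B (suc (suc zero)))
  total-permuted B (suc zero) (suc (suc zero)) (suc zero) _ h _ = ⊥-elim (h refl)
  total-permuted B (suc zero) (suc (suc zero)) (suc (suc zero)) _ _ h = ⊥-elim (h refl)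
  total-permuted B (suc (suc zero)) zero zero _ _ h = ⊥-elim (h refl)
  total-permuted B (suc (suc zero)) zero (suc zero) _ _ _ = vlia 3 (λ x y z → z :+ x :+ y := x :+ y :+ z) (B zero) (B (suc zero)) (B (suc (suc zero)))
  total-permuted B (suc (suc zero)) zero (suc (suc zero)) _ h _ = ⊥-elim (h refl)
  total-permuted B (suc (suc zero)) (suc zero) zero _ _ _ = vlia 3 (λ x y z → z :+ y :+ x := x :+ y :+ z) (B zero) (B (suc zero)) (B (suc (suc zero)))
  total-permuted B (suc (suc zero)) (suc zero) (suc zero) _ _ h = ⊥-elim (h refl)
  total-permuted B (suc (suc zero)) (suc zero) (suc (suc zero)) _ h _ = ⊥-elim (h refl)
  total-permuted B (suc (suc zero)) (suc (suc zero)) c h _ _ = ⊥-elim (h refl)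

  e-cyclic : ∀ l → e l ⊕ e (next l) ⊕ e (next (next l)) ≡ 𝟏
  e-cyclic zero = refl
  e-cyclic (suc zero) = refl
  e-cyclic (suc (suc zero)) = refl

  total-cyclic : ∀ (B : Fin 3 → Pt) l → B l ⊕ B (next l) ⊕ B (next (next l)) ≡ total B
  total-cyclic B l = total-permuted B l (next l) (next (next l)) (≢-sym (next≢ l)) (≢-sym (next²≢ l)) (≢-sym (next≢ (next l)))

-- Three classes at the levels of each parity

module PlanePairs where

  open import Data.Bool using (T)
  open import Data.Integer using (_+_; _*_; -_; _-_)
  open import Relation.Nullary.Decidable using (from-no)
  open LinearArithmetic
  open Cones using (_•_; triple)
  open Bodies
  open Congruences
  open Midpoints
  open MidpointTable
  open Trios
  open Packing

  module _ {G : Set} (K : Body G) where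
    open Body K
    open Rules K

    centroid : ∀ {p q r} g → P p → P q → P r → p ⊕ q ⊕ r ≡ + 3 • g → P g
    centroid g Pp Pq Pr h = hull-÷ 2 (subst (hull (+ 3)) h (hull-+ (hull-+ (point Pp) (point Pq)) (point Pr)))

    record Trio (s : Pt) : Set where
      field
        A : Fin 3 → Pt
        PA : ∀ i → P (A i)
        cls : ∀ i → A i ≡₂ s ⊕ e i

      open Analysis K s A PA cls (distinct-classes {s} {A} cls) public

      A-level : ∀ i → ∃ λ d → sum₃ (A i) ≡ sum₃ s + 1ℤ + + 2 * d
      A-level i = proj₁ l , trans (proj₂ l) (cong (_+ + 2 * proj₁ l) (trans (sum₃-⊕ s (e i)) (cong (_+_ (sum₃ s)) (sum₃-e i))))
        where l = level {A i} {s ⊕ e i} 2 (cls i)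

      -- The centroid g is a lattice point of P. Modulo 2 it equals 3 g, the sum of the three
      -- classes, which is the class that the trio leaves out.
      centre : total A ≡₃ origin → ∃ λ g → P g × total A ≡ + 3 • g × g ≡₂ s ⊕ 𝟏
      centre (g , h) = g , centroid g (PA zero) (PA (suc zero)) (PA (suc (suc zero))) h′ , h′ ,
        s ⊕ d₀ ⊕ d₁ ⊕ d₂ ⊖ g ,
        vlia 12 (λ x y z s a b c o d f k g → x := s :+ a :+ + 2 :* d ⇒ y := s :+ b :+ + 2 :* f ⇒ z := s :+ c :+ + 2 :* k ⇒
            x :+ y :+ z := + 3 :* g ⇒ a :+ b :+ c := o ⇒ g := s :+ o :+ + 2 :* (s :+ d :+ f :+ k :- g))
          (A zero) (A (suc zero)) (A (suc (suc zero))) s e₀ e₁ e₂ 𝟏 d₀ d₁ d₂ g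
          (proj₂ (cls zero)) (proj₂ (cls (suc zero))) (proj₂ (cls (suc (suc zero)))) h′ refl
        where
        d₀ = proj₁ (cls zero)
        d₁ = proj₁ (cls (suc zero))
        d₂ = proj₁ (cls (suc (suc zero)))
        h′ : total A ≡ + 3 • g
        h′ = trans h (vlia 1 (λ g → con 0ℤ :+ + 3 :* g := + 3 :* g) g)

    module TwoPlanes {s s′ : Pt} (planes : ∃ λ d → sum₃ s′ ≡ sum₃ s + 1ℤ + + 2 * d)
                     (T : Trio s) (U : Trio s′)
                     (absent : ∀ p → P p → ¬ p ≡₂ s ⊕ 𝟏) (absent′ : ∀ p → P p → ¬ p ≡₂ s′ ⊕ 𝟏) where
      module T = Trio T
      module U = Trio U

      levels : ∀ i j → sum₃ (T.A i) ≢ sum₃ (U.A j)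
      levels i j h = odd (sum₃ (T.A i)) (proj₁ planes + proj₁ (U.A-level j) - proj₁ (T.A-level i))
        (lia 7 (λ a b s t d f g → a := s :+ con 1ℤ :+ + 2 :* d ⇒ b := t :+ con 1ℤ :+ + 2 :* f ⇒ t := s :+ con 1ℤ :+ + 2 :* g ⇒
            a := b ⇒ a := a :+ con 1ℤ :+ + 2 :* (g :+ f :- d))
          (sum₃ (T.A i)) (sum₃ (U.A j)) (sum₃ s) (sum₃ s′) (proj₁ (T.A-level i)) (proj₁ (U.A-level j)) (proj₁ planes)
          (proj₂ (T.A-level i)) (proj₂ (U.A-level j)) (proj₂ planes) h)

      -- The two congruent sums lie at levels of different parity and therefore cannot coincide.
      touching : ∀ i j → Touch (T.A i) (U.A j) → G
      touching i j (x , y , h) = [ (λ q → ⊥-elim (levels i j (+-cancel q))) , (λ g → g) ]′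
        (tripled (T.A i ⊕ e x) (U.A j ⊕ e y) (translate (T.PA i) x) (translate (U.PA j) y) h)
        where
        +-cancel : T.A i ⊕ e x ≡ U.A j ⊕ e y → sum₃ (T.A i) ≡ sum₃ (U.A j)
        +-cancel q = lia 4 (λ a b e f → a :+ e := b :+ f ⇒ e := con 1ℤ ⇒ f := con 1ℤ ⇒ a := b) (sum₃ (T.A i)) (sum₃ (U.A j)) (sum₃ (e x)) (sum₃ (e y))
          (trans (sym (sum₃-⊕ (T.A i) (e x))) (trans (cong sum₃ q) (sum₃-⊕ (U.A j) (e y)))) (sum₃-e x) (sum₃-e y)

      touch-sym : ∀ {x y} → Touch x y → Touch y x
      touch-sym {x} {y} (i , j , h) = j , i , ≡₃-sym {x ⊕ e i} {y ⊕ e j} h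

      -- Two edges that do not give `G` share a vertex, which the parities of the levels forbid.
      both-steps : T.SS → U.SS → G
      both-steps (i , j , _ , h) (k , l , _ , g) = [ impossible , (λ g → g) ]′ (edges K (T.PA i) (T.PA j) (U.PA k) (U.PA l) h g)
        where
        impossible : Edges K (T.A i) (T.A j) (U.A k) (U.A l) → G
        impossible (same p _) = ⊥-elim (levels i k (cong sum₃ p))
        impossible (opposite p _) = ⊥-elim (levels i l (cong sum₃ p))
        impossible (corner _ _ (inj₁ p) _) = ⊥-elim (levels i k (cong sum₃ p))
        impossible (corner _ _ (inj₂ (inj₁ p)) _) = ⊥-elim (levels i l (cong sum₃ p))
        impossible (corner _ _ (inj₂ (inj₂ (inj₁ p))) _) = ⊥-elim (levels j k (cong sum₃ p))
        impossible (corner _ _ (inj₂ (inj₂ (inj₂ p))) _) = ⊥-elim (levels j l (cong sum₃ p))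

      -- Some point of U has the level of the edge modulo 3, and then it touches one end of the
      -- edge.
      step-left : T.SS → Spread U.A → G
      step-left (i , j , _ , h) f = [ touching i k , touching j k ]′ (edge-packing (T.A i) (T.A j) (U.A k) c h)
        where
        k = proj₁ (cover {U.A} f (sum₃ (T.A i)))
        c = proj₂ (cover {U.A} f (sum₃ (T.A i)))

      step-right : U.SS → Spread T.A → G
      step-right (i , j , _ , h) f =
        [ (λ t → touching k i (touch-sym {U.A i} {T.A k} t)) , (λ t → touching k j (touch-sym {U.A j} {T.A k} t)) ]′
          (edge-packing (U.A i) (U.A j) (T.A k) c h)
        where
        k = proj₁ (cover {T.A} f (sum₃ (U.A i)))
        c = proj₂ (cover {T.A} f (sum₃ (U.A i)))

    -- If every Aₗ + 𝟏 is congruent modulo 3 to some B, then each midpoint of a pair of the trio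
    -- A + e coincides with some B + e; the resulting equations contradict the parities of the levels.
    module Shifted {s s′ : Pt} (planes : ∃ λ d → sum₃ s′ ≡ sum₃ s + 1ℤ + + 2 * d) (T : Trio s) (U : Trio s′)
                   (centred : total (Trio.A T) ≡₃ 𝟏)
                   (partner : ∀ l → ∃ λ j → Trio.A U j ≡₃ Trio.A T l ⊕ 𝟏) where
      module T = Trio T
      module U = Trio U

      target : Fin 3 → Pt
      target l = U.A (proj₁ (partner l)) ⊕ e l

      -- Modulo 3, twice the midpoint is 2 • 𝟏 ⊖ A l ⊖ e l, because both totals are 𝟏; doubling
      -- again gives A l ⊕ 𝟏 ⊕ e l.
      near : ∀ l → T.mid l ≡₃ target l
      near l = T.mid l ⊖ target l ⊕ T.A l ⊕ e l ⊖ q ⊕ + 2 • d ,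
        vlia 12 (λ a b c e f g t o q u d m → a :+ b :+ c := t ⇒ t := o :+ + 3 :* q ⇒ e :+ f :+ g := o ⇒ u := a :+ o :+ + 3 :* d ⇒
            b :+ c :+ f :+ g := + 2 :* m ⇒ m := u :+ e :+ + 3 :* (m :- (u :+ e) :+ a :+ e :- q :+ + 2 :* d))
          (T.A l) (T.A (next l)) (T.A (next (next l))) (e l) (e (next l)) (e (next (next l))) (total T.A) 𝟏 q
          (U.A (proj₁ (partner l))) d (T.mid l)
          (total-cyclic T.A l) (proj₂ centred) (e-cyclic l) (proj₂ (proj₂ (partner l))) (T.mid-double l)
        where
        q = proj₁ centred
        d = proj₁ (proj₂ (partner l))

      exact : ∀ l → T.mid l ≡ target l ⊎ G
      exact l = tripled (T.mid l) (target l) (T.XV (M l)) (translate (U.PA (proj₁ (partner l))) l) (near l)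

      contradiction : T.mid zero ≡ target zero → T.mid (suc zero) ≡ target (suc zero) → T.mid (suc (suc zero)) ≡ target (suc (suc zero)) → ⊥
      contradiction h₀ h₁ h₂ = odd (sum₃ a) (g + f₁ + f₂ - f₀ - d)
        (lia 12 (λ a b c d₀ s t g f₀ f₁ f₂ d x → a := b :+ c :- d₀ ⇒ a := s :+ con 1ℤ :+ + 2 :* d ⇒ t := s :+ con 1ℤ :+ + 2 :* g ⇒
            d₀ := t :+ con 1ℤ :+ + 2 :* f₀ ⇒ b := t :+ con 1ℤ :+ + 2 :* f₁ ⇒ c := t :+ con 1ℤ :+ + 2 :* f₂ ⇒
            a := a :+ con 1ℤ :+ + 2 :* (g :+ f₁ :+ f₂ :- f₀ :- d))
          (sum₃ a) (sum₃ (u (suc zero))) (sum₃ (u (suc (suc zero)))) (sum₃ (u zero)) (sum₃ s) (sum₃ s′) g f₀ f₁ f₂ d 0ℤ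
          sums (proj₂ (T.A-level zero)) (proj₂ planes)
          (proj₂ (U.A-level (proj₁ (partner zero)))) (proj₂ (U.A-level (proj₁ (partner (suc zero))))) (proj₂ (U.A-level (proj₁ (partner (suc (suc zero)))))))
        where
        a = T.A zero
        u = λ l → U.A (proj₁ (partner l))
        g = proj₁ planes
        d = proj₁ (T.A-level zero)
        f₀ = proj₁ (U.A-level (proj₁ (partner zero)))
        f₁ = proj₁ (U.A-level (proj₁ (partner (suc zero))))
        f₂ = proj₁ (U.A-level (proj₁ (partner (suc (suc zero)))))
        -- The vertex A zero ⊕ e₀ of a triangle is recovered from the midpoints of its sides: the
        -- two adjacent ones minus the opposite one.
        relation : a ⊕ + 2 • e₀ ≡ u (suc zero) ⊕ e₁ ⊕ u (suc (suc zero)) ⊕ e₂ ⊖ u zero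
        relation = vlia 12 (λ a b c e f g m₀ m₁ m₂ u v w → b :+ c :+ f :+ g := + 2 :* m₀ ⇒ c :+ a :+ g :+ e := + 2 :* m₁ ⇒ a :+ b :+ e :+ f := + 2 :* m₂ ⇒
            m₀ := u :+ e ⇒ m₁ := v :+ f ⇒ m₂ := w :+ g ⇒ a :+ + 2 :* e := v :+ f :+ w :+ g :- u)
          a (T.A (suc zero)) (T.A (suc (suc zero))) e₀ e₁ e₂ (T.mid zero) (T.mid (suc zero)) (T.mid (suc (suc zero)))
          (u zero) (u (suc zero)) (u (suc (suc zero)))
          (T.mid-double zero) (T.mid-double (suc zero)) (T.mid-double (suc (suc zero))) h₀ h₁ h₂
        sums : sum₃ a ≡ sum₃ (u (suc zero)) + sum₃ (u (suc (suc zero))) - sum₃ (u zero)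
        sums = lia 5 (λ a b c d z → a :+ con (+ 2) := b :+ con 1ℤ :+ c :+ con 1ℤ :- d ⇒ a := b :+ c :- d) (sum₃ a) (sum₃ (u (suc zero))) (sum₃ (u (suc (suc zero)))) (sum₃ (u zero)) 0ℤ
          (trans (sym (sum₃-⊕ a (+ 2 • e₀))) (trans (cong sum₃ relation) (trans (sum₃-⊖ (u (suc zero) ⊕ e₁ ⊕ u (suc (suc zero)) ⊕ e₂) (u zero))
            (cong (_- sum₃ (u zero)) (trans (sum₃-⊕ (u (suc zero) ⊕ e₁ ⊕ u (suc (suc zero))) e₂) (cong (_+ 1ℤ)
              (trans (sum₃-⊕ (u (suc zero) ⊕ e₁) (u (suc (suc zero)))) (cong (_+ sum₃ (u (suc (suc zero)))) (sum₃-⊕ (u (suc zero)) e₁)))))))))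

      goal : G
      goal = [ (λ h₀ → [ (λ h₁ → [ (λ h₂ → ⊥-elim (contradiction h₀ h₁ h₂)) , (λ g → g) ]′ (exact (suc (suc zero)))) , (λ g → g) ]′ (exact (suc zero))) , (λ g → g) ]′ (exact zero)

    module TwoPlanesConclusion {s s′ : Pt} (planes : ∃ λ d → sum₃ s′ ≡ sum₃ s + 1ℤ + + 2 * d)
                     (T : Trio s) (U : Trio s′)
                     (absent : ∀ p → P p → ¬ p ≡₂ s ⊕ 𝟏) (absent′ : ∀ p → P p → ¬ p ≡₂ s′ ⊕ 𝟏) where
      open TwoPlanes planes T U absent absent′

      planes′ : ∃ λ d → sum₃ s ≡ sum₃ s′ + 1ℤ + + 2 * d
      planes′ = - 1ℤ - proj₁ planes , lia 3 (λ s t d → t := s :+ con 1ℤ :+ + 2 :* d ⇒ s := t :+ con 1ℤ :+ + 2 :* (con (- 1ℤ) :- d)) (sum₃ s) (sum₃ s′) (proj₁ planes) (proj₂ planes)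

      Up Down : Fin 3 → Fin 3 → Set
      Up k j = U.A j ≡₃ T.A k ⊕ 𝟏
      Down k j = T.A k ≡₃ U.A j ⊕ 𝟏

      -- Each trio has one point at every level modulo 3, which matches the trios. Matched points
      -- either touch or differ by plus or minus 𝟏 modulo 3, and since the totals agree modulo 3 the
      -- three signs must be equal.
      module Generic² (f : Spread T.A) (g : Spread U.A) (hT : total T.A ≡₃ 𝟏) (hU : total U.A ≡₃ 𝟏) where
        τ : Fin 3 → Fin 3
        τ k = proj₁ (cover {U.A} g (sum₃ (T.A k)))

        heights : ∀ k → sum₃ (T.A k) ≡ sum₃ (U.A (τ k)) mod 3
        heights k = proj₂ (cover {U.A} g (sum₃ (T.A k)))

        τ-injective : ∀ {k l} → k ≢ l → τ k ≢ τ l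
        τ-injective {k} {l} k≢l h = f k l (k≢l , proj₁ (heights k) - proj₁ (heights l) ,
          lia 5 (λ a b u d e → a := u :+ + 3 :* d ⇒ b := u :+ + 3 :* e ⇒ a := b :+ + 3 :* (d :- e)) (sum₃ (T.A k)) (sum₃ (T.A l)) (sum₃ (U.A (τ k)))
            (proj₁ (heights k)) (proj₁ (heights l)) (proj₂ (heights k)) (subst (λ j → sum₃ (T.A l) ≡ sum₃ (U.A j) + + 3 * proj₁ (heights l)) (sym h) (proj₂ (heights l))))

        sign : ∀ k → G ⊎ Up k (τ k) ⊎ Down k (τ k)
        sign k = [ (λ t → inj₁ (touching k (τ k) t)) , [ (λ d → inj₂ (inj₂ d)) , (λ u → inj₂ (inj₁ u)) ]′ ]′ (packing (T.A k) (U.A (τ k)) (heights k))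

        τ-total : U.A (τ zero) ⊕ U.A (τ (suc zero)) ⊕ U.A (τ (suc (suc zero))) ≡ total U.A
        τ-total = total-permuted U.A (τ zero) (τ (suc zero)) (τ (suc (suc zero))) (τ-injective (λ ())) (τ-injective (λ ())) (τ-injective (λ ()))

        -- The shifts ±𝟏 add up to the difference of the totals, which is divisible by 3.
        shift : Fin 3 → ℤ → Set
        shift k ε = U.A (τ k) ≡₃ T.A k ⊕ ε • 𝟏

        balanced : ∀ a b c → shift zero a → shift (suc zero) b → shift (suc (suc zero)) c → (a + b + c) • 𝟏 ≡₃ origin
        balanced a b c (d₀ , h₀) (d₁ , h₁) (d₂ , h₂) = D , trans (distribute a b c) rest
          where
          D : Pt
          D = proj₁ hU ⊖ proj₁ hT ⊖ d₀ ⊖ d₁ ⊖ d₂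
          distribute : ∀ a b c → (a + b + c) • 𝟏 ≡ a • 𝟏 ⊕ b • 𝟏 ⊕ c • 𝟏
          distribute a b c = triple (each a b c) (each a b c) (each a b c)
            where
            each : ∀ a b c → (a + b + c) * 1ℤ ≡ a * 1ℤ + b * 1ℤ + c * 1ℤ
            each a b c = trans (ℤ.*-distribʳ-+ 1ℤ (a + b) c) (cong (_+ c * 1ℤ) (ℤ.*-distribʳ-+ 1ℤ a b))
          rest : a • 𝟏 ⊕ b • 𝟏 ⊕ c • 𝟏 ≡ origin ⊕ + 3 • D
          rest = vlia 17 (λ u v w x y z p q r s t o e f d₀ d₁ d₂ → u := x :+ p :+ + 3 :* d₀ ⇒ v := y :+ q :+ + 3 :* d₁ ⇒ w := z :+ r :+ + 3 :* d₂ ⇒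
              u :+ v :+ w := t ⇒ x :+ y :+ z := s ⇒ t := o :+ + 3 :* e ⇒ s := o :+ + 3 :* f ⇒ p :+ q :+ r := con 0ℤ :+ + 3 :* (e :- f :- d₀ :- d₁ :- d₂))
            (U.A (τ zero)) (U.A (τ (suc zero))) (U.A (τ (suc (suc zero)))) (T.A zero) (T.A (suc zero)) (T.A (suc (suc zero)))
            (a • 𝟏) (b • 𝟏) (c • 𝟏) (total T.A) (total U.A) 𝟏 (proj₁ hU) (proj₁ hT) d₀ d₁ d₂ h₀ h₁ h₂ τ-total refl (proj₂ hU) (proj₂ hT)

        down⁺ : ∀ {k} → Down k (τ k) → shift k (- 1ℤ)
        down⁺ {k} (d , h) = origin ⊖ d , vlia 5 (λ x u o n d → x := u :+ o :+ + 3 :* d ⇒ n := con 0ℤ :- o ⇒ u := x :+ n :+ + 3 :* (con 0ℤ :- d)) (T.A k) (U.A (τ k)) 𝟏 (- 1ℤ • 𝟏) d h refl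

        unbalanced₁ : ¬ 1ℤ • 𝟏 ≡₃ origin
        unbalanced₁ = from-no (1ℤ • 𝟏 ≡₃? origin)
        unbalanced₋₁ : ¬ - 1ℤ • 𝟏 ≡₃ origin
        unbalanced₋₁ = from-no (- 1ℤ • 𝟏 ≡₃? origin)

        all-up : Up zero (τ zero) → Up (suc zero) (τ (suc zero)) → Up (suc (suc zero)) (τ (suc (suc zero))) → G
        all-up h₀ h₁ h₂ = Shifted.goal planes T U hT partner
          where
          partner : ∀ l → ∃ λ j → Up l j
          partner zero = τ zero , h₀
          partner (suc zero) = τ (suc zero) , h₁
          partner (suc (suc zero)) = τ (suc (suc zero)) , h₂

        -- The roles of the trios are exchanged, so every point of U needs a partner; τ is onto
        -- because it is injective on three indices.
        all-down : Down zero (τ zero) → Down (suc zero) (τ (suc zero)) → Down (suc (suc zero)) (τ (suc (suc zero))) → G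
        all-down h₀ h₁ h₂ = Shifted.goal planes′ U T hU λ j → partner j (injective⇒surjective (τ zero) (τ (suc zero)) (τ (suc (suc zero))))
          where
          find : ∀ j → τ zero ≡ j ⊎ τ (suc zero) ≡ j ⊎ τ (suc (suc zero)) ≡ j → ∃ λ k → Down k j
          find j (inj₁ refl) = zero , h₀
          find j (inj₂ (inj₁ refl)) = suc zero , h₁
          find j (inj₂ (inj₂ refl)) = suc (suc zero) , h₂
          partner : ∀ j → τ zero ≡ τ (suc zero) ⊎ τ zero ≡ τ (suc (suc zero)) ⊎ τ (suc zero) ≡ τ (suc (suc zero)) ⊎
            (∀ j → τ zero ≡ j ⊎ τ (suc zero) ≡ j ⊎ τ (suc (suc zero)) ≡ j) → ∃ λ k → Down k j
          partner j (inj₁ h) = ⊥-elim (τ-injective (λ ()) h)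
          partner j (inj₂ (inj₁ h)) = ⊥-elim (τ-injective (λ ()) h)
          partner j (inj₂ (inj₂ (inj₁ h))) = ⊥-elim (τ-injective (λ ()) h)
          partner j (inj₂ (inj₂ (inj₂ h))) = find j (h j)

        combine : Up zero (τ zero) ⊎ Down zero (τ zero) → Up (suc zero) (τ (suc zero)) ⊎ Down (suc zero) (τ (suc zero)) →
          Up (suc (suc zero)) (τ (suc (suc zero))) ⊎ Down (suc (suc zero)) (τ (suc (suc zero))) → G
        combine (inj₁ a) (inj₁ b) (inj₁ c) = all-up a b c
        combine (inj₂ a) (inj₂ b) (inj₂ c) = all-down a b c
        combine (inj₁ a) (inj₁ b) (inj₂ c) = ⊥-elim (unbalanced₁ (balanced 1ℤ 1ℤ (- 1ℤ) a b (down⁺ c)))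
        combine (inj₁ a) (inj₂ b) (inj₁ c) = ⊥-elim (unbalanced₁ (balanced 1ℤ (- 1ℤ) 1ℤ a (down⁺ b) c))
        combine (inj₂ a) (inj₁ b) (inj₁ c) = ⊥-elim (unbalanced₁ (balanced (- 1ℤ) 1ℤ 1ℤ (down⁺ a) b c))
        combine (inj₁ a) (inj₂ b) (inj₂ c) = ⊥-elim (unbalanced₋₁ (balanced 1ℤ (- 1ℤ) (- 1ℤ) a (down⁺ b) (down⁺ c)))
        combine (inj₂ a) (inj₁ b) (inj₂ c) = ⊥-elim (unbalanced₋₁ (balanced (- 1ℤ) 1ℤ (- 1ℤ) (down⁺ a) b (down⁺ c)))
        combine (inj₂ a) (inj₂ b) (inj₁ c) = ⊥-elim (unbalanced₋₁ (balanced (- 1ℤ) (- 1ℤ) 1ℤ (down⁺ a) (down⁺ b) c))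

        goal : G
        goal = [ (λ g → g) , (λ a → [ (λ g → g) , (λ b → [ (λ g → g) , (λ c → combine a b c) ]′ (sign (suc (suc zero)))) ]′ (sign (suc zero))) ]′ (sign zero)

      -- A total divisible by 3 would place the centroid in a class that P does not meet.
      centred : total T.A ≡₃ 𝟏 ⊎ total T.A ≡₃ origin → total T.A ≡₃ 𝟏
      centred (inj₁ h) = h
      centred (inj₂ h) = ⊥-elim (absent (proj₁ c) (proj₁ (proj₂ c)) (proj₂ (proj₂ (proj₂ c))))
        where c = T.centre h

      centred′ : total U.A ≡₃ 𝟏 ⊎ total U.A ≡₃ origin → total U.A ≡₃ 𝟏
      centred′ (inj₁ h) = h
      centred′ (inj₂ h) = ⊥-elim (absent′ (proj₁ c) (proj₁ (proj₂ c)) (proj₂ (proj₂ (proj₂ c))))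
        where c = U.centre h

      decide : T.SS ⊎ G ⊎ T.Generic → U.SS ⊎ G ⊎ U.Generic → G
      decide (inj₂ (inj₁ g)) _ = g
      decide _ (inj₂ (inj₁ g)) = g
      decide (inj₁ a) (inj₁ b) = both-steps a b
      decide (inj₁ a) (inj₂ (inj₂ (g , _))) = step-left a g
      decide (inj₂ (inj₂ (f , _))) (inj₁ b) = step-right b f
      decide (inj₂ (inj₂ (f , h))) (inj₂ (inj₂ (g , k))) = Generic².goal f g (centred h) (centred′ k)

      conclusion : G
      conclusion = decide T.classify U.classify

-- Affine changes of coordinates

module Frames where

  open import Data.Integer using (_+_; _*_; -_; _-_; _≤_)
  open LinearArithmetic
  open Cones using (_•_; triple)
  open Bodies
  open Midpoints
  open Trios
  open Packing
  open PlanePairs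

  •-+ : ∀ k l p → (k + l) • p ≡ k • p ⊕ l • p
  •-+ k l (a , b , c) = triple (ℤ.*-distribʳ-+ a k l) (ℤ.*-distribʳ-+ b k l) (ℤ.*-distribʳ-+ c k l)

  •-* : ∀ k l p → (k * l) • p ≡ k • (l • p)
  •-* k l (a , b , c) = triple (ℤ.*-assoc k l a) (ℤ.*-assoc k l b) (ℤ.*-assoc k l c)

  •-⊕ : ∀ k p q → k • (p ⊕ q) ≡ k • p ⊕ k • q
  •-⊕ k (a , b , c) (d , f , g) = triple (ℤ.*-distribˡ-+ k a d) (ℤ.*-distribˡ-+ k b f) (ℤ.*-distribˡ-+ k c g)

  •-1 : ∀ p → 1ℤ • p ≡ p
  •-1 (a , b , c) = triple (ℤ.*-identityˡ a) (ℤ.*-identityˡ b) (ℤ.*-identityˡ c)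

  •-0 : ∀ p → 0ℤ • p ≡ origin
  •-0 (a , b , c) = refl

  lin : (Fin 3 → Pt) → Pt → Pt
  lin f (a , b , c) = a • f zero ⊕ b • f (suc zero) ⊕ c • f (suc (suc zero))

  lin-⊕ : ∀ f v w → lin f (v ⊕ w) ≡ lin f v ⊕ lin f w
  lin-⊕ f (a , b , c) (a′ , b′ , c′) =
    trans (cong₂ _⊕_ (cong₂ _⊕_ (•-+ a a′ p) (•-+ b b′ q)) (•-+ c c′ r))
      (vlia 6 (λ a b c d f g → a :+ d :+ (b :+ f) :+ (c :+ g) := a :+ b :+ c :+ (d :+ f :+ g)) (a • p) (b • q) (c • r) (a′ • p) (b′ • q) (c′ • r))
    where
    p = f zero
    q = f (suc zero)
    r = f (suc (suc zero))

  lin-• : ∀ f k v → lin f (k • v) ≡ k • lin f v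
  lin-• f k (a , b , c) = trans (cong₂ _⊕_ (cong₂ _⊕_ (•-* k a p) (•-* k b q)) (•-* k c r))
    (sym (trans (•-⊕ k (a • p ⊕ b • q) (c • r)) (cong (_⊕ k • (c • r)) (•-⊕ k (a • p) (b • q)))))
    where
    p = f zero
    q = f (suc zero)
    r = f (suc (suc zero))

  lin-e-id : ∀ v → lin e v ≡ v
  lin-e-id (a , b , c) = triple (x a b c) (y a b c) (z a b c)
    where
    x : ∀ a b c → a * + 1 + b * + 0 + c * + 0 ≡ a
    x = solve-∀
    y : ∀ a b c → a * + 0 + b * + 1 + c * + 0 ≡ b
    y = solve-∀
    z : ∀ a b c → a * + 0 + b * + 0 + c * + 1 ≡ c
    z = solve-∀

  -- A polytope together with its Minkowski sum with the triangle with vertices q i.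
  record Pair (G : Set) (q : Fin 3 → Pt) : Set₁ where
    field
      P X : Pt → Set
      hull : ℤ → Pt → Set
      point : ∀ {p} → P p → hull 1ℤ p
      hull-+ : ∀ {n m v w} → hull n v → hull m w → hull (n + m) (v ⊕ w)
      hull-* : ∀ {n v} k → 0ℤ ≤ k → hull n v → hull (k * n) (k • v)
      hull-÷ : ∀ n {v} → hull (+ suc n) (+ suc n • v) → P v
      mink : ∀ n {v x} w → hull (+ suc n) v → (∀ i → 0ℤ ≤ w at i) → sum₃ w ≡ + suc n → v ⊕ lin q w ≡ + suc n • x → X x
      middle : ∀ {x y} m → X x → X y → x ⊕ y ≡ + 2 • m → X m
      third : ∀ {x y} m → X x → X y → x ⊕ x ⊕ y ≡ + 3 • m → X m
      box : ∀ x d a b → d ≢ origin → a ≢ origin → b ≢ origin →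
        X x → X (x ⊕ d) → X (x ⊕ a) → X (x ⊕ b) → X (x ⊕ d ⊕ a) → X (x ⊕ d ⊕ b) → X (x ⊕ a ⊕ b) → X (x ⊕ d ⊕ a ⊕ b) → G

  asPair : ∀ {G} → Body G → Pair G e
  asPair K = record
    { P = P ; X = X ; hull = hull ; point = point ; hull-+ = hull-+ ; hull-* = hull-* ; hull-÷ = hull-÷
    ; mink = λ n {v} w h w≥0 s eq → mink n w h w≥0 s (trans (cong (v ⊕_) (sym (lin-e-id w))) eq)
    ; middle = middle ; third = third ; box = box }
    where open Body K

  swap₀₁ swap₁₂ : Fin 3 → Fin 3
  swap₀₁ zero = suc zero
  swap₀₁ (suc zero) = zero
  swap₀₁ (suc (suc zero)) = suc (suc zero)
  swap₁₂ zero = zero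
  swap₁₂ (suc zero) = suc (suc zero)
  swap₁₂ (suc (suc zero)) = suc zero

  module _ {G q} (K : Pair G q) (o O : Pt) (f : Fin 3 → Pt) (vertices : ∀ i → q i ≡ O ⊕ f i)
           (independent : ∀ x → lin f x ≡ origin → x ≡ origin) where
    private module K = Pair K

    lin-vertices : ∀ w → lin q w ≡ sum₃ w • O ⊕ lin f w
    lin-vertices (a , b , c) = trans (cong₂ _⊕_ (cong₂ _⊕_ (one a zero) (one b (suc zero))) (one c (suc (suc zero))))
      (trans (vlia 6 (λ x y z u v w → x :+ u :+ (y :+ v) :+ (z :+ w) := x :+ y :+ z :+ (u :+ v :+ w)) (a • O) (b • O) (c • O) (a • f zero) (b • f (suc zero)) (c • f (suc (suc zero))))
        (cong (_⊕ lin f (a , b , c)) (sym (trans (•-+ (a + b) c O) (cong (_⊕ c • O) (•-+ a b O))))))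
      where
      one : ∀ k i → k • q i ≡ k • O ⊕ k • f i
      one k i = trans (cong (k •_) (vertices i)) (•-⊕ k O (f i))

    private
      moved : ∀ {x y} → x ≡ y → K.X x → K.X y
      moved refl h = h

    -- The same pair in the coordinates x ↦ o + lin f x.
    frame : Body G
    frame = record
      { P = λ c → K.P (o ⊕ lin f c)
      -- Origins add under Minkowski sum: o is the origin chosen for P and O the one chosen for the
      -- triangle.
      ; X = λ c → K.X (O ⊕ o ⊕ lin f c)
      ; hull = λ n v → K.hull n (n • o ⊕ lin f v)
      ; point = λ {p} h → subst (K.hull 1ℤ) (cong (_⊕ lin f p) (sym (•-1 o))) (K.point h)
      ; hull-+ = λ {n} {m} {v} {w} h k → subst (K.hull (n + m))
          (trans (vlia 4 (λ a b c d → a :+ b :+ (c :+ d) := a :+ c :+ (b :+ d)) (n • o) (lin f v) (m • o) (lin f w))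
            (cong₂ _⊕_ (sym (•-+ n m o)) (sym (lin-⊕ f v w)))) (K.hull-+ h k)
      ; hull-* = λ {n} {v} k k≥0 h → subst (K.hull (k * n))
          (trans (•-⊕ k (n • o) (lin f v)) (cong₂ _⊕_ (sym (•-* k n o)) (sym (lin-• f k v)))) (K.hull-* k k≥0 h)
      ; hull-÷ = λ n {v} h → K.hull-÷ n (subst (K.hull (+ suc n))
          (trans (cong (+ suc n • o ⊕_) (lin-• f (+ suc n) v)) (sym (•-⊕ (+ suc n) o (lin f v)))) h)
      ; mink = λ n {v} {x} w h w≥0 s eq → K.mink n w h w≥0 s
          (trans (cong (+ suc n • o ⊕ lin f v ⊕_) (trans (lin-vertices w) (cong (λ k → k • O ⊕ lin f w) s)))
            (trans (vlia 4 (λ a b c d → a :+ b :+ (c :+ d) := c :+ a :+ (b :+ d)) (+ suc n • o) (lin f v) (+ suc n • O) (lin f w))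
              (trans (cong₂ _⊕_ (sym (•-⊕ (+ suc n) O o)) (trans (sym (lin-⊕ f v w)) (trans (cong (lin f) eq) (lin-• f (+ suc n) x))))
                (sym (•-⊕ (+ suc n) (O ⊕ o) (lin f x))))))
      ; middle = λ {x} {y} m h k eq → K.middle (O ⊕ o ⊕ lin f m) h k
          (trans (vlia 3 (λ u a b → u :+ a :+ (u :+ b) := u :+ u :+ (a :+ b)) (O ⊕ o) (lin f x) (lin f y))
            (trans (cong (O ⊕ o ⊕ (O ⊕ o) ⊕_) (trans (sym (lin-⊕ f x y)) (trans (cong (lin f) eq) (lin-• f (+ 2) m))))
              (vlia 2 (λ u a → u :+ u :+ + 2 :* a := + 2 :* (u :+ a)) (O ⊕ o) (lin f m))))
      ; third = λ {x} {y} m h k eq → K.third (O ⊕ o ⊕ lin f m) h k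
          (trans (vlia 3 (λ u a b → u :+ a :+ (u :+ a) :+ (u :+ b) := u :+ u :+ u :+ (a :+ a :+ b)) (O ⊕ o) (lin f x) (lin f y))
            (trans (cong (O ⊕ o ⊕ (O ⊕ o) ⊕ (O ⊕ o) ⊕_) (trans (cong (_⊕ lin f y) (sym (lin-⊕ f x x)))
                (trans (sym (lin-⊕ f (x ⊕ x) y)) (trans (cong (lin f) eq) (lin-• f (+ 3) m)))))
              (vlia 2 (λ u a → u :+ u :+ u :+ + 3 :* a := + 3 :* (u :+ a)) (O ⊕ o) (lin f m))))
      ; box = λ x d a b d≢0 a≢0 b≢0 X₀ X₁ X₂ X₃ X₄ X₅ X₆ X₇ →
          let u = O ⊕ o
              one = λ x y → trans (cong (u ⊕_) (lin-⊕ f x y)) (vlia 3 (λ u a b → u :+ (a :+ b) := u :+ a :+ b) u (lin f x) (lin f y))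
              two = λ x y z → trans (one (x ⊕ y) z) (cong (_⊕ lin f z) (one x y))
              three = λ x y z w → trans (one (x ⊕ y ⊕ z) w) (cong (_⊕ lin f w) (two x y z))
          in K.box (u ⊕ lin f x) (lin f d) (lin f a) (lin f b)
               (λ z → d≢0 (independent d z)) (λ z → a≢0 (independent a z)) (λ z → b≢0 (independent b z))
               X₀ (moved (one x d) X₁) (moved (one x a) X₂) (moved (one x b) X₃)
               (moved (two x d a) X₄) (moved (two x d b) X₅) (moved (two x a b) X₆) (moved (three x d a b) X₇)
      }

  -- The affine chart fixing e₀, e₁, e₂ and taking the origin to w.
  chart-axes : Pt → Fin 3 → Pt
  chart-axes w i = e i ⊖ w

  -- The factor 1 - sum₃ w is the determinant of the matrix with columns e i ⊖ w. It is a unit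
  -- exactly when sum₃ w is 0 or 2, the two cases that `chart` allows.
  sum₃-lin : ∀ w x → sum₃ (lin (chart-axes w) x) ≡ sum₃ x * (1ℤ - sum₃ w)
  sum₃-lin (u , v , w) (a , b , c) = lemma u v w a b c
    where
    lemma : ∀ u v w a b c →
      (a * (+ 1 - u) + b * (+ 0 - u) + c * (+ 0 - u)) + (a * (+ 0 - v) + b * (+ 1 - v) + c * (+ 0 - v)) +
        (a * (+ 0 - w) + b * (+ 0 - w) + c * (+ 1 - w)) ≡ (a + b + c) * (+ 1 - (u + v + w))
    lemma = solve-∀

  lin-chart : ∀ w x → lin (chart-axes w) x ≡ x ⊖ sum₃ x • w
  lin-chart (u , v , w) (a , b , c) = triple (x u a b c) (y v a b c) (z w a b c)
    where
    x : ∀ u a b c → a * (+ 1 - u) + b * (+ 0 - u) + c * (+ 0 - u) ≡ a - (a + b + c) * u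
    x = solve-∀
    y : ∀ u a b c → a * (+ 0 - u) + b * (+ 1 - u) + c * (+ 0 - u) ≡ b - (a + b + c) * u
    y = solve-∀
    z : ∀ u a b c → a * (+ 0 - u) + b * (+ 0 - u) + c * (+ 1 - u) ≡ c - (a + b + c) * u
    z = solve-∀

  lin-chart-injective : ∀ w → (∀ s → s * (1ℤ - sum₃ w) ≡ 0ℤ → s ≡ 0ℤ) → ∀ x → lin (chart-axes w) x ≡ origin → x ≡ origin
  lin-chart-injective w nonzero-factor x h = trans (vlia 2 (λ x l → x := x :- l :+ l) x (sum₃ x • w))
    (trans (cong (_⊕ sum₃ x • w) (trans (sym (lin-chart w x)) h)) (cong (λ s → origin ⊕ s • w) s≡0))
    where
    s≡0 : sum₃ x ≡ 0ℤ
    s≡0 = nonzero-factor (sum₃ x) (trans (sym (sum₃-lin w x)) (cong sum₃ h))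

  chart : ∀ {G} (K : Body G) w → sum₃ w ≡ 0ℤ ⊎ sum₃ w ≡ + 2 → Body G
  chart K w s = frame (asPair K) w w (chart-axes w) (λ i → vlia 2 (λ a w → a := w :+ (a :- w)) (e i) w)
    (lin-chart-injective w (λ t → nonzero-factor t (sum₃ w) s))
    where
    nonzero-factor : ∀ t u → (u ≡ 0ℤ ⊎ u ≡ + 2) → t * (1ℤ - u) ≡ 0ℤ → t ≡ 0ℤ
    nonzero-factor t .0ℤ (inj₁ refl) h = trans (sym (ℤ.*-identityʳ t)) h
    nonzero-factor t .(+ 2) (inj₂ refl) h = ℤ.neg-injective (trans (sym (lemma t)) h)
      where
      lemma : ∀ t → t * (- 1ℤ) ≡ - t
      lemma = solve-∀

-- Lattice points forced by the triangle and a distant point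

module Apexes where

  open import Data.Bool using (_∧_; T)
  open import Data.Bool.Properties using (T-∧)
  open import Data.Integer using (_+_; _*_; -_; _-_; _≤_; +≤+)
  open import Data.List using (List; []; _∷_; foldr)
  open import Data.List.Relation.Unary.All using (All; []; _∷_)
  open import Data.Vec using (Vec; []; _∷_)
  open import Function using (Equivalence)
  open import Relation.Nullary.Decidable using (True; toWitness)
  open LinearArithmetic
  open Cones using (_•_; triple)
  open Bodies
  open Midpoints
  open Trios
  open Packing
  open PlanePairs
  open Frames

  axes : ∀ {Q : Axis → Set} → Q x₀ → Q x₁ → Q x₂ → ∀ i → Q i
  axes a b c x₀ = a
  axes a b c x₁ = b
  axes a b c x₂ = c

  by-cases : ∀ a b → a ≤ b ⊎ 1ℤ + b ≤ a
  by-cases a b with a ℤ.≤? b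
  ... | yes h = inj₁ h
  ... | no h = inj₂ (ℤ.i<j⇒suc[i]≤j (ℤ.≰⇒> h))

  at-⊖ : ∀ x y i → (x ⊖ y) at i ≡ x at i - y at i
  at-⊖ x y x₀ = refl
  at-⊖ x y x₁ = refl
  at-⊖ x y x₂ = refl

  at-• : ∀ k x i → (k • x) at i ≡ k * (x at i)
  at-• k x x₀ = refl
  at-• k x x₁ = refl
  at-• k x x₂ = refl

  record Split (k : Pt) (m : ℤ) : Set where
    constructor split
    field
      u w : Pt
      u⊕w : u ⊕ w ≡ k
      u≥0 : ∀ i → 0ℤ ≤ u at i
      w≥0 : ∀ i → 0ℤ ≤ w at i
      sum-u : sum₃ u ≡ m

  -- The amount m is taken greedily from the first coordinates. It serves to divide a multiple of
  -- the triangle between the summands P and Q.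
  splitting : ∀ k m → (∀ i → 0ℤ ≤ k at i) → 0ℤ ≤ m → m ≤ sum₃ k → Split k m
  splitting (a , b , c) m k≥0 m≥0 m≤k = go (by-cases m a) (by-cases m (a + b))
    where
    z = ℤ.≤-refl {0ℤ}
    go : m ≤ a ⊎ 1ℤ + a ≤ m → m ≤ a + b ⊎ 1ℤ + (a + b) ≤ m → Split (a , b , c) m
    go (inj₁ h) _ = split (m , 0ℤ , 0ℤ) (a - m , b , c)
      (triple (lia 2 (λ m a → m :+ (a :- m) := a) m a) (ℤ.+-identityˡ b) (ℤ.+-identityˡ c))
      (axes m≥0 z z) (axes (lia 2 (λ m a → m :≤ a ⇒ con 0ℤ :≤ a :- m) m a h) (k≥0 x₁) (k≥0 x₂))
      (lia 1 (λ m → m :+ con 0ℤ :+ con 0ℤ := m) m)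
    go (inj₂ h) (inj₁ g) = split (a , m - a , 0ℤ) (0ℤ , a + b - m , c)
      (triple (ℤ.+-identityʳ a) (lia 3 (λ m a b → m :- a :+ (a :+ b :- m) := b) m a b) (ℤ.+-identityˡ c))
      (axes (k≥0 x₀) (lia 2 (λ m a → con 1ℤ :+ a :≤ m ⇒ con 0ℤ :≤ m :- a) m a h) z)
      (axes z (lia 3 (λ m a b → m :≤ a :+ b ⇒ con 0ℤ :≤ a :+ b :- m) m a b g) (k≥0 x₂))
      (lia 2 (λ m a → a :+ (m :- a) :+ con 0ℤ := m) m a)
    go (inj₂ h) (inj₂ g) = split (a , b , m - a - b) (0ℤ , 0ℤ , a + b + c - m)
      (triple (ℤ.+-identityʳ a) (ℤ.+-identityʳ b) (lia 4 (λ m a b c → m :- a :- b :+ (a :+ b :+ c :- m) := c) m a b c))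
      (axes (k≥0 x₀) (k≥0 x₁) (lia 3 (λ m a b → con 1ℤ :+ (a :+ b) :≤ m ⇒ con 0ℤ :≤ m :- a :- b) m a b g))
      (axes z z (lia 4 (λ m a b c → m :≤ a :+ b :+ c ⇒ con 0ℤ :≤ a :+ b :+ c :- m) m a b c m≤k))
      (lia 3 (λ m a b → a :+ b :+ (m :- a :- b) := m) m a b)

  entails : ∀ {n} → List (Atom n) → Claim n → Claim n
  entails hs c = foldr _⇒_ c hs

  entails⁺ : ∀ {n} hs (c : Claim n) ρ → ⟦ entails hs c ⟧ ρ → All (λ a → ⟦ a ⟧ₐ ρ) hs → ⟦ c ⟧ ρ
  entails⁺ [] c ρ h [] = h
  entails⁺ (_ ∷ hs) c ρ h (p ∷ ps) = entails⁺ hs c ρ (h p) ps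

  record Given {n} (ρ : Vec ℤ n) : Set where
    constructor given
    field
      atoms : List (Atom n)
      proofs : All (λ a → ⟦ a ⟧ₐ ρ) atoms

  deduce : ∀ {n} {ρ : Vec ℤ n} (Γ : Given ρ) (c : Claim n) → {T (valid [] [] (entails (Given.atoms Γ) c))} → ⟦ c ⟧ ρ
  deduce {ρ = ρ} (given hs ps) c {t} = entails⁺ hs c ρ (valid⁺ [] [] (entails hs c) t ρ [] []) ps

  infixl 5 _▸_
  _▸_ : ∀ {n} {ρ : Vec ℤ n} (Γ : Given ρ) {a : Atom n} → ⟦ a ⟧ₐ ρ → Given ρ
  _▸_ (given hs ps) {a} p = given (a ∷ hs) (p ∷ ps)

  module Triangle {G : Set} (K : Body G) (vertex : ∀ i → Body.P K (e i)) where
    open Body K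
    open Rules K

    hull-e : ∀ k → (∀ i → 0ℤ ≤ k at i) → hull (sum₃ k) k
    hull-e k@(a , b , c) k≥0 = subst₂ hull (cong₂ _+_ (cong₂ _+_ (ℤ.*-identityʳ a) (ℤ.*-identityʳ b)) (ℤ.*-identityʳ c)) (lin-e-id k)
      (hull-+ (hull-+ (hull-* a (k≥0 x₀) (point (vertex zero))) (hull-* b (k≥0 x₁) (point (vertex (suc zero))))) (hull-* c (k≥0 x₂) (point (vertex (suc (suc zero))))))

    -- x is recognised from a point v of the m-fold dilate by v ≤ N x.
    module _ {m v} (hv : hull m v) (n : ℕ) {x : Pt} (below : ∀ i → v at i ≤ (x at i) * + suc n) where
      private
        N = + suc n
        k = N • x ⊖ v

        k≥0 : ∀ i → 0ℤ ≤ k at i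
        k≥0 i = subst (0ℤ ≤_) (sym (trans (at-⊖ (N • x) v i) (cong (_- (v at i)) (trans (at-• N x i) (ℤ.*-comm N (x at i))))))
          (ℤ.i≤j⇒0≤j-i (below i))

        sum-k : sum₃ k ≡ sum₃ x * N - sum₃ v
        sum-k = trans (sum₃-⊖ (N • x) v) (cong (_- sum₃ v) (trans (sum₃-• N x) (ℤ.*-comm N (sum₃ x))))

      mixP : sum₃ v + (N - m) ≡ sum₃ x * N → P x
      mixP s = hull-÷ n (subst₂ hull
        (trans (cong (_+_ m) sum-k) (lia 4 (λ m n v w → v :+ (n :- m) := w ⇒ m :+ (w :- v) := n) m N (sum₃ v) (sum₃ x * N) s))
        (vlia 2 (λ u v → v :+ (u :- v) := u) (N • x) v)
        (hull-+ hv (hull-e k k≥0)))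

      -- The remainder N • x ⊖ v has weight 2 N - m. A part of weight N - m completes v to a point
      -- of the N-fold dilate of P, and the rest, of weight N, is the contribution of Q.
      mixX : m ≤ N → sum₃ v + (+ 2 * N - m) ≡ sum₃ x * N → X x
      mixX m≤N s = finish (splitting k (N - m) k≥0 (ℤ.i≤j⇒0≤j-i m≤N)
          (subst (N - m ≤_) (sym sum≡) (lia 2 (λ m n → con 0ℤ :≤ n ⇒ n :- m :≤ + 2 :* n :- m) m N (+≤+ ℕ.z≤n))))
        where
        sum≡ : sum₃ k ≡ + 2 * N - m
        sum≡ = trans sum-k (lia 4 (λ m n v w → v :+ (+ 2 :* n :- m) := w ⇒ w :- v := + 2 :* n :- m) m N (sum₃ v) (sum₃ x * N) s)
        finish : Split k (N - m) → X x
        finish (split u w u⊕w u≥0 w≥0 sum-u) = mink n w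
          (subst (λ t → hull t (v ⊕ u)) (trans (cong (_+_ m) sum-u) (lia 2 (λ m n → m :+ (n :- m) := n) m N))
            (hull-+ hv (hull-e u u≥0)))
          w≥0
          (lia 4 (λ u w n m → u :+ w := + 2 :* n :- m ⇒ u := n :- m ⇒ w := n) (sum₃ u) (sum₃ w) N m
            (trans (sym (sum₃-⊕ u w)) (trans (cong sum₃ u⊕w) sum≡)) sum-u)
          (vlia 5 (λ u w k x v → u :+ w := k ⇒ k := x :- v ⇒ v :+ u :+ w := x) u w k (N • x) v u⊕w refl)

    -- Upper bounds on the coordinates of v, linear in the parameters, stand in for v itself. The
    -- scale N is again linear in the parameters while x is a numeral, so all conditions are linear
    -- and are decided by `valid`.
    module Inside {n} {ρ : Vec ℤ n} (Γ : Given ρ) (m N σ v₀ v₁ v₂ : Expr n) {v} (hv : hull (eval m ρ) v) (sum-v : sum₃ v ≡ eval σ ρ)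
                  (v≤ : ∀ i → v at i ≤ (eval v₀ ρ , eval v₁ ρ , eval v₂ ρ) at i) (x : Pt) where
      private
        hs = Given.atoms Γ
        Positive = valid [] [] (entails hs (con 1ℤ :≤ N))
        Below₀ = valid [] [] (entails hs (v₀ :≤ (x at x₀) :* N))
        Below₁ = valid [] [] (entails hs (v₁ :≤ (x at x₁) :* N))
        Below₂ = valid [] [] (entails hs (v₂ :≤ (x at x₂) :* N))
        Light = valid [] [] (entails hs (m :≤ N))
        SumP = valid [] [] (entails hs (σ :+ (N :- m) := (sum₃ x) :* N))
        SumX = valid [] [] (entails hs (σ :+ (+ 2 :* N :- m) := (sum₃ x) :* N))
        u : Pt
        u = eval v₀ ρ , eval v₁ ρ , eval v₂ ρ

      insideP : {T Positive} → {T Below₀} → {T Below₁} → {T Below₂} → {T SumP} → P x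
      insideP {t} {b₀} {b₁} {b₂} {s} = go (eval N ρ) (deduce Γ (con 1ℤ :≤ N) {t})
          (axes (deduce Γ (v₀ :≤ (x at x₀) :* N) {b₀}) (deduce Γ (v₁ :≤ (x at x₁) :* N) {b₁}) (deduce Γ (v₂ :≤ (x at x₂) :* N) {b₂}))
          (deduce Γ (σ :+ (N :- m) := (sum₃ x) :* N) {s})
        where
        go : ∀ M → 1ℤ ≤ M → (∀ i → u at i ≤ (x at i) * M) → eval σ ρ + (M - eval m ρ) ≡ sum₃ x * M → P x
        go (+ 0) (+≤+ ()) f s
        go (+ suc k) _ f s = mixP hv k {x} (λ i → ℤ.≤-trans (v≤ i) (f i)) (trans (cong (_+ (+ suc k - eval m ρ)) sum-v) s)

      insideX : {T Positive} → {T Below₀} → {T Below₁} → {T Below₂} → {T Light} → {T SumX} → X x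
      insideX {t} {b₀} {b₁} {b₂} {l} {s} = go (eval N ρ) (deduce Γ (con 1ℤ :≤ N) {t})
          (axes (deduce Γ (v₀ :≤ (x at x₀) :* N) {b₀}) (deduce Γ (v₁ :≤ (x at x₁) :* N) {b₁}) (deduce Γ (v₂ :≤ (x at x₂) :* N) {b₂}))
          (deduce Γ (m :≤ N) {l}) (deduce Γ (σ :+ (+ 2 :* N :- m) := (sum₃ x) :* N) {s})
        where
        go : ∀ M → 1ℤ ≤ M → (∀ i → u at i ≤ (x at i) * M) → eval m ρ ≤ M → eval σ ρ + (+ 2 * M - eval m ρ) ≡ sum₃ x * M → X x
        go (+ 0) (+≤+ ()) f l s
        go (+ suc k) _ f l s = mixX hv k {x} (λ i → ℤ.≤-trans (v≤ i) (f i)) l (trans (cong (_+ (+ 2 * + suc k - eval m ρ)) sum-v) s)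

    edge-sum : ∀ i j → X (e i ⊕ e j)
    edge-sum i j = translate (vertex i) j

    -- A point r at height h + 1 over the triangle at height 1; the points of P and X at height c
    -- are recognised by linear inequalities.
    module Level (r₀ r₁ r₂ : ℤ) (n : ℕ) (Pr : P (r₀ , r₁ , r₂)) (height : r₀ + r₁ + r₂ ≡ + suc n + 1ℤ) where
      h : ℤ
      h = + suc n
      r : Pt
      r = r₀ , r₁ , r₂
      ρ : Vec ℤ 4
      ρ = r₀ ∷ r₁ ∷ r₂ ∷ h ∷ []
      v₀ v₁ v₂ vₕ : Expr 4
      v₀ = var zero
      v₁ = var (suc zero)
      v₂ = var (suc (suc zero))
      vₕ = var (suc (suc (suc zero)))

      compare : ∀ a b → ⟦ a :≤ b ⟧ₐ ρ ⊎ ⟦ con 1ℤ :+ b :≤ a ⟧ₐ ρ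
      compare a b = by-cases (eval a ρ) (eval b ρ)

      coordinates : ℤ → Pt → Axis → Claim 4
      coordinates c x x₀ = c :* v₀ :≤ (x at x₀) :* vₕ
      coordinates c x x₁ = c :* v₁ :≤ (x at x₁) :* vₕ
      coordinates c x x₂ = c :* v₂ :≤ (x at x₂) :* vₕ

      Bounded : Given ρ → ℤ → Pt → Set
      Bounded (given hs _) c x = T (valid [] [] (entails hs (coordinates c x x₀)) ∧ valid [] [] (entails hs (coordinates c x x₁)) ∧
        valid [] [] (entails hs (coordinates c x x₂)))

      bounded : ∀ Γ c x → Bounded Γ c x → ∀ i → c * (r at i) ≤ (x at i) * h
      bounded Γ@(given hs _) c x t = axes (deduce Γ (coordinates c x x₀) {proj₁ t₀}) (deduce Γ (coordinates c x x₁) {proj₁ t₁}) (deduce Γ (coordinates c x x₂) {proj₂ t₁})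
        where
        t₀ = Equivalence.to (T-∧ {valid [] [] (entails hs (coordinates c x x₀))}) t
        t₁ = Equivalence.to (T-∧ {valid [] [] (entails hs (coordinates c x x₁))}) (proj₂ t₀)

      private
        multiple : ∀ {c} → 0ℤ ≤ c → hull c (c • r)
        multiple {c} c≥0 = subst (λ m → hull m (c • r)) (ℤ.*-identityʳ c) (hull-* c c≥0 (point Pr))

        multiple-bound : ∀ c x → (∀ i → c * (r at i) ≤ (x at i) * h) → ∀ i → (c • r) at i ≤ (x at i) * h
        multiple-bound c x f i = subst (_≤ (x at i) * h) (sym (at-• c r i)) (f i)

      -- At height c over the triangle the points of the hull are (c r + (h - c) t) / h with t in
      -- the triangle. Such a t exists when c r ≤ h x coordinatewise; the level of x is c + 1.
      inP : ∀ Γ c x → {Bounded Γ c x} → {True (0ℤ ℤ.≤? c)} → {True (sum₃ x ℤ.≟ c + 1ℤ)} → P x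
      inP Γ c x {t} {c≥0} {s} = mixP (multiple (toWitness c≥0)) n {x} (multiple-bound c x (bounded Γ c x t))
        (trans (cong (_+ (h - c)) (trans (sum₃-• c r) (cong (c *_) height))) (trans (lemma c h) (cong (_* h) (sym (toWitness s)))))
        where
        lemma : ∀ c h → c * (h + 1ℤ) + (h - c) ≡ (c + 1ℤ) * h
        lemma = solve-∀

      inX : ∀ Γ c x → {Bounded Γ c x} → {T (valid [] [] (entails (Given.atoms Γ) (con c :≤ vₕ)))} → {True (0ℤ ℤ.≤? c)} → {True (sum₃ x ℤ.≟ c + + 2)} → X x
      inX Γ c x {t} {c≤h} {c≥0} {s} = mixX (multiple (toWitness c≥0)) n {x} (multiple-bound c x (bounded Γ c x t))
        (deduce Γ (con c :≤ vₕ) {c≤h})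
        (trans (cong (_+ (+ 2 * h - c)) (trans (sum₃-• c r) (cong (c *_) height))) (trans (lemma c h) (cong (_* h) (sym (toWitness s)))))
        where
        lemma : ∀ c h → c * (h + 1ℤ) + (+ 2 * h - c) ≡ (c + + 2) * h
        lemma = solve-∀

      -- The apexes that do not give `G` here are (2,2,2) over a = (1,1,1) and (-1,3,3) over b =
      -- (0,1,1). They are recorded by relations with matching weights, 5 = 2 + 3 and 4 = 1 + 3,
      -- where `𝟏` is the sum of the three vertices; such relations survive every chart fixing the
      -- triangle.
      Five Four : Set
      Five = ∃ λ a → P a × + 5 • a ≡ + 2 • r ⊕ 𝟏 × sum₃ r ≡ + 6
      Four = ∃ λ b → P b × + 4 • b ≡ r ⊕ 𝟏 × sum₃ r ≡ + 5

      G-of : ∀ {x y : Pt} → x ≢ y → x ≡ y ⊎ G → G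
      G-of x≢y (inj₁ q) = ⊥-elim (x≢y q)
      G-of x≢y (inj₂ g) = g

      -- The thresholds h/3, 2h/5, h/2 and h/4 for the coordinates of r are those at which the
      -- points named in each branch enter P or P + Q.
      module Positive (r₁≤r₀ : r₁ ≤ r₀) (r₂≤r₁ : r₂ ≤ r₁) (1≤r₂ : + 1 ≤ r₂) (3≤h : + 3 ≤ h) where
        Γ : Given ρ
        Γ = given
          ((v₀ :+ v₁ :+ v₂ := vₕ :+ con 1ℤ) ∷ (v₁ :≤ v₀) ∷ (v₂ :≤ v₁) ∷ (con (+ 1) :≤ v₂) ∷ (con (+ 3) :≤ vₕ) ∷ [])
          (height ∷ r₁≤r₀ ∷ r₂≤r₁ ∷ 1≤r₂ ∷ 3≤h ∷ [])

        module A (a : ⟦ + 3 :* v₁ :≤ vₕ ⟧ₐ ρ) where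
          Δ = _▸_ Γ {+ 3 :* v₁ :≤ vₕ} a
          goal : G
          goal = G-of (λ ()) (tripled (+ 3 , + 1 , + 1) (+ 0 , + 1 , + 1) (inX Δ (+ 3) (+ 3 , + 1 , + 1)) (edge-sum (suc zero) (suc (suc zero))) (e₀ , refl))

        module B (a : ⟦ con 1ℤ :+ vₕ :≤ + 3 :* v₁ ⟧ₐ ρ) (b : ⟦ con 1ℤ :+ vₕ :≤ + 2 :* v₀ ⟧ₐ ρ) where
          Δ = _▸_ (_▸_ Γ {con 1ℤ :+ vₕ :≤ + 3 :* v₁} a) {con 1ℤ :+ vₕ :≤ + 2 :* v₀} b
          goal₁ : ⟦ + 5 :* v₁ :≤ + 2 :* vₕ ⟧ₐ ρ → G
          goal₁ c = doubled (+ 0 , + 1 , + 1) (+ 2 , + 1 , + 1) (+ 2 , + 1 , + 0) 𝟏 (λ ()) (λ ()) refl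
              (edge-sum (suc zero) (suc (suc zero))) (inX E (+ 2) (+ 2 , + 1 , + 1)) (inX E (+ 3) (+ 2 , + 2 , + 1)) (inX E (+ 5) (+ 4 , + 2 , + 1))
            where E = _▸_ Δ {+ 5 :* v₁ :≤ + 2 :* vₕ} c
          goal₂ : ⟦ con 1ℤ :+ + 2 :* vₕ :≤ + 5 :* v₁ ⟧ₐ ρ → G
          goal₂ c = doubled (+ 1 , + 0 , + 1) (+ 3 , + 2 , + 1) e₁ (+ 2 , + 1 , + 1) (λ ()) (λ ()) refl
              (edge-sum zero (suc (suc zero))) (inX E (+ 4) (+ 3 , + 2 , + 1)) (inX E (+ 1) 𝟏) (inX E (+ 5) (+ 3 , + 3 , + 1))
            where E = _▸_ Δ {con 1ℤ :+ + 2 :* vₕ :≤ + 5 :* v₁} c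
          goal : G
          goal = [ goal₁ , goal₂ ]′ (compare (+ 5 :* v₁) (+ 2 :* vₕ))

        module C (a : ⟦ con 1ℤ :+ vₕ :≤ + 3 :* v₁ ⟧ₐ ρ) (b : ⟦ + 2 :* v₀ :≤ vₕ ⟧ₐ ρ) where
          Δ = _▸_ (_▸_ Γ {con 1ℤ :+ vₕ :≤ + 3 :* v₁} a) {+ 2 :* v₀ :≤ vₕ} b

          P𝟏 : P 𝟏
          P𝟏 = inP Δ (+ 2) 𝟏

          goal₁ : ⟦ + 4 :* v₂ :≤ vₕ ⟧ₐ ρ → G
          goal₁ c = doubled (+ 0 , + 1 , + 1) (+ 2 , + 1 , + 1) (+ 1 , + 1 , + 0) 𝟏 (λ ()) (λ ()) refl
              (edge-sum (suc zero) (suc (suc zero))) (inX E (+ 2) (+ 2 , + 1 , + 1)) (inX E (+ 2) (+ 1 , + 2 , + 1)) (inX E (+ 4) (+ 3 , + 2 , + 1))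
            where E = _▸_ Δ {+ 4 :* v₂ :≤ vₕ} c

          -- All coordinates are 1 or 2; together with the earlier bounds only (2,2,2) is left.
          small : ⟦ con 1ℤ :+ vₕ :≤ + 4 :* v₂ ⟧ₐ ρ → ⟦ v₀ :≤ con (+ 2) ⟧ₐ ρ → Five ⊎ G
          small c d = [ tiny , two ]′ (compare v₂ (con (+ 1)))
            where
            E = _▸_ (_▸_ Δ {con 1ℤ :+ vₕ :≤ + 4 :* v₂} c) {v₀ :≤ con (+ 2)} d
            tiny : ⟦ v₂ :≤ con (+ 1) ⟧ₐ ρ → Five ⊎ G
            tiny f = [ (λ g → ⊥-elim (deduce (_▸_ F {v₀ :≤ con (+ 1)} g) absurd)) , (λ g → ⊥-elim (deduce (_▸_ F {con 1ℤ :+ con (+ 1) :≤ v₀} g) absurd)) ]′ (compare v₀ (con (+ 1)))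
              where F = _▸_ E {v₂ :≤ con (+ 1)} f
            two : ⟦ con 1ℤ :+ con (+ 1) :≤ v₂ ⟧ₐ ρ → Five ⊎ G
            two f = inj₁ (𝟏 , P𝟏 , cong (λ q → + 2 • q ⊕ 𝟏) (triple (deduce F (con (+ 2) := v₀)) (deduce F (con (+ 2) := v₁)) (deduce F (con (+ 2) := v₂))) , deduce F (v₀ :+ v₁ :+ v₂ := con (+ 6)))
              where F = _▸_ E {con 1ℤ :+ con (+ 1) :≤ v₂} f

          large : ⟦ con 1ℤ :+ vₕ :≤ + 4 :* v₂ ⟧ₐ ρ → ⟦ con 1ℤ :+ con (+ 2) :≤ v₀ ⟧ₐ ρ → G
          large c d = [ under , equal ]′ (compare (+ 3 :* v₂) vₕ)
            where
            E = _▸_ Δ {con 1ℤ :+ con (+ 2) :≤ v₀} d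
            under : ⟦ + 3 :* v₂ :≤ vₕ ⟧ₐ ρ → G
            under f = G-of (λ ()) (tripled (+ 3 , + 3 , + 2) (+ 0 , + 0 , + 2)
                (inX (_▸_ E {+ 3 :* v₂ :≤ vₕ} f) (+ 6) (+ 3 , + 3 , + 2)) (edge-sum (suc (suc zero)) (suc (suc zero))) ((+ 1 , + 1 , + 0) , refl))
            equal : ⟦ con 1ℤ :+ vₕ :≤ + 3 :* v₂ ⟧ₐ ρ → G
            equal f = G-of (λ ()) (congruent (+ 3 , + 3 , + 3) 𝟏 (inP (_▸_ E {con 1ℤ :+ vₕ :≤ + 3 :* v₂} f) (+ 8) (+ 3 , + 3 , + 3)) P𝟏 (𝟏 , refl))

          goal : Five ⊎ G
          goal = [ (λ c → inj₂ (goal₁ c)) , (λ c → [ small c , (λ d → inj₂ (large c d)) ]′ (compare v₀ (con (+ 2)))) ]′ (compare (+ 4 :* v₂) vₕ)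

        goal : Five ⊎ G
        goal = [ (λ a → inj₂ (A.goal a)) , (λ a → [ C.goal a , (λ b → inj₂ (B.goal a b)) ]′ (compare (+ 2 :* v₀) vₕ)) ]′ (compare (+ 3 :* v₁) vₕ)

      module Nonpositive (r₀≤0 : r₀ ≤ 0ℤ) (r₂≤r₁ : r₂ ≤ r₁) (1≤r₂ : + 1 ≤ r₂) (r₁≤h : r₁ ≤ h) (3≤h : + 3 ≤ h) where
        Γ : Given ρ
        Γ = given
          ((v₀ :+ v₁ :+ v₂ := vₕ :+ con 1ℤ) ∷ (v₀ :≤ con 0ℤ) ∷ (v₂ :≤ v₁) ∷ (con (+ 1) :≤ v₂) ∷ (v₁ :≤ vₕ) ∷ (con (+ 3) :≤ vₕ) ∷ [])
          (height ∷ r₀≤0 ∷ r₂≤r₁ ∷ 1≤r₂ ∷ r₁≤h ∷ 3≤h ∷ [])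

        b : Pt
        b = + 0 , + 1 , + 1

        Pb : P b
        Pb = inP Γ (+ 1) b

        D₃ : ⟦ + 3 :* v₀ :≤ con 0ℤ :- vₕ ⟧ₐ ρ → G
        D₃ a = G-of (λ ()) (tripled (- 1ℤ , + 3 , + 3) (+ 2 , + 0 , + 0) (inX (_▸_ Γ {+ 3 :* v₀ :≤ con 0ℤ :- vₕ} a) (+ 3) (- 1ℤ , + 3 , + 3)) (edge-sum zero zero) ((- 1ℤ , + 1 , + 1) , refl))

        D₄ : ⟦ + 3 :* v₂ :≤ + 2 :* vₕ ⟧ₐ ρ → G
        D₄ a = G-of (λ ()) (tripled (+ 0 , + 3 , + 2) (+ 0 , + 0 , + 2) (inX (_▸_ Γ {+ 3 :* v₂ :≤ + 2 :* vₕ} a) (+ 3) (+ 0 , + 3 , + 2)) (edge-sum (suc (suc zero)) (suc (suc zero))) (e₁ , refl))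

        -- Here r₁ and r₂ exceed 2h/3 while r₀ exceeds -h/3. For h ≤ 4 only (-1,3,3) is left; for
        -- larger h, r₀ ≤ -2 and P contains (-2,5,5), congruent to b modulo 2.
        D₅ : ⟦ con 1ℤ :+ (con 0ℤ :- vₕ) :≤ + 3 :* v₀ ⟧ₐ ρ → ⟦ con 1ℤ :+ + 2 :* vₕ :≤ + 3 :* v₂ ⟧ₐ ρ → Four ⊎ G
        D₅ a c = [ four , far ]′ (compare vₕ (con (+ 4)))
          where
          Δ = _▸_ (_▸_ Γ {con 1ℤ :+ (con 0ℤ :- vₕ) :≤ + 3 :* v₀} a) {con 1ℤ :+ + 2 :* vₕ :≤ + 3 :* v₂} c
          four : ⟦ vₕ :≤ con (+ 4) ⟧ₐ ρ → Four ⊎ G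
          four d = [ (λ f → inj₁ (exact f)) , (λ f → ⊥-elim (deduce (_▸_ E {con 1ℤ :+ con (- 1ℤ) :≤ v₀} f) absurd)) ]′ (compare v₀ (con (- 1ℤ)))
            where
            E = _▸_ Δ {vₕ :≤ con (+ 4)} d
            exact : ⟦ v₀ :≤ con (- 1ℤ) ⟧ₐ ρ → Four
            exact f = b , Pb , triple (deduce F (con (+ 0) := v₀ :+ con 1ℤ)) (deduce F (con (+ 4) := v₁ :+ con 1ℤ)) (deduce F (con (+ 4) := v₂ :+ con 1ℤ)) ,
                deduce F (v₀ :+ v₁ :+ v₂ := con (+ 5))
              where F = _▸_ E {v₀ :≤ con (- 1ℤ)} f
          far : ⟦ con 1ℤ :+ con (+ 4) :≤ vₕ ⟧ₐ ρ → Four ⊎ G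
          far d = [ (λ f → inj₂ (distant f)) , (λ f → ⊥-elim (deduce (_▸_ E {con 1ℤ :+ con (- + 2) :≤ v₀} f) absurd)) ]′ (compare v₀ (con (- + 2)))
            where
            E = _▸_ Δ {con 1ℤ :+ con (+ 4) :≤ vₕ} d
            distant : ⟦ v₀ :≤ con (- + 2) ⟧ₐ ρ → G
            distant f = G-of (λ ()) (congruent (- + 2 , + 5 , + 5) b (inP (_▸_ E {v₀ :≤ con (- + 2)} f) (+ 7) (- + 2 , + 5 , + 5)) Pb ((- 1ℤ , + 2 , + 2) , refl))

        goal : Four ⊎ G
        goal = [ (λ a → inj₂ (D₃ a)) , (λ a → [ (λ c → inj₂ (D₄ c)) , D₅ a ]′ (compare (+ 3 :* v₂) (+ 2 :* vₕ))) ]′ (compare (+ 3 :* v₀) (con 0ℤ :- vₕ))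

-- Points of P at small distance from the triangle

module NearPoints where

  open import Data.Fin.Properties using () renaming (_≟_ to _≟ᶠ_)
  open import Data.Integer using (_+_; -_; _-_)
  open import Relation.Nullary.Decidable using (from-no)
  open LinearArithmetic
  open Cones using (_•_; triple)
  open Bodies
  open Congruences
  open Midpoints
  open Trios
  open Packing
  open PlanePairs
  open Frames
  open Apexes

  third-index : ∀ i j → i ≢ j → ∃ λ k → e i ⊕ e j ⊕ e k ≡ 𝟏
  third-index zero zero h = ⊥-elim (h refl)
  third-index zero (suc zero) _ = suc (suc zero) , refl
  third-index zero (suc (suc zero)) _ = suc zero , refl
  third-index (suc zero) zero _ = suc (suc zero) , refl
  third-index (suc zero) (suc zero) h = ⊥-elim (h refl)
  third-index (suc zero) (suc (suc zero)) _ = zero , refl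
  third-index (suc (suc zero)) zero _ = suc zero , refl
  third-index (suc (suc zero)) (suc zero) _ = zero , refl
  third-index (suc (suc zero)) (suc (suc zero)) h = ⊥-elim (h refl)

  sum≢ : ∀ {x y} {a b : ℤ} → sum₃ x ≡ a → sum₃ y ≡ b → a ≢ b → x ≢ y
  sum≢ p q a≢b h = a≢b (trans (sym p) (trans (cong sum₃ h) q))

  module FlatFacts {G : Set} (K : Body G) (vertex : ∀ i → Body.P K (e i)) where
    open Body K
    open Rules K
    open Triangle K vertex

    exactly : ∀ {x y : Pt} → x ≢ y → x ≡ y ⊎ G → G
    exactly x≢y (inj₁ q) = ⊥-elim (x≢y q)
    exactly x≢y (inj₂ g) = g

    -- The only edges of P parallel to the triangle are those of the triangle itself.
    no-step : ∀ {p q} → P p → P q → Step p q → sum₃ p ≢ 1ℤ → sum₃ q ≢ 1ℤ → G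
    no-step {p} {q} Pp Pq s@(i , j , i≢j , h) p≢1 q≢1 = [ impossible , (λ g → g) ]′ (edges K Pp Pq (vertex i) (vertex j) s (i , j , i≢j , refl))
      where
      impossible : Edges K p q (e i) (e j) → G
      impossible (same a _) = ⊥-elim (p≢1 (trans (cong sum₃ a) (sum₃-e i)))
      impossible (opposite a _) = ⊥-elim (p≢1 (trans (cong sum₃ a) (sum₃-e j)))
      impossible (corner _ _ (inj₁ a) _) = ⊥-elim (p≢1 (trans (cong sum₃ a) (sum₃-e i)))
      impossible (corner _ _ (inj₂ (inj₁ a)) _) = ⊥-elim (p≢1 (trans (cong sum₃ a) (sum₃-e j)))
      impossible (corner _ _ (inj₂ (inj₂ (inj₁ a))) _) = ⊥-elim (q≢1 (trans (cong sum₃ a) (sum₃-e i)))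
      impossible (corner _ _ (inj₂ (inj₂ (inj₂ a))) _) = ⊥-elim (q≢1 (trans (cong sum₃ a) (sum₃-e j)))

    -- Either the congruent sums are distinct and three steps fit between them, or they coincide and
    -- p, q span an edge parallel to Q away from the triangle.
    touching : ∀ {p q} → P p → P q → p ≢ q → sum₃ p ≢ 1ℤ → sum₃ q ≢ 1ℤ → Touch p q → G
    touching {p} {q} Pp Pq p≢q p≢1 q≢1 (x , y , h) = [ close (x ≟ᶠ y) , (λ g → g) ]′ (tripled (p ⊕ e x) (q ⊕ e y) (translate Pp x) (translate Pq y) h)
      where
      close : Dec (x ≡ y) → p ⊕ e x ≡ q ⊕ e y → G
      close (yes refl) k = ⊥-elim (p≢q (vlia 3 (λ p q a → p :+ a := q :+ a ⇒ p := q) p q (e x) k))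
      close (no x≢y) k = no-step Pp Pq (y , x , ≢-sym x≢y , vlia 4 (λ p q a b → p :+ a := q :+ b ⇒ p :- q := b :- a) p q (e x) (e y) k) p≢1 q≢1

    -- Opposite parities of B and C: B + C + eᵢ + eⱼ = 2 m.
    Linked : Pt → Pt → Fin 3 → Fin 3 → Pt → Set
    Linked B C i j m = B ⊕ C ⊕ e i ⊕ e j ≡ + 2 • m

    linked-X : ∀ {B C i j m} → P B → P C → Linked B C i j m → X m
    linked-X {B} {C} {i} {j} {m} PB PC h = middle m (translate PB i) (translate PC j)
      (trans (vlia 4 (λ b c i j → b :+ i :+ (c :+ j) := b :+ c :+ i :+ j) B C (e i) (e j)) h)

    linked-≢ : ∀ {B C i j m} → i ≢ j → Linked B C i j m → B ≢ C
    linked-≢ {B} {C} {i} {j} {m} i≢j h q = e-odd i j (i≢j , m ⊖ B ⊖ e j ,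
      vlia 5 (λ b c i j m → b :+ c :+ i :+ j := + 2 :* m ⇒ b := c ⇒ i :- j := con 0ℤ :+ + 2 :* (m :- b :- j)) B C (e i) (e j) m h q)

    linked-sym : ∀ {B C i j m} → Linked B C i j m → Linked C B i j m
    linked-sym {B} {C} {i} {j} h = trans (vlia 4 (λ b c i j → c :+ b :+ i :+ j := b :+ c :+ i :+ j) B C (e i) (e j)) h

    -- Two points at the same distance 1 from the triangle.
    parallel-shift : ∀ {B C i j k m} → P B → P C → i ≢ j → e i ⊕ e j ⊕ e k ≡ 𝟏 → Linked B C i j m → sum₃ C ≡ + 2 → C ≡₃ B ⊕ 𝟏 → G
    parallel-shift {B} {C} {i} {j} {k} {m} PB PC i≢j ijk h sC (d , q) = [ exact , (λ g → g) ]′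
      (tripled m (C ⊕ e k) (linked-X {_} {C} {i} {j} {m} PB PC h) (translate PC k)
        (m ⊖ C ⊕ d ,
          vlia 8 (λ b c i j k o d m → c := b :+ o :+ + 3 :* d ⇒ i :+ j :+ k := o ⇒ b :+ c :+ i :+ j := + 2 :* m ⇒
              m := c :+ k :+ + 3 :* (m :- c :+ d))
            B C (e i) (e j) (e k) 𝟏 d m q ijk h))
      where
      exact : m ≡ C ⊕ e k → G
      -- The points C ⊕ e i, C ⊕ e k, B ⊕ e j are now in arithmetic progression, and a translate of
      -- them is the side of the doubled triangle from 2 • e i to 2 • e k.
      exact z = doubled (C ⊕ e i) (B ⊕ e j) (e i ⊕ e i ⊖ (C ⊕ e i)) (C ⊕ e k)
        (λ y → i≢k (vlia 6 (λ b c i j k m → b :+ c :+ i :+ j := + 2 :* m ⇒ m := c :+ k ⇒ c :+ i := b :+ j ⇒ i :- k := con 0ℤ) B C (e i) (e j) (e k) m h z y))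
        (λ y → sum≢ {e i ⊕ e i} {C ⊕ e i} {+ 2} {+ 3} (trans (sum₃-⊕ (e i) (e i)) (cong₂ _+_ (sum₃-e i) (sum₃-e i)))
            (trans (sum₃-⊕ C (e i)) (cong₂ _+_ sC (sum₃-e i))) (λ ())
          (vlia 2 (λ a b → a :- b := con 0ℤ ⇒ a := b) (e i ⊕ e i) (C ⊕ e i) y))
        (vlia 6 (λ b c i j k m → b :+ c :+ i :+ j := + 2 :* m ⇒ m := c :+ k ⇒ c :+ i :+ (b :+ j) := + 2 :* (c :+ k)) B C (e i) (e j) (e k) m h z)
        (translate PC i) (translate PB j)
        (X≡ (vlia 2 (λ a b → a := b :+ (a :- b)) (e i ⊕ e i) (C ⊕ e i)) (edge-sum i i))
        (X≡ (vlia 6 (λ b c i j k m → b :+ c :+ i :+ j := + 2 :* m ⇒ m := c :+ k ⇒ k :+ k := b :+ j :+ (i :+ i :- (c :+ i))) B C (e i) (e j) (e k) m h z) (edge-sum k k))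
        where
        i≢k : e i ⊖ e k ≢ origin
        i≢k = e-difference {i} {k} λ { refl → absurd-index i j ijk }
          where
          absurd-index : ∀ i j → e i ⊕ e j ⊕ e i ≢ 𝟏
          absurd-index zero zero ()
          absurd-index zero (suc zero) ()
          absurd-index zero (suc (suc zero)) ()
          absurd-index (suc zero) zero ()
          absurd-index (suc zero) (suc zero) ()
          absurd-index (suc zero) (suc (suc zero)) ()
          absurd-index (suc (suc zero)) zero ()
          absurd-index (suc (suc zero)) (suc zero) ()
          absurd-index (suc (suc zero)) (suc (suc zero)) ()

    -- Equal levels make `packing` applicable. Touching points give `G`, and the two shifts by 𝟏 are
    -- `parallel-shift` in either order.
    same-side : ∀ {B C i j m} → P B → P C → i ≢ j → Linked B C i j m → sum₃ B ≡ + 2 → sum₃ C ≡ + 2 → G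
    same-side {B} {C} {i} {j} {m} PB PC i≢j h sB sC =
      [ touching PC PB (≢-sym (linked-≢ {B} {C} {i} {j} {m} i≢j h)) (λ q → off (trans (sym sC) q)) (λ q → off (trans (sym sB) q)) ,
        [ parallel-shift {B} {C} {i} {j} {proj₁ k} {m} PB PC i≢j (proj₂ k) h sC ,
          parallel-shift {C} {B} {i} {j} {proj₁ k} {m} PC PB i≢j (proj₂ k) (linked-sym {B} {C} {i} {j} {m} h) sB ]′ ]′
        (packing C B (0ℤ , trans sC (trans (sym sB) (sym (ℤ.+-identityʳ (sum₃ B))))))
      where
      k = third-index i j i≢j
      off : + 2 ≢ 1ℤ
      off ()

    -- A = (1,1,1) and B = (2,2,2), with C on the other side.
    opposite-five : ∀ {C i j m} → P 𝟏 → P (+ 2 • 𝟏) → P C → i ≢ j → Linked (+ 2 • 𝟏) C i j m → sum₃ C ≡ 0ℤ → G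
    opposite-five {C} {i} {j} {m} PA PB PC i≢j h sC = go (packing C 𝟏 (- 1ℤ , sC)) (packing C B (- + 2 , sC))
      where
      B = + 2 • 𝟏
      k = third-index i j i≢j
      off : 0ℤ ≢ 1ℤ
      off ()
      away : sum₃ C ≢ 1ℤ
      away q = off (trans (sym sC) q)
      settled : C ≡₃ origin → G
      -- Modulo 3 the midpoint m agrees with C ⊕ e k for the third index k, but their levels are 4
      -- and 1.
      settled (d , q) = exactly
        (sum≢ {m} {C ⊕ e (proj₁ k)} {+ 4} {+ 1} sum-m (trans (sum₃-⊕ C (e (proj₁ k))) (cong₂ _+_ sC (sum₃-e (proj₁ k)))) (λ ()))
        (tripled m (C ⊕ e (proj₁ k)) (linked-X {_} {C} {i} {j} {m} PB PC h) (translate PC (proj₁ k))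
          (m ⊖ 𝟏 ⊖ d ⊖ d , vlia 7 (λ c i j k o d m → c := con 0ℤ :+ + 3 :* d ⇒ i :+ j :+ k := o ⇒ + 2 :* o :+ c :+ i :+ j := + 2 :* m ⇒
              m := c :+ k :+ + 3 :* (m :- o :- d :- d)) C (e i) (e j) (e (proj₁ k)) 𝟏 d m q (proj₂ k) h))
        where
        sum-m : sum₃ m ≡ + 4
        sum-m = lia 5 (λ m b c i j → b :+ c :+ i :+ j := + 2 :* m ⇒ b := con (+ 6) ⇒ c := con 0ℤ ⇒ i := con 1ℤ ⇒ j := con 1ℤ ⇒ m := con (+ 4))
          (sum₃ m) (sum₃ B) (sum₃ C) (sum₃ (e i)) (sum₃ (e j))
          (trans (sym (trans (sum₃-⊕ (B ⊕ C ⊕ e i) (e j)) (cong (_+ sum₃ (e j)) (trans (sum₃-⊕ (B ⊕ C) (e i)) (cong (_+ sum₃ (e i)) (sum₃-⊕ B C))))))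
            (trans (cong sum₃ h) (sum₃-• (+ 2) m))) refl sC (sum₃-e i) (sum₃-e j)
      go : Touch C 𝟏 ⊎ C ≡₃ 𝟏 ⊕ 𝟏 ⊎ 𝟏 ≡₃ C ⊕ 𝟏 → Touch C B ⊎ C ≡₃ B ⊕ 𝟏 ⊎ B ≡₃ C ⊕ 𝟏 → G
      go (inj₁ t) _ = touching PC PA (sum≢ {C} {𝟏} sC refl (λ ())) away (λ ()) t
      go (inj₂ _) (inj₁ t) = touching PC PB (sum≢ {C} {B} sC refl (λ ())) away (λ ()) t
      go (inj₂ _) (inj₂ (inj₁ (d , q))) = settled (d ⊕ 𝟏 , vlia 3 (λ c o d → c := + 2 :* o :+ o :+ + 3 :* d ⇒ c := con 0ℤ :+ + 3 :* (d :+ o)) C 𝟏 d q)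
      go (inj₂ (inj₂ (d , q))) _ = settled (origin ⊖ d , vlia 3 (λ c o d → o := c :+ o :+ + 3 :* d ⇒ c := con 0ℤ :+ + 3 :* (con 0ℤ :- d)) C 𝟏 d q)
      go (inj₂ (inj₁ (d , q))) (inj₂ (inj₂ (f , r))) = ⊥-elim (from-no (𝟏 ≡₃? origin) (origin ⊖ d ⊖ f ,
        vlia 4 (λ c o d f → c := o :+ o :+ + 3 :* d ⇒ + 2 :* o := c :+ o :+ + 3 :* f ⇒ o := con 0ℤ :+ + 3 :* (con 0ℤ :- d :- f)) C 𝟏 d f q r))

    -- The segment from e i ⊕ e j to 𝟏 ⊕ e k has midpoint 𝟏. Its translate by 𝟏 ends in 2 • 𝟏 ⊕ e k
    -- and begins in the midpoint of (e i ⊕ e j) ⊕ e i and 2 • 𝟏 ⊕ e j.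
    same-five : ∀ {i j k} → e i ⊕ e j ⊕ e k ≡ 𝟏 → P 𝟏 → P (+ 2 • 𝟏) → P (e i ⊕ e j) → G
    same-five {i} {j} {k} h PA PB PC = doubled (e i ⊕ e j) (𝟏 ⊕ e k) 𝟏 𝟏
      (sum≢ {e i ⊕ e j} {𝟏 ⊕ e k} {+ 2} {+ 4} (trans (sum₃-⊕ (e i) (e j)) (cong₂ _+_ (sum₃-e i) (sum₃-e j))) (trans (sum₃-⊕ 𝟏 (e k)) (cong (_+_ (+ 3)) (sum₃-e k))) (λ ()))
      (λ ()) (vlia 4 (λ i j k o → i :+ j :+ k := o ⇒ i :+ j :+ (o :+ k) := + 2 :* o) (e i) (e j) (e k) 𝟏 h) (edge-sum i j) (translate PA k)
      (middle (e i ⊕ e j ⊕ 𝟏) (translate PC i) (translate PB j)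
        (vlia 3 (λ i j o → i :+ j :+ i :+ (+ 2 :* o :+ j) := + 2 :* (i :+ j :+ o)) (e i) (e j) 𝟏))
      (X≡ (vlia 2 (λ o k → + 2 :* o :+ k := o :+ k :+ o) 𝟏 (e k)) (translate PB k))

    -- The points 2 • e i, e i ⊕ e j, e i ⊕ e k, e j ⊕ e k form a parallelogram. Its translate by B
    -- ⊖ e i has three corners in B + Q; the hypothesis supplies the fourth.
    square : ∀ {B i j k} → P B → i ≢ j → i ≢ k → sum₃ B ≡ + 2 → X (B ⊕ (e j ⊕ e k ⊖ e i)) → G
    square {B} {i} {j} {k} PB i≢j i≢k sB Xr = box (e i ⊕ e i) (e j ⊖ e i) (e k ⊖ e i) (B ⊖ e i) (e-difference (≢-sym i≢j)) (e-difference (≢-sym i≢k))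
      (λ y → sum≢ {B} {e i} {+ 2} {+ 1} sB (sum₃-e i) (λ ()) (vlia 2 (λ a b → a :- b := con 0ℤ ⇒ a := b) B (e i) y))
      (edge-sum i i)
      (X≡ (vlia 2 (λ i j → i :+ j := i :+ i :+ (j :- i)) (e i) (e j)) (edge-sum i j))
      (X≡ (vlia 2 (λ i j → i :+ j := i :+ i :+ (j :- i)) (e i) (e k)) (edge-sum i k))
      (X≡ (vlia 2 (λ i b → b :+ i := i :+ i :+ (b :- i)) (e i) B) (translate PB i))
      (X≡ (vlia 3 (λ i j k → j :+ k := i :+ i :+ (j :- i) :+ (k :- i)) (e i) (e j) (e k)) (edge-sum j k))
      (X≡ (vlia 3 (λ i j b → b :+ j := i :+ i :+ (j :- i) :+ (b :- i)) (e i) (e j) B) (translate PB j))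
      (X≡ (vlia 3 (λ i j b → b :+ j := i :+ i :+ (j :- i) :+ (b :- i)) (e i) (e k) B) (translate PB k))
      (X≡ (vlia 4 (λ i j k b → b :+ (j :+ k :- i) := i :+ i :+ (j :- i) :+ (k :- i) :+ (b :- i)) (e i) (e j) (e k) B) Xr)

    -- The side from 2 • e j to 2 • e i of the doubled triangle has lattice length 2; its translate
    -- by B ⊖ e j begins in B + Q and ends in the point of the hypothesis.
    line : ∀ {B i j} → P B → i ≢ j → sum₃ B ≡ + 2 → X (B ⊕ (e i ⊕ e i ⊖ e j)) → G
    line {B} {i} {j} PB i≢j sB Xr = doubled (e j ⊕ e j) (e i ⊕ e i) (B ⊖ e j) (e i ⊕ e j)
      (λ y → e-difference i≢j (vlia 2 (λ i j → j :+ j := i :+ i ⇒ i :- j := con 0ℤ) (e i) (e j) y))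
      (λ y → sum≢ {B} {e j} {+ 2} {+ 1} sB (sum₃-e j) (λ ()) (vlia 2 (λ a b → a :- b := con 0ℤ ⇒ a := b) B (e j) y))
      (vlia 2 (λ i j → j :+ j :+ (i :+ i) := + 2 :* (i :+ j)) (e i) (e j))
      (edge-sum j j) (edge-sum i i)
      (X≡ (vlia 2 (λ j b → b :+ j := j :+ j :+ (b :- j)) (e j) B) (translate PB j))
      (X≡ (vlia 3 (λ i j b → b :+ (i :+ i :- j) := i :+ i :+ (b :- j)) (e i) (e j) B) Xr)

-- Points of P at level 1, just above it, and on both sides of it

module RingPoints where

  open import Data.Bool using (T)
  open import Data.Integer using (_+_; _*_; -_; _-_; _≤_; +≤+)
  open import Data.List using ([]; _∷_)
  open import Data.List.Relation.Unary.All using ([]; _∷_)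
  open import Data.Vec using (Vec; []; _∷_)
  open import Relation.Nullary.Decidable using (True; toWitness)
  open LinearArithmetic
  open Cones using (_•_; triple)
  open Bodies
  open Midpoints
  open MidpointTable
  open Trios
  open Packing
  open PlanePairs
  open Frames
  open Apexes
  open NearPoints

  flip₀₁ flip₁₂ : Pt → Pt
  flip₀₁ x = proj₁ (proj₂ x) , proj₁ x , proj₂ (proj₂ x)
  flip₁₂ x = proj₁ x , proj₂ (proj₂ x) , proj₁ (proj₂ x)

  sum-flip₀₁ : ∀ x → sum₃ (flip₀₁ x) ≡ sum₃ x
  sum-flip₀₁ (a , b , c) = cong (_+ c) (ℤ.+-comm b a)

  sum-flip₁₂ : ∀ x → sum₃ (flip₁₂ x) ≡ sum₃ x
  sum-flip₁₂ (a , b , c) = lia 3 (λ a b c → a :+ c :+ b := a :+ b :+ c) a b c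

  flipped₀₁ : ∀ {G} → Body G → Body G
  flipped₀₁ K = record
    { P = λ x → P (flip₀₁ x) ; X = λ x → X (flip₀₁ x) ; hull = λ n v → hull n (flip₀₁ v)
    ; point = λ {p} → point {flip₀₁ p} ; hull-+ = λ {n} {m} {v} {w} → hull-+ {n} {m} {flip₀₁ v} {flip₀₁ w}
    ; hull-* = λ {n} {v} → hull-* {n} {flip₀₁ v} ; hull-÷ = λ n {v} → hull-÷ n {flip₀₁ v}
    ; mink = λ n {v} {x} w h w≥0 s eq → mink n {flip₀₁ v} {flip₀₁ x} (flip₀₁ w) h (axes (w≥0 x₁) (w≥0 x₀) (w≥0 x₂)) (trans (sum-flip₀₁ w) s) (cong flip₀₁ eq)
    ; middle = λ {x} {y} m h k eq → middle {flip₀₁ x} {flip₀₁ y} (flip₀₁ m) h k (cong flip₀₁ eq)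
    ; third = λ {x} {y} m h k eq → third {flip₀₁ x} {flip₀₁ y} (flip₀₁ m) h k (cong flip₀₁ eq)
    ; box = λ x d a b d≢0 a≢0 b≢0 → box (flip₀₁ x) (flip₀₁ d) (flip₀₁ a) (flip₀₁ b)
        (λ z → d≢0 (cong flip₀₁ z)) (λ z → a≢0 (cong flip₀₁ z)) (λ z → b≢0 (cong flip₀₁ z)) }
    where open Body K

  flipped₁₂ : ∀ {G} → Body G → Body G
  flipped₁₂ K = record
    { P = λ x → P (flip₁₂ x) ; X = λ x → X (flip₁₂ x) ; hull = λ n v → hull n (flip₁₂ v)
    ; point = λ {p} → point {flip₁₂ p} ; hull-+ = λ {n} {m} {v} {w} → hull-+ {n} {m} {flip₁₂ v} {flip₁₂ w}
    ; hull-* = λ {n} {v} → hull-* {n} {flip₁₂ v} ; hull-÷ = λ n {v} → hull-÷ n {flip₁₂ v}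
    ; mink = λ n {v} {x} w h w≥0 s eq → mink n {flip₁₂ v} {flip₁₂ x} (flip₁₂ w) h (axes (w≥0 x₀) (w≥0 x₂) (w≥0 x₁)) (trans (sum-flip₁₂ w) s) (cong flip₁₂ eq)
    ; middle = λ {x} {y} m h k eq → middle {flip₁₂ x} {flip₁₂ y} (flip₁₂ m) h k (cong flip₁₂ eq)
    ; third = λ {x} {y} m h k eq → third {flip₁₂ x} {flip₁₂ y} (flip₁₂ m) h k (cong flip₁₂ eq)
    ; box = λ x d a b d≢0 a≢0 b≢0 → box (flip₁₂ x) (flip₁₂ d) (flip₁₂ a) (flip₁₂ b)
        (λ z → d≢0 (cong flip₁₂ z)) (λ z → a≢0 (cong flip₁₂ z)) (λ z → b≢0 (cong flip₁₂ z)) }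
    where open Body K

  Vertices : ∀ {G} → Body G → Set
  Vertices K = ∀ i → Body.P K (e i)

  vertices₀₁ : ∀ {G} (K : Body G) → Vertices K → Vertices (flipped₀₁ K)
  vertices₀₁ K f zero = f (suc zero)
  vertices₀₁ K f (suc zero) = f zero
  vertices₀₁ K f (suc (suc zero)) = f (suc (suc zero))

  vertices₁₂ : ∀ {G} (K : Body G) → Vertices K → Vertices (flipped₁₂ K)
  vertices₁₂ K f zero = f zero
  vertices₁₂ K f (suc zero) = f (suc (suc zero))
  vertices₁₂ K f (suc (suc zero)) = f (suc zero)

  flip₀₁-e : ∀ i → flip₀₁ (e i) ≡ e (swap₀₁ i)
  flip₀₁-e zero = refl
  flip₀₁-e (suc zero) = refl
  flip₀₁-e (suc (suc zero)) = refl

  flip₁₂-e : ∀ i → flip₁₂ (e i) ≡ e (swap₁₂ i)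
  flip₁₂-e zero = refl
  flip₁₂-e (suc zero) = refl
  flip₁₂-e (suc (suc zero)) = refl

  -- Permuting coordinates permutes the vertices of the triangle, so decreasing coordinates may be
  -- assumed. The body is permuted together with the point, which is why Q speaks of both.
  sorting : ∀ {G} (Q : Body G → Pt → Set) →
    (∀ K x → Q (flipped₀₁ K) (flip₀₁ x) → Q K x) → (∀ K x → Q (flipped₁₂ K) (flip₁₂ x) → Q K x) →
    (∀ K x → x at x₁ ≤ x at x₀ → x at x₂ ≤ x at x₁ → Q K x) → ∀ K x → Q K x
  sorting {G} Q s₀₁ s₁₂ sorted K x = [ half K x , (λ h → s₁₂ K x (half (flipped₁₂ K) (flip₁₂ x) (weaken h))) ]′ (by-cases (x at x₂) (x at x₁))
    where
    weaken : ∀ {a b : ℤ} → 1ℤ + a ≤ b → a ≤ b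
    weaken {a} {b} = lia 2 (λ a b → con 1ℤ :+ a :≤ b ⇒ a :≤ b) a b
    last-least : ∀ K x → x at x₂ ≤ x at x₀ → x at x₂ ≤ x at x₁ → Q K x
    last-least K x h₀ h₁ = [ (λ h → sorted K x h h₁) , (λ h → s₀₁ K x (sorted (flipped₀₁ K) (flip₀₁ x) (weaken h) h₀)) ]′ (by-cases (x at x₁) (x at x₀))
    half : ∀ K x → x at x₂ ≤ x at x₁ → Q K x
    half K x h₁ = [ (λ h → last-least K x h h₁) ,
      (λ h → s₀₁ K x (s₁₂ (flipped₀₁ K) (flip₀₁ x) (last-least (flipped₁₂ (flipped₀₁ K)) (flip₁₂ (flip₀₁ x)) (ℤ.≤-trans (weaken h) h₁) (weaken h)))) ]′
      (by-cases (x at x₂) (x at x₀))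

  y₀ y₁ y₂ : ∀ {n} → Expr (suc (suc (suc n)))
  y₀ = var zero
  y₁ = var (suc zero)
  y₂ = var (suc (suc zero))

  module RingFacts {G : Set} (K : Body G) (vertex : Vertices K) where
    open Body K
    open Rules K
    open Triangle K vertex
    open FlatFacts K vertex

    -- A further point 𝟏 + 2 d at the level of the triangle.
    module LevelZero (d₀ d₁ d₂ : ℤ) (PA : P (𝟏 ⊕ + 2 • (d₀ , d₁ , d₂))) (total : d₀ + d₁ + d₂ ≡ - 1ℤ) (d₁≤d₀ : d₁ ≤ d₀) (d₂≤d₁ : d₂ ≤ d₁) where
      ρ : Vec ℤ 3
      ρ = d₀ ∷ d₁ ∷ d₂ ∷ []

      Γ : Given ρ
      Γ = given ((y₀ :+ y₁ :+ y₂ := con (- 1ℤ)) ∷ (y₁ :≤ y₀) ∷ (y₂ :≤ y₁) ∷ []) (total ∷ d₁≤d₀ ∷ d₂≤d₁ ∷ [])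

      sum-A : sum₃ (𝟏 ⊕ + 2 • (d₀ , d₁ , d₂)) ≡ 1ℤ
      sum-A = deduce Γ (con 1ℤ :+ + 2 :* y₀ :+ (con 1ℤ :+ + 2 :* y₁) :+ (con 1ℤ :+ + 2 :* y₂) := con 1ℤ)

      -- The scale -1 - 2 d₂ is minus the last coordinate of A. It matches the points tested below,
      -- all of which have last coordinate -1.
      module On (Δ : Given ρ) = Inside Δ (con 1ℤ) (con (- 1ℤ) :- + 2 :* y₂) (con 1ℤ) (con 1ℤ :+ + 2 :* y₀) (con 1ℤ :+ + 2 :* y₁) (con 1ℤ :+ + 2 :* y₂) (point PA) sum-A (λ i → ℤ.≤-refl)



      quad : ⟦ con 0ℤ :≤ y₁ ⟧ₐ ρ → G
      quad h = parallelogram e₁ e₂ (+ 1 , + 1 , - + 1) e₀ (vertex (suc zero)) (vertex (suc (suc zero)))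
        (On.insideP (_▸_ Γ {con 0ℤ :≤ y₁} h) (+ 1 , + 1 , - + 1)) (vertex zero) refl (λ ()) (λ ())

      outer : ⟦ con 1ℤ :+ y₁ :≤ con 0ℤ ⟧ₐ ρ → ⟦ con 1ℤ :+ y₂ :≤ y₁ ⟧ₐ ρ → G
      outer h k = exactly (λ ()) (congruent (+ 2 , + 0 , - + 1) e₂
        (On.insideP (_▸_ (_▸_ Γ {con 1ℤ :+ y₁ :≤ con 0ℤ} h) {con 1ℤ :+ y₂ :≤ y₁} k) (+ 2 , + 0 , - + 1)) (vertex (suc (suc zero))) ((+ 1 , + 0 , - + 1) , refl))

      -- The triangle with vertices A, e₁, e₂ has centre e₀.
      centre : ⟦ con 1ℤ :+ y₁ :≤ con 0ℤ ⟧ₐ ρ → ⟦ y₁ :≤ y₂ ⟧ₐ ρ → G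
      centre h k = exactly (λ ()) (tripled (+ 3 , + 0 , - + 1) (+ 0 , + 0 , + 2)
          (translate (On.insideP (_▸_ (_▸_ Γ {con 1ℤ :+ y₁ :≤ con 0ℤ} h) {y₁ :≤ y₂} k) (+ 3 , - + 1 , - + 1)) (suc zero)) (edge-sum (suc (suc zero)) (suc (suc zero)))
          ((+ 1 , + 0 , - + 1) , refl))

      goal : G
      goal = [ quad , (λ h → [ centre h , outer h ]′ (by-cases d₁ d₂)) ]′ (by-cases 0ℤ d₁)

    module Next (D₀ D₁ D₂ : ℤ) (P𝟏 : P 𝟏) (PB : P (𝟏 ⊖ (D₀ , D₁ , D₂))) (total : D₀ + D₁ + D₂ ≡ 1ℤ)
                (unique : ∀ x → P x → sum₃ x ≡ + 2 → x ≡ 𝟏 ⊖ (D₀ , D₁ , D₂)) (no-unit : ∀ m → (D₀ , D₁ , D₂) ≢ e m)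
                (D₁≤D₀ : D₁ ≤ D₀) (D₂≤D₁ : D₂ ≤ D₁) where
      D B : Pt
      D = D₀ , D₁ , D₂
      B = 𝟏 ⊖ D
      ρ : Vec ℤ 3
      ρ = D₀ ∷ D₁ ∷ D₂ ∷ []

      Γ : Given ρ
      Γ = given ((y₀ :+ y₁ :+ y₂ := con 1ℤ) ∷ (y₁ :≤ y₀) ∷ (y₂ :≤ y₁) ∷ []) (total ∷ D₁≤D₀ ∷ D₂≤D₁ ∷ [])

      sum-B : sum₃ B ≡ + 2
      sum-B = trans (sum₃-⊖ 𝟏 D) (cong (_-_ (+ 3)) total)

      -- The multiple M (B ⊕ r) uses 𝟏 with weight a, B with weight M - 2a and the triangle of P
      -- with weight a: what 𝟏 lies above level 2, the triangle lies below it. For P + Q, weight M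
      -- of Q is added.
      module _ (Δ : Given ρ) (a : ℤ) (M : Expr 3) (r : Pt)
               {p : T (valid [] [] (entails (Given.atoms Δ) (con 1ℤ :≤ M)))} {q : T (valid [] [] (entails (Given.atoms Δ) (con (+ 2 * a) :≤ M)))}
               {b₀ : T (valid [] [] (entails (Given.atoms Δ) ((+ 2 * a) :* y₀ :≤ con a :+ (r at x₀) :* M)))}
               {b₁ : T (valid [] [] (entails (Given.atoms Δ) ((+ 2 * a) :* y₁ :≤ con a :+ (r at x₁) :* M)))}
               {b₂ : T (valid [] [] (entails (Given.atoms Δ) ((+ 2 * a) :* y₂ :≤ con a :+ (r at x₂) :* M)))}
               {a≥0 : True (0ℤ ℤ.≤? a)} where
        private
          m₀ = eval M ρ
          v : ℤ → Pt
          v m = a • 𝟏 ⊕ (m - + 2 * a) • B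

          hull-v : ∀ m → + 2 * a ≤ m → hull (m - a) (v m)
          hull-v m h = subst (λ t → hull t (v m)) (lemma a m)
              (hull-+ (hull-* a (toWitness a≥0) (point P𝟏)) (hull-* (m - + 2 * a) (ℤ.i≤j⇒0≤j-i h) (point PB)))
            where
            lemma : ∀ a m → a * 1ℤ + (m - + 2 * a) * 1ℤ ≡ m - a
            lemma = solve-∀

          sum-v : ∀ m → sum₃ (v m) ≡ a * + 3 + (m - + 2 * a) * + 2
          sum-v m = trans (sum₃-⊕ (a • 𝟏) ((m - + 2 * a) • B)) (cong₂ _+_ (sum₃-• a 𝟏) (trans (sum₃-• (m - + 2 * a) B) (cong ((m - + 2 * a) *_) sum-B)))

          dominated : ∀ m d s → + 2 * a * d ≤ a + s * m → a * 1ℤ + (m - + 2 * a) * (1ℤ - d) ≤ (1ℤ - d + s) * m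
          dominated m d s h = ℤ.0≤i-j⇒j≤i (subst (0ℤ ≤_) (lemma a m d s) (ℤ.i≤j⇒0≤j-i h))
            where
            lemma : ∀ a m d s → a + s * m - + 2 * a * d ≡ (1ℤ - d + s) * m - (a * 1ℤ + (m - + 2 * a) * (1ℤ - d))
            lemma = solve-∀

          all-below : ∀ i → v m₀ at i ≤ ((B ⊕ r) at i) * m₀
          all-below = axes (dominated m₀ D₀ (r at x₀) (deduce Δ ((+ 2 * a) :* y₀ :≤ con a :+ (r at x₀) :* M) {b₀}))
            (dominated m₀ D₁ (r at x₁) (deduce Δ ((+ 2 * a) :* y₁ :≤ con a :+ (r at x₁) :* M) {b₁}))
            (dominated m₀ D₂ (r at x₂) (deduce Δ ((+ 2 * a) :* y₂ :≤ con a :+ (r at x₂) :* M) {b₂}))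

          sum-x : ∀ m t → sum₃ r ≡ t → (+ 2 + t) * m ≡ sum₃ (B ⊕ r) * m
          sum-x m t h = cong (_* m) (sym (trans (sum₃-⊕ B r) (cong₂ _+_ sum-B h)))

        aroundX : {True (sum₃ r ℤ.≟ 1ℤ)} → X (B ⊕ r)
        aroundX {s} = go m₀ (deduce Δ (con 1ℤ :≤ M) {p}) (deduce Δ (con (+ 2 * a) :≤ M) {q}) all-below
          where
          lemma : ∀ a m → a * + 3 + (m - + 2 * a) * + 2 + (+ 2 * m - (m - a)) ≡ (+ 2 + 1ℤ) * m
          lemma = solve-∀
          go : ∀ m → 1ℤ ≤ m → + 2 * a ≤ m → (∀ i → v m at i ≤ ((B ⊕ r) at i) * m) → X (B ⊕ r)
          go (+ 0) (+≤+ ()) _ _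
          go (+ suc n) _ h f = mixX (hull-v (+ suc n) h) n {B ⊕ r} f (lia 2 (λ a m → con 0ℤ :≤ a ⇒ m :- a :≤ m) a (+ suc n) (toWitness a≥0))
            (trans (cong (_+ (+ 2 * + suc n - (+ suc n - a))) (sum-v (+ suc n))) (trans (lemma a (+ suc n)) (sum-x (+ suc n) 1ℤ (toWitness s))))

        aroundP : {True (sum₃ r ℤ.≟ 0ℤ)} → P (B ⊕ r)
        aroundP {s} = go m₀ (deduce Δ (con 1ℤ :≤ M) {p}) (deduce Δ (con (+ 2 * a) :≤ M) {q}) all-below
          where
          lemma : ∀ a m → a * + 3 + (m - + 2 * a) * + 2 + (m - (m - a)) ≡ (+ 2 + 0ℤ) * m
          lemma = solve-∀
          go : ∀ m → 1ℤ ≤ m → + 2 * a ≤ m → (∀ i → v m at i ≤ ((B ⊕ r) at i) * m) → P (B ⊕ r)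
          go (+ 0) (+≤+ ()) _ _
          go (+ suc n) _ h f = mixP (hull-v (+ suc n) h) n {B ⊕ r} f
            (trans (cong (_+ (+ suc n - (+ suc n - a))) (sum-v (+ suc n))) (trans (lemma a (+ suc n)) (sum-x (+ suc n) 0ℤ (toWitness s))))

      distance : Expr 3
      distance = con 0ℤ :- + 2 :* y₂

      beyond : X (B ⊕ (+ 2 , + 0 , - + 1)) → G
      beyond = line {B} {zero} {suc (suc zero)} PB (λ ()) sum-B

      convex : ⟦ con 1ℤ :+ y₂ :≤ con 0ℤ ⟧ₐ ρ → ⟦ con 1ℤ :+ con 0ℤ :≤ y₁ ⟧ₐ ρ → G
      convex h k = square {B} {suc (suc zero)} {zero} {suc zero} PB (λ ()) (λ ()) sum-B
        (aroundX (_▸_ (_▸_ Γ {con 1ℤ :+ y₂ :≤ con 0ℤ} h) {con 1ℤ :+ con 0ℤ :≤ y₁} k) (+ 1) distance (+ 1 , + 1 , - + 1))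

      flat : ⟦ con 1ℤ :+ y₂ :≤ con 0ℤ ⟧ₐ ρ → ⟦ y₁ :≤ con 0ℤ ⟧ₐ ρ → ⟦ con 0ℤ :≤ y₁ ⟧ₐ ρ → G
      flat h k l = beyond (aroundX (_▸_ (_▸_ (_▸_ Γ {con 1ℤ :+ y₂ :≤ con 0ℤ} h) {y₁ :≤ con 0ℤ} k) {con 0ℤ :≤ y₁} l) (+ 1) distance (+ 2 , + 0 , - + 1))

      steep : ⟦ con 1ℤ :+ y₁ :≤ con 0ℤ ⟧ₐ ρ → ⟦ con 1ℤ :+ y₂ :≤ y₁ ⟧ₐ ρ → G
      steep h k = beyond (aroundX (_▸_ (_▸_ Γ {con 1ℤ :+ y₁ :≤ con 0ℤ} h) {con 1ℤ :+ y₂ :≤ y₁} k) (+ 1) distance (+ 2 , + 0 , - + 1))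

      -- Here no box is exhibited: B ⊕ (2,-1,-1) would be a second point of P at level 2.
      spike : ⟦ con 1ℤ :+ y₁ :≤ con 0ℤ ⟧ₐ ρ → ⟦ y₁ :≤ y₂ ⟧ₐ ρ → G
      spike h k = ⊥-elim (away (unique (B ⊕ r) (aroundP (_▸_ (_▸_ Γ {con 1ℤ :+ y₁ :≤ con 0ℤ} h) {y₁ :≤ y₂} k) (+ 2) (con 1ℤ :- + 4 :* y₂) r)
          (trans (sum₃-⊕ B r) (cong (_+ 0ℤ) sum-B))))
        where
        r : Pt
        r = + 2 , - + 1 , - + 1
        away : B ⊕ r ≢ B
        away z with vlia 2 (λ b r → b :+ r := b ⇒ r := con 0ℤ) B r z
        ... | ()

      vertex-like : ⟦ con 0ℤ :≤ y₂ ⟧ₐ ρ → G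
      vertex-like h = ⊥-elim (no-unit zero (triple (deduce Δ (y₀ := con 1ℤ)) (deduce Δ (y₁ := con 0ℤ)) (deduce Δ (y₂ := con 0ℤ))))
        where
        split₁ : ⟦ y₁ :≤ con 0ℤ ⟧ₐ ρ
        split₁ = [ (λ z → z) , (λ z → ⊥-elim (deduce (_▸_ (_▸_ Γ {con 0ℤ :≤ y₂} h) {con 1ℤ :+ con 0ℤ :≤ y₁} z) absurd)) ]′ (by-cases D₁ 0ℤ)
        Δ = _▸_ (_▸_ Γ {con 0ℤ :≤ y₂} h) {y₁ :≤ con 0ℤ} split₁

      goal : G
      goal = [ vertex-like , (λ h → [ (λ k → [ flat h k , (λ l → [ spike l , steep l ]′ (by-cases D₁ D₂)) ]′ (by-cases 0ℤ D₁)) , convex h ]′ (by-cases D₁ 0ℤ)) ]′ (by-cases 0ℤ D₂)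

    -- This is meant for F = B ⊕ C with B and C at levels 2 and 0, and g = 𝟏 ⊖ e k. Then F / 2 lies
    -- in P at level 1 and n in P + Q at level 2. If n is outside the doubled triangle, F reaches
    -- far enough to force further points of P + Q at that level.
    module Opposite (n₀ n₁ n₂ F₀ F₁ F₂ g₀ g₁ g₂ : ℤ) (hull-F : hull (+ 2) (F₀ , F₁ , F₂))
                    (F⊕g : (F₀ , F₁ , F₂) ⊕ (g₀ , g₁ , g₂) ≡ + 2 • (n₀ , n₁ , n₂))
                    (g≥0 : ∀ i → 0ℤ ≤ (g₀ , g₁ , g₂) at i) (g≤1 : ∀ i → (g₀ , g₁ , g₂) at i ≤ 1ℤ) (sum-g : g₀ + g₁ + g₂ ≡ + 2) (sum-n : n₀ + n₁ + n₂ ≡ + 2)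
                    (no-edge : ∀ k l → (n₀ , n₁ , n₂) ≢ e k ⊕ e l) (n₁≤n₀ : n₁ ≤ n₀) (n₂≤n₁ : n₂ ≤ n₁) where
      ρ : Vec ℤ 3
      ρ = n₀ ∷ n₁ ∷ n₂ ∷ []

      F≤2n : ∀ F g n → F + g ≡ + 2 * n → 0ℤ ≤ g → F ≤ + 2 * n
      F≤2n = lia 3 λ F g n → F :+ g := + 2 :* n ⇒ con 0ℤ :≤ g ⇒ F :≤ + 2 :* n

      strictly : ∀ F g n → F + g ≡ + 2 * n → 1ℤ ≤ g → F ≤ + 2 * n - 1ℤ
      strictly = lia 3 λ F g n → F :+ g := + 2 :* n ⇒ con 1ℤ :≤ g ⇒ F :≤ + 2 :* n :- con 1ℤ

      eq₀ = cong (_at x₀) F⊕g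
      eq₁ = cong (_at x₁) F⊕g
      eq₂ = cong (_at x₂) F⊕g

      sum-F : F₀ + F₁ + F₂ ≡ + 2
      sum-F = lia 9 (λ a b c f g h x y z → f :+ x := + 2 :* a ⇒ g :+ y := + 2 :* b ⇒ h :+ z := + 2 :* c ⇒ a :+ b :+ c := con (+ 2) ⇒ x :+ y :+ z := con (+ 2) ⇒ f :+ g :+ h := con (+ 2))
        n₀ n₁ n₂ F₀ F₁ F₂ g₀ g₁ g₂ eq₀ eq₁ eq₂ sum-n sum-g

      Γ : Given ρ
      Γ = given ((y₀ :+ y₁ :+ y₂ := con (+ 2)) ∷ (y₁ :≤ y₀) ∷ (y₂ :≤ y₁) ∷ []) (sum-n ∷ n₁≤n₀ ∷ n₂≤n₁ ∷ [])

      ≤₀ = F≤2n F₀ g₀ n₀ eq₀ (g≥0 x₀)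
      ≤₁ = F≤2n F₁ g₁ n₁ eq₁ (g≥0 x₁)
      ≤₂ = F≤2n F₂ g₂ n₂ eq₂ (g≥0 x₂)

      module On (Δ : Given ρ) (N : Expr 3) = Inside Δ (con (+ 2)) N (con (+ 2)) (+ 2 :* y₀) (+ 2 :* y₁) (+ 2 :* y₂) hull-F sum-F (axes ≤₀ ≤₁ ≤₂)

      depth : Expr 3
      depth = con 0ℤ :- + 2 :* y₂

      left : X (+ 3 , + 0 , - + 1) → G
      left h = exactly (λ ()) (tripled (+ 3 , + 0 , - + 1) (+ 0 , + 0 , + 2) h (edge-sum (suc (suc zero)) (suc (suc zero))) ((+ 1 , + 0 , - + 1) , refl))

      right : X (+ 3 , - + 1 , + 0) → G
      right h = exactly (λ ()) (tripled (+ 3 , - + 1 , + 0) (+ 0 , + 2 , + 0) h (edge-sum (suc zero) (suc zero)) ((+ 1 , - + 1 , + 0) , refl))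

      between : ⟦ con 1ℤ :+ y₂ :≤ con 0ℤ ⟧ₐ ρ → ⟦ con 1ℤ :+ con 0ℤ :≤ y₁ ⟧ₐ ρ → G
      between h k = doubled (+ 2 , + 1 , - + 1) (+ 0 , + 1 , + 1) (+ 0 , - + 1 , + 1) (+ 1 , + 1 , + 0) (λ ()) (λ ()) refl
        (On.insideX (_▸_ Δ {y₁ :≤ con 0ℤ :- y₂} small) depth (+ 2 , + 1 , - + 1))
        (edge-sum (suc zero) (suc (suc zero))) (edge-sum zero zero) (edge-sum (suc (suc zero)) (suc (suc zero)))
        where
        Δ = _▸_ (_▸_ Γ {con 1ℤ :+ y₂ :≤ con 0ℤ} h) {con 1ℤ :+ con 0ℤ :≤ y₁} k
        small : ⟦ y₁ :≤ con 0ℤ :- y₂ ⟧ₐ ρ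
        small = [ (λ z → z) , (λ z → ⊥-elim (deduce (_▸_ Δ {con 1ℤ :+ (con 0ℤ :- y₂) :≤ y₁} z) absurd)) ]′ (by-cases n₁ (0ℤ - n₂))

      axis : ⟦ con 1ℤ :+ y₂ :≤ con 0ℤ ⟧ₐ ρ → ⟦ y₁ :≤ con 0ℤ ⟧ₐ ρ → ⟦ con 0ℤ :≤ y₁ ⟧ₐ ρ → G
      axis h k l = left (On.insideX (_▸_ (_▸_ (_▸_ Γ {con 1ℤ :+ y₂ :≤ con 0ℤ} h) {y₁ :≤ con 0ℤ} k) {con 0ℤ :≤ y₁} l) depth (+ 3 , + 0 , - + 1))

      steep : ⟦ con 1ℤ :+ y₁ :≤ con 0ℤ ⟧ₐ ρ → ⟦ con 1ℤ :+ y₂ :≤ y₁ ⟧ₐ ρ → G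
      steep h k = left (On.insideX (_▸_ (_▸_ Γ {con 1ℤ :+ y₁ :≤ con 0ℤ} h) {con 1ℤ :+ y₂ :≤ y₁} k) depth (+ 3 , + 0 , - + 1))

      spike : ⟦ con 1ℤ :+ y₁ :≤ con 0ℤ ⟧ₐ ρ → ⟦ y₁ :≤ y₂ ⟧ₐ ρ → G
      -- The bound F ≤ 2n falls one short. Since g₁ + g₂ ≥ 1, one of F₁, F₂ satisfies F ≤ 2n - 1,
      -- which the scale 1 - 2 n₂ meets with equality.
      spike h k = [ (λ z → right (Inside.insideX Δ (con (+ 2)) (con 1ℤ :+ depth) (con (+ 2)) (+ 2 :* y₀) (+ 2 :* y₁ :- con 1ℤ) (+ 2 :* y₂) hull-F sum-F
                      (axes ≤₀ (strictly F₁ g₁ n₁ eq₁ (other z)) ≤₂) (+ 3 , - + 1 , + 0))) ,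
                    (λ z → left (Inside.insideX Δ (con (+ 2)) (con 1ℤ :+ depth) (con (+ 2)) (+ 2 :* y₀) (+ 2 :* y₁) (+ 2 :* y₂ :- con 1ℤ) hull-F sum-F
                      (axes ≤₀ ≤₁ (strictly F₂ g₂ n₂ eq₂ z)) (+ 3 , + 0 , - + 1))) ]′ (by-cases g₂ 0ℤ)
        where
        Δ = _▸_ (_▸_ Γ {con 1ℤ :+ y₁ :≤ con 0ℤ} h) {y₁ :≤ y₂} k
        other : g₂ ≤ 0ℤ → 1ℤ ≤ g₁
        other z = lia 3 (λ a b c → a :+ b :+ c := con (+ 2) ⇒ a :≤ con 1ℤ ⇒ c :≤ con 0ℤ ⇒ con 1ℤ :≤ b) g₀ g₁ g₂ sum-g (g≤1 x₀) z

      edge-like : ⟦ con 0ℤ :≤ y₂ ⟧ₐ ρ → G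
      edge-like h = [ (λ z → let Δ = _▸_ Γ₂ {y₁ :≤ con 0ℤ} z in
            ⊥-elim (no-edge zero zero (triple (deduce Δ (y₀ := con (+ 2))) (deduce Δ (y₁ := con 0ℤ)) (deduce Δ (y₂ := con 0ℤ))))) ,
          (λ z → let Δ = _▸_ Γ₂ {con 1ℤ :+ con 0ℤ :≤ y₁} z in
            ⊥-elim (no-edge zero (suc zero) (triple (deduce Δ (y₀ := con (+ 1))) (deduce Δ (y₁ := con (+ 1))) (deduce Δ (y₂ := con 0ℤ))))) ]′ (by-cases n₁ 0ℤ)
        where Γ₂ = _▸_ Γ {con 0ℤ :≤ y₂} h

      goal : G
      goal = [ edge-like , (λ h → [ (λ k → [ axis h k , (λ l → [ spike l , steep l ]′ (by-cases n₁ n₂)) ]′ (by-cases 0ℤ n₁)) , between h ]′ (by-cases n₁ 0ℤ)) ]′ (by-cases 0ℤ n₂)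

  module _ {G : Set} where
    level-zero : (K : Body G) → ∀ d → Vertices K → Body.P K (𝟏 ⊕ + 2 • d) → sum₃ d ≡ - 1ℤ → G
    level-zero = sorting (λ K d → Vertices K → Body.P K (𝟏 ⊕ + 2 • d) → sum₃ d ≡ - 1ℤ → G)
      (λ K d f v PA s → f (vertices₀₁ K v) PA (trans (sum-flip₀₁ d) s))
      (λ K d f v PA s → f (vertices₁₂ K v) PA (trans (sum-flip₁₂ d) s))
      (λ { K (d₀ , d₁ , d₂) h k v PA s → RingFacts.LevelZero.goal K v d₀ d₁ d₂ PA s h k })

    next-level : (K : Body G) → ∀ D → Vertices K → Body.P K 𝟏 → Body.P K (𝟏 ⊖ D) → sum₃ D ≡ 1ℤ →
      (∀ x → Body.P K x → sum₃ x ≡ + 2 → x ≡ 𝟏 ⊖ D) → (∀ m → D ≢ e m) → G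
    next-level = sorting (λ K D → Vertices K → Body.P K 𝟏 → Body.P K (𝟏 ⊖ D) → sum₃ D ≡ 1ℤ →
        (∀ x → Body.P K x → sum₃ x ≡ + 2 → x ≡ 𝟏 ⊖ D) → (∀ m → D ≢ e m) → G)
      (λ K D f v P𝟏 PB s u n → f (vertices₀₁ K v) P𝟏 PB (trans (sum-flip₀₁ D) s)
        (λ x Px t → cong flip₀₁ (u (flip₀₁ x) Px (trans (sum-flip₀₁ x) t))) (λ m z → n (swap₀₁ m) (trans (cong flip₀₁ z) (flip₀₁-e m))))
      (λ K D f v P𝟏 PB s u n → f (vertices₁₂ K v) P𝟏 PB (trans (sum-flip₁₂ D) s)
        (λ x Px t → cong flip₁₂ (u (flip₁₂ x) Px (trans (sum-flip₁₂ x) t))) (λ m z → n (swap₁₂ m) (trans (cong flip₁₂ z) (flip₁₂-e m))))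
      (λ { K (D₀ , D₁ , D₂) h k v P𝟏 PB s u n → RingFacts.Next.goal K v D₀ D₁ D₂ P𝟏 PB s u n h k })

    opposite-levels : (K : Body G) → ∀ n → Vertices K → ∀ F g → Body.hull K (+ 2) F → F ⊕ g ≡ + 2 • n → (∀ i → 0ℤ ≤ g at i) → (∀ i → g at i ≤ 1ℤ) →
      sum₃ g ≡ + 2 → sum₃ n ≡ + 2 → (∀ k l → n ≢ e k ⊕ e l) → G
    opposite-levels = sorting (λ K n → Vertices K → ∀ F g → Body.hull K (+ 2) F → F ⊕ g ≡ + 2 • n → (∀ i → 0ℤ ≤ g at i) → (∀ i → g at i ≤ 1ℤ) →
        sum₃ g ≡ + 2 → sum₃ n ≡ + 2 → (∀ k l → n ≢ e k ⊕ e l) → G)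
      (λ K n f v F g hF eq g≥0 g≤1 sg sn off → f (vertices₀₁ K v) (flip₀₁ F) (flip₀₁ g) hF (cong flip₀₁ eq)
        (axes (g≥0 x₁) (g≥0 x₀) (g≥0 x₂)) (axes (g≤1 x₁) (g≤1 x₀) (g≤1 x₂)) (trans (sum-flip₀₁ g) sg) (trans (sum-flip₀₁ n) sn)
        (λ k l z → off (swap₀₁ k) (swap₀₁ l) (trans (cong flip₀₁ z) (cong₂ _⊕_ (flip₀₁-e k) (flip₀₁-e l)))))
      (λ K n f v F g hF eq g≥0 g≤1 sg sn off → f (vertices₁₂ K v) (flip₁₂ F) (flip₁₂ g) hF (cong flip₁₂ eq)
        (axes (g≥0 x₀) (g≥0 x₂) (g≥0 x₁)) (axes (g≤1 x₀) (g≤1 x₂) (g≤1 x₁)) (trans (sum-flip₁₂ g) sg) (trans (sum-flip₁₂ n) sn)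
        (λ k l z → off (swap₁₂ k) (swap₁₂ l) (trans (cong flip₁₂ z) (cong₂ _⊕_ (flip₁₂-e k) (flip₁₂-e l)))))
      (λ { K (n₀ , n₁ , n₂) h k v (F₀ , F₁ , F₂) (g₀ , g₁ , g₂) hF eq g≥0 g≤1 sg sn off →
        RingFacts.Opposite.goal K v n₀ n₁ n₂ F₀ F₁ F₂ g₀ g₁ g₂ hF eq g≥0 g≤1 sg sn off h k })

-- Configurations over a translate of Q, up to affine maps fixing it

module Configurations where

  open import Data.Fin.Properties using (toℕ<n)
  open import Data.Integer using (_+_; _*_; -_; _-_; _≤_; +≤+)
  open LinearArithmetic
  open Cones using (_•_; triple)
  open Bodies
  open Congruences
  open Midpoints hiding (S; M)
  open Trios
  open Packing
  open PlanePairs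
  open Frames
  open Apexes
  open NearPoints
  open RingPoints

  -- Read from new to old coordinates, ψ w is the affine map fixing e₀, e₁, e₂ and taking the origin to w.
  ψ : Pt → Pt → Pt
  ψ w c = c ⊕ (1ℤ - sum₃ c) • w

  ψ-at : ∀ w {c s} → sum₃ c ≡ s → ψ w c ≡ c ⊕ (1ℤ - s) • w
  ψ-at w refl = refl

  sum-ψ : ∀ w c → sum₃ (ψ w c) ≡ sum₃ c + (1ℤ - sum₃ c) * sum₃ w
  sum-ψ w c = trans (sum₃-⊕ c ((1ℤ - sum₃ c) • w)) (cong (_+_ (sum₃ c)) (sum₃-• (1ℤ - sum₃ c) w))

  chart-point : ∀ w c → w ⊕ lin (chart-axes w) c ≡ ψ w c
  chart-point w c = trans (cong (w ⊕_) (lin-chart w c)) (each w c (sum₃ c))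
    where
    lemma : ∀ w c s → w + (c - s * w) ≡ c + (1ℤ - s) * w
    lemma = solve-∀
    each : ∀ w c s → w ⊕ (c ⊖ s • w) ≡ c ⊕ (1ℤ - s) • w
    each (w₀ , w₁ , w₂) (c₀ , c₁ , c₂) s = triple (lemma w₀ c₀ s) (lemma w₁ c₁ s) (lemma w₂ c₂ s)

  record Chart : Set where
    field
      w w′ : Pt
      sum-w : sum₃ w ≡ 0ℤ ⊎ sum₃ w ≡ + 2
      sum-w′ : sum₃ w′ ≡ 0ℤ ⊎ sum₃ w′ ≡ + 2
      left : ∀ x → ψ w (ψ w′ x) ≡ x
      right : ∀ x → ψ w′ (ψ w x) ≡ x

  ψ-level : ∀ w → sum₃ w ≡ 0ℤ → ∀ x → sum₃ (ψ w x) ≡ sum₃ x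
  ψ-level w h x = trans (sum-ψ w x) (trans (cong (λ t → sum₃ x + (1ℤ - sum₃ x) * t) h) (trans (cong (_+_ (sum₃ x)) (ℤ.*-zeroʳ (1ℤ - sum₃ x))) (ℤ.+-identityʳ (sum₃ x))))

  ψ-inverse : ∀ w w′ → w ⊕ w′ ≡ origin → sum₃ w′ ≡ 0ℤ → ∀ x → ψ w (ψ w′ x) ≡ x
  ψ-inverse w w′ h h′ x = trans (ψ-at w {ψ w′ x} (ψ-level w′ h′ x)) (trans
      (vlia 3 (λ x u v → x :+ u :+ v := x :+ (v :+ u)) x (t • w′) (t • w))
      (trans (cong (x ⊕_) (trans (sym (•-⊕ t w w′)) (cong (t •_) h))) (trans (cong (x ⊕_) (triple z z z)) (vlia 1 (λ x → x :+ con 0ℤ := x) x))))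
    where
    t = 1ℤ - sum₃ x
    z = ℤ.*-zeroʳ t

  negate-sum : ∀ w → sum₃ w ≡ 0ℤ → sum₃ (origin ⊖ w) ≡ 0ℤ
  negate-sum w h = trans (sum₃-⊖ origin w) (cong (_-_ 0ℤ) h)

  shear : ∀ w → sum₃ w ≡ 0ℤ → Chart
  shear w h = record
    { w = w ; w′ = origin ⊖ w ; sum-w = inj₁ h ; sum-w′ = inj₁ (negate-sum w h)
    ; left = ψ-inverse w (origin ⊖ w) (vlia 1 (λ w → w :+ (con 0ℤ :- w) := con 0ℤ) w) (negate-sum w h)
    ; right = ψ-inverse (origin ⊖ w) w (vlia 1 (λ w → con 0ℤ :- w :+ w := con 0ℤ) w) h }

  -- A vector of level 2: its chart fixes the triangle and exchanges the levels s and 2 - s.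
  mirror : Pt
  mirror = + 2 , + 0 , + 0

  sum-mirror : ∀ x → sum₃ (ψ mirror x) ≡ + 2 - sum₃ x
  sum-mirror x = trans (sum-ψ mirror x) (lemma (sum₃ x))
    where
    lemma : ∀ s → s + (1ℤ - s) * + 2 ≡ + 2 - s
    lemma = solve-∀

  reflect : Chart
  reflect = record { w = mirror ; w′ = mirror ; sum-w = inj₂ refl ; sum-w′ = inj₂ refl ; left = involutive ; right = involutive }
    where
    involutive : ∀ x → ψ mirror (ψ mirror x) ≡ x
    involutive x = trans (ψ-at mirror {ψ mirror x} (sum-mirror x)) (each x (sum₃ x))
      where
      first : ∀ x s → x + (1ℤ - s) * + 2 + (1ℤ - (+ 2 - s)) * + 2 ≡ x
      first = solve-∀
      other : ∀ x s → x + (1ℤ - s) * + 0 + (1ℤ - (+ 2 - s)) * + 0 ≡ x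
      other = solve-∀
      each : ∀ x s → x ⊕ (1ℤ - s) • mirror ⊕ (1ℤ - (+ 2 - s)) • mirror ≡ x
      each (a , b , c) s = triple (first a s) (other b s) (other c s)

  module InChart {G : Set} (K : Body G) (ch : Chart) where
    open Chart ch
    chart′ : Body G
    chart′ = chart K w sum-w

    private
      module K = Body K
      module L = Body chart′

      moved : ∀ {x y} → x ≡ y → K.P x → K.P y
      moved refl h = h

    out : ∀ {x} → L.P x → K.P (ψ w x)
    out {x} = moved (chart-point w x)

    into′ : ∀ {x} → K.P (ψ w x) → L.P x
    into′ {x} = moved (sym (chart-point w x))

    into : ∀ {x} → K.P x → L.P (ψ w′ x)
    into {x} h = into′ {ψ w′ x} (moved (sym (left x)) h)

    vertices : Vertices K → Vertices chart′
    vertices v zero = into′ {e₀} (v zero)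
    vertices v (suc zero) = into′ {e₁} (v (suc zero))
    vertices v (suc (suc zero)) = into′ {e₂} (v (suc (suc zero)))

  Even : ℤ → Set
  Even s = ∃ λ t → s ≡ + 2 * t

  ψ-even : ∀ w → sum₃ w ≡ 0ℤ ⊎ sum₃ w ≡ + 2 → ∀ x → Even (sum₃ x) → Even (sum₃ (ψ w x))
  ψ-even w h x (t , eq) = [ (λ z → t , trans (ψ-level w z x) eq) ,
      (λ z → 1ℤ - t , trans (sum-ψ w x) (trans (cong₂ (λ s u → s + (1ℤ - s) * u) eq z) (lemma t))) ]′ h
    where
    lemma : ∀ t → + 2 * t + (1ℤ - + 2 * t) * + 2 ≡ + 2 * (1ℤ - t)
    lemma = solve-∀

  -- P contains the triangle, a point A of the fourth class of planes parallel to it, and exactly two points B, C at the other levels modulo 2.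
  record Config {G : Set} (K : Body G) : Set where
    open Body K
    field
      vertex : Vertices K
      A B C d m : Pt
      k : Fin 3
      PA : P A
      PB : P B
      PC : P C
      odd-A : A ≡ 𝟏 ⊕ + 2 • d
      link : B ⊕ C ⊕ (𝟏 ⊖ e k) ≡ + 2 • m
      even-B : Even (sum₃ B)
      even-C : Even (sum₃ C)
      only : ∀ x → P x → Even (sum₃ x) → x ≡ B ⊎ x ≡ C

  module _ {G : Set} (K : Body G) (ch : Chart) (S : Config K) where
    open Chart ch
    open InChart K ch
    open Config S

    -- A chart adds to x the multiple 1 - sum₃ x of w′. At odd levels this is an even multiple, so
    -- the class of A is kept; at even levels it is odd, and the additions to B and C together are
    -- even. Parities of levels are kept as well.
    charted : Config chart′
    charted = record
      { vertex = vertices vertex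
      ; A = ψ w′ A ; B = ψ w′ B ; C = ψ w′ C ; d = d ⊖ (1ℤ + sum₃ d) • w′
      ; m = m ⊕ (1ℤ - proj₁ even-B - proj₁ even-C) • w′ ; k = k
      ; PA = into {A} PA ; PB = into {B} PB ; PC = into {C} PC
      ; odd-A = trans (cong (ψ w′) odd-A) (odd-ψ d w′)
      ; link = trans (cong₂ (λ x y → x ⊕ y ⊕ (𝟏 ⊖ e k)) (ψ-at w′ {B} (proj₂ even-B)) (ψ-at w′ {C} (proj₂ even-C)))
          (vlia 7 (λ b c u v g m z → u :+ v := + 2 :* z ⇒ b :+ c :+ g := + 2 :* m ⇒ b :+ u :+ (c :+ v) :+ g := + 2 :* (m :+ z))
            B C ((1ℤ - + 2 * proj₁ even-B) • w′) ((1ℤ - + 2 * proj₁ even-C) • w′) (𝟏 ⊖ e k) m ((1ℤ - proj₁ even-B - proj₁ even-C) • w′)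
            (factor (proj₁ even-B) (proj₁ even-C) w′) link)
      ; even-B = ψ-even w′ sum-w′ B even-B ; even-C = ψ-even w′ sum-w′ C even-C
      ; only = λ x Px s → [ (λ z → inj₁ (trans (sym (right x)) (cong (ψ w′) z))) , (λ z → inj₂ (trans (sym (right x)) (cong (ψ w′) z))) ]′
          (only (ψ w x) (out {x} Px) (ψ-even w sum-w x s)) }
      where
      factor : ∀ b c w → (1ℤ - + 2 * b) • w ⊕ (1ℤ - + 2 * c) • w ≡ + 2 • ((1ℤ - b - c) • w)
      factor b c (x , y , z) = triple (lemma b c x) (lemma b c y) (lemma b c z)
        where
        lemma : ∀ b c x → (1ℤ - + 2 * b) * x + (1ℤ - + 2 * c) * x ≡ + 2 * ((1ℤ - b - c) * x)
        lemma = solve-∀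
      odd-ψ : ∀ d w → ψ w (𝟏 ⊕ + 2 • d) ≡ 𝟏 ⊕ + 2 • (d ⊖ (1ℤ + sum₃ d) • w)
      odd-ψ (a , b , c) (x , y , z) = triple (lemma a x) (lemma b y) (lemma c z)
        where
        lemma : ∀ d w → + 1 + + 2 * d + (1ℤ - (+ 1 + + 2 * a + (+ 1 + + 2 * b) + (+ 1 + + 2 * c))) * w ≡ + 1 + + 2 * (d - (1ℤ + (a + b + c)) * w)
        lemma d w = solve′ a b c d w
          where
          solve′ : ∀ a b c d w → + 1 + + 2 * d + (1ℤ - (+ 1 + + 2 * a + (+ 1 + + 2 * b) + (+ 1 + + 2 * c))) * w ≡ + 1 + + 2 * (d - (1ℤ + (a + b + c)) * w)
          solve′ = solve-∀

  Five Four : ∀ {G} → Body G → Pt → Set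
  Five K r = ∃ λ a → Body.P K a × + 5 • a ≡ + 2 • r ⊕ 𝟏 × sum₃ r ≡ + 6
  Four K r = ∃ λ b → Body.P K b × + 4 • b ≡ r ⊕ 𝟏 × sum₃ r ≡ + 5

  module _ {G : Set} where
    private
      height-of : ∀ S → + 4 ≤ S → ∃ λ n → S ≡ + suc n + 1ℤ × + 3 ≤ + suc n
      height-of (+ 0) (+≤+ ())
      height-of (+ 1) (+≤+ (ℕ.s≤s ()))
      height-of (+ suc (suc n)) (+≤+ (ℕ.s≤s h)) = n , cong +_ (ℕ.+-comm 1 (suc n)) , +≤+ h

    apex-positive : (K : Body G) → ∀ r → Vertices K → Body.P K r → + 4 ≤ sum₃ r → (∀ i → + 1 ≤ r at i) → Five K r ⊎ G
    apex-positive = sorting (λ K r → Vertices K → Body.P K r → + 4 ≤ sum₃ r → (∀ i → + 1 ≤ r at i) → Five K r ⊎ G)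
      (λ K r f v Pr s p → [ (λ { (a , Pa , eq , t) → inj₁ (flip₀₁ a , Pa , cong flip₀₁ eq , trans (sym (sum-flip₀₁ r)) t) }) , inj₂ ]′
        (f (vertices₀₁ K v) Pr (subst (+ 4 ≤_) (sym (sum-flip₀₁ r)) s) (axes (p x₁) (p x₀) (p x₂))))
      (λ K r f v Pr s p → [ (λ { (a , Pa , eq , t) → inj₁ (flip₁₂ a , Pa , cong flip₁₂ eq , trans (sym (sum-flip₁₂ r)) t) }) , inj₂ ]′
        (f (vertices₁₂ K v) Pr (subst (+ 4 ≤_) (sym (sum-flip₁₂ r)) s) (axes (p x₀) (p x₂) (p x₁))))
      (λ { K (r₀ , r₁ , r₂) h k v Pr s p → let n , t , u = height-of (r₀ + r₁ + r₂) s in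
        Triangle.Level.Positive.goal K v r₀ r₁ r₂ n Pr t h k (p x₂) u })

    apex-nonpositive : (K : Body G) → ∀ r → Vertices K → Body.P K r → + 4 ≤ sum₃ r → r at x₀ ≤ 0ℤ → + 1 ≤ r at x₁ → + 1 ≤ r at x₂ →
      1ℤ + r at x₁ ≤ sum₃ r → 1ℤ + r at x₂ ≤ sum₃ r → Four K r ⊎ G
    apex-nonpositive K r v Pr s r₀≤0 r₁≥1 r₂≥1 r₁<S r₂<S = [ (λ h → sorted K r v Pr s r₀≤0 r₂≥1 r₁<S h) , (λ h → back (sorted (flipped₁₂ K) (flip₁₂ r) (vertices₁₂ K v) Pr
        (subst (+ 4 ≤_) (sym (sum-flip₁₂ r)) s) r₀≤0 r₁≥1 (subst (1ℤ + r at x₂ ≤_) (sym (sum-flip₁₂ r)) r₂<S)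
        (lia 2 (λ a b → con 1ℤ :+ a :≤ b ⇒ a :≤ b) (r at x₁) (r at x₂) h))) ]′ (by-cases (r at x₂) (r at x₁))
      where
      back : Four (flipped₁₂ K) (flip₁₂ r) ⊎ G → Four K r ⊎ G
      back = [ (λ { (b , Pb , eq , t) → inj₁ (flip₁₂ b , Pb , cong flip₁₂ eq , trans (sym (sum-flip₁₂ r)) t) }) , inj₂ ]′
      sorted : (K : Body G) → ∀ r → Vertices K → Body.P K r → + 4 ≤ sum₃ r → r at x₀ ≤ 0ℤ → + 1 ≤ r at x₂ → 1ℤ + r at x₁ ≤ sum₃ r → r at x₂ ≤ r at x₁ → Four K r ⊎ G
      sorted K (r₀ , r₁ , r₂) v Pr s z p q o = let n , t , u = height-of (r₀ + r₁ + r₂) s in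
        Triangle.Level.Nonpositive.goal K v r₀ r₁ r₂ n Pr t z o p
          (lia 3 (λ r s h → con 1ℤ :+ r :≤ s ⇒ s := h :+ con 1ℤ ⇒ r :≤ h) r₁ (r₀ + r₁ + r₂) (+ suc n) q t) u

    -- A shear brings the last two coordinates into [1, h].
    apex : (K : Body G) → ∀ r → Vertices K → Body.P K r → + 4 ≤ sum₃ r → Five K r ⊎ Four K r ⊎ G
    apex K r v Pr s = [ (λ h → [ (λ f → inj₂ (inj₁ (four f))) , (λ g → inj₂ (inj₂ g)) ]′
          (apex-nonpositive chart′ c (vertices v) (into {r} Pr) s′ h (proj₁ c₁) (proj₁ c₂) (proj₂ c₁) (proj₂ c₂))) ,
        (λ h → [ (λ f → inj₁ (five f)) , (λ g → inj₂ (inj₂ g)) ]′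
          (apex-positive chart′ c (vertices v) (into {r} Pr) s′ (axes (subst (_≤ c at x₀) (ℤ.+-identityʳ 1ℤ) h) (proj₁ c₁) (proj₁ c₂)))) ]′
        (by-cases (c at x₀) 0ℤ)
      where
      H = height-of (sum₃ r) s
      n = proj₁ H
      -- Subtracting 1 before reduction modulo h gives representatives 1 to h rather than 0 to h -
      -- 1.
      R₁ = residue n (r at x₁ - 1ℤ)
      R₂ = residue n (r at x₂ - 1ℤ)
      d₁ = proj₁ (proj₂ R₁)
      d₂ = proj₁ (proj₂ R₂)
      w₀ : Pt
      w₀ = d₁ + d₂ , - d₁ , - d₂
      sum-w₀ : sum₃ w₀ ≡ 0ℤ
      sum-w₀ = lemma d₁ d₂
        where
        lemma : ∀ a b → a + b + - a + - b ≡ 0ℤ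
        lemma = solve-∀
      ch = shear w₀ sum-w₀
      open Chart ch using (w′; left)
      open InChart K ch
      c = ψ w′ r
      sum-c : sum₃ c ≡ sum₃ r
      sum-c = ψ-level w′ (negate-sum w₀ sum-w₀) r
      s′ : + 4 ≤ sum₃ c
      s′ = subst (+ 4 ≤_) (sym sum-c) s
      reduced : ∀ x S (R : Fin (suc n)) d → S ≡ + suc n + 1ℤ → x - 1ℤ ≡ + toℕ R + + suc n * d → x + (1ℤ - S) * (+ 0 - - d) ≡ + toℕ R + 1ℤ
      reduced x S R d refl h = trans (lemma x (+ suc n) d) (trans (cong (λ y → y - + suc n * d + 1ℤ) h) (lemma′ (+ toℕ R) (+ suc n * d)))
        where
        lemma : ∀ x h d → x + (1ℤ - (h + 1ℤ)) * (+ 0 - - d) ≡ x - 1ℤ - h * d + 1ℤ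
        lemma = solve-∀
        lemma′ : ∀ a b → a + b - b + 1ℤ ≡ a + 1ℤ
        lemma′ = solve-∀
      range : ∀ x (R : Fin (suc n)) → x ≡ + toℕ R + 1ℤ → + 1 ≤ x × 1ℤ + x ≤ sum₃ c
      range x R h = lia 2 (λ x t → x := t :+ con 1ℤ ⇒ con 0ℤ :≤ t ⇒ con (+ 1) :≤ x) x (+ toℕ R) h (+≤+ ℕ.z≤n) ,
        lia 4 (λ x t m S → x := t :+ con 1ℤ ⇒ con 1ℤ :+ t :≤ m ⇒ S := m :+ con 1ℤ ⇒ con 1ℤ :+ x :≤ S) x (+ toℕ R) (+ suc n) (sum₃ c) h (+≤+ (toℕ<n R)) (trans sum-c (proj₁ (proj₂ H)))
      c₁ = range (c at x₁) (proj₁ R₁) (reduced (r at x₁) (sum₃ r) (proj₁ R₁) d₁ (proj₁ (proj₂ H)) (proj₂ (proj₂ R₁)))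
      c₂ = range (c at x₂) (proj₁ R₂) (reduced (r at x₂) (sum₃ r) (proj₁ R₂) d₂ (proj₁ (proj₂ H)) (proj₂ (proj₂ R₂)))

      five : Five chart′ c → Five K r
      five (a , Pa , eq , t) = ψ w₀ a , out {a} Pa ,
          trans (cong (+ 5 •_) (ψ-at w₀ {a} sum-a))
            (trans (vlia 3 (λ a c w → + 5 :* a := + 2 :* c :+ con 1ℤ ⇒ + 5 :* (a :+ (- + 2) :* w) := + 2 :* (c :+ (- + 5) :* w) :+ con 1ℤ) a c w₀ eq)
              (cong (λ y → + 2 • y ⊕ 𝟏) (trans (sym (ψ-at w₀ {c} t)) (left r)))) , trans (sym sum-c) t
        where
        sum-a : sum₃ a ≡ + 3
        sum-a = lia 2 (λ a c → + 5 :* a := + 2 :* c :+ con (+ 3) ⇒ c := con (+ 6) ⇒ a := con (+ 3)) (sum₃ a) (sum₃ c)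
          (trans (sym (sum₃-• (+ 5) a)) (trans (cong sum₃ eq) (trans (sum₃-⊕ (+ 2 • c) 𝟏) (cong (_+ + 3) (sum₃-• (+ 2) c))))) t

      four : Four chart′ c → Four K r
      four (b , Pb , eq , t) = ψ w₀ b , out {b} Pb ,
          trans (cong (+ 4 •_) (ψ-at w₀ {b} sum-b))
            (trans (vlia 3 (λ b c w → + 4 :* b := c :+ con 1ℤ ⇒ + 4 :* (b :+ (- + 1) :* w) := c :+ (- + 4) :* w :+ con 1ℤ) b c w₀ eq)
              (cong (λ y → y ⊕ 𝟏) (trans (sym (ψ-at w₀ {c} t)) (left r)))) , trans (sym sum-c) t
        where
        sum-b : sum₃ b ≡ + 2
        sum-b = lia 2 (λ b c → + 4 :* b := c :+ con (+ 3) ⇒ c := con (+ 5) ⇒ b := con (+ 2)) (sum₃ b) (sum₃ c)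
          (trans (sym (sum₃-• (+ 4) b)) (trans (cong sum₃ eq) (trans (sum₃-⊕ c 𝟏) refl))) t

-- Explicit certificates for the remaining positions

module SmallCases where

  open import Data.Integer using (_+_; _*_; -_; _-_; +≤+)
  open import Relation.Nullary.Decidable using (True; toWitness)
  open LinearArithmetic
  open Cones using (_•_; triple)
  open Bodies
  open Midpoints hiding (S; M)
  open MidpointTable
  open Trios
  open Packing
  open PlanePairs
  open Frames
  open Apexes
  open NearPoints
  open RingPoints
  open Configurations

  data Six : Set where
    t₀₀ t₀₁ t₀₂ t₁₁ t₁₂ t₂₂ : Six

  six : Six → Pt
  six t₀₀ = + 2 , + 0 , + 0
  six t₀₁ = + 1 , + 1 , + 0
  six t₀₂ = + 1 , + 0 , + 1
  six t₁₁ = + 0 , + 2 , + 0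
  six t₁₂ = + 0 , + 1 , + 1
  six t₂₂ = + 0 , + 0 , + 2

  unordered : ∀ a b → ∃ λ t → e a ⊕ e b ≡ six t
  unordered zero zero = t₀₀ , refl
  unordered zero (suc zero) = t₀₁ , refl
  unordered zero (suc (suc zero)) = t₀₂ , refl
  unordered (suc zero) zero = t₀₁ , refl
  unordered (suc zero) (suc zero) = t₁₁ , refl
  unordered (suc zero) (suc (suc zero)) = t₁₂ , refl
  unordered (suc (suc zero)) zero = t₀₂ , refl
  unordered (suc (suc zero)) (suc zero) = t₁₂ , refl
  unordered (suc (suc zero)) (suc (suc zero)) = t₂₂ , refl

  -- The point C determined by B + C + (𝟏 − eₖ) = 2 n for a point n of the doubled triangle.
  partner : Pt → Fin 3 → Six → Pt
  partner B k t = + 2 • six t ⊖ B ⊖ (𝟏 ⊖ e k)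

  module Certificates {G : Set} (K : Body G) (v : Vertices K) where
    open Body K
    open Rules K
    open Triangle K v
    open FlatFacts K v

    fifth : ∀ a {b p q x} → P p → P q → + 5 • x ≡ + a • p ⊕ + b • q → {True (a ℕ.+ b ℕ.≟ 5)} → P x
    fifth a {b} {p} {q} Pp Pq h {t} = hull-÷ 4 (subst₂ hull sum (sym h) (hull-+ (hull-* (+ a) (+≤+ ℕ.z≤n) (point Pp)) (hull-* (+ b) (+≤+ ℕ.z≤n) (point Pq))))
      where
      sum : + a * 1ℤ + + b * 1ℤ ≡ + 5
      sum = trans (cong₂ _+_ (ℤ.*-identityʳ (+ a)) (ℤ.*-identityʳ (+ b))) (cong +_ (toWitness t))

    module _ (PA : P 𝟏) (PB : P (+ 1 , + 1 , + 0)) where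
      -- The choices of k and t leave eighteen positions of C. Each has an explicit witness: two
      -- points of P + Q congruent modulo 3, a parallelogram in P, or a segment with midpoint and a
      -- parallel copy.
      neighbour : ∀ k t → P (partner (+ 1 , + 1 , + 0) k t) → G
      neighbour zero t₀₀ PC = exactly (λ ()) (tripled (+ 1 , + 1 , + 2) (+ 4 , - + 2 , - + 1) (translate PA (suc (suc zero))) (translate PC zero) ((- + 1 , + 1 , + 1) , refl))
      neighbour zero t₀₁ PC = parallelogram (+ 1 , + 0 , + 0) (+ 1 , + 1 , + 1) (+ 1 , + 0 , - + 1) (+ 1 , + 1 , + 0) (v zero) PA PC PB refl (λ ()) (λ ())
      neighbour zero t₀₂ PC = exactly (λ ()) (tripled (+ 2 , + 1 , + 1) (+ 2 , - + 2 , + 1) (translate PA zero) (translate PC zero) ((+ 0 , + 1 , + 0) , refl))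
      neighbour zero t₁₁ PC = doubled (+ 0 , + 1 , + 1) (+ 2 , + 1 , + 1) (- + 1 , + 1 , - + 1) (+ 1 , + 1 , + 1) (λ ()) (λ ()) refl (translate (v (suc zero)) (suc (suc zero))) (translate PA zero) (translate PC (suc (suc zero))) (translate PB (suc zero))
      neighbour zero t₁₂ PC = parallelogram (+ 0 , + 1 , + 0) (+ 1 , + 1 , + 0) (- + 1 , + 0 , + 1) (+ 0 , + 0 , + 1) (v (suc zero)) PB PC (v (suc (suc zero))) refl (λ ()) (λ ())
      neighbour zero t₂₂ PC = exactly (λ ()) (tripled (+ 2 , + 1 , + 1) (- + 1 , - + 2 , + 4) (translate PA zero) (translate PC (suc (suc zero))) ((+ 1 , + 1 , - + 1) , refl))
      neighbour (suc zero) t₀₀ PC = doubled (+ 1 , + 0 , + 1) (+ 1 , + 2 , + 1) (+ 1 , - + 1 , - + 1) (+ 1 , + 1 , + 1) (λ ()) (λ ()) refl (translate (v zero) (suc (suc zero))) (translate PA (suc zero)) (translate PC (suc (suc zero))) (translate PB zero)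
      neighbour (suc zero) t₀₁ PC = parallelogram (+ 0 , + 1 , + 0) (+ 1 , + 1 , + 1) (+ 0 , + 1 , - + 1) (+ 1 , + 1 , + 0) (v (suc zero)) PA PC PB refl (λ ()) (λ ())
      neighbour (suc zero) t₀₂ PC = parallelogram (+ 1 , + 0 , + 0) (+ 1 , + 1 , + 0) (+ 0 , - + 1 , + 1) (+ 0 , + 0 , + 1) (v zero) PB PC (v (suc (suc zero))) refl (λ ()) (λ ())
      neighbour (suc zero) t₁₁ PC = exactly (λ ()) (tripled (+ 1 , + 1 , + 2) (- + 2 , + 4 , - + 1) (translate PA (suc (suc zero))) (translate PC (suc zero)) ((+ 1 , - + 1 , + 1) , refl))
      neighbour (suc zero) t₁₂ PC = exactly (λ ()) (tripled (+ 2 , + 1 , + 1) (- + 1 , + 1 , + 1) (translate PA zero) (translate PC zero) ((+ 1 , + 0 , + 0) , refl))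
      neighbour (suc zero) t₂₂ PC = exactly (λ ()) (tripled (+ 1 , + 2 , + 1) (- + 2 , - + 1 , + 4) (translate PA (suc zero)) (translate PC (suc (suc zero))) ((+ 1 , + 1 , - + 1) , refl))
      neighbour (suc (suc zero)) t₀₀ PC = exactly (λ ()) (tripled (+ 2 , + 1 , + 1) (+ 2 , - + 2 , + 1) (translate PA zero) (translate PC (suc (suc zero))) ((+ 0 , + 1 , + 0) , refl))
      neighbour (suc (suc zero)) t₀₁ PC = parallelogram (+ 1 , + 0 , + 0) (+ 1 , + 1 , + 0) (+ 0 , + 0 , + 0) (+ 0 , + 1 , + 0) (v zero) PB PC (v (suc zero)) refl (λ ()) (λ ())
      neighbour (suc (suc zero)) t₀₂ PC = exactly (λ ()) (tripled (+ 1 , + 1 , + 2) (+ 1 , - + 2 , + 2) (translate PA (suc (suc zero))) (translate PC zero) ((+ 0 , + 1 , + 0) , refl))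
      neighbour (suc (suc zero)) t₁₁ PC = exactly (λ ()) (tripled (+ 1 , + 2 , + 1) (- + 2 , + 2 , + 1) (translate PA (suc zero)) (translate PC (suc (suc zero))) ((+ 1 , + 0 , + 0) , refl))
      neighbour (suc (suc zero)) t₁₂ PC = exactly (λ ()) (tripled (+ 1 , + 1 , + 2) (- + 2 , + 1 , + 2) (translate PA (suc (suc zero))) (translate PC (suc zero)) ((+ 1 , + 0 , + 0) , refl))
      neighbour (suc (suc zero)) t₂₂ PC = exactly (λ ()) (tripled (+ 2 , + 1 , + 1) (- + 1 , - + 2 , + 4) (translate PA zero) (translate PC zero) ((+ 1 , + 1 , - + 1) , refl))

    module _ (PA : P (- + 1 , + 3 , + 3)) (PB : P (+ 0 , + 1 , + 1)) where
      private
        -- The midpoint of A ⊕ e₀ = (0,3,3) and e₁ ⊕ e₂ = (0,1,1), a point of P + Q on which twelve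
        -- of the eighteen cases rest.
        Xz : X (+ 0 , + 2 , + 2)
        Xz = middle (+ 0 , + 2 , + 2) (translate PA zero) (edge-sum (suc zero) (suc (suc zero))) refl

      quadrupled : ∀ k t → P (partner (+ 0 , + 1 , + 1) k t) → G
      quadrupled zero t₀₀ PC = exactly (λ ()) (congruent (+ 3 , - + 1 , - + 1) (+ 1 , + 1 , + 1) (fifth 1 {4} PA PC refl) (fifth 3 {2} PA PC refl) ((+ 1 , - + 1 , - + 1) , refl))
      quadrupled zero t₀₁ PC = doubled (+ 2 , + 0 , + 0) (+ 0 , + 2 , + 2) (+ 0 , + 0 , - + 1) (+ 1 , + 1 , + 1) (λ ()) (λ ()) refl (translate (v zero) zero) Xz (translate PC (suc (suc zero))) (translate PB (suc zero))
      quadrupled zero t₀₂ PC = doubled (+ 2 , + 0 , + 0) (+ 0 , + 2 , + 2) (+ 0 , - + 1 , + 0) (+ 1 , + 1 , + 1) (λ ()) (λ ()) refl (translate (v zero) zero) Xz (translate PC (suc zero)) (translate PB (suc (suc zero)))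
      quadrupled zero t₁₁ PC = exactly (λ ()) (tripled (+ 0 , + 2 , - + 1) (+ 0 , + 2 , + 2) (translate PC (suc (suc zero))) Xz ((+ 0 , + 0 , - + 1) , refl))
      quadrupled zero t₁₂ PC = parallelogram (+ 0 , + 1 , + 0) (+ 0 , + 1 , + 1) (+ 0 , + 0 , + 0) (+ 0 , + 0 , + 1) (v (suc zero)) PB PC (v (suc (suc zero))) refl (λ ()) (λ ())
      quadrupled zero t₂₂ PC = exactly (λ ()) (tripled (+ 0 , - + 1 , + 2) (+ 0 , + 2 , + 2) (translate PC (suc zero)) Xz ((+ 0 , - + 1 , + 0) , refl))
      quadrupled (suc zero) t₀₀ PC = exactly (λ ()) (tripled (+ 3 , - + 1 , - + 1) (+ 0 , + 2 , + 2) (translate PC (suc (suc zero))) Xz ((+ 1 , - + 1 , - + 1) , refl))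
      quadrupled (suc zero) t₀₁ PC = doubled (+ 0 , + 2 , + 0) (+ 0 , + 2 , + 2) (+ 1 , - + 1 , - + 1) (+ 0 , + 2 , + 1) (λ ()) (λ ()) refl (translate (v (suc zero)) (suc zero)) Xz (translate PC (suc (suc zero))) (translate PB zero)
      quadrupled (suc zero) t₀₂ PC = parallelogram (+ 1 , + 0 , + 0) (+ 0 , + 1 , + 1) (+ 1 , - + 1 , + 0) (+ 0 , + 0 , + 1) (v zero) PB PC (v (suc (suc zero))) refl (λ ()) (λ ())
      quadrupled (suc zero) t₁₁ PC = exactly (λ ()) (congruent (- + 1 , + 3 , - + 1) (- + 1 , + 3 , + 1) (fifth 1 {4} PA PC refl) (fifth 3 {2} PA PC refl) ((+ 0 , + 0 , - + 1) , refl))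
      quadrupled (suc zero) t₁₂ PC = doubled (+ 0 , + 2 , + 0) (+ 0 , + 2 , + 2) (+ 0 , - + 1 , + 0) (+ 0 , + 2 , + 1) (λ ()) (λ ()) refl (translate (v (suc zero)) (suc zero)) Xz (translate PC zero) (translate PB (suc (suc zero)))
      quadrupled (suc zero) t₂₂ PC = exactly (λ ()) (tripled (+ 0 , - + 1 , + 2) (+ 0 , + 2 , + 2) (translate PC zero) Xz ((+ 0 , - + 1 , + 0) , refl))
      quadrupled (suc (suc zero)) t₀₀ PC = exactly (λ ()) (tripled (+ 3 , - + 1 , - + 1) (+ 0 , + 2 , + 2) (translate PC (suc zero)) Xz ((+ 1 , - + 1 , - + 1) , refl))
      quadrupled (suc (suc zero)) t₀₁ PC = parallelogram (+ 1 , + 0 , + 0) (+ 0 , + 1 , + 1) (+ 1 , + 0 , - + 1) (+ 0 , + 1 , + 0) (v zero) PB PC (v (suc zero)) refl (λ ()) (λ ())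
      quadrupled (suc (suc zero)) t₀₂ PC = doubled (+ 0 , + 0 , + 2) (+ 0 , + 2 , + 2) (+ 1 , - + 1 , - + 1) (+ 0 , + 1 , + 2) (λ ()) (λ ()) refl (translate (v (suc (suc zero))) (suc (suc zero))) Xz (translate PC (suc zero)) (translate PB zero)
      quadrupled (suc (suc zero)) t₁₁ PC = exactly (λ ()) (tripled (+ 0 , + 2 , - + 1) (+ 0 , + 2 , + 2) (translate PC zero) Xz ((+ 0 , + 0 , - + 1) , refl))
      quadrupled (suc (suc zero)) t₁₂ PC = doubled (+ 0 , + 0 , + 2) (+ 0 , + 2 , + 2) (+ 0 , + 0 , - + 1) (+ 0 , + 1 , + 2) (λ ()) (λ ()) refl (translate (v (suc (suc zero))) (suc (suc zero))) Xz (translate PC zero) (translate PB (suc zero))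
      quadrupled (suc (suc zero)) t₂₂ PC = exactly (λ ()) (congruent (- + 1 , - + 1 , + 3) (- + 1 , + 1 , + 3) (fifth 1 {4} PA PC refl) (fifth 3 {2} PA PC refl) ((+ 0 , - + 1 , + 0) , refl))

-- P contains a translate of Q: the levels of the other points

module TriangleCase where

  open import Data.Fin.Properties using (any?)
  open import Data.Integer using (_+_; _*_; -_; _-_; _≤_; +≤+)
  open import Relation.Nullary.Decidable using (from-no)
  open LinearArithmetic
  open Cones using (_•_; triple)
  open Bodies
  open Congruences
  open Midpoints hiding (S; M)
  open MidpointTable
  open Trios
  open Packing
  open PlanePairs
  open Frames
  open Apexes
  open NearPoints
  open RingPoints
  open Configurations
  open SmallCases

  odd-5 : ¬ Even (+ 5)
  odd-5 (t , h) = from-no (mod? 2 (+ 5) 0ℤ) (t , trans h (sym (ℤ.+-identityˡ (+ 2 * t))))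

  module _ {G : Set} where
    exchanged : {K : Body G} → Config K → Config K
    exchanged S = record
      { vertex = vertex ; A = A ; B = C ; C = B ; d = d ; m = m ; k = k ; PA = PA ; PB = PC ; PC = PB ; odd-A = odd-A
      ; link = trans (vlia 3 (λ b c g → c :+ b :+ g := b :+ c :+ g) B C (𝟏 ⊖ e k)) link
      ; even-B = even-C ; even-C = even-B ; only = λ x Px s → [ inj₂ , inj₁ ]′ (only x Px s) }
      where open Config S

    -- The even points are at levels 0 and 2 unless one of them determines A = (1,1,1) by 5 A = 2 x + 𝟏.
    data Place (A x : Pt) : Set where
      zeroth : sum₃ x ≡ 0ℤ → Place A x
      second : sum₃ x ≡ + 2 → Place A x
      sixth : + 5 • A ≡ + 2 • x ⊕ 𝟏 → sum₃ A ≡ + 3 → Place A x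

    -- Of the exceptional apexes, `Four` has the odd level 5. `Five` yields a point congruent to 𝟏
    -- modulo 2, which is the class of A, so it is A or a box exists.
    high : (K : Body G) (S : Config K) → ∀ x → Body.P K x → Even (sum₃ x) → + 4 ≤ sum₃ x → (+ 5 • Config.A S ≡ + 2 • x ⊕ 𝟏 × sum₃ (Config.A S) ≡ + 3) ⊎ G
    high K S x Px s h = [ five , [ (λ { (_ , _ , _ , t) → ⊥-elim (odd-5 (subst Even t s)) }) , inj₂ ]′ ]′ (apex K x vertex Px h)
      where
      open Body K
      open Rules K
      open Config S
      five : Five K x → _
      five (a , Pa , eq , t) = [ (λ z → inj₁ (exact (trans (cong (+ 5 •_) (sym z)) eq))) , inj₂ ]′
        (congruent a A Pa PA (x ⊖ + 2 • a ⊖ d , vlia 4 (λ a x A d → + 5 :* a := + 2 :* x :+ con 1ℤ ⇒ A := con 1ℤ :+ + 2 :* d ⇒ a := A :+ + 2 :* (x :- + 2 :* a :- d))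
          a x A d eq odd-A))
        where
        exact : + 5 • A ≡ + 2 • x ⊕ 𝟏 → + 5 • A ≡ + 2 • x ⊕ 𝟏 × sum₃ A ≡ + 3
        exact q = q , lia 2 (λ A x → + 5 :* A := + 2 :* x :+ con (+ 3) ⇒ x := con (+ 6) ⇒ A := con (+ 3)) (sum₃ A) (sum₃ x)
          (trans (sym (sum₃-• (+ 5) A)) (trans (cong sum₃ q) (trans (sum₃-⊕ (+ 2 • x) 𝟏) (cong (_+ + 3) (sum₃-• (+ 2) x))))) t

    -- Reflection raises x to level at least 4. The exceptional case would put the reflected A at
    -- level 3, but it lies at level -1 or lower.
    low : (K : Body G) (S : Config K) → + 3 ≤ sum₃ (Config.A S) → ∀ x → Body.P K x → Even (sum₃ x) → sum₃ x ≤ - + 2 → G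
    low K S hA x Px s h = [ (λ { (_ , t) → ⊥-elim (lia 2 (λ a b → b := con (+ 2) :- a ⇒ con (+ 3) :≤ a ⇒ b := con (+ 3) ⇒ absurd) (sum₃ A) (sum₃ (ψ mirror A)) (sum-mirror A) hA t) }) , (λ g → g) ]′
      (high chart′ (charted K reflect S) (ψ mirror x) (into {x} Px) (ψ-even mirror (inj₂ refl) x s)
        (lia 2 (λ a b → b := con (+ 2) :- a ⇒ a :≤ con (- + 2) ⇒ con (+ 4) :≤ b) (sum₃ x) (sum₃ (ψ mirror x)) (sum-mirror x) h))
      where
      open Config S
      open InChart K reflect

    place : (K : Body G) (S : Config K) → + 3 ≤ sum₃ (Config.A S) → ∀ x → Body.P K x → Even (sum₃ x) → Place (Config.A S) x ⊎ G
    place K S hA x Px s@(t , eq) = [ (λ h → inj₂ (low K S hA x Px s (lia 2 (λ x t → x := + 2 :* t ⇒ con 1ℤ :+ t :≤ con 0ℤ ⇒ x :≤ con (- + 2)) (sum₃ x) t eq h))) ,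
        (λ h → [ (λ l → inj₁ (zeroth (lia 2 (λ x t → x := + 2 :* t ⇒ con 0ℤ :≤ t ⇒ t :≤ con 0ℤ ⇒ x := con 0ℤ) (sum₃ x) t eq h l))) ,
          (λ l → [ (λ u → inj₁ (second (lia 2 (λ x t → x := + 2 :* t ⇒ con 1ℤ :≤ t ⇒ t :≤ con 1ℤ ⇒ x := con (+ 2)) (sum₃ x) t eq l u))) ,
              (λ u → [ (λ { (q , r) → inj₁ (sixth q r) }) , inj₂ ]′ (high K S x Px s (lia 2 (λ x t → x := + 2 :* t ⇒ con (+ 2) :≤ t ⇒ con (+ 4) :≤ x) (sum₃ x) t eq u))) ]′ (by-cases t 1ℤ)) ]′ (by-cases t 0ℤ)) ]′
      (reorder (by-cases 0ℤ t))
      where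
      reorder : 0ℤ ≤ t ⊎ 1ℤ + t ≤ 0ℤ → 1ℤ + t ≤ 0ℤ ⊎ 0ℤ ≤ t
      reorder = [ inj₂ , inj₁ ]′

    module Cases (K : Body G) (S : Config K) where
      open Body K
      open Rules K
      open Config S
      open FlatFacts K vertex

      i j : Fin 3
      i = next k
      j = next (next k)

      i≢j : i ≢ j
      i≢j = ≢-sym (next≢ i)

      ijk : e i ⊕ e j ⊕ e k ≡ 𝟏
      ijk = trans (vlia 3 (λ i j k → i :+ j :+ k := k :+ i :+ j) (e i) (e j) (e k)) (e-cyclic k)

      linked : Linked B C i j m
      linked = vlia 7 (λ b c i j k o m → i :+ j :+ k := o ⇒ b :+ c :+ (o :- k) := + 2 :* m ⇒ b :+ c :+ i :+ j := + 2 :* m) B C (e i) (e j) (e k) 𝟏 m ijk link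

      sum-g : sum₃ (𝟏 ⊖ e k) ≡ + 2
      sum-g = trans (sum₃-⊖ 𝟏 (e k)) (cong (_-_ (+ 3)) (sum₃-e k))

      both-second : sum₃ B ≡ + 2 → sum₃ C ≡ + 2 → G
      both-second = same-side {B} {C} {i} {j} {m} PB PC i≢j linked

      -- This treats every midpoint m outside the doubled triangle. The six lattice points inside it
      -- determine C from B and are left to the certificates.
      across : sum₃ B ≡ + 2 → sum₃ C ≡ 0ℤ → (∀ a b → m ≢ e a ⊕ e b) → G
      across sB sC = opposite-levels K m vertex (B ⊕ C) (𝟏 ⊖ e k) (hull-+ (point PB) (point PC)) link (g≥0 k) (g≤1 k) sum-g
        (lia 4 (λ m b c g → b :+ c :+ g := + 2 :* m ⇒ b := con (+ 2) ⇒ c := con 0ℤ ⇒ g := con (+ 2) ⇒ m := con (+ 2)) (sum₃ m) (sum₃ B) (sum₃ C) (sum₃ (𝟏 ⊖ e k))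
          (trans (sym (trans (sum₃-⊕ (B ⊕ C) (𝟏 ⊖ e k)) (cong (_+ sum₃ (𝟏 ⊖ e k)) (sum₃-⊕ B C)))) (trans (cong sum₃ link) (sum₃-• (+ 2) m))) sB sC sum-g)
        where
        g≥0 : ∀ k i → 0ℤ ≤ (𝟏 ⊖ e k) at i
        g≥0 = from-yes′
          where
          from-yes′ : ∀ k i → 0ℤ ≤ (𝟏 ⊖ e k) at i
          from-yes′ zero = axes (+≤+ ℕ.z≤n) (+≤+ ℕ.z≤n) (+≤+ ℕ.z≤n)
          from-yes′ (suc zero) = axes (+≤+ ℕ.z≤n) (+≤+ ℕ.z≤n) (+≤+ ℕ.z≤n)
          from-yes′ (suc (suc zero)) = axes (+≤+ ℕ.z≤n) (+≤+ ℕ.z≤n) (+≤+ ℕ.z≤n)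
        g≤1 : ∀ k i → (𝟏 ⊖ e k) at i ≤ 1ℤ
        g≤1 zero = axes (+≤+ ℕ.z≤n) ℤ.≤-refl ℤ.≤-refl
        g≤1 (suc zero) = axes ℤ.≤-refl (+≤+ ℕ.z≤n) ℤ.≤-refl
        g≤1 (suc (suc zero)) = axes ℤ.≤-refl ℤ.≤-refl (+≤+ ℕ.z≤n)

      edge? : Dec (∃ λ a → ∃ λ b → m ≡ e a ⊕ e b)
      edge? = any? λ a → any? λ b → m ≟ (e a ⊕ e b)

      partner≡ : ∀ {b a a′} → B ≡ b → m ≡ e a ⊕ e a′ → C ≡ partner b k (proj₁ (unordered a a′))
      partner≡ {b} {a} {a′} hB hm = vlia 6 (λ B C g m b t → B :+ C :+ g := + 2 :* m ⇒ B := b ⇒ m := t ⇒ C := + 2 :* t :- b :- g)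
        B C (𝟏 ⊖ e k) m b (six (proj₁ (unordered a a′))) link hB (trans hm (proj₂ (unordered a a′)))

      P≡ : ∀ {x y} → x ≡ y → P x → P y
      P≡ refl h = h

    private
      moved : ∀ {x y} (K : Body G) → x ≡ y → Body.P K x → Body.P K y
      moved K refl h = h

    -- B is 𝟏 minus a unit vector. Permutations of the coordinates reduce all three choices to
    -- (1,1,0), for which the certificates are written.
    Neighbours : Fin 3 → Set₁
    Neighbours l = (K : Body G) → Vertices K → Body.P K 𝟏 → Body.P K (𝟏 ⊖ e l) → ∀ C k a b → Body.P K C →
      (𝟏 ⊖ e l) ⊕ C ⊕ (𝟏 ⊖ e k) ≡ + 2 • (e a ⊕ e b) → G

    neighbours₂ : Neighbours (suc (suc zero))
    neighbours₂ K v PA PB C k a b PC h = Certificates.neighbour K v PA PB k (proj₁ (unordered a b))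
      (moved K (vlia 4 (λ b C g t → b :+ C :+ g := + 2 :* t ⇒ C := + 2 :* t :- b :- g) (+ 1 , + 1 , + 0) C (𝟏 ⊖ e k) (six (proj₁ (unordered a b)))
        (trans h (cong (+ 2 •_) (proj₂ (unordered a b))))) PC)

    neighbours₁ : Neighbours (suc zero)
    neighbours₁ K v PA PB C k a b PC h = neighbours₂ (flipped₁₂ K) (vertices₁₂ K v) PA PB (flip₁₂ C) (swap₁₂ k) (swap₁₂ a) (swap₁₂ b) PC
      (trans (cong (λ g → (𝟏 ⊖ e₂) ⊕ flip₁₂ C ⊕ (𝟏 ⊖ g)) (sym (flip₁₂-e k))) (trans (cong flip₁₂ h) (cong₂ (λ x y → + 2 • (x ⊕ y)) (flip₁₂-e a) (flip₁₂-e b))))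

    neighbours₀ : Neighbours zero
    neighbours₀ K v PA PB C k a b PC h = neighbours₁ (flipped₀₁ K) (vertices₀₁ K v) PA PB (flip₀₁ C) (swap₀₁ k) (swap₀₁ a) (swap₀₁ b) PC
      (trans (cong (λ g → (𝟏 ⊖ e₁) ⊕ flip₀₁ C ⊕ (𝟏 ⊖ g)) (sym (flip₀₁-e k))) (trans (cong flip₀₁ h) (cong₂ (λ x y → + 2 • (x ⊕ y)) (flip₀₁-e a) (flip₀₁-e b))))

    neighbours : ∀ l → Neighbours l
    neighbours zero = neighbours₀
    neighbours (suc zero) = neighbours₁
    neighbours (suc (suc zero)) = neighbours₂

    module UnitApex (K : Body G) (S : Config K) (A≡𝟏 : Config.A S ≡ 𝟏) where
      open Body K
      open Rules K
      open Config S
      open Cases K S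
      open FlatFacts K vertex

      P𝟏 : P 𝟏
      P𝟏 = P≡ A≡𝟏 PA

      -- C is at another level and every even point is B or C, so B is the only point of P at level
      -- 2, as `next-level` requires.
      adjacent : sum₃ B ≡ + 2 → sum₃ C ≢ + 2 → (∃ λ l → B ≡ 𝟏 ⊖ e l) ⊎ G
      adjacent sB sC = go (any? λ l → D ≟ e l)
        where
        D = 𝟏 ⊖ B
        B≡ : B ≡ 𝟏 ⊖ D
        B≡ = vlia 2 (λ b o → b := o :- (o :- b)) B 𝟏
        go : Dec (∃ λ l → D ≡ e l) → (∃ λ l → B ≡ 𝟏 ⊖ e l) ⊎ G
        go (yes (l , h)) = inj₁ (l , trans B≡ (cong (𝟏 ⊖_) h))
        go (no n) = inj₂ (next-level K D vertex P𝟏 (P≡ B≡ PB) (trans (sum₃-⊖ 𝟏 B) (cong (_-_ (+ 3)) sB))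
          (λ x Px s → [ (λ z → trans z B≡) , (λ z → ⊥-elim (sC (trans (sym (cong sum₃ z)) s))) ]′ (only x Px (1ℤ , s))) (λ l h → n (l , h)))

      opposite-sides : sum₃ B ≡ + 2 → sum₃ C ≡ 0ℤ → G
      opposite-sides sB sC = [ (λ { (l , h) → final l h edge? }) , (λ g → g) ]′ (adjacent sB (λ z → 0≢2 (trans (sym sC) z)))
        where
        0≢2 : 0ℤ ≢ + 2
        0≢2 ()
        final : ∀ l → B ≡ 𝟏 ⊖ e l → Dec (∃ λ a → ∃ λ b → m ≡ e a ⊕ e b) → G
        final l h (yes (a , b , q)) = neighbours l K vertex P𝟏 (P≡ h PB) C k a b PC (trans (cong (λ x → x ⊕ C ⊕ (𝟏 ⊖ e k)) (sym h)) (trans link (cong (+ 2 •_) q)))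
        final l h (no n) = across sB sC (λ a b q → n (a , b , q))

      sixth≡ : ∀ {x} → + 5 • A ≡ + 2 • x ⊕ 𝟏 → x ≡ + 2 • 𝟏
      sixth≡ {x} q = vlia 3 (λ A x o → + 5 :* A := + 2 :* x :+ o ⇒ A := o ⇒ x := + 2 :* o) A x 𝟏 q A≡𝟏

      sixth-zeroth : + 5 • A ≡ + 2 • B ⊕ 𝟏 → sum₃ C ≡ 0ℤ → G
      sixth-zeroth q sC = opposite-five {C} {i} {j} {m} P𝟏 (P≡ (sixth≡ {B} q) PB) PC i≢j (subst (λ x → Linked x C i j m) (sixth≡ {B} q) linked) sC

      second-sixth : sum₃ B ≡ + 2 → + 5 • A ≡ + 2 • C ⊕ 𝟏 → G
      second-sixth sB q = [ (λ { (l , h) → same-five {next l} {next (next l)} {l} (around l) P𝟏 (P≡ (sixth≡ {C} q) PC)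
          (P≡ (trans h (vlia 4 (λ i j k o → i :+ j :+ k := o ⇒ o :- k := i :+ j) (e (next l)) (e (next (next l))) (e l) 𝟏 (around l))) PB) }) , (λ g → g) ]′
        (adjacent sB (λ z → 6≢2 (trans (sym (cong sum₃ (sixth≡ {C} q))) z)))
        where
        6≢2 : + 6 ≢ + 2
        6≢2 ()
        around : ∀ l → e (next l) ⊕ e (next (next l)) ⊕ e l ≡ 𝟏
        around l = trans (vlia 3 (λ i j k → i :+ j :+ k := k :+ i :+ j) (e (next l)) (e (next (next l))) (e l)) (e-cyclic l)

      both-sixth : + 5 • A ≡ + 2 • B ⊕ 𝟏 → + 5 • A ≡ + 2 • C ⊕ 𝟏 → G
      both-sixth p q = ⊥-elim (linked-≢ {B} {C} {i} {j} {m} i≢j linked (trans (sixth≡ {B} p) (sym (sixth≡ {C} q))))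

    both-zeroth : (K : Body G) (S : Config K) → sum₃ (Config.B S) ≡ 0ℤ → sum₃ (Config.C S) ≡ 0ℤ → G
    both-zeroth K S sB sC = Cases.both-second (InChart.chart′ K reflect) (charted K reflect S)
      (trans (sum-mirror (Config.B S)) (cong (_-_ (+ 2)) sB)) (trans (sum-mirror (Config.C S)) (cong (_-_ (+ 2)) sC))

    unit-apex : (K : Body G) (S : Config K) → Config.A S ≡ 𝟏 → G
    unit-apex K S A≡𝟏 = [ (λ p → [ decide p , (λ g → g) ]′ (place K S hA C PC even-C)) , (λ g → g) ]′ (place K S hA B PB even-B)
      where
      open Config S
      hA : + 3 ≤ sum₃ A
      hA = subst (+ 3 ≤_) (sym (cong sum₃ A≡𝟏)) ℤ.≤-refl
      module U = UnitApex K S A≡𝟏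
      module V = UnitApex K (exchanged S) A≡𝟏
      decide : Place A B → Place A C → G
      decide (zeroth b) (zeroth c) = both-zeroth K S b c
      decide (zeroth b) (second c) = V.opposite-sides c b
      decide (zeroth b) (sixth c _) = V.sixth-zeroth c b
      decide (second b) (zeroth c) = U.opposite-sides b c
      decide (second b) (second c) = Cases.both-second K S b c
      decide (second b) (sixth c _) = U.second-sixth b c
      decide (sixth b _) (zeroth c) = U.sixth-zeroth b c
      decide (sixth b _) (second c) = V.second-sixth c b
      decide (sixth b _) (sixth c _) = U.both-sixth b c

    -- A shear brings A to 𝟏.
    third-level : (K : Body G) (S : Config K) → sum₃ (Config.A S) ≡ + 3 → G
    third-level K S sA = unit-apex chart′ (charted K ch S)
        (trans (ψ-at w′ {A} sA) (vlia 4 (λ A d o w → A := o :+ + 2 :* d ⇒ w := con 0ℤ :- (con 0ℤ :- d) ⇒ A :+ (- + 2) :* w := o) A d 𝟏 w′ odd-A refl))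
      where
      open Config S
      sum-d : sum₃ d ≡ 0ℤ
      sum-d = lia 2 (λ A d → A := con (+ 3) :+ + 2 :* d ⇒ A := con (+ 3) ⇒ d := con 0ℤ) (sum₃ A) (sum₃ d)
        (trans (cong sum₃ odd-A) (trans (sum₃-⊕ 𝟏 (+ 2 • d)) (cong (_+_ (+ 3)) (sum₃-• (+ 2) d)))) sA
      ch = shear (origin ⊖ d) (negate-sum d sum-d)
      open Chart ch using (w′)
      open InChart K ch

    module Quadruple (K : Body G) (S : Config K) (A≡ : Config.A S ≡ (- + 1 , + 3 , + 3)) (B≡ : Config.B S ≡ (+ 0 , + 1 , + 1)) where
      open Config S
      open Cases K S

      goal : G
      goal = [ decide , (λ g → g) ]′ (place K S (subst (+ 3 ≤_) (sym (cong sum₃ A≡)) (+≤+ (ℕ.s≤s (ℕ.s≤s (ℕ.s≤s ℕ.z≤n))))) C PC even-C)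
        where
        sB : sum₃ B ≡ + 2
        sB = cong sum₃ B≡
        5≢3 : + 5 ≢ + 3
        5≢3 ()
        final : sum₃ C ≡ 0ℤ → Dec (∃ λ a → ∃ λ b → m ≡ e a ⊕ e b) → G
        final sC (yes (a , b , q)) = Certificates.quadrupled K vertex (P≡ A≡ PA) (P≡ B≡ PB) k (proj₁ (unordered a b)) (P≡ (partner≡ {_} {a} {b} B≡ q) PC)
        final sC (no n) = across sB sC (λ a b q → n (a , b , q))
        decide : Place A C → G
        decide (zeroth c) = final c edge?
        decide (second c) = both-second sB c
        decide (sixth _ sA) = ⊥-elim (5≢3 (trans (sym (cong sum₃ A≡)) sA))

    -- A shear brings B to (0,1,1).
    fifth-level : (K : Body G) (S : Config K) → sum₃ (Config.A S) ≡ + 5 → + 4 • Config.B S ≡ Config.A S ⊕ 𝟏 → G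
    fifth-level K S sA q = Quadruple.goal chart′ (charted K ch S)
        (trans (ψ-at w′ {A} sA) (vlia 7 (λ A B o z b w t → + 4 :* B := A :+ o ⇒ w := z :- (b :- B) ⇒ z := con 0ℤ ⇒ + 4 :* b := t :+ o ⇒ A :+ (- + 4) :* w := t)
          A B 𝟏 origin b₀ w′ (- + 1 , + 3 , + 3) q refl refl refl))
        (trans (ψ-at w′ {B} sB) (vlia 4 (λ B z b w → w := z :- (b :- B) ⇒ z := con 0ℤ ⇒ B :+ (- + 1) :* w := b) B origin b₀ w′ refl refl))
      where
      open Config S
      b₀ : Pt
      b₀ = + 0 , + 1 , + 1
      sB : sum₃ B ≡ + 2
      sB = lia 2 (λ A B → + 4 :* B := A :+ con (+ 3) ⇒ A := con (+ 5) ⇒ B := con (+ 2)) (sum₃ A) (sum₃ B)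
        (trans (sym (sum₃-• (+ 4) B)) (trans (cong sum₃ q) (sum₃-⊕ A 𝟏))) sA
      ch = shear (b₀ ⊖ B) (trans (sum₃-⊖ b₀ B) (cong (_-_ (+ 2)) sB))
      open Chart ch using (w′)
      open InChart K ch

    -- Above level 3 the point A is itself an apex. `Five` would give a point congruent to A, hence
    -- A itself unless there is a box; 5 A = 2 A + 𝟏 then means level 1 and not 6. In `Four` the
    -- point b is at the even level 2, hence it is B or C.
    upper : (K : Body G) (S : Config K) → + 3 ≤ sum₃ (Config.A S) → G
    upper K S h = [ (λ z → third-level K S (ℤ.≤-antisym z h)) , (λ z → [ five , [ four , (λ g → g) ]′ ]′ (apex K A vertex PA z)) ]′ (by-cases (sum₃ A) (+ 3))
      where
      open Body K
      open Rules K
      open Config S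
      6≢1 : + 6 ≢ 1ℤ
      6≢1 ()
      five : Five K A → G
      five (a , Pa , eq , t) = [ (λ z → ⊥-elim (6≢1 (trans (sym t) (lia 1 (λ A → + 5 :* A := + 2 :* A :+ con (+ 3) ⇒ A := con 1ℤ) (sum₃ A)
            (trans (sym (sum₃-• (+ 5) A)) (trans (cong (λ y → sum₃ (+ 5 • y)) (sym z)) (trans (cong sum₃ eq) (trans (sum₃-⊕ (+ 2 • A) 𝟏) (cong (_+ + 3) (sum₃-• (+ 2) A)))))))))) ,
          (λ g → g) ]′
        (congruent a A Pa PA (A ⊖ + 2 • a ⊖ d , vlia 3 (λ a A d → + 5 :* a := + 2 :* A :+ con 1ℤ ⇒ A := con 1ℤ :+ + 2 :* d ⇒ a := A :+ + 2 :* (A :- + 2 :* a :- d)) a A d eq odd-A))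
      four : Four K A → G
      four (b , Pb , eq , t) = [ (λ z → fifth-level K S t (trans (cong (+ 4 •_) (sym z)) eq)) , (λ z → fifth-level K (exchanged S) t (trans (cong (+ 4 •_) (sym z)) eq)) ]′
        (only b Pb (1ℤ , lia 2 (λ A b → + 4 :* b := A :+ con (+ 3) ⇒ A := con (+ 5) ⇒ b := con (+ 2)) (sum₃ A) (sum₃ b)
          (trans (sym (sum₃-• (+ 4) b)) (trans (cong sum₃ eq) (sum₃-⊕ A 𝟏))) t))

    -- The level of A is 3 + 2 D, odd. Level 1 is that of the triangle, higher levels go to `upper`,
    -- and lower ones are reflected to at least 3.
    triangle-case : (K : Body G) → Config K → G
    triangle-case K S = [ (λ h → [ (λ l → level-zero K d vertex (Cases.P≡ K S odd-A PA) (ℤ.≤-antisym h l)) , (λ l → below-zero l) ]′ (by-cases (- 1ℤ) D)) ,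
        (λ h → upper K S (lia 2 (λ A D → A := con (+ 3) :+ + 2 :* D ⇒ con 1ℤ :+ con (- 1ℤ) :≤ D ⇒ con (+ 3) :≤ A) (sum₃ A) D sum-A h)) ]′ (by-cases D (- 1ℤ))
      where
      open Config S
      D = sum₃ d
      sum-A : sum₃ A ≡ + 3 + + 2 * D
      sum-A = trans (cong sum₃ odd-A) (trans (sum₃-⊕ 𝟏 (+ 2 • d)) (cong (_+_ (+ 3)) (sum₃-• (+ 2) d)))
      below-zero : 1ℤ + D ≤ - 1ℤ → G
      below-zero l = upper (InChart.chart′ K reflect) (charted K reflect S)
        (lia 3 (λ A D B → A := con (+ 3) :+ + 2 :* D ⇒ con 1ℤ :+ D :≤ con (- 1ℤ) ⇒ B := con (+ 2) :- A ⇒ con (+ 3) :≤ B) (sum₃ A) D (sum₃ (ψ mirror A)) sum-A l (sum-mirror A))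

-- Four classes at the levels of one parity

module FullPlane where

  open import Data.Bool using (T)
  open import Data.Fin.Properties using (all?; any?) renaming (_≟_ to _≟ᶠ_)
  open import Data.Integer using (_+_; _*_; -_; _-_)
  open import Relation.Nullary.Decidable using (_⊎-dec_; from-yes; ¬?)
  open LinearArithmetic
  open Cones using (_•_; triple)
  open Bodies
  open Congruences
  open Midpoints hiding (S; M)
  open MidpointTable
  open Trios
  open Packing
  open PlanePairs
  open Frames
  open Apexes
  open NearPoints
  open RingPoints using (Vertices)
  open Configurations using (Config; Even)
  open TriangleCase

  -- The four classes modulo 2 of a plane parallel to the triangle, up to translation.
  cl : Fin 4 → Pt
  cl zero = e₀
  cl (suc zero) = e₁
  cl (suc (suc zero)) = e₂
  cl (suc (suc (suc zero))) = 𝟏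

  -- The classes other than that of cl m, translated by offset m, are those of e₀, e₁, e₂.
  offset : Fin 4 → Pt
  offset (suc (suc (suc zero))) = origin
  offset zero = + 0 , + 1 , + 1
  offset (suc zero) = + 1 , + 0 , + 1
  offset (suc (suc zero)) = + 1 , + 1 , + 0

  other : Fin 4 → Fin 3 → Fin 4
  other zero zero = suc (suc (suc zero))
  other zero (suc zero) = suc (suc zero)
  other zero (suc (suc zero)) = suc zero
  other (suc zero) zero = suc (suc zero)
  other (suc zero) (suc zero) = suc (suc (suc zero))
  other (suc zero) (suc (suc zero)) = zero
  other (suc (suc zero)) zero = suc zero
  other (suc (suc zero)) (suc zero) = zero
  other (suc (suc zero)) (suc (suc zero)) = suc (suc (suc zero))
  other (suc (suc (suc zero))) zero = zero
  other (suc (suc (suc zero))) (suc zero) = suc zero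
  other (suc (suc (suc zero))) (suc (suc zero)) = suc (suc zero)

  other-class : ∀ m i → cl (other m i) ≡₂ offset m ⊕ e i
  other-class = from-yes (all? λ m → all? λ i → cl (other m i) ≡₂? offset m ⊕ e i)

  own-class : ∀ m → cl m ≡₂ offset m ⊕ 𝟏
  own-class = from-yes (all? λ m → cl m ≡₂? offset m ⊕ 𝟏)

  other≢ : ∀ m i → other m i ≢ m
  other≢ = from-yes (all? λ m → all? λ i → ¬? (other m i ≟ᶠ m))

  other-injective : ∀ m i j → i ≡ j ⊎ other m i ≢ other m j
  other-injective = from-yes (all? λ m → all? λ i → all? λ j → (i ≟ᶠ j) ⊎-dec ¬? (other m i ≟ᶠ other m j))

  -- When W j is the vertex c ⊕ e i of a translate of the triangle, c ⊕ 𝟏 represents the class of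
  -- the same parity missed by the three vertices; m is its index.
  cl-opposite : ∀ j i → ∃ λ m → cl m ≡₂ cl j ⊖ e i ⊕ 𝟏
  cl-opposite = from-yes (all? λ j → all? λ i → any? λ m → cl m ≡₂? cl j ⊖ e i ⊕ 𝟏)

  cl-difference : ∀ a b → a ≡ b ⊎ ∃ λ k → cl a ≡₂ cl b ⊕ (𝟏 ⊖ e k)
  cl-difference = from-yes (all? λ a → all? λ b → (a ≟ᶠ b) ⊎-dec any? λ k → cl a ≡₂? cl b ⊕ (𝟏 ⊖ e k))

  cl-distinct : ∀ a b → a ≡ b ⊎ ¬ cl a ≡₂ cl b
  cl-distinct = from-yes (all? λ a → all? λ b → (a ≟ᶠ b) ⊎-dec ¬? (cl a ≡₂? cl b))

  cl-odd : ∀ m → ∃ λ t → sum₃ (cl m) ≡ 1ℤ + + 2 * t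
  cl-odd zero = 0ℤ , refl
  cl-odd (suc zero) = 0ℤ , refl
  cl-odd (suc (suc zero)) = 0ℤ , refl
  cl-odd (suc (suc (suc zero))) = 1ℤ , refl

  step-not-shift : ∀ i j → ¬ (e i ⊖ e j ≡₃ 𝟏 ⊎ e i ⊖ e j ≡₃ origin ⊖ 𝟏)
  step-not-shift = from-yes (all? λ i → all? λ j → ¬? ((e i ⊖ e j ≡₃? 𝟏) ⊎-dec (e i ⊖ e j ≡₃? origin ⊖ 𝟏)))

  InPlane : Pt → Pt → Set
  InPlane s x = ∃ λ κ → x ≡₂ s ⊕ cl κ

  plane-level : ∀ {s x} → InPlane s x → ∃ λ t → sum₃ x ≡ sum₃ s + 1ℤ + + 2 * t
  plane-level {s} {x} (κ , h) = proj₁ (cl-odd κ) + proj₁ l ,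
    lia 5 (λ x s c t u → x := s :+ c :+ + 2 :* u ⇒ c := con 1ℤ :+ + 2 :* t ⇒ x := s :+ con 1ℤ :+ + 2 :* (t :+ u)) (sum₃ x) (sum₃ s) (sum₃ (cl κ)) (proj₁ (cl-odd κ)) (proj₁ l)
      (trans (proj₂ l) (cong (_+ + 2 * proj₁ l) (sum₃-⊕ s (cl κ)))) (proj₂ (cl-odd κ))
    where l = level {x} {s ⊕ cl κ} 2 h

  module _ {G : Set} (K : Body G) (s s′ : Pt) (planes : ∃ λ d → sum₃ s′ ≡ sum₃ s + 1ℤ + + 2 * d)
           (W : Fin 4 → Pt) (PW : ∀ i → Body.P K (W i)) (class : ∀ i → W i ≡₂ s ⊕ cl i)
           (B C : Pt) (PB : Body.P K B) (PC : Body.P K C) (B-plane : InPlane s′ B) (C-plane : InPlane s′ C) (B≢C : proj₁ B-plane ≢ proj₁ C-plane)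
           (complete : ∀ x → Body.P K x → InPlane s x ⊎ x ≡ B ⊎ x ≡ C) where
    open Body K
    open Rules K

    trio : ∀ m → Trio K (s ⊕ offset m)
    trio m = record { A = λ i → W (other m i) ; PA = λ i → PW (other m i) ; cls = λ i → proj₁ (class (other m i)) ⊕ proj₁ (other-class m i) ,
      vlia 7 (λ w s c d o f g → w := s :+ c :+ + 2 :* d ⇒ c := o :+ f :+ + 2 :* g ⇒ w := s :+ o :+ f :+ + 2 :* (d :+ g))
        (W (other m i)) s (cl (other m i)) (proj₁ (class (other m i))) (offset m) (e i) (proj₁ (other-class m i)) (proj₂ (class (other m i))) (proj₂ (other-class m i)) }

    W-distinct : ∀ {a b} → a ≢ b → W a ≢ W b
    W-distinct {a} {b} a≢b h = [ a≢b , (λ n → n (proj₁ (class b) ⊖ proj₁ (class a) ,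
      vlia 7 (λ u v s c d f g → u := s :+ c :+ + 2 :* f ⇒ v := s :+ d :+ + 2 :* g ⇒ u := v ⇒ c := d :+ + 2 :* (g :- f))
        (W a) (W b) s (cl a) (cl b) (proj₁ (class a)) (proj₁ (class b)) (proj₂ (class a)) (proj₂ (class b)) h)) ]′ (cl-distinct a b)

    sum-W : Pt
    sum-W = W zero ⊕ W (suc zero) ⊕ W (suc (suc zero)) ⊕ W (suc (suc (suc zero)))

    total-other : ∀ m → sum-W ≡ W m ⊕ total (λ i → W (other m i))
    total-other zero = vlia 4 (λ a b c d → a :+ b :+ c :+ d := a :+ (d :+ c :+ b)) (W zero) (W (suc zero)) (W (suc (suc zero))) (W (suc (suc (suc zero))))
    total-other (suc zero) = vlia 4 (λ a b c d → a :+ b :+ c :+ d := b :+ (c :+ d :+ a)) (W zero) (W (suc zero)) (W (suc (suc zero))) (W (suc (suc (suc zero))))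
    total-other (suc (suc zero)) = vlia 4 (λ a b c d → a :+ b :+ c :+ d := c :+ (b :+ a :+ d)) (W zero) (W (suc zero)) (W (suc (suc zero))) (W (suc (suc (suc zero))))
    total-other (suc (suc (suc zero))) = vlia 4 (λ a b c d → a :+ b :+ c :+ d := d :+ (a :+ b :+ c)) (W zero) (W (suc zero)) (W (suc (suc zero))) (W (suc (suc (suc zero))))

    -- The outcomes for the trio that omits W m, rewritten through the sum of all four points so
    -- that different m can be compared. In the last one the centroid of the trio lies in the class
    -- of W m and hence equals it.
    Steps Shift Centre : Fin 4 → Set
    Steps m = ∃ λ a → ∃ λ b → a ≢ m × b ≢ m × a ≢ b × Step (W a) (W b)
    Shift m = sum-W ≡₃ W m ⊕ 𝟏
    Centre m = sum-W ≡ + 4 • W m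

    analyse : ∀ m → Steps m ⊎ G ⊎ Shift m ⊎ Centre m
    analyse m = go T.classify
      where
      module T = Trio (trio m)
      go : T.SS ⊎ G ⊎ T.Generic → Steps m ⊎ G ⊎ Shift m ⊎ Centre m
      go (inj₁ (i , j , i≢j , h)) = inj₁ (other m i , other m j , other≢ m i , other≢ m j , [ (λ z → ⊥-elim (i≢j z)) , (λ n → n) ]′ (other-injective m i j) , h)
      go (inj₂ (inj₁ g)) = inj₂ (inj₁ g)
      go (inj₂ (inj₂ (_ , inj₁ (d , h)))) = inj₂ (inj₂ (inj₁ (d , vlia 5 (λ S w t o d → S := w :+ t ⇒ t := o :+ + 3 :* d ⇒ S := w :+ o :+ + 3 :* d)
        sum-W (W m) (total T.A) 𝟏 d (total-other m) h)))
      go (inj₂ (inj₂ (_ , inj₂ h))) = [ (λ z → inj₂ (inj₂ (inj₂ (vlia 4 (λ S w t g → S := w :+ t ⇒ t := + 3 :* g ⇒ g := w ⇒ S := + 4 :* w)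
          sum-W (W m) (total T.A) (proj₁ c) (total-other m) (proj₁ (proj₂ (proj₂ c))) z)))) , (λ g → inj₂ (inj₁ g)) ]′
        (congruent (proj₁ c) (W m) (proj₁ (proj₂ c)) (PW m) (proj₁ (proj₂ (proj₂ (proj₂ c))) ⊖ proj₁ (own-class m) ⊖ proj₁ (class m) ,
          vlia 9 (λ g w s c o n f d t → g := s :+ o :+ n :+ + 2 :* f ⇒ w := s :+ c :+ + 2 :* d ⇒ c := o :+ n :+ + 2 :* t ⇒ g := w :+ + 2 :* (f :- t :- d))
            (proj₁ c) (W m) s (cl m) (offset m) 𝟏 (proj₁ (proj₂ (proj₂ (proj₂ c)))) (proj₁ (class m)) (proj₁ (own-class m))
            (proj₂ (proj₂ (proj₂ (proj₂ c)))) (proj₂ (class m)) (proj₂ (own-class m))))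
        where c = T.centre h

    two-shifts : ∀ {a b} → a ≢ b → Shift a → Shift b → G
    two-shifts {a} {b} a≢b (d , h) (f , k) = [ (λ z → ⊥-elim (W-distinct a≢b (vlia 3 (λ u v x → u :+ x := v :+ x ⇒ u := v) (W a) (W b) e₀ z))) , (λ g → g) ]′
      (tripled (W a ⊕ e₀) (W b ⊕ e₀) (translate (PW a) zero) (translate (PW b) zero) (f ⊖ d ,
        vlia 7 (λ u v S o x d f → S := u :+ o :+ + 3 :* d ⇒ S := v :+ o :+ + 3 :* f ⇒ u :+ x := v :+ x :+ + 3 :* (f :- d)) (W a) (W b) sum-W 𝟏 e₀ d f h k))

    two-centres : ∀ {a b} → a ≢ b → Centre a → Centre b → G
    two-centres {a} {b} a≢b h k = ⊥-elim (W-distinct a≢b (vlia 3 (λ u v S → S := + 4 :* u ⇒ S := + 4 :* v ⇒ u := v) (W a) (W b) sum-W h k))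

    -- In coordinates with origin c the translate is the standard triangle. The fourth class
    -- supplies A, and B and C are the points of the other parity.
    translated : ∀ c → (∀ i → P (c ⊕ e i)) → (∃ λ i → ∃ λ j → W j ≡ c ⊕ e i) → G
    translated c vertex (i , j , q) = triangle-case L config
      where
      L : Body G
      L = frame (asPair K) c origin e (λ i → vlia 1 (λ x → x := con 0ℤ :+ x) (e i)) (λ x h → trans (sym (lin-e-id x)) h)
      moved : ∀ {x y} → x ≡ y → P x → P y
      moved refl h = h
      into : ∀ {x} → P x → Body.P L (x ⊖ c)
      into {x} = moved (trans (vlia 2 (λ x c → x := c :+ (x :- c)) x c) (cong (c ⊕_) (sym (lin-e-id (x ⊖ c)))))
      opp = cl-opposite j i
      n = proj₁ opp
      f = proj₁ (proj₂ opp)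
      diff : ∃ λ k → cl (proj₁ B-plane) ≡₂ cl (proj₁ C-plane) ⊕ (𝟏 ⊖ e k)
      diff = [ (λ z → ⊥-elim (B≢C z)) , (λ z → z) ]′ (cl-difference (proj₁ B-plane) (proj₁ C-plane))
      k = proj₁ diff
      β = proj₁ (proj₂ B-plane)
      γ = proj₁ (proj₂ C-plane)
      δ = proj₁ (proj₂ diff)
      base : ∃ λ t → sum₃ c ≡ sum₃ s + + 2 * t
      base = t , lia 4 (λ w c s t → w := c :+ con 1ℤ ⇒ w := s :+ con 1ℤ :+ + 2 :* t ⇒ c := s :+ + 2 :* t) (sum₃ (W j)) (sum₃ c) (sum₃ s) t
          (trans (cong sum₃ q) (trans (sum₃-⊕ c (e i)) (cong (_+_ (sum₃ c)) (sum₃-e i)))) (proj₂ l)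
        where
        l = plane-level {s} {W j} (j , class j)
        t = proj₁ l
      even : ∀ {x} → InPlane s′ x → Even (sum₃ (x ⊖ c))
      even {x} p = proj₁ planes + 1ℤ + proj₁ l - proj₁ base , trans (sum₃-⊖ x c)
          (lia 7 (λ x c s r d t u → x := r :+ con 1ℤ :+ + 2 :* t ⇒ r := s :+ con 1ℤ :+ + 2 :* d ⇒ c := s :+ + 2 :* u ⇒ x :- c := + 2 :* (d :+ con 1ℤ :+ t :- u))
            (sum₃ x) (sum₃ c) (sum₃ s) (sum₃ s′) (proj₁ planes) (proj₁ l) (proj₁ base) (proj₂ l) (proj₂ planes) (proj₂ base))
        where l = plane-level {s′} {x} p
      only : ∀ x → Body.P L x → Even (sum₃ x) → x ≡ B ⊖ c ⊎ x ≡ C ⊖ c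
      only x Px (t , h) = go (complete (c ⊕ x) (moved (cong (c ⊕_) (lin-e-id x)) Px))
        where
        go : InPlane s (c ⊕ x) ⊎ c ⊕ x ≡ B ⊎ c ⊕ x ≡ C → x ≡ B ⊖ c ⊎ x ≡ C ⊖ c
        go (inj₁ p) = ⊥-elim (odd (sum₃ s) (proj₁ l - t - proj₁ base)
            (lia 5 (λ s x c l b → c :+ x := s :+ con 1ℤ :+ + 2 :* l ⇒ c := s :+ + 2 :* b ⇒ s := s :+ con 1ℤ :+ (+ 2 :* l :- x :- + 2 :* b)) (sum₃ s) (sum₃ x) (sum₃ c) (proj₁ l) (proj₁ base)
              (trans (sym (sum₃-⊕ c x)) (proj₂ l)) (proj₂ base)
            ∙ lia 5 (λ s x l b t → x := + 2 :* t ⇒ s :+ con 1ℤ :+ (+ 2 :* l :- x :- + 2 :* b) := s :+ con 1ℤ :+ + 2 :* (l :- t :- b)) (sum₃ s) (sum₃ x) (proj₁ l) (proj₁ base) t h))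
          where
          l = plane-level {s} {c ⊕ x} p
          infixr 4 _∙_
          _∙_ : ∀ {x y z : ℤ} → x ≡ y → y ≡ z → x ≡ z
          _∙_ = trans
        go (inj₂ (inj₁ p)) = inj₁ (vlia 3 (λ c x b → c :+ x := b ⇒ x := b :- c) c x B p)
        go (inj₂ (inj₂ p)) = inj₂ (vlia 3 (λ c x b → c :+ x := b ⇒ x := b :- c) c x C p)
      config : Config L
      config = record
        { vertex = λ i → moved (cong (c ⊕_) (sym (lin-e-id (e i)))) (vertex i)
        ; A = W n ⊖ c ; B = B ⊖ c ; C = C ⊖ c ; d = proj₁ (class n) ⊕ f ⊖ proj₁ (class j) ; k = k ; m = C ⊖ c ⊕ (𝟏 ⊖ e k) ⊕ δ ⊕ β ⊖ γ
        ; PA = into {W n} (PW n) ; PB = into {B} PB ; PC = into {C} PC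
        ; odd-A = vlia 11 (λ w v s a b d g f c i o → w := s :+ a :+ + 2 :* d ⇒ v := s :+ b :+ + 2 :* g ⇒ a := b :- i :+ o :+ + 2 :* f ⇒ v := c :+ i ⇒
              w :- c := o :+ + 2 :* (d :+ f :- g))
            (W n) (W j) s (cl n) (cl j) (proj₁ (class n)) (proj₁ (class j)) f c (e i) 𝟏 (proj₂ (class n)) (proj₂ (class j)) (proj₂ (proj₂ opp)) q
        ; link = vlia 10 (λ B C r a b β γ δ g c → B := r :+ a :+ + 2 :* β ⇒ C := r :+ b :+ + 2 :* γ ⇒ a := b :+ g :+ + 2 :* δ ⇒
              (B :- c) :+ (C :- c) :+ g := + 2 :* (C :- c :+ g :+ δ :+ β :- γ))
            B C s′ (cl (proj₁ B-plane)) (cl (proj₁ C-plane)) β γ δ (𝟏 ⊖ e k) c (proj₂ (proj₂ B-plane)) (proj₂ (proj₂ C-plane)) (proj₂ (proj₂ diff))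
        ; even-B = even {B} B-plane ; even-C = even {C} C-plane ; only = only }

    -- One end of the first edge is no end of the second, so the edges are neither equal nor
    -- opposite and must be two sides of a translate of the triangle.
    two-steps : ∀ {a b c d} → a ≢ b → Step (W a) (W b) → Step (W c) (W d) → (a ≢ c × a ≢ d) ⊎ (b ≢ c × b ≢ d) → G
    two-steps {a} {b} {c} {d} a≢b h k apart = [ go apart , (λ g → g) ]′ (edges K (PW a) (PW b) (PW c) (PW d) h k)
      where
      go : (a ≢ c × a ≢ d) ⊎ (b ≢ c × b ≢ d) → Edges K (W a) (W b) (W c) (W d) → G
      go _ (corner o v _ (i , q)) = translated o v (i , b , q)
      go (inj₁ (x , _)) (same p _) = ⊥-elim (W-distinct x p)
      go (inj₁ (_ , y)) (opposite p _) = ⊥-elim (W-distinct y p)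
      go (inj₂ (_ , y)) (same _ p) = ⊥-elim (W-distinct y p)
      go (inj₂ (x , _)) (opposite _ p) = ⊥-elim (W-distinct x p)

    -- A trio omitting an end of the known edge can only show a second edge. If neither trio has
    -- one, two equal outcomes identify W a and W b, exactly or modulo 3, and two different ones
    -- make the edge plus or minus 𝟏 modulo 3.
    with-step : ∀ {a b} → a ≢ b → Step (W a) (W b) → G
    with-step {a} {b} a≢b h@(i , j , i≢j , q) = go (analyse a) (analyse b)
      where
      go : Steps a ⊎ G ⊎ Shift a ⊎ Centre a → Steps b ⊎ G ⊎ Shift b ⊎ Centre b → G
      go (inj₁ (c , d , c≢a , d≢a , _ , k)) _ = two-steps a≢b h k (inj₁ (≢-sym c≢a , ≢-sym d≢a))
      go _ (inj₁ (c , d , c≢b , d≢b , _ , k)) = two-steps a≢b h k (inj₂ (≢-sym c≢b , ≢-sym d≢b))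
      go (inj₂ (inj₁ g)) _ = g
      go _ (inj₂ (inj₁ g)) = g
      go (inj₂ (inj₂ (inj₁ x))) (inj₂ (inj₂ (inj₁ y))) = two-shifts a≢b x y
      go (inj₂ (inj₂ (inj₂ x))) (inj₂ (inj₂ (inj₂ y))) = two-centres a≢b x y
      go (inj₂ (inj₂ (inj₁ (d , x)))) (inj₂ (inj₂ (inj₂ y))) = ⊥-elim (step-not-shift i j (inj₂ (W b ⊖ d ,
        vlia 7 (λ u v S o d i j → S := u :+ o :+ + 3 :* d ⇒ S := + 4 :* v ⇒ u :- v := i :- j ⇒ i :- j := con 0ℤ :- o :+ + 3 :* (v :- d)) (W a) (W b) sum-W 𝟏 d (e i) (e j) x y q)))
      go (inj₂ (inj₂ (inj₂ x))) (inj₂ (inj₂ (inj₁ (d , y)))) = ⊥-elim (step-not-shift i j (inj₁ (d ⊖ W a ,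
        vlia 7 (λ u v S o d i j → S := v :+ o :+ + 3 :* d ⇒ S := + 4 :* u ⇒ u :- v := i :- j ⇒ i :- j := o :+ + 3 :* (d :- u)) (W a) (W b) sum-W 𝟏 d (e i) (e j) y x q)))

    -- Among three omitted indices without an edge, two share the outcome `Shift` or the outcome
    -- `Centre`.
    full-plane : G
    full-plane = go (analyse zero) (analyse (suc zero)) (analyse (suc (suc zero)))
      where
      step : ∀ {m} → Steps m → G
      step (_ , _ , _ , _ , a≢b , h) = with-step a≢b h
      go : Steps zero ⊎ G ⊎ Shift zero ⊎ Centre zero → Steps (suc zero) ⊎ G ⊎ Shift (suc zero) ⊎ Centre (suc zero) →
        Steps (suc (suc zero)) ⊎ G ⊎ Shift (suc (suc zero)) ⊎ Centre (suc (suc zero)) → G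
      go (inj₁ x) _ _ = step x
      go _ (inj₁ x) _ = step x
      go _ _ (inj₁ x) = step x
      go (inj₂ (inj₁ g)) _ _ = g
      go _ (inj₂ (inj₁ g)) _ = g
      go _ _ (inj₂ (inj₁ g)) = g
      go (inj₂ (inj₂ (inj₁ x))) (inj₂ (inj₂ (inj₁ y))) _ = two-shifts (λ ()) x y
      go (inj₂ (inj₂ (inj₁ x))) _ (inj₂ (inj₂ (inj₁ y))) = two-shifts (λ ()) x y
      go _ (inj₂ (inj₂ (inj₁ x))) (inj₂ (inj₂ (inj₁ y))) = two-shifts (λ ()) x y
      go (inj₂ (inj₂ (inj₂ x))) (inj₂ (inj₂ (inj₂ y))) _ = two-centres (λ ()) x y
      go (inj₂ (inj₂ (inj₂ x))) _ (inj₂ (inj₂ (inj₂ y))) = two-centres (λ ()) x y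
      go _ (inj₂ (inj₂ (inj₂ x))) (inj₂ (inj₂ (inj₂ y))) = two-centres (λ ()) x y

-- Distribution of the six points over the classes modulo 2

module SixPoints where

  open import Data.Bool using (T)
  open import Data.Fin using (punchOut)
  open import Data.Fin.Properties using (all?; any?; punchOut-injective) renaming (_≟_ to _≟ᶠ_)
  open import Data.Integer using (_+_; _*_; -_; _-_)
  open import Data.List using (List; []; _∷_; length)
  open import Data.List.Membership.Propositional using (_∈_)
  import Data.List.Relation.Unary.All as All
  open import Data.List.Relation.Unary.All using (All; []; _∷_)
  open import Data.List.Relation.Unary.AllPairs using (AllPairs; []; _∷_)
  open import Data.List.Relation.Unary.Any using (here; there)
  open import Data.Vec using ([]; _∷_)
  open import Relation.Nullary.Decidable using (_×-dec_; _⊎-dec_; from-yes; ¬?)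
  open LinearArithmetic
  open Cones using (_•_; triple)
  open Bodies
  open Congruences
  open Midpoints hiding (S; M)
  open Trios
  open Packing
  open PlanePairs
  open Frames
  open Apexes
  open NearPoints
  open FullPlane

  Apart : Pt → Pt → Set
  Apart x y = ¬ x ≡₂ y

  plane-table : ∀ a b c → (∃ λ κ → pt {2} a b c ≡₂ origin ⊕ cl κ) ⊎ (∃ λ κ → pt {2} a b c ≡₂ e₀ ⊕ cl κ)
  plane-table = from-yes (all? λ a → all? λ b → all? λ c →
    any? (λ κ → pt {2} a b c ≡₂? origin ⊕ cl κ) ⊎-dec any? (λ κ → pt {2} a b c ≡₂? e₀ ⊕ cl κ))

  -- All representatives `cl κ` have odd level, so the two alternatives are the odd and the even
  -- levels.
  plane-of : ∀ x → InPlane origin x ⊎ InPlane e₀ x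
  plane-of x = [ (λ { (κ , f , k) → inj₁ (κ , shift {origin} {κ} f k) }) , (λ { (κ , f , k) → inj₂ (κ , shift {e₀} {κ} f k) }) ]′ (plane-table a b c)
    where
    r = residueₚ 1 x
    a = proj₁ r
    b = proj₁ (proj₂ r)
    c = proj₁ (proj₂ (proj₂ r))
    d = proj₁ (proj₂ (proj₂ (proj₂ r)))
    shift : ∀ {s κ} f → pt a b c ≡ s ⊕ cl κ ⊕ + 2 • f → x ≡₂ s ⊕ cl κ
    shift {s} {κ} f k = f ⊕ d , vlia 6 (λ x p s c f d → x := p :+ + 2 :* d ⇒ p := s :+ c :+ + 2 :* f ⇒ x := s :+ c :+ + 2 :* (f :+ d))
      x (pt a b c) s (cl κ) f d (proj₂ (proj₂ (proj₂ (proj₂ r)))) k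

  same-class : ∀ {s x y κ λ′} → x ≡₂ s ⊕ cl κ → y ≡₂ s ⊕ cl λ′ → κ ≡ λ′ → x ≡₂ y
  same-class {s} {x} {y} {κ} (d , h) (f , k) refl = d ⊖ f ,
    vlia 6 (λ x y s c d f → x := s :+ c :+ + 2 :* d ⇒ y := s :+ c :+ + 2 :* f ⇒ x := y :+ + 2 :* (d :- f)) x y s (cl κ) d f h k

  unique-class : ∀ {s x κ λ′} → x ≡₂ s ⊕ cl κ → x ≡₂ s ⊕ cl λ′ → κ ≡ λ′
  unique-class {s} {x} {κ} {λ′} (d , h) (f , k) = [ (λ z → z) , (λ n → ⊥-elim (n (f ⊖ d ,
    vlia 6 (λ x s a b d f → x := s :+ a :+ + 2 :* d ⇒ x := s :+ b :+ + 2 :* f ⇒ a := b :+ + 2 :* (f :- d)) x s (cl κ) (cl λ′) d f h k))) ]′ (cl-distinct κ λ′)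

  missing-class : ∀ (a b c : Fin 4) → ∃ λ m → m ≢ a × m ≢ b × m ≢ c
  missing-class = from-yes (all? {4} λ a → all? {4} λ b → all? {4} λ c → any? λ m → ¬? (m ≟ᶠ a) ×-dec ¬? (m ≟ᶠ b) ×-dec ¬? (m ≟ᶠ c))

  -- Were κ a fifth value, deleting it would leave four distinct values among three.
  four-distinct : ∀ {a b c d : Fin 4} → a ≢ b → a ≢ c → a ≢ d → b ≢ c → b ≢ d → c ≢ d → ∀ κ → κ ≡ a ⊎ κ ≡ b ⊎ κ ≡ c ⊎ κ ≡ d
  four-distinct {a} {b} {c} {d} ab ac ad bc bd cd κ = go (κ ≟ᶠ a) (κ ≟ᶠ b) (κ ≟ᶠ c) (κ ≟ᶠ d)
    where
    squeeze : (na : κ ≢ a) (nb : κ ≢ b) (nc : κ ≢ c) (nd : κ ≢ d) →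
      punchOut na ≡ punchOut nb ⊎ punchOut na ≡ punchOut nc ⊎ punchOut nb ≡ punchOut nc ⊎ punchOut nd ≡ punchOut na ⊎ punchOut nd ≡ punchOut nb ⊎ punchOut nd ≡ punchOut nc → ⊥
    squeeze na nb nc nd (inj₁ h) = ab (punchOut-injective na nb h)
    squeeze na nb nc nd (inj₂ (inj₁ h)) = ac (punchOut-injective na nc h)
    squeeze na nb nc nd (inj₂ (inj₂ (inj₁ h))) = bc (punchOut-injective nb nc h)
    squeeze na nb nc nd (inj₂ (inj₂ (inj₂ (inj₁ h)))) = ad (sym (punchOut-injective nd na h))
    squeeze na nb nc nd (inj₂ (inj₂ (inj₂ (inj₂ (inj₁ h))))) = bd (sym (punchOut-injective nd nb h))
    squeeze na nb nc nd (inj₂ (inj₂ (inj₂ (inj₂ (inj₂ h))))) = cd (sym (punchOut-injective nd nc h))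
    go : Dec (κ ≡ a) → Dec (κ ≡ b) → Dec (κ ≡ c) → Dec (κ ≡ d) → κ ≡ a ⊎ κ ≡ b ⊎ κ ≡ c ⊎ κ ≡ d
    go (yes h) _ _ _ = inj₁ h
    go _ (yes h) _ _ = inj₂ (inj₁ h)
    go _ _ (yes h) _ = inj₂ (inj₂ (inj₁ h))
    go _ _ _ (yes h) = inj₂ (inj₂ (inj₂ h))
    go (no na) (no nb) (no nc) (no nd) = ⊥-elim (squeeze na nb nc nd (covered (punchOut na) (punchOut nb) (punchOut nc) (punchOut nd)))

  offset-even : ∀ m → ∃ λ t → sum₃ (offset m) ≡ + 2 * t
  offset-even zero = 1ℤ , refl
  offset-even (suc zero) = 1ℤ , refl
  offset-even (suc (suc zero)) = 1ℤ , refl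
  offset-even (suc (suc (suc zero))) = 0ℤ , refl

  own-shift : ∀ {s p} m → p ≡₂ s ⊕ offset m ⊕ 𝟏 → p ≡₂ s ⊕ cl m
  own-shift {s} {p} m (d , h) = go (own-class m)
    where
    go : cl m ≡₂ offset m ⊕ 𝟏 → p ≡₂ s ⊕ cl m
    go (f , k) = d ⊖ f , vlia 7 (λ p s o n c d f → p := s :+ o :+ n :+ + 2 :* d ⇒ c := o :+ n :+ + 2 :* f ⇒ p := s :+ c :+ + 2 :* (d :- f))
      p s (offset m) 𝟏 (cl m) d f h k

  other-shift : ∀ {s w} m i → w ≡₂ s ⊕ cl (other m i) → w ≡₂ s ⊕ offset m ⊕ e i
  other-shift {s} {w} m i (d , h) = go (other-class m i)
    where
    go : cl (other m i) ≡₂ offset m ⊕ e i → w ≡₂ s ⊕ offset m ⊕ e i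
    go (f , k) = d ⊕ f , vlia 7 (λ p s o n c d f → p := s :+ c :+ + 2 :* d ⇒ c := o :+ n :+ + 2 :* f ⇒ p := s :+ o :+ n :+ + 2 :* (d :+ f))
      w s (offset m) (e i) (cl (other m i)) d f h k

  record Parts (l : List Pt) : Set where
    field
      odds evens : List Pt
      odds-plane : All (InPlane origin) odds
      evens-plane : All (InPlane e₀) evens
      odds-apart : AllPairs Apart odds
      evens-apart : AllPairs Apart evens
      odds⊆ : ∀ {x} → x ∈ odds → x ∈ l
      evens⊆ : ∀ {x} → x ∈ evens → x ∈ l
      covering : ∀ {x} → x ∈ l → x ∈ odds ⊎ x ∈ evens
      lengths : length odds ℕ.+ length evens ≡ length l

  parts : ∀ l → AllPairs Apart l → Parts l
  parts [] [] = record
    { odds = [] ; evens = [] ; odds-plane = [] ; evens-plane = [] ; odds-apart = [] ; evens-apart = []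
    ; odds⊆ = λ () ; evens⊆ = λ () ; covering = λ () ; lengths = refl }
  parts (x ∷ l) (a ∷ as) = [ left , right ]′ (plane-of x)
    where
    open Parts (parts l as)
    left : InPlane origin x → Parts (x ∷ l)
    left p = record
      { odds = x ∷ odds ; evens = evens ; odds-plane = p ∷ odds-plane ; evens-plane = evens-plane
      ; odds-apart = All.tabulate (λ h → All.lookup a (odds⊆ h)) ∷ odds-apart ; evens-apart = evens-apart
      ; odds⊆ = λ { (here h) → here h ; (there h) → there (odds⊆ h) } ; evens⊆ = λ h → there (evens⊆ h)
      ; covering = λ { (here h) → inj₁ (here h) ; (there h) → [ (λ k → inj₁ (there k)) , inj₂ ]′ (covering h) }
      ; lengths = cong suc lengths }
    right : InPlane e₀ x → Parts (x ∷ l)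
    right p = record
      { odds = odds ; evens = x ∷ evens ; odds-plane = odds-plane ; evens-plane = p ∷ evens-plane
      ; odds-apart = odds-apart ; evens-apart = All.tabulate (λ h → All.lookup a (evens⊆ h)) ∷ evens-apart
      ; odds⊆ = λ h → there (odds⊆ h) ; evens⊆ = λ { (here h) → here h ; (there h) → there (evens⊆ h) }
      ; covering = λ { (here h) → inj₂ (here h) ; (there h) → [ inj₁ , (λ k → inj₂ (there k)) ]′ (covering h) }
      ; lengths = trans (ℕ.+-suc (length odds) (length evens)) (cong suc lengths) }

  module _ {G : Set} (K : Body G) where
    open Body K
    open Rules K

    apart-from : ∀ x → P x → ∀ xs → All P xs → All (x ≢_) xs → All (Apart x) xs ⊎ G
    apart-from x p [] [] [] = inj₁ []
    apart-from x p (y ∷ ys) (q ∷ qs) (n ∷ ns) = go (x ≡₂? y)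
      where
      go : Dec (x ≡₂ y) → All (Apart x) (y ∷ ys) ⊎ G
      go (yes h) = [ (λ z → ⊥-elim (n z)) , inj₂ ]′ (congruent x y p q h)
      go (no h) = [ (λ t → inj₁ (h ∷ t)) , inj₂ ]′ (apart-from x p ys qs ns)

    all-apart : ∀ l → All P l → AllPairs _≢_ l → AllPairs Apart l ⊎ G
    all-apart [] [] [] = inj₁ []
    all-apart (x ∷ xs) (p ∷ ps) (n ∷ ns) = [ (λ t → [ (λ a → inj₁ (a ∷ t)) , inj₂ ]′ (apart-from x p xs ps n)) , inj₂ ]′ (all-apart xs ps ns)

    planes-disjoint : ∀ {s s′ x} → (∃ λ d → sum₃ s′ ≡ sum₃ s + 1ℤ + + 2 * d) → InPlane s x → InPlane s′ x → ⊥
    planes-disjoint {s} {s′} {x} (d , h) p p′ = odd (sum₃ s) (d + proj₁ l′ - proj₁ l)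
        (lia 6 (λ s s′ x d t u → s′ := s :+ con 1ℤ :+ + 2 :* d ⇒ x := s :+ con 1ℤ :+ + 2 :* t ⇒ x := s′ :+ con 1ℤ :+ + 2 :* u ⇒ s := s :+ con 1ℤ :+ + 2 :* (d :+ u :- t))
          (sum₃ s) (sum₃ s′) (sum₃ x) d (proj₁ l) (proj₁ l′) h (proj₂ l) (proj₂ l′))
      where
      l = plane-level {s} {x} p
      l′ = plane-level {s′} {x} p′

    no-five : ∀ {s a b c d f r} → All (InPlane s) (a ∷ b ∷ c ∷ d ∷ f ∷ r) → AllPairs Apart (a ∷ b ∷ c ∷ d ∷ f ∷ r) → ⊥
    no-five {s} {a} {b} {c} {d} {f} ((α , ha) ∷ (β , hb) ∷ (γ , hc) ∷ (δ , hd) ∷ (φ , hf) ∷ _)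
        ((ab ∷ ac ∷ ad ∷ af ∷ _) ∷ (bc ∷ bd ∷ bf ∷ _) ∷ (cd ∷ cf ∷ _) ∷ (df ∷ _) ∷ _) = go (four-distinct
          (λ z → ab (same-class {s} {a} {b} {α} {β} ha hb z)) (λ z → ac (same-class {s} {a} {c} {α} {γ} ha hc z)) (λ z → ad (same-class {s} {a} {d} {α} {δ} ha hd z))
          (λ z → bc (same-class {s} {b} {c} {β} {γ} hb hc z)) (λ z → bd (same-class {s} {b} {d} {β} {δ} hb hd z)) (λ z → cd (same-class {s} {c} {d} {γ} {δ} hc hd z)) φ)
      where
      go : φ ≡ α ⊎ φ ≡ β ⊎ φ ≡ γ ⊎ φ ≡ δ → ⊥
      go (inj₁ z) = af (same-class {s} {a} {f} {α} {φ} ha hf (sym z))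
      go (inj₂ (inj₁ z)) = bf (same-class {s} {b} {f} {β} {φ} hb hf (sym z))
      go (inj₂ (inj₂ (inj₁ z))) = cf (same-class {s} {c} {f} {γ} {φ} hc hf (sym z))
      go (inj₂ (inj₂ (inj₂ z))) = df (same-class {s} {d} {f} {δ} {φ} hd hf (sym z))

    four-two : ∀ s s′ → (∃ λ d → sum₃ s′ ≡ sum₃ s + 1ℤ + + 2 * d) → ∀ {a b c d B C} →
      All P (a ∷ b ∷ c ∷ d ∷ []) → All (InPlane s) (a ∷ b ∷ c ∷ d ∷ []) → AllPairs Apart (a ∷ b ∷ c ∷ d ∷ []) →
      All P (B ∷ C ∷ []) → All (InPlane s′) (B ∷ C ∷ []) → AllPairs Apart (B ∷ C ∷ []) →
      (∀ x → P x → x ∈ a ∷ b ∷ c ∷ d ∷ [] ⊎ x ∈ B ∷ C ∷ []) → G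
    four-two s s′ planes {a} {b} {c} {d} {B} {C} (Pa ∷ Pb ∷ Pc ∷ Pd ∷ []) in-plane@((α , ha) ∷ (β , hb) ∷ (γ , hc) ∷ (δ , hd) ∷ [])
        ((ab ∷ ac ∷ ad ∷ []) ∷ (bc ∷ bd ∷ []) ∷ (cd ∷ []) ∷ _) (PB ∷ PC ∷ []) (pB ∷ pC ∷ []) ((BC ∷ []) ∷ _) cover-P =
      full-plane K s s′ planes (λ κ → proj₁ (pick κ)) (λ κ → proj₁ (proj₂ (pick κ))) (λ κ → proj₂ (proj₂ (pick κ))) B C PB PC pB pC
        (λ z → BC (same-class {s′} {B} {C} {proj₁ pB} {proj₁ pC} (proj₂ pB) (proj₂ pC) z)) complete
      where
      pick : ∀ κ → ∃ λ w → P w × w ≡₂ s ⊕ cl κ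
      pick κ = go (four-distinct
          (λ z → ab (same-class {s} {a} {b} {α} {β} ha hb z)) (λ z → ac (same-class {s} {a} {c} {α} {γ} ha hc z)) (λ z → ad (same-class {s} {a} {d} {α} {δ} ha hd z))
          (λ z → bc (same-class {s} {b} {c} {β} {γ} hb hc z)) (λ z → bd (same-class {s} {b} {d} {β} {δ} hb hd z)) (λ z → cd (same-class {s} {c} {d} {γ} {δ} hc hd z)) κ)
        where
        go : κ ≡ α ⊎ κ ≡ β ⊎ κ ≡ γ ⊎ κ ≡ δ → ∃ λ w → P w × w ≡₂ s ⊕ cl κ
        go (inj₁ refl) = a , Pa , ha
        go (inj₂ (inj₁ refl)) = b , Pb , hb
        go (inj₂ (inj₂ (inj₁ refl))) = c , Pc , hc
        go (inj₂ (inj₂ (inj₂ refl))) = d , Pd , hd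
      complete : ∀ x → P x → InPlane s x ⊎ x ≡ B ⊎ x ≡ C
      complete x Px = go (cover-P x Px)
        where
        go : x ∈ a ∷ b ∷ c ∷ d ∷ [] ⊎ x ∈ B ∷ C ∷ [] → InPlane s x ⊎ x ≡ B ⊎ x ≡ C
        go (inj₁ h) = inj₁ (All.lookup in-plane h)
        go (inj₂ (here h)) = inj₂ (inj₁ h)
        go (inj₂ (there (here h))) = inj₂ (inj₂ h)

    -- Three classes of a plane, with the index m of the fourth.
    record Three (s s′ : Pt) : Set where
      field
        m : Fin 4
        members : Trio K (s ⊕ offset m)
        absent : ∀ p → P p → ¬ p ≡₂ s ⊕ offset m ⊕ 𝟏

    three : ∀ s s′ → (∃ λ d → sum₃ s′ ≡ sum₃ s + 1ℤ + + 2 * d) → ∀ {a b c} → All P (a ∷ b ∷ c ∷ []) → All (InPlane s) (a ∷ b ∷ c ∷ []) → AllPairs Apart (a ∷ b ∷ c ∷ []) →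
      (∀ x → P x → x ∈ a ∷ b ∷ c ∷ [] ⊎ InPlane s′ x) → Three s s′
    three s s′ planes {a} {b} {c} (Pa ∷ Pb ∷ Pc ∷ []) ((α , ha) ∷ (β , hb) ∷ (γ , hc) ∷ []) ((ab ∷ ac ∷ []) ∷ (bc ∷ []) ∷ _) cover-P = build (missing-class α β γ)
      where
      build : (∃ λ m → m ≢ α × m ≢ β × m ≢ γ) → Three s s′
      build (m , m≢α , m≢β , m≢γ) = record
        { m = m
        ; members = record { A = λ i → proj₁ (pick i) ; PA = λ i → proj₁ (proj₂ (pick i)) ; cls = λ i → proj₂ (proj₂ (pick i)) }
        ; absent = λ p Pp h → missing p (cover-P p Pp) (own-shift {s} {p} m h) }
        where
        missing : ∀ p → p ∈ a ∷ b ∷ c ∷ [] ⊎ InPlane s′ p → p ≡₂ s ⊕ cl m → ⊥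
        missing p (inj₁ (here refl)) h = m≢α (unique-class {s} {a} {m} {α} h ha)
        missing p (inj₁ (there (here refl))) h = m≢β (unique-class {s} {b} {m} {β} h hb)
        missing p (inj₁ (there (there (here refl)))) h = m≢γ (unique-class {s} {c} {m} {γ} h hc)
        missing p (inj₂ q) h = planes-disjoint {s} {s′} {p} planes (m , h) q
        pick : ∀ i → ∃ λ w → P w × w ≡₂ s ⊕ offset m ⊕ e i
        pick i = go (four-distinct {α} {β} {γ} {m}
            (λ z → ab (same-class {s} {a} {b} {α} {β} ha hb z)) (λ z → ac (same-class {s} {a} {c} {α} {γ} ha hc z)) (≢-sym m≢α)
            (λ z → bc (same-class {s} {b} {c} {β} {γ} hb hc z)) (≢-sym m≢β) (≢-sym m≢γ) (other m i))
          where
          go : other m i ≡ α ⊎ other m i ≡ β ⊎ other m i ≡ γ ⊎ other m i ≡ m → ∃ λ w → P w × w ≡₂ s ⊕ offset m ⊕ e i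
          go (inj₁ z) = a , Pa , other-shift {s} {a} m i (subst (λ κ → a ≡₂ s ⊕ cl κ) (sym z) ha)
          go (inj₂ (inj₁ z)) = b , Pb , other-shift {s} {b} m i (subst (λ κ → b ≡₂ s ⊕ cl κ) (sym z) hb)
          go (inj₂ (inj₂ (inj₁ z))) = c , Pc , other-shift {s} {c} m i (subst (λ κ → c ≡₂ s ⊕ cl κ) (sym z) hc)
          go (inj₂ (inj₂ (inj₂ z))) = ⊥-elim (other≢ m i z)

    three-three : ∀ {s s′} → (∃ λ d → sum₃ s′ ≡ sum₃ s + 1ℤ + + 2 * d) → Three s s′ → Three s′ s → G
    three-three {s} {s′} (d , h) T U = TwoPlanesConclusion.conclusion K {s ⊕ offset T.m} {s′ ⊕ offset U.m}
        (d + proj₁ u - proj₁ t , trans (sum₃-⊕ s′ (offset U.m)) (trans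
          (lia 7 (λ s s′ d x y t u → s′ := s :+ con 1ℤ :+ + 2 :* d ⇒ x := + 2 :* t ⇒ y := + 2 :* u ⇒ s′ :+ y := s :+ x :+ con 1ℤ :+ + 2 :* (d :+ u :- t))
            (sum₃ s) (sum₃ s′) d (sum₃ (offset T.m)) (sum₃ (offset U.m)) (proj₁ t) (proj₁ u) h (proj₂ t) (proj₂ u))
          (cong (λ z → z + 1ℤ + + 2 * (d + proj₁ u - proj₁ t)) (sym (sum₃-⊕ s (offset T.m))))))
        T.members U.members T.absent U.absent
      where
      module T = Three T
      module U = Three U
      t = offset-even T.m
      u = offset-even U.m

    -- Each parity offers four classes and no class is met twice, so the division is 4 + 2, 2 + 4 or
    -- 3 + 3.
    six-points : ∀ l → length l ≡ 6 → AllPairs _≢_ l → (∀ x → x ∈ l → P x) → (∀ x → P x → x ∈ l) → G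
    six-points l len unique inP P⇒∈ = [ (λ a → go (parts l a)) , (λ g → g) ]′ (all-apart l (All.tabulate (λ {x} → inP x)) unique)
      where
      up : ∃ λ d → sum₃ e₀ ≡ sum₃ origin + 1ℤ + + 2 * d
      up = 0ℤ , refl
      down : ∃ λ d → sum₃ origin ≡ sum₃ e₀ + 1ℤ + + 2 * d
      down = - 1ℤ , refl
      flip-⊎ : ∀ {A B : Set} → A ⊎ B → B ⊎ A
      flip-⊎ = [ inj₂ , inj₁ ]′
      sizes : ∀ os es → length os ℕ.+ length es ≡ 6 → All P os → All P es → All (InPlane origin) os → All (InPlane e₀) es → AllPairs Apart os → AllPairs Apart es →
        (∀ x → P x → x ∈ os ⊎ x ∈ es) → G
      sizes (_ ∷ _ ∷ _ ∷ _ ∷ _ ∷ _) es n _ _ p _ a _ _ = ⊥-elim (no-five {origin} p a)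
      sizes os (_ ∷ _ ∷ _ ∷ _ ∷ _ ∷ _) n _ _ _ p _ a _ = ⊥-elim (no-five {e₀} p a)
      sizes (_ ∷ _ ∷ _ ∷ _ ∷ []) (_ ∷ _ ∷ []) n Po Pe po pe ao ae c = four-two origin e₀ up Po po ao Pe pe ae c
      sizes (_ ∷ _ ∷ []) (_ ∷ _ ∷ _ ∷ _ ∷ []) n Po Pe po pe ao ae c = four-two e₀ origin down Pe pe ae Po po ao (λ x Px → flip-⊎ (c x Px))
      sizes (_ ∷ _ ∷ _ ∷ []) (_ ∷ _ ∷ _ ∷ []) n Po Pe po pe ao ae c = three-three {origin} {e₀} up
        (three origin e₀ up Po po ao (λ x Px → [ inj₁ , (λ h → inj₂ (All.lookup pe h)) ]′ (c x Px)))
        (three e₀ origin down Pe pe ae (λ x Px → [ (λ h → inj₂ (All.lookup po h)) , inj₁ ]′ (c x Px)))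
      go : Parts l → G
      go p = sizes odds evens (trans lengths len) (All.tabulate (λ {x} h → inP x (odds⊆ h))) (All.tabulate (λ {x} h → inP x (evens⊆ h)))
          odds-plane evens-plane odds-apart evens-apart (λ x Px → covering (P⇒∈ x Px))
        where open Parts p

-- Greatest common divisors, cross products and lattice bases

module Bases where

  open import Data.Fin.Properties using (all?)
  open import Data.Integer using (∣_∣; _+_; _*_; -_; _-_)
  open import Data.Nat.Divisibility using () renaming (divides to dividesℕ)
  open import Data.Nat.GCD using (GCD; module Bézout)
  open import Relation.Nullary.Decidable using (map′; _⊎-dec_; from-yes; ¬?)
  open LinearArithmetic
  open Cones
  open Bodies
  open Congruences
  open Midpoints hiding (S; M)
  open Trios
  open Packing
  open PlanePairs
  open Frames
  open Apexes
  open NearPoints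

  _∙_ : Pt → Pt → ℤ
  (a , b , c) ∙ (d , f , g) = a * d + b * f + c * g

  cross : Pt → Pt → Pt
  cross (a , b , c) (d , f , g) = b * g - c * f , c * d - a * g , a * f - b * d

  record GCD₂ (a b : ℤ) : Set where
    field
      g : ℕ
      x y a′ b′ : ℤ
      bezout : x * a + y * b ≡ + g
      a≡ : a ≡ + g * a′
      b≡ : b ≡ + g * b′

  signed : ∀ a → ∃ λ σ → σ * a ≡ + ∣ a ∣ × a ≡ + ∣ a ∣ * σ
  signed (+ n) = 1ℤ , ℤ.*-identityˡ (+ n) , sym (ℤ.*-identityʳ (+ n))
  signed (-[1+ n ]) = - 1ℤ , ℤ.-1*i≡-i -[1+ n ] , sym (trans (ℤ.*-comm (+ suc n) (- 1ℤ)) (ℤ.-1*i≡-i (+ suc n)))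

  gcd₂ : ∀ a b → GCD₂ a b
  gcd₂ a b = go (Bézout.lemma ∣ a ∣ ∣ b ∣)
    where
    σ = proj₁ (signed a)
    τ = proj₁ (signed b)
    factor : ∀ d a q → ∣ a ∣ ≡ q ℕ.* d → a ≡ + d * (+ q * proj₁ (signed a))
    factor d a q h = trans (proj₂ (proj₂ (signed a))) (trans (cong (λ n → + n * proj₁ (signed a)) h)
      (trans (cong (_* proj₁ (signed a)) (trans (ℤ.pos-* q d) (ℤ.*-comm (+ q) (+ d)))) (ℤ.*-assoc (+ d) (+ q) (proj₁ (signed a)))))
    combine : ∀ d x y m n → d ℕ.+ y ℕ.* n ≡ x ℕ.* m → + x * + m - + y * + n ≡ + d
    combine d x y m n h = trans (cong (_- + y * + n) (trans (sym (ℤ.pos-* x m)) (trans (cong +_ (sym h)) (trans (ℤ.pos-+ d (y ℕ.* n)) (cong (_+_ (+ d)) (ℤ.pos-* y n))))))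
      (lia 2 (λ d z → d :+ z :- z := d) (+ d) (+ y * + n))
    rearrange : ∀ x y σ τ a b → x * σ * a + (- y) * τ * b ≡ x * (σ * a) - y * (τ * b)
    rearrange = solve-∀
    rearrange′ : ∀ x y σ τ a b → (- x) * σ * a + y * τ * b ≡ y * (τ * b) - x * (σ * a)
    rearrange′ = solve-∀
    go : Bézout.Lemma ∣ a ∣ ∣ b ∣ → GCD₂ a b
    go (Bézout.result d (GCD.is (dividesℕ q h , dividesℕ r k) _) (Bézout.+- x y eq)) = record
      { g = d ; x = + x * σ ; y = - + y * τ ; a′ = + q * σ ; b′ = + r * τ
      ; bezout = trans (rearrange (+ x) (+ y) σ τ a b) (trans (cong₂ (λ m n → + x * m - + y * n) (proj₁ (proj₂ (signed a))) (proj₁ (proj₂ (signed b)))) (combine d x y ∣ a ∣ ∣ b ∣ eq))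
      ; a≡ = factor d a q h ; b≡ = factor d b r k }
    go (Bézout.result d (GCD.is (dividesℕ q h , dividesℕ r k) _) (Bézout.-+ x y eq)) = record
      { g = d ; x = - + x * σ ; y = + y * τ ; a′ = + q * σ ; b′ = + r * τ
      ; bezout = trans (rearrange′ (+ x) (+ y) σ τ a b) (trans (cong₂ (λ m n → + y * n - + x * m) (proj₁ (proj₂ (signed a))) (proj₁ (proj₂ (signed b)))) (combine d y x ∣ b ∣ ∣ a ∣ eq))
      ; a≡ = factor d a q h ; b≡ = factor d b r k }

  gcd₃ : ∀ c → ∃ λ g → ∃ λ w → ∃ λ c′ → w ∙ c ≡ + g × c ≡ + g • c′
  gcd₃ (a , b , c) = N.g , (N.x * M.x , N.x * M.y , N.y) , (N.a′ * M.a′ , N.a′ * M.b′ , N.b′) ,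
      trans (collect N.x M.x M.y a b N.y c) (trans (cong (λ z → N.x * z + N.y * c) M.bezout) N.bezout) ,
      triple (nested M.a≡) (nested M.b≡) N.b≡
    where
    module M = GCD₂ (gcd₂ a b)
    module N = GCD₂ (gcd₂ (+ M.g) c)
    collect : ∀ n x y a b m c → n * x * a + n * y * b + m * c ≡ n * (x * a + y * b) + m * c
    collect = solve-∀
    nested : ∀ {z t} → z ≡ + M.g * t → z ≡ + N.g * (N.a′ * t)
    nested {z} {t} h = trans h (trans (cong (_* t) N.a≡) (ℤ.*-assoc (+ N.g) N.a′ t))

  -- Cramer's rule in the basis w, u, v, multiplied through by the determinant w ∙ cross u v.
  cramer : ∀ w u v p → (w ∙ cross u v) • p ≡ (p ∙ cross u v) • w ⊕ (p ∙ cross v w) • u ⊕ (p ∙ cross w u) • v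
  cramer (w₀ , w₁ , w₂) (u₀ , u₁ , u₂) (v₀ , v₁ , v₂) (p₀ , p₁ , p₂) = triple (first w₀ w₁ w₂ u₀ u₁ u₂ v₀ v₁ v₂ p₀ p₁ p₂)
      (second w₀ w₁ w₂ u₀ u₁ u₂ v₀ v₁ v₂ p₀ p₁ p₂) (last w₀ w₁ w₂ u₀ u₁ u₂ v₀ v₁ v₂ p₀ p₁ p₂)
    where
    first : ∀ w₀ w₁ w₂ u₀ u₁ u₂ v₀ v₁ v₂ p₀ p₁ p₂ →
      (w₀ * (u₁ * v₂ - u₂ * v₁) + w₁ * (u₂ * v₀ - u₀ * v₂) + w₂ * (u₀ * v₁ - u₁ * v₀)) * p₀ ≡
      (p₀ * (u₁ * v₂ - u₂ * v₁) + p₁ * (u₂ * v₀ - u₀ * v₂) + p₂ * (u₀ * v₁ - u₁ * v₀)) * w₀ +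
      (p₀ * (v₁ * w₂ - v₂ * w₁) + p₁ * (v₂ * w₀ - v₀ * w₂) + p₂ * (v₀ * w₁ - v₁ * w₀)) * u₀ +
      (p₀ * (w₁ * u₂ - w₂ * u₁) + p₁ * (w₂ * u₀ - w₀ * u₂) + p₂ * (w₀ * u₁ - w₁ * u₀)) * v₀
    first = solve-∀
    second : ∀ w₀ w₁ w₂ u₀ u₁ u₂ v₀ v₁ v₂ p₀ p₁ p₂ →
      (w₀ * (u₁ * v₂ - u₂ * v₁) + w₁ * (u₂ * v₀ - u₀ * v₂) + w₂ * (u₀ * v₁ - u₁ * v₀)) * p₁ ≡
      (p₀ * (u₁ * v₂ - u₂ * v₁) + p₁ * (u₂ * v₀ - u₀ * v₂) + p₂ * (u₀ * v₁ - u₁ * v₀)) * w₁ +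
      (p₀ * (v₁ * w₂ - v₂ * w₁) + p₁ * (v₂ * w₀ - v₀ * w₂) + p₂ * (v₀ * w₁ - v₁ * w₀)) * u₁ +
      (p₀ * (w₁ * u₂ - w₂ * u₁) + p₁ * (w₂ * u₀ - w₀ * u₂) + p₂ * (w₀ * u₁ - w₁ * u₀)) * v₁
    second = solve-∀
    last : ∀ w₀ w₁ w₂ u₀ u₁ u₂ v₀ v₁ v₂ p₀ p₁ p₂ →
      (w₀ * (u₁ * v₂ - u₂ * v₁) + w₁ * (u₂ * v₀ - u₀ * v₂) + w₂ * (u₀ * v₁ - u₁ * v₀)) * p₂ ≡
      (p₀ * (u₁ * v₂ - u₂ * v₁) + p₁ * (u₂ * v₀ - u₀ * v₂) + p₂ * (u₀ * v₁ - u₁ * v₀)) * w₂ +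
      (p₀ * (v₁ * w₂ - v₂ * w₁) + p₁ * (v₂ * w₀ - v₀ * w₂) + p₂ * (v₀ * w₁ - v₁ * w₀)) * u₂ +
      (p₀ * (w₁ * u₂ - w₂ * u₁) + p₁ * (w₂ * u₀ - w₀ * u₂) + p₂ * (w₀ * u₁ - w₁ * u₀)) * v₂
    last = solve-∀

  -- Eliminating b from a u + b v = 0.
  cross-linear : ∀ a b u v → a • cross u v ≡ cross (a • u ⊕ b • v) v
  cross-linear a b (u₀ , u₁ , u₂) (v₀ , v₁ , v₂) = triple (each a b u₁ v₁ u₂ v₂) (each a b u₂ v₂ u₀ v₀) (each a b u₀ v₀ u₁ v₁)
    where
    each : ∀ a b u v u′ v′ → a * (u * v′ - u′ * v) ≡ (a * u + b * v) * v′ - (a * u′ + b * v′) * v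
    each = solve-∀

  cross-linear′ : ∀ a b u v → b • cross u v ≡ cross u (a • u ⊕ b • v)
  cross-linear′ a b (u₀ , u₁ , u₂) (v₀ , v₁ , v₂) = triple (each a b u₁ v₁ u₂ v₂) (each a b u₂ v₂ u₀ v₀) (each a b u₀ v₀ u₁ v₁)
    where
    each : ∀ a b u v u′ v′ → b * (u * v′ - u′ * v) ≡ u * (a * u′ + b * v′) - u′ * (a * u + b * v)
    each = solve-∀

  cross-0 : ∀ v → cross origin v ≡ origin
  cross-0 (a , b , c) = refl

  cross-0′ : ∀ v → cross v origin ≡ origin
  cross-0′ (a , b , c) = triple (each b c) (each c a) (each a b)
    where
    each : ∀ a b → a * + 0 - b * + 0 ≡ + 0
    each = solve-∀

  •-cancel : ∀ k {c} → c ≢ origin → k • c ≡ origin → k ≡ 0ℤ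
  •-cancel k {a , b , c} c≢0 h = go (ℤ.i*j≡0⇒i≡0∨j≡0 k (cong (_at x₀) h)) (ℤ.i*j≡0⇒i≡0∨j≡0 k (cong (_at x₁) h)) (ℤ.i*j≡0⇒i≡0∨j≡0 k (cong (_at x₂) h))
    where
    go : k ≡ 0ℤ ⊎ a ≡ 0ℤ → k ≡ 0ℤ ⊎ b ≡ 0ℤ → k ≡ 0ℤ ⊎ c ≡ 0ℤ → k ≡ 0ℤ
    go (inj₁ z) _ _ = z
    go _ (inj₁ z) _ = z
    go _ _ (inj₁ z) = z
    go (inj₂ x) (inj₂ y) (inj₂ z) = ⊥-elim (c≢0 (triple x y z))

  independence : ∀ {u v} → cross u v ≢ origin → ∀ a b → a • u ⊕ b • v ≡ origin → a ≡ 0ℤ × b ≡ 0ℤ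
  independence {u} {v} c≢0 a b h =
    •-cancel a c≢0 (trans (cross-linear a b u v) (trans (cong (λ x → cross x v) h) (cross-0 v))) ,
    •-cancel b c≢0 (trans (cross-linear′ a b u v) (trans (cong (cross u) h) (cross-0′ u)))

  dot-• : ∀ k x c → (k • x) ∙ c ≡ k * (x ∙ c)
  dot-• k (x , y , z) (a , b , c) = each k x y z a b c
    where
    each : ∀ k x y z a b c → k * x * a + k * y * b + k * z * c ≡ k * (x * a + y * b + z * c)
    each = solve-∀

  dot-⊕ : ∀ x y c → (x ⊕ y) ∙ c ≡ x ∙ c + y ∙ c
  dot-⊕ (p₀ , p₁ , p₂) (y₀ , y₁ , y₂) (a , b , c) = each p₀ p₁ p₂ y₀ y₁ y₂ a b c
    where
    each : ∀ p₀ p₁ p₂ y₀ y₁ y₂ a b c → (p₀ + y₀) * a + (p₁ + y₁) * b + (p₂ + y₂) * c ≡ p₀ * a + p₁ * b + p₂ * c + (y₀ * a + y₁ * b + y₂ * c)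
    each = solve-∀

  cross-⊥ : ∀ u v → u ∙ cross u v ≡ 0ℤ
  cross-⊥ (a , b , c) (d , f , g) = each a b c d f g
    where
    each : ∀ a b c d f g → a * (b * g - c * f) + b * (c * d - a * g) + c * (a * f - b * d) ≡ 0ℤ
    each = solve-∀

  cross-⊥′ : ∀ u v → v ∙ cross u v ≡ 0ℤ
  cross-⊥′ (a , b , c) (d , f , g) = each a b c d f g
    where
    each : ∀ a b c d f g → d * (b * g - c * f) + f * (c * d - a * g) + g * (a * f - b * d) ≡ 0ℤ
    each = solve-∀

  -- Modulo 2, a vanishing cross product makes u, v or u - v vanish.
  parity-table : ∀ a b c d f g → (∃ λ r → pt {2} a b c ≡ + 2 • r) ⊎ (∃ λ r → pt {2} d f g ≡ + 2 • r) ⊎ pt {2} a b c ≡ pt d f g ⊎ ¬ cross (pt {2} a b c) (pt {2} d f g) ≡₂ origin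
  parity-table = from-yes (all? λ a → all? λ b → all? λ c → all? λ d → all? λ f → all? λ g →
    zero? (pt {2} a b c) ⊎-dec zero? (pt {2} d f g) ⊎-dec (pt {2} a b c ≟ pt d f g) ⊎-dec ¬? (cross (pt {2} a b c) (pt {2} d f g) ≡₂? origin))
    where
    zero? : ∀ x → Dec (∃ λ r → x ≡ + 2 • r)
    zero? x = map′ (λ { (r , h) → r , trans h (vlia 1 (λ r → con 0ℤ :+ + 2 :* r := + 2 :* r) r) }) (λ { (r , h) → r , trans h (vlia 1 (λ r → + 2 :* r := con 0ℤ :+ + 2 :* r) r) }) (x ≡₂? origin)

  cross-shift : ∀ u v d f → cross (u ⊕ + 2 • d) (v ⊕ + 2 • f) ≡ cross u v ⊕ + 2 • (cross u f ⊕ cross d v ⊕ + 2 • cross d f)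
  cross-shift (u₀ , u₁ , u₂) (v₀ , v₁ , v₂) (d₀ , d₁ , d₂) (f₀ , f₁ , f₂) = triple (each u₁ v₂ u₂ v₁ d₁ f₂ d₂ f₁) (each u₂ v₀ u₀ v₂ d₂ f₀ d₀ f₂) (each u₀ v₁ u₁ v₀ d₀ f₁ d₁ f₀)
    where
    each : ∀ u v u′ v′ d f d′ f′ → (u + + 2 * d) * (v + + 2 * f) - (u′ + + 2 * d′) * (v′ + + 2 * f′) ≡
      u * v - u′ * v′ + + 2 * (u * f - u′ * f′ + (d * v - d′ * v′) + + 2 * (d * f - d′ * f′))
    each = solve-∀

  -- Applied to two sides of a degenerate triangle: among three collinear lattice points some two
  -- are congruent modulo 2.
  parallel-parity : ∀ u v → cross u v ≡ origin → (∃ λ r → u ≡ + 2 • r) ⊎ (∃ λ r → v ≡ + 2 • r) ⊎ u ≡₂ v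
  parallel-parity u v h = go (parity-table (proj₁ ru) (proj₁ (proj₂ ru)) (proj₁ (proj₂ (proj₂ ru))) (proj₁ rv) (proj₁ (proj₂ rv)) (proj₁ (proj₂ (proj₂ rv))))
    where
    ru = residueₚ 1 u
    rv = residueₚ 1 v
    a = pt (proj₁ ru) (proj₁ (proj₂ ru)) (proj₁ (proj₂ (proj₂ ru)))
    b = pt (proj₁ rv) (proj₁ (proj₂ rv)) (proj₁ (proj₂ (proj₂ rv)))
    d = proj₁ (proj₂ (proj₂ (proj₂ ru)))
    f = proj₁ (proj₂ (proj₂ (proj₂ rv)))
    hu = proj₂ (proj₂ (proj₂ (proj₂ ru)))
    hv = proj₂ (proj₂ (proj₂ (proj₂ rv)))
    z = cross a f ⊕ cross d b ⊕ + 2 • cross d f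
    go : _ → (∃ λ r → u ≡ + 2 • r) ⊎ (∃ λ r → v ≡ + 2 • r) ⊎ u ≡₂ v
    go (inj₁ (r , k)) = inj₁ (r ⊕ d , vlia 4 (λ u a r d → u := a :+ + 2 :* d ⇒ a := + 2 :* r ⇒ u := + 2 :* (r :+ d)) u a r d hu k)
    go (inj₂ (inj₁ (r , k))) = inj₂ (inj₁ (r ⊕ f , vlia 4 (λ u a r d → u := a :+ + 2 :* d ⇒ a := + 2 :* r ⇒ u := + 2 :* (r :+ d)) v b r f hv k))
    go (inj₂ (inj₂ (inj₁ k))) = inj₂ (inj₂ (d ⊖ f , vlia 6 (λ u v a b d f → u := a :+ + 2 :* d ⇒ v := b :+ + 2 :* f ⇒ a := b ⇒ u := v :+ + 2 :* (d :- f)) u v a b d f hu hv k))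
    go (inj₂ (inj₂ (inj₂ n))) = ⊥-elim (n (origin ⊖ z , vlia 2 (λ c z → con 0ℤ := c :+ + 2 :* z ⇒ c := con 0ℤ :+ + 2 :* (con 0ℤ :- z)) (cross a b) z
      (trans (sym h) (trans (cong₂ cross hu hv) (cross-shift a b d f)))))

-- Reduction of Q to the standard triangle

module Reduction where

  open import Data.Fin.Properties using (toℕ<n)
  open import Data.Integer using (_+_; _*_; -_; _-_; _≤_; +≤+)
  open import Data.List using (List; []; _∷_; map; length)
  open import Data.List.Membership.Propositional using (_∈_)
  open import Data.List.Membership.Propositional.Properties using (∈-map⁺; ∈-map⁻)
  open import Data.List.Properties using (length-map)
  import Data.List.Relation.Unary.All as All
  open import Data.List.Relation.Unary.All using (All; []; _∷_)
  open import Data.List.Relation.Unary.AllPairs using (AllPairs; []; _∷_)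
  open import Data.List.Relation.Unary.Any using (here; there)
  import Data.List.Relation.Unary.Unique.Propositional.Properties as Unique
  open import Data.Vec using ([]; _∷_)
  open LinearArithmetic
  open Cones
  open Bodies
  open Congruences
  open Midpoints hiding (S; M)
  open Trios
  open Packing
  open PlanePairs
  open Frames
  open Apexes
  open NearPoints
  open SixPoints
  open Bases

  module Polytopes (P Q : List Pt) where
    G : Set
    G = MinkLengthAtLeast (MinkPair P Q) 3

    X : Pt → Set
    X = InConv (MinkPair P Q)

    same-point : ∀ {S x y} → x ≡ y → InConv S x → InConv S y
    same-point refl h = h

    divided : ∀ {S} n {m v} x → m ≡ + suc n → v ≡ + suc n • x → Cone S m v → InConv S x
    divided {S} n x refl refl h = cone⇒conv {S} {x} (cone-÷ n x h)

    one : ∀ {S} k {v} → 0ℤ ≤ k → InConv S v → Cone S k (k • v)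
    one {S} k {v} k≥0 h = subst (λ m → Cone S m (k • v)) (ℤ.*-identityʳ k) (cone-* k 1ℤ v k≥0 (conv⇒cone {S} {v} h))

    mixture : ∀ {S} a b c {x y z} → 0ℤ ≤ a → 0ℤ ≤ b → 0ℤ ≤ c → InConv S x → InConv S y → InConv S z → Cone S (a + b + c) (a • x ⊕ b • y ⊕ c • z)
    mixture a b c {x} {y} {z} a≥0 b≥0 c≥0 hx hy hz =
      cone-+ (a + b) c (a • x ⊕ b • y) (c • z) (cone-+ a b (a • x) (b • y) (one a {x} a≥0 hx) (one b {y} b≥0 hy)) (one c {z} c≥0 hz)

    0≤ : ∀ {n} → 0ℤ ≤ + n
    0≤ = +≤+ ℕ.z≤n

    halfway : ∀ {S x y} m → InConv S x → InConv S y → x ⊕ y ≡ + 2 • m → InConv S m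
    halfway {S} {x} {y} m hx hy eq = divided 1 m refl eq (cone-+ 1ℤ 1ℤ x y (conv⇒cone {S} {x} hx) (conv⇒cone {S} {y} hy))

    thirdway : ∀ {S x y} m → InConv S x → InConv S y → x ⊕ x ⊕ y ≡ + 3 • m → InConv S m
    thirdway {S} {x} {y} m hx hy eq = divided 2 m refl eq (cone-+ (+ 2) 1ℤ (x ⊕ x) y (cone-+ 1ℤ 1ℤ x x (conv⇒cone {S} {x} hx) (conv⇒cone {S} {x} hx)) (conv⇒cone {S} {y} hy))

    sum-X : ∀ {p q} → InConv P p → InConv Q q → X (p ⊕ q)
    sum-X {p} {q} hp hq = cone⇒conv {MinkPair P Q} {p ⊕ q} (cone-mink 0 p q (p ⊕ q) (conv⇒cone {P} {p} hp) (conv⇒cone {Q} {q} hq) (sym (•-1 (p ⊕ q))))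

    boxed : ∀ x d a b → d ≢ origin → a ≢ origin → b ≢ origin →
      X x → X (x ⊕ d) → X (x ⊕ a) → X (x ⊕ b) → X (x ⊕ d ⊕ a) → X (x ⊕ d ⊕ b) → X (x ⊕ a ⊕ b) → X (x ⊕ d ⊕ a ⊕ b) → G
    boxed x d a b d≢0 a≢0 b≢0 X₀ X₁ X₂ X₃ X₄ X₅ X₆ X₇ =
      -- The base point is put into the first segment; the other two start at the origin.
      (x ∷ x ⊕ d ∷ []) ∷ (origin ∷ a ∷ []) ∷ (origin ∷ b ∷ []) ∷ [] , ℕ.≤-refl ,
      (x , x ⊕ d , here refl , there (here refl) , (λ h → d≢0 (vlia 2 (λ x d → x := x :+ d ⇒ d := con 0ℤ) x d h))) ∷
      (origin , a , here refl , there (here refl) , ≢-sym a≢0) ∷ (origin , b , here refl , there (here refl) , ≢-sym b≢0) ∷ [] ,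
      λ y h → All.lookup all h
      where
      z : Pt
      z = origin
      all : All X (MinkSum ((x ∷ x ⊕ d ∷ []) ∷ (origin ∷ a ∷ []) ∷ (origin ∷ b ∷ []) ∷ []))
      all = same-point (vlia 2 (λ x z → z := con 0ℤ ⇒ x := x :+ (z :+ (z :+ z))) x z refl) X₀
        ∷ same-point (vlia 3 (λ x b z → z := con 0ℤ ⇒ x :+ b := x :+ (z :+ (b :+ z))) x b z refl) X₃
        ∷ same-point (vlia 3 (λ x a z → z := con 0ℤ ⇒ x :+ a := x :+ (a :+ (z :+ z))) x a z refl) X₂
        ∷ same-point (vlia 4 (λ x a b z → z := con 0ℤ ⇒ x :+ a :+ b := x :+ (a :+ (b :+ z))) x a b z refl) X₆
        ∷ same-point (vlia 3 (λ x d z → z := con 0ℤ ⇒ x :+ d := x :+ d :+ (z :+ (z :+ z))) x d z refl) X₁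
        ∷ same-point (vlia 4 (λ x d b z → z := con 0ℤ ⇒ x :+ d :+ b := x :+ d :+ (z :+ (b :+ z))) x d b z refl) X₅
        ∷ same-point (vlia 4 (λ x d a z → z := con 0ℤ ⇒ x :+ d :+ a := x :+ d :+ (a :+ (z :+ z))) x d a z refl) X₄
        ∷ same-point (vlia 5 (λ x d a b z → z := con 0ℤ ⇒ x :+ d :+ a :+ b := x :+ d :+ (a :+ (b :+ z))) x d a b z refl) X₇ ∷ []

    -- If Q contains a segment of lattice length 2, any segment of P completes the decomposition.
    segment : ∀ {p p′ q q′} r → InConv P p → InConv P p′ → p ≢ p′ → InConv Q q → InConv Q q′ → q ≢ q′ → q′ ⊖ q ≡ + 2 • r → G
    segment {p} {p′} {q} {q′} r hp hp′ p≢p′ hq hq′ q≢q′ eq =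
      boxed (p ⊕ q) (p′ ⊖ p) r r (λ h → p≢p′ (vlia 2 (λ p p′ → p′ :- p := con 0ℤ ⇒ p := p′) p p′ h)) r≢0 r≢0
        (sum-X {p} {q} hp hq) (moved (vlia 3 (λ p p′ q → p′ :+ q := p :+ q :+ (p′ :- p)) p p′ q) (sum-X {p′} {q} hp′ hq))
        (centre p hp) (centre p hp) (centre′ p p′ hp′) (centre′ p p′ hp′)
        (moved (vlia 4 (λ p q q′ r → q′ :- q := + 2 :* r ⇒ p :+ q′ := p :+ q :+ r :+ r) p q q′ r eq) (sum-X {p} {q′} hp hq′))
        (moved (vlia 5 (λ p p′ q q′ r → q′ :- q := + 2 :* r ⇒ p′ :+ q′ := p :+ q :+ (p′ :- p) :+ r :+ r) p p′ q q′ r eq) (sum-X {p′} {q′} hp′ hq′))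
      where
      moved : ∀ {x y} → x ≡ y → X x → X y
      moved refl h = h
      r≢0 : r ≢ origin
      r≢0 h = q≢q′ (vlia 3 (λ q q′ r → q′ :- q := + 2 :* r ⇒ r := con 0ℤ ⇒ q := q′) q q′ r eq h)
      mid-Q : InConv Q (q ⊕ r)
      mid-Q = halfway {Q} {q} {q′} (q ⊕ r) hq hq′ (vlia 3 (λ q q′ r → q′ :- q := + 2 :* r ⇒ q :+ q′ := + 2 :* (q :+ r)) q q′ r eq)
      centre : ∀ p → InConv P p → X (p ⊕ q ⊕ r)
      centre p h = moved (vlia 3 (λ p q r → p :+ (q :+ r) := p :+ q :+ r) p q r) (sum-X {p} {q ⊕ r} h mid-Q)
      centre′ : ∀ p p′ → InConv P p′ → X (p ⊕ q ⊕ (p′ ⊖ p) ⊕ r)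
      centre′ p p′ h = moved (vlia 4 (λ p p′ q r → p′ :+ (q :+ r) := p :+ q :+ (p′ :- p) :+ r) p p′ q r) (sum-X {p′} {q ⊕ r} h mid-Q)

    module Triangular (q₀ q₁ q₂ : Pt) (h₀ : InConv Q q₀) (h₁ : InConv Q q₁) (h₂ : InConv Q q₂)
                      (only : ∀ x → InConv Q x → x ≡ q₀ ⊎ x ≡ q₁ ⊎ x ≡ q₂) where
      u v c : Pt
      u = q₁ ⊖ q₀
      v = q₂ ⊖ q₀
      c = cross u v

      module Oblique (c≢0 : c ≢ origin) where
        -- A further lattice point of the triangle.
        interior : ∀ n α β y → 0ℤ ≤ α → 0ℤ ≤ β → α + β ≤ + suc n → α • u ⊕ β • v ≡ + suc n • y →
          (α ≡ 0ℤ → β ≡ 0ℤ → ⊥) → α ≢ + suc n → β ≢ + suc n → ⊥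
        interior n α β y α≥0 β≥0 αβ≤ eq nonzero α≢ β≢ = go (only (q₀ ⊕ y) inside)
          where
          N = + suc n
          expand : ∀ N a b q₀ q₁ q₂ → (N - a - b) • q₀ ⊕ a • q₁ ⊕ b • q₂ ≡ N • q₀ ⊕ (a • (q₁ ⊖ q₀) ⊕ b • (q₂ ⊖ q₀))
          expand N a b (x , y , z) (x′ , y′ , z′) (x″ , y″ , z″) = triple (each N a b x x′ x″) (each N a b y y′ y″) (each N a b z z′ z″)
            where
            each : ∀ N a b x y z → (N - a - b) * x + a * y + b * z ≡ N * x + (a * (y - x) + b * (z - x))
            each = solve-∀
          inside : InConv Q (q₀ ⊕ y)
          inside = divided n (q₀ ⊕ y) (lia 3 (λ N a b → N :- a :- b :+ a :+ b := N) N α β)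
            (trans (expand N α β q₀ q₁ q₂) (trans (cong (N • q₀ ⊕_) eq) (sym (•-⊕ N q₀ y))))
            (mixture (N - α - β) α β {q₀} {q₁} {q₂} (lia 3 (λ N a b → a :+ b :≤ N ⇒ con 0ℤ :≤ N :- a :- b) N α β αβ≤) α≥0 β≥0 h₀ h₁ h₂)
          left-over : ∀ N a b u v y → a • u ⊕ b • v ≡ N • y → y ≡ u → (a - N) • u ⊕ b • v ≡ origin
          left-over N a b u v y h refl = trans (lemma N a b u v) (trans (cong (_⊖ N • u) h) (vlia 1 (λ x → x :- x := con 0ℤ) (N • u)))
            where
            lemma : ∀ N a b u v → (a - N) • u ⊕ b • v ≡ a • u ⊕ b • v ⊖ N • u
            lemma N a b (x , y , z) (x′ , y′ , z′) = triple (each N a b x x′) (each N a b y y′) (each N a b z z′)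
              where
              each : ∀ N a b x y → (a - N) * x + b * y ≡ a * x + b * y - N * x
              each = solve-∀
          zero-sum : y ≡ origin → α • u ⊕ β • v ≡ origin
          zero-sum h = trans eq (trans (cong (N •_) h) (triple (ℤ.*-zeroʳ N) (ℤ.*-zeroʳ N) (ℤ.*-zeroʳ N)))
          equal : ∀ {a b : ℤ} → a - b ≡ 0ℤ → a ≡ b
          equal {a} {b} = lia 2 (λ a b → a :- b := con 0ℤ ⇒ a := b) a b
          go : q₀ ⊕ y ≡ q₀ ⊎ q₀ ⊕ y ≡ q₁ ⊎ q₀ ⊕ y ≡ q₂ → ⊥
          go (inj₁ h) = nonzero (proj₁ i) (proj₂ i)
            where i = independence {u} {v} c≢0 α β (zero-sum (vlia 2 (λ q y → q :+ y := q ⇒ y := con 0ℤ) q₀ y h))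
          go (inj₂ (inj₁ h)) = α≢ (equal (proj₁ (independence {u} {v} c≢0 (α - N) β
            (left-over N α β u v y eq (vlia 3 (λ q y r → q :+ y := r ⇒ y := r :- q) q₀ y q₁ h)))))
          go (inj₂ (inj₂ h)) = β≢ (equal (proj₂ (independence {u} {v} c≢0 α (β - N)
            (trans (vlia 2 (λ x y → x :+ y := y :+ x) (α • u) ((β - N) • v))
              (left-over N β α v u y (trans (vlia 2 (λ x y → x :+ y := y :+ x) (β • v) (α • u)) eq) (vlia 3 (λ q y r → q :+ y := r ⇒ y := r :- q) q₀ y q₂ h))))))

        -- If α + β exceeds N, the point lies in the other half of the parallelogram spanned by u
        -- and v; reflection in the centre of the parallelogram brings it into the triangle.
        fourth : ∀ n (α β : Fin (suc n)) y → (+ toℕ α) • u ⊕ (+ toℕ β) • v ≡ + suc n • y → (+ toℕ α ≡ 0ℤ → + toℕ β ≡ 0ℤ → ⊥) → ⊥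
        fourth n α β y eq nonzero = [ (λ h → interior n a b y 0≤ 0≤ h eq nonzero (small a<) (small b<)) ,
            (λ h → interior n (N - a) (N - b) (u ⊕ v ⊖ y)
              (lia 2 (λ N a → con 1ℤ :+ a :≤ N ⇒ con 0ℤ :≤ N :- a) N a a<) (lia 2 (λ N b → con 1ℤ :+ b :≤ N ⇒ con 0ℤ :≤ N :- b) N b b<)
              (lia 3 (λ N a b → con 1ℤ :+ N :≤ a :+ b ⇒ N :- a :+ (N :- b) :≤ N) N a b h)
              (trans (reflected N a b u v) (trans (cong (N • (u ⊕ v) ⊖_) eq) (sym (•-⊖ N (u ⊕ v) y))))
              (λ z _ → small a< (sym (lia 2 (λ N a → N :- a := con 0ℤ ⇒ N := a) N a z)))
              (λ z → lia 3 (λ N a b → N :- a := N ⇒ con 1ℤ :+ N :≤ a :+ b ⇒ con 1ℤ :+ b :≤ N ⇒ absurd) N a b z h b<)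
              (λ z → lia 3 (λ N a b → N :- b := N ⇒ con 1ℤ :+ N :≤ a :+ b ⇒ con 1ℤ :+ a :≤ N ⇒ absurd) N a b z h a<)) ]′ (by-cases (a + b) N)
          where
          N = + suc n
          a = + toℕ α
          b = + toℕ β
          a< : 1ℤ + a ≤ N
          a< = +≤+ (toℕ<n α)
          b< : 1ℤ + b ≤ N
          b< = +≤+ (toℕ<n β)
          small : ∀ {x} → 1ℤ + x ≤ N → x ≢ N
          small {x} h z = lia 2 (λ x N → con 1ℤ :+ x :≤ N ⇒ x := N ⇒ absurd) x N h z
          •-⊖ : ∀ k x y → k • (x ⊖ y) ≡ k • x ⊖ k • y
          •-⊖ k (x , y , z) (x′ , y′ , z′) = triple (each k x x′) (each k y y′) (each k z z′)
            where
            each : ∀ k x y → k * (x - y) ≡ k * x - k * y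
            each = solve-∀
          reflected : ∀ N a b u v → (N - a) • u ⊕ (N - b) • v ≡ N • (u ⊕ v) ⊖ (a • u ⊕ b • v)
          reflected N a b (x , y , z) (x′ , y′ , z′) = triple (each N a b x x′) (each N a b y y′) (each N a b z z′)
            where
            each : ∀ N a b x y → (N - a) * x + (N - b) * y ≡ N * (x + y) - (a * x + b * y)
            each = solve-∀

        -- Residues of (vᵢ, -uᵢ) give a relation between u and v modulo any divisor of u × v.
        relation : ∀ n (a b : ℤ) z → b • u ⊖ a • v ≡ + suc n • z →
          (∃ λ a′ → a ≡ + suc n * a′) × (∃ λ b′ → b ≡ + suc n * b′)
        relation n a b z eq = go (zero? α) (zero? β)
          where
          N = + suc n
          rb = residue n b
          ra = residue n (- a)
          α = proj₁ rb
          β = proj₁ ra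
          s = proj₁ (proj₂ rb)
          t = proj₁ (proj₂ ra)
          zero? : (r : Fin (suc n)) → Dec (+ toℕ r ≡ 0ℤ)
          zero? r = + toℕ r ℤ.≟ 0ℤ
          multiple : ∀ x (r : Fin (suc n)) d → x ≡ + toℕ r + N * d → + toℕ r ≡ 0ℤ → x ≡ N * d
          multiple x r d h k = trans h (trans (cong (_+ N * d) k) (ℤ.+-identityˡ (N * d)))
          reduce : ∀ N r r′ s t a b u v → b ≡ r + N * s → - a ≡ r′ + N * t → r • u ⊕ r′ • v ≡ b • u ⊖ a • v ⊖ N • (s • u ⊕ t • v)
          reduce N r r′ s t a b (x , y , z) (x′ , y′ , z′) refl h = triple (each x x′) (each y y′) (each z z′)
            where
            lemma : ∀ N r r′ s t a x y → r * x + r′ * y ≡ (r + N * s) * x - a * y - N * (s * x + t * y) + (a + (r′ + N * t)) * y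
            lemma = solve-∀
            cancelled : ∀ w y → w + (a + - a) * y ≡ w
            cancelled w y = trans (cong (λ k → w + k * y) (ℤ.+-inverseʳ a)) (ℤ.+-identityʳ w)
            each : ∀ x y → r * x + r′ * y ≡ (r + N * s) * x - a * y - N * (s * x + t * y)
            each x y = trans (lemma N r r′ s t a x y) (trans (cong (λ k → (r + N * s) * x - a * y - N * (s * x + t * y) + (a + k) * y) (sym h)) (cancelled ((r + N * s) * x - a * y - N * (s * x + t * y)) y))
          impossible : (+ toℕ α ≡ 0ℤ → + toℕ β ≡ 0ℤ → ⊥) → ⊥
          impossible nonzero = fourth n α β (z ⊖ (s • u ⊕ t • v))
            (trans (reduce N (+ toℕ α) (+ toℕ β) s t a b u v (proj₂ (proj₂ rb)) (proj₂ (proj₂ ra)))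
              (trans (cong (_⊖ N • (s • u ⊕ t • v)) eq) (sym (factored N z (s • u ⊕ t • v))))) nonzero
            where
            factored : ∀ k x y → k • (x ⊖ y) ≡ k • x ⊖ k • y
            factored k (x , y , z) (x′ , y′ , z′) = triple (each k x x′) (each k y y′) (each k z z′)
              where
              each : ∀ k x y → k * (x - y) ≡ k * x - k * y
              each = solve-∀
          negated : ∀ {d} → - a ≡ N * d → a ≡ N * (- d)
          negated {d} h = trans (sym (ℤ.neg-involutive a)) (trans (cong -_ h) (ℤ.neg-distribʳ-* N d))
          go : Dec (+ toℕ α ≡ 0ℤ) → Dec (+ toℕ β ≡ 0ℤ) → (∃ λ a′ → a ≡ N * a′) × (∃ λ b′ → b ≡ N * b′)
          go (yes p) (yes q) = (- t , negated (multiple (- a) β t (proj₂ (proj₂ ra)) q)) , (s , multiple b α s (proj₂ (proj₂ rb)) p)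
          go (no p) _ = ⊥-elim (impossible (λ x _ → p x))
          go _ (no q) = ⊥-elim (impossible (λ _ y → q y))

        -- The coordinates of vᵢ u - uᵢ v are 0 or, up to sign, coordinates of c, hence divisible by
        -- N. By `relation` N divides every uᵢ, so u / N gives a further lattice point on the side
        -- from q₀ to q₁.
        no-divisor : ∀ n c′ → c ≡ + suc (suc n) • c′ → ⊥
        no-divisor n c′@(k₀ , k₁ , k₂) h = fourth (suc n) (suc zero) zero (u′ , u″ , u‴)
            (trans (trans (cong₂ _⊕_ (•-1 u) (•-0 v)) (vlia 1 (λ x → x :+ con 0ℤ := x) u))
              (triple (proj₂ (proj₁ R₀)) (proj₂ (proj₁ R₁)) (proj₂ (proj₁ R₂)))) (λ ())
          where
          N = + suc (suc n)
          u₀ = u at x₀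
          u₁ = u at x₁
          u₂ = u at x₂
          v₀ = v at x₀
          v₁ = v at x₁
          v₂ = v at x₂
          skew : ∀ x y z → y * x - x * y ≡ N * 0ℤ
          skew x y z = trans (lemma x y) (sym (ℤ.*-zeroʳ N))
            where
            lemma : ∀ x y → y * x - x * y ≡ 0ℤ
            lemma = solve-∀
          up : ∀ x y x′ y′ k → x * y′ - x′ * y ≡ N * k → y′ * x - x′ * y ≡ N * k
          up x y x′ y′ k h = trans (cong (_- x′ * y) (ℤ.*-comm y′ x)) h
          down : ∀ x y x′ y′ k → x′ * y - x * y′ ≡ N * k → y′ * x - x′ * y ≡ N * (- k)
          down x y x′ y′ k h = trans (lemma x y x′ y′) (trans (cong -_ h) (ℤ.neg-distribʳ-* N k))
            where
            lemma : ∀ x y x′ y′ → y′ * x - x′ * y ≡ - (x′ * y - x * y′)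
            lemma = solve-∀
          e₀₁ = cong (_at x₂) h
          e₁₂ = cong (_at x₀) h
          e₂₀ = cong (_at x₁) h
          R₀ = relation (suc n) u₀ v₀ (0ℤ , - k₂ , k₁) (triple (skew u₀ v₀ u₀) (down u₁ v₁ u₀ v₀ k₂ e₀₁) (up u₂ v₂ u₀ v₀ k₁ e₂₀))
          R₁ = relation (suc n) u₁ v₁ (k₂ , 0ℤ , - k₀) (triple (up u₀ v₀ u₁ v₁ k₂ e₀₁) (skew u₁ v₁ u₁) (down u₂ v₂ u₁ v₁ k₀ e₁₂))
          R₂ = relation (suc n) u₂ v₂ (- k₁ , k₀ , 0ℤ) (triple (down u₀ v₀ u₂ v₂ k₁ e₂₀) (up u₁ v₁ u₂ v₂ k₀ e₁₂) (skew u₂ v₂ u₂))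
          u′ = proj₁ (proj₁ R₀)
          u″ = proj₁ (proj₁ R₁)
          u‴ = proj₁ (proj₁ R₂)

      module Unimodular (w : Pt) (wc≡1 : w ∙ c ≡ 1ℤ) where
        O : Pt
        O = q₀ ⊖ w

        -- The vectors w, w ⊕ u, w ⊕ v have determinant w ∙ c = 1. With the origin at q₀ ⊖ w they
        -- point to the three vertices, which thereby become e₀, e₁, e₂.
        f q : Fin 3 → Pt
        f zero = w
        f (suc zero) = w ⊕ u
        f (suc (suc zero)) = w ⊕ v
        q zero = q₀
        q (suc zero) = q₁
        q (suc (suc zero)) = q₂

        vertices-of : ∀ i → q i ≡ O ⊕ f i
        vertices-of zero = vlia 2 (λ q w → q := q :- w :+ w) q₀ w
        vertices-of (suc zero) = vlia 3 (λ q w r → r := q :- w :+ (w :+ (r :- q))) q₀ w q₁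
        vertices-of (suc (suc zero)) = vlia 3 (λ q w r → r := q :- w :+ (w :+ (r :- q))) q₀ w q₂

        lin-f : ∀ a b c → lin f (a , b , c) ≡ (a + b + c) • w ⊕ (b • u ⊕ c • v)
        lin-f a b c = trans (cong₂ (λ x y → a • w ⊕ x ⊕ y) (•-⊕ b w u) (•-⊕ c w v))
          (trans (vlia 5 (λ x y z s t → x :+ (y :+ s) :+ (z :+ t) := x :+ y :+ z :+ (s :+ t)) (a • w) (b • w) (c • w) (b • u) (c • v))
            (cong (_⊕ (b • u ⊕ c • v)) (sym (trans (•-+ (a + b) c w) (cong (_⊕ c • w) (•-+ a b w))))))

        c≢0 : c ≢ origin
        c≢0 h = 0≢1 (trans (sym (trans (cong (w ∙_) h) (dot-0 w))) wc≡1)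
          where
          0≢1 : 0ℤ ≢ 1ℤ
          0≢1 ()
          dot-0 : ∀ w → w ∙ origin ≡ 0ℤ
          dot-0 (a , b , c) = lemma a b c
            where
            lemma : ∀ a b c → a * + 0 + b * + 0 + c * + 0 ≡ 0ℤ
            lemma = solve-∀

        independent : ∀ x → lin f x ≡ origin → x ≡ origin
        independent (a , b , d) h = triple (lia 3 (λ a b d → a :+ b :+ d := con 0ℤ ⇒ b := con 0ℤ ⇒ d := con 0ℤ ⇒ a := con 0ℤ) a b d total≡0 (proj₁ i) (proj₂ i)) (proj₁ i) (proj₂ i)
          where
          h′ : (a + b + d) • w ⊕ (b • u ⊕ d • v) ≡ origin
          h′ = trans (sym (lin-f a b d)) h
          total≡0 : a + b + d ≡ 0ℤ
          total≡0 = trans (sym (ℤ.*-identityʳ (a + b + d))) (trans (cong ((a + b + d) *_) (sym wc≡1)) (trans (sym (ℤ.+-identityʳ ((a + b + d) * (w ∙ c))))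
            (trans (sym (trans (dot-⊕ ((a + b + d) • w) (b • u ⊕ d • v) c) (cong₂ _+_ (dot-• (a + b + d) w c)
                (trans (dot-⊕ (b • u) (d • v) c) (cong₂ _+_ (trans (dot-• b u c) (trans (cong (b *_) (cross-⊥ u v)) (ℤ.*-zeroʳ b))) (trans (dot-• d v c) (trans (cong (d *_) (cross-⊥′ u v)) (ℤ.*-zeroʳ d))))))))
              (cong (_∙ c) h′))))
          i = independence {u} {v} c≢0 b d (trans (sym (vlia 1 (λ x → con 0ℤ :+ x := x) (b • u ⊕ d • v))) (trans (cong (λ k → k • w ⊕ (b • u ⊕ d • v)) (sym total≡0)) h′))

        coords : Pt → Pt
        coords p = p ∙ c - p ∙ cross v w - p ∙ cross w u , p ∙ cross v w , p ∙ cross w u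

        lin-coords : ∀ p → lin f (coords p) ≡ p
        lin-coords p = trans (lin-f (s - β - γ) β γ) (trans (cong (λ k → k • w ⊕ (β • u ⊕ γ • v)) (lia 3 (λ s b g → s :- b :- g :+ b :+ g := s) s β γ))
            (trans (vlia 3 (λ x y z → x :+ (y :+ z) := x :+ y :+ z) (s • w) (β • u) (γ • v)) (trans (sym (cramer w u v p)) (trans (cong (_• p) wc≡1) (•-1 p)))))
          where
          s = p ∙ c
          β = p ∙ cross v w
          γ = p ∙ cross w u

        coords-lin : ∀ x → coords (lin f x) ≡ x
        coords-lin x = vlia 2 (λ a b → a :+ (- + 1) :* b := con 0ℤ ⇒ a := b) (coords (lin f x)) x (independent (coords (lin f x) ⊕ (- + 1) • x)
          (trans (lin-⊕ f (coords (lin f x)) ((- + 1) • x)) (trans (cong₂ _⊕_ (lin-coords (lin f x)) (lin-• f (- + 1) x)) (vlia 1 (λ a → a :+ (- + 1) :* a := con 0ℤ) (lin f x)))))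

        body : Body G
        body = frame pq origin O f vertices-of independent
          where
          h : ∀ i → InConv Q (q i)
          h zero = h₀
          h (suc zero) = h₁
          h (suc (suc zero)) = h₂
          pq : Pair G q
          pq = record
            { P = InConv P ; X = X ; hull = Cone P ; point = λ {p} → conv⇒cone {P} {p}
            ; hull-+ = λ {n} {m} {v} {w} → cone-+ n m v w ; hull-* = λ {n} {v} k k≥0 → cone-* k n v k≥0
            ; hull-÷ = λ n {v} h → cone⇒conv {P} {v} (cone-÷ n v h)
            ; mink = λ n {v} {x} w hv w≥0 s eq → cone⇒conv {MinkPair P Q} {x} (cone-mink n v (lin q w) x hv
                (subst (λ m → Cone Q m (lin q w)) s (mixture (w at x₀) (w at x₁) (w at x₂) {q₀} {q₁} {q₂} (w≥0 x₀) (w≥0 x₁) (w≥0 x₂) (h zero) (h (suc zero)) (h (suc (suc zero))))) eq)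
            ; middle = λ {x} {y} → halfway {_} {x} {y} ; third = λ {x} {y} → thirdway {_} {x} {y} ; box = boxed }

        conclusion : ∀ l → length l ≡ 6 → AllPairs _≢_ l → (∀ x → x ∈ l → InConv P x) → (∀ x → InConv P x → x ∈ l) → G
        conclusion l len unique inP P⇒∈ = six-points body (map coords l) (trans (length-map coords l) len)
            (Unique.map⁺ (λ {x} {y} h → trans (sym (lin-coords x)) (trans (cong (lin f) h) (lin-coords y))) unique)
            (λ x h → let y , y∈l , x≡ = ∈-map⁻ coords h in
              same-point (trans (sym (lin-coords y)) (trans (cong (lin f) (sym x≡)) (vlia 1 (λ z → z := con 0ℤ :+ z) (lin f x)))) (inP y y∈l))
            (λ x Px → subst (_∈ map coords l) (coords-lin x) (∈-map⁺ coords (P⇒∈ (lin f x) (same-point (vlia 1 (λ z → con 0ℤ :+ z := z) (lin f x)) Px))))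

      -- The greatest common divisor of the coordinates of c decides. If c = 0 the vertices are
      -- collinear and two are congruent modulo 2; at 1 the triangle extends to a lattice basis; a
      -- larger value would give Q a fourth lattice point.
      goal : ∀ l → length l ≡ 6 → AllPairs _≢_ l → (∀ x → x ∈ l → InConv P x) → (∀ x → InConv P x → x ∈ l) → q₀ ≢ q₁ → q₀ ≢ q₂ → q₁ ≢ q₂ → G
      goal l@(p ∷ p′ ∷ _) len unique@((p≢p′ ∷ _) ∷ _) inP P⇒∈ n₀₁ n₀₂ n₁₂ = go (c ≟ origin)
        where
        parallel : (∃ λ r → u ≡ + 2 • r) ⊎ (∃ λ r → v ≡ + 2 • r) ⊎ u ≡₂ v → G
        parallel (inj₁ (r , eq)) = segment {p} {p′} {q₀} {q₁} r (inP p (here refl)) (inP p′ (there (here refl))) p≢p′ h₀ h₁ n₀₁ eq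
        parallel (inj₂ (inj₁ (r , eq))) = segment {p} {p′} {q₀} {q₂} r (inP p (here refl)) (inP p′ (there (here refl))) p≢p′ h₀ h₂ n₀₂ eq
        parallel (inj₂ (inj₂ (r , eq))) = segment {p} {p′} {q₂} {q₁} r (inP p (here refl)) (inP p′ (there (here refl))) p≢p′ h₂ h₁ (≢-sym n₁₂)
          (vlia 4 (λ q₀ q₁ q₂ r → q₁ :- q₀ := q₂ :- q₀ :+ + 2 :* r ⇒ q₁ :- q₂ := + 2 :* r) q₀ q₁ q₂ r eq)
        divisor : c ≢ origin → (∃ λ g → ∃ λ w → ∃ λ c′ → w ∙ c ≡ + g × c ≡ + g • c′) → G
        divisor c≢0 (0 , w , c′ , _ , h) = ⊥-elim (c≢0 (trans h (•-0 c′)))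
        divisor c≢0 (1 , w , c′ , h , _) = Unimodular.conclusion w h l len unique inP P⇒∈
        divisor c≢0 (suc (suc n) , w , c′ , _ , h) = ⊥-elim (Oblique.no-divisor c≢0 n c′ h)
        go : Dec (c ≡ origin) → G
        go (yes h) = parallel (parallel-parity u v h)
        go (no h) = divisor h (gcd₃ c)

open Reduction

theorem3p23 : (P Q : List Pt) → NumLatticePts P 6 → NumLatticePts Q 3 →
  MinkLengthAtLeast (MinkPair P Q) 3
theorem3p23 P Q (l , len , unique , inP) (q₀ ∷ q₁ ∷ q₂ ∷ [] , refl , (n₀₁ ∷ n₀₂ ∷ []) ∷ (n₁₂ ∷ []) ∷ [] ∷ [] , inQ) =
  Polytopes.Triangular.goal P Q q₀ q₁ q₂ (proj₁ (inQ q₀) (here refl)) (proj₁ (inQ q₁) (there (here refl))) (proj₁ (inQ q₂) (there (there (here refl))))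
    (λ x h → listed (proj₂ (inQ x) h)) l len unique (λ x → proj₁ (inP x)) (λ x → proj₂ (inP x)) n₀₁ n₀₂ n₁₂
  where
  listed : ∀ {x} → x ∈ q₀ ∷ q₁ ∷ q₂ ∷ [] → x ≡ q₀ ⊎ x ≡ q₁ ⊎ x ≡ q₂
  listed (here h) = inj₁ h
  listed (there (here h)) = inj₂ (inj₁ h)
  listed (there (there (here h))) = inj₂ (inj₂ h)
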